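{- Let $X$ be a smooth projective geometrically irreducible curve over $\mathbb{F}_q$ of genus $g_X$ with function field $F$, and let $m_X=\max\{2g_X-2,0\}$. Let $\mathcal{V}_0$ be the complex vector space of all functions $f:\mathrm{PGL}_2(F)\backslash\mathrm{PGL}_2(\mathbb{A})/K\to\mathbb{C}$ such that $$\int_{N(F)\backslash N(\mathbb{A})}\Phi(f)(n)\,dn=0\qquad\text{for all }\Phi\in\mathcal{H}_K.$$ Then the dimension of $\mathcal{V}_0$ is finite and bounded by $$\dim\mathcal{V}_0\le\#\{[\mathcal{M}]\in\mathbb{P}\mathrm{Bun}_2X\mid\delta(\mathcal{M})\le m_X\}.$$
   Context: $\mathbb{A}$ is the adele ring of $F$, $\mathcal{O}_{\mathbb{A}}=\prod_x\mathcal{O}_x$ its maximal compact subring, $G=\mathrm{PGL}_2$, $K=G(\mathcal{O}_{\mathbb{A}})$, and $N\subset G$ is the subgroup of upper triangular unipotent matrices. $dn$ is a (non-zero) Haar measure on $N(F)\backslash N(\mathbb{A})$. The Haar measure on $G(\mathbb{A})$ is normalized by $\mathrm{vol}\,K=1$. $\mathcal{H}_K$ is the algebra of compactly supported, locally constant, bi-$K$-invariant functions $\Phi:G(\mathbb{A})\to\mathbb{C}$ under convolution, acting by $\Phi(f)(g)=\int_{G(\mathbb{A})}\Phi(h)f(gh)\,dh$. $\mathbb{P}\mathrm{Bun}_2X$ is the set of isomorphism classes of rank $2$ vector bundles on $X$ modulo tensoring with line bundles. For a rank $2$ bundle $\mathcal{M}$, $\delta(\mathcal{M})=\sup(2\deg\mathcal{L}-\deg\mathcal{M})$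 over all line subbundles $\mathcal{L}\to\mathcal{M}$ (injective morphisms from a line bundle with locally free cokernel); it only depends on the class $[\mathcal{M}]\in\mathbb{P}\mathrm{Bun}_2X$. -}

module Defs where

open import Level using (0ℓ; _⊔_) renaming (suc to lsuc)
open import Algebra.Bundles using (AbelianGroup; CommutativeRing; RawRing)
open import Algebra.Definitions.RawSemiring using () renaming (_^_ to pow)
open import Algebra.Module.Bundles using (Module)
open import Algebra.Module.Bundles.Raw using (RawLeftModule)
open import Algebra.Morphism.Structures using (IsRingHomomorphism; IsRingMonomorphism)
import Algebra.Morphism.RingMonomorphism as RingMonomorphism
open import Data.Fin.Base using (Fin; zero; suc; punchIn)
open import Data.Integer.Base as ℤ using (ℤ)
import Data.Integer.Properties as ℤₚ
open import Data.List.Base as List using (List; []; _∷_; _++_)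
open import Data.List.Membership.Propositional using (_∈_)
open import Data.List.Membership.Propositional.Properties using (∈-++⁺ˡ; ∈-++⁺ʳ)
open import Data.List.Relation.Unary.All using (All)
open import Data.List.Relation.Unary.Any using (Any)
open import Data.List.Relation.Unary.Unique.Propositional using (Unique)
open import Data.Nat.Base as ℕ using (ℕ; zero; suc)
open import Data.Product.Base using (Σ; ∃; _×_; _,_; proj₁; proj₂)
open import Data.Sum.Base using (_⊎_; inj₁; inj₂; map₁)
import Data.Vec.Functional as Vector
open import Function.Base using (_∘_)
open import Function.Bundles using (Bijection)
open import Relation.Binary.Core using (Rel)
open import Relation.Binary.PropositionalEquality as ≡ using (_≡_)
open import Relation.Binary.Structures using (IsTotalOrder)
open import Relation.Nullary using (¬_)
open import Relation.Nullary.Decidable using (decidable-stable)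

CRing : Set₁
CRing = CommutativeRing 0ℓ 0ℓ

record RingHom (R S : CRing) : Set where
  private
    module R = CommutativeRing R
    module S = CommutativeRing S
  field
    fun   : R.Carrier → S.Carrier
    isHom : IsRingHomomorphism R.rawRing S.rawRing fun
  open IsRingHomomorphism isHom public

record Field : Set₁ where
  field
    ring : CRing
  open CommutativeRing ring public hiding (ring)
  field
    1≉0     : ¬ 1# ≈ 0#
    inverse : ∀ x → ¬ x ≈ 0# → ∃ λ y → x * y ≈ 1#

∑ : ∀ {a n} {A : Set a} → (A → A → A) → A → (Fin n → A) → A
∑ _+_ ε = Vector.foldr _+_ ε

-- For linear subspaces B ⊆ A of E, `HasDim R E A B n` says dim (A / B) = n:
-- A / B has a basis with n elements.
HasDim : ∀ {r ℓr m ℓm p p′} (R : RawRing r ℓr)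
         (E : RawLeftModule (RawRing.Carrier R) m ℓm) →
         let open RawLeftModule E in
         (A : Carrierᴹ → Set p) (B : Carrierᴹ → Set p′) → ℕ →
         Set (r ⊔ ℓr ⊔ m ⊔ p ⊔ p′)
HasDim R E A B n =
  Σ (Fin n → Carrierᴹ) λ e →
    (∀ i → A (e i)) ×
    (∀ a → A a → Σ (Fin n → R.Carrier) λ c →
       B (a +ᴹ -ᴹ lin e c) ×
       (∀ c′ → B (a +ᴹ -ᴹ lin e c′) → ∀ i → c i R.≈ c′ i))
  where
  module R = RawRing R
  open RawLeftModule E
  lin : (Fin n → Carrierᴹ) → (Fin n → R.Carrier) → Carrierᴹ
  lin e c = ∑ _+ᴹ_ 0ᴹ (λ i → c i *ₗ e i)

module _ (R : CRing) where
  open CommutativeRing R hiding (zero)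

  alternating : ∀ {n} → (Fin n → Carrier) → Carrier
  alternating {zero}  a = 0#
  alternating {suc n} a = a zero - alternating (a ∘ suc)

  det : ∀ {n} → (Fin n → Fin n → Carrier) → Carrier
  det {zero}  A = 1#
  det {suc n} A =
    alternating (λ j → A zero j * det (λ i l → A (suc i) (punchIn j l)))

module _ (R : CRing) where
  open CommutativeRing R
  open import Algebra.Properties.Ring (CommutativeRing.ring R)
    using (-1*x≈-x; -‿involutive; -0#≈0#)
  open import Algebra.Solver.Ring.NaturalCoefficients.Default commutativeSemiring
    using (solve; _:+_; _:*_; _:=_)
  open import Relation.Binary.Reasoning.Setoid setoid

  det-mult : ∀ a b c d a′ b′ c′ d′ u u′ →
    ((a * a′ + b * c′) * (c * b′ + d * d′) -
     (a * b′ + b * d′) * (c * a′ + d * c′)) * (u * u′) ≈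
    ((a * d - b * c) * u) * ((a′ * d′ - b′ * c′) * u′)
  det-mult a b c d a′ b′ c′ d′ u u′ = begin
    (X - Y) * (u * u′)  ≈⟨ *-congʳ (+-congˡ (-1*x≈-x Y)) ⟨
    (X + n * Y) * (u * u′)
      ≈⟨ solve 11 (λ n a b c d a′ b′ c′ d′ u u′ →
           (((a :* a′ :+ b :* c′) :* (c :* b′ :+ d :* d′))
             :+ n :* ((a :* b′ :+ b :* d′) :* (c :* a′ :+ d :* c′))) :* (u :* u′)
           := (((a :* d) :* (a′ :* d′)
                 :+ n :* ((a :* d) :* (b′ :* c′) :+ (b :* c) :* (a′ :* d′))
                 :+ (b :* c) :* (b′ :* c′))
               :+ (a :* a′ :* c :* b′ :+ b :* c′ :* d :* d′)
               :+ n :* (a :* a′ :* c :* b′ :+ b :* c′ :* d :* d′)) :* (u :* u′))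
           refl n a b c d a′ b′ c′ d′ u u′ ⟩
    (D + BC + Z + n * Z) * (u * u′)
      ≈⟨ *-congʳ (trans (+-assoc _ _ _) (trans (+-congˡ cancel) (+-identityʳ _))) ⟩
    (D + BC) * (u * u′)  ≈⟨ *-congʳ (+-congˡ (trans (*-congʳ n²≈1) (*-identityˡ BC))) ⟨
    (D + n * n * BC) * (u * u′)
      ≈⟨ solve 11 (λ n a b c d a′ b′ c′ d′ u u′ →
           ((a :* d) :* (a′ :* d′)
             :+ n :* ((a :* d) :* (b′ :* c′) :+ (b :* c) :* (a′ :* d′))
             :+ n :* n :* ((b :* c) :* (b′ :* c′))) :* (u :* u′)
           := ((a :* d :+ n :* (b :* c)) :* u) :*
              ((a′ :* d′ :+ n :* (b′ :* c′)) :* u′))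
           refl n a b c d a′ b′ c′ d′ u u′ ⟩
    ((a * d + n * (b * c)) * u) * ((a′ * d′ + n * (b′ * c′)) * u′)
      ≈⟨ *-cong (*-congʳ (+-congˡ (-1*x≈-x _))) (*-congʳ (+-congˡ (-1*x≈-x _))) ⟩
    ((a * d - b * c) * u) * ((a′ * d′ - b′ * c′) * u′)  ∎
    where
    n = - 1#
    X = (a * a′ + b * c′) * (c * b′ + d * d′)
    Y = (a * b′ + b * d′) * (c * a′ + d * c′)
    Z = a * a′ * c * b′ + b * c′ * d * d′
    D = (a * d) * (a′ * d′) + n * ((a * d) * (b′ * c′) + (b * c) * (a′ * d′))
    BC = (b * c) * (b′ * c′)
    n²≈1 : n * n ≈ 1#
    n²≈1 = trans (-1*x≈-x n) (-‿involutive 1#)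
    cancel : Z + n * Z ≈ 0#
    cancel = trans (+-congˡ (-1*x≈-x Z)) (-‿inverseʳ Z)

  det-mult-unit : ∀ a b c d a′ b′ c′ d′ u u′ →
    (a * d - b * c) * u ≈ 1# → (a′ * d′ - b′ * c′) * u′ ≈ 1# →
    ((a * a′ + b * c′) * (c * b′ + d * d′) -
     (a * b′ + b * d′) * (c * a′ + d * c′)) * (u * u′) ≈ 1#
  det-mult-unit a b c d a′ b′ c′ d′ u u′ p p′ =
    trans (det-mult a b c d a′ b′ c′ d′ u u′)
          (trans (*-cong p p′) (*-identityˡ 1#))

  unipotent-unit : ∀ b → (1# * 1# - b * 0#) * 1# ≈ 1#
  unipotent-unit b = begin
    (1# * 1# - b * 0#) * 1#  ≈⟨ *-identityʳ _ ⟩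
    1# * 1# - b * 0#  ≈⟨ +-cong (*-identityˡ 1#) (-‿cong (zeroʳ b)) ⟩
    1# - 0#           ≈⟨ +-congˡ -0#≈0# ⟩
    1# + 0#           ≈⟨ +-identityʳ 1# ⟩
    1#                ∎

-- A complete ordered field; any two are uniquely isomorphic.
record RealField : Set₁ where
  field
    fld : Field
  open Field fld public
  infix 4 _≤_
  field
    _≤_          : Rel Carrier 0ℓ
    isTotalOrder : IsTotalOrder _≈_ _≤_
    +-monoˡ-≤    : ∀ z {x y} → x ≤ y → x + z ≤ y + z
    *-nonneg     : ∀ {x y} → 0# ≤ x → 0# ≤ y → 0# ≤ x * y
    sup          : (S : Carrier → Set) → ∃ S →
                   (∃ λ b → ∀ s → S s → s ≤ b) →
                   ∃ λ b → (∀ s → S s → s ≤ b) ×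
                           (∀ b′ → (∀ s → S s → s ≤ b′) → b ≤ b′)

module Complex (ℝ : RealField) where
  private module ℝ = RealField ℝ

  ℂ-ring : RawRing 0ℓ 0ℓ
  ℂ-ring = record
    { Carrier = ℝ.Carrier × ℝ.Carrier
    ; _≈_ = λ (a , b) (c , d) → a ℝ.≈ c × b ℝ.≈ d
    ; _+_ = λ (a , b) (c , d) → a ℝ.+ c , b ℝ.+ d
    ; _*_ = λ (a , b) (c , d) → a ℝ.* c ℝ.- b ℝ.* d , a ℝ.* d ℝ.+ b ℝ.* c
    ; -_  = λ (a , b) → ℝ.- a , ℝ.- b
    ; 0#  = ℝ.0# , ℝ.0#
    ; 1#  = ℝ.1# , ℝ.0#
    }

  open RawRing ℂ-ring public renaming (Carrier to ℂ)

  Nonnegative : ℂ → Set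
  Nonnegative (a , b) = ℝ.0# ℝ.≤ a × b ℝ.≈ ℝ.0#

  functions : Set → RawLeftModule ℂ 0ℓ 0ℓ
  functions T = record
    { Carrierᴹ = T → ℂ
    ; _≈ᴹ_ = λ f g → ∀ t → f t ≈ g t
    ; _+ᴹ_ = λ f g t → f t + g t
    ; _*ₗ_ = λ c f t → c * f t
    ; 0ᴹ   = λ _ → 0#
    ; -ᴹ_  = λ f t → - f t
    }

module _ (K : Field) where
  open Field K

  -- Normalized discrete valuation; the value at 0 is irrelevant.
  record IsDiscreteValuation (v : Carrier → ℤ) : Set where
    field
      cong  : ∀ {a b} → a ≈ b → v a ≡ v b
      mult  : ∀ {a b} → ¬ a ≈ 0# → ¬ b ≈ 0# → v (a * b) ≡ v a ℤ.+ v b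
      ultra : ∀ {a b} → ¬ a ≈ 0# → ¬ b ≈ 0# → ¬ a + b ≈ 0# →
              v a ℤ.⊓ v b ℤ.≤ v (a + b)
      norm  : ∃ λ π → ¬ π ≈ 0# × v π ≡ ℤ.1ℤ

  -- v(a) ≥ n, with the convention v(0) = ∞.
  Ball : (Carrier → ℤ) → ℤ → Carrier → Set
  Ball v n a = ¬ a ≈ 0# → n ℤ.≤ v a

  module Valued {v : Carrier → ℤ} (isV : IsDiscreteValuation v) where
    open IsDiscreteValuation isV
    open import Algebra.Properties.Ring (CommutativeRing.ring ring)
      using (-1*x≈-x; -‿involutive)

    ball-resp : ∀ {n a b} → a ≈ b → Ball v n a → Ball v n b
    ball-resp a≈b p b≉0 =
      ≡.subst (_ ℤ.≤_) (cong a≈b) (p (b≉0 ∘ trans (sym a≈b)))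

    ball-0 : ∀ {n} → Ball v n 0#
    ball-0 0≉0 with () ← 0≉0 refl

    ball-+ : ∀ {n a b} → Ball v n a → Ball v n b → Ball v n (a + b)
    ball-+ {n} {a} {b} p q s≉0 = decidable-stable (n ℤₚ.≤? v (a + b)) λ ¬le →
      let
        a≉0 = λ a≈0 → ¬le (ball-resp
                (sym (trans (+-congʳ a≈0) (+-identityˡ b))) q s≉0)
        b≉0 = λ b≈0 → ¬le (ball-resp
                (sym (trans (+-congˡ b≈0) (+-identityʳ a))) p s≉0)
      in ¬le (ℤₚ.≤-trans (ℤₚ.⊓-glb (p a≉0) (q b≉0)) (ultra a≉0 b≉0 s≉0))

    ball-* : ∀ {a b} → Ball v ℤ.0ℤ a → Ball v ℤ.0ℤ b → Ball v ℤ.0ℤ (a * b)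
    ball-* {a} {b} p q ab≉0 =
      ≡.subst (ℤ.0ℤ ℤ.≤_) (≡.sym (mult a≉0 b≉0)) (ℤₚ.+-mono-≤ (p a≉0) (q b≉0))
      where
      a≉0 = λ a≈0 → ab≉0 (trans (*-congʳ a≈0) (zeroˡ b))
      b≉0 = λ b≈0 → ab≉0 (trans (*-congˡ b≈0) (zeroʳ a))

    v1≡0 : v 1# ≡ ℤ.0ℤ
    v1≡0 = identityʳ-unique (v 1#) (v 1#)
      (≡.trans (≡.sym (mult 1≉0 1≉0)) (cong (*-identityˡ 1#)))
      where open import Algebra.Properties.Group (AbelianGroup.group ℤₚ.+-0-abelianGroup)

    ball-1 : Ball v ℤ.0ℤ 1#
    ball-1 _ = ℤₚ.≤-reflexive (≡.sym v1≡0)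

    private
      half : ∀ i → ℤ.0ℤ ≡ i ℤ.+ i → ℤ.0ℤ ℤ.≤ i
      half (ℤ.+ n) _ = ℤ.+≤+ ℕ.z≤n
      half (ℤ.-[1+ n ]) ()

    ball--1 : Ball v ℤ.0ℤ (- 1#)
    ball--1 -1≉0 = half (v (- 1#)) (≡.trans (≡.sym v1≡0) (≡.trans
      (cong (sym (trans (-1*x≈-x (- 1#)) (-‿involutive 1#))))
      (mult -1≉0 -1≉0)))

    ball-neg : ∀ {a} → Ball v ℤ.0ℤ a → Ball v ℤ.0ℤ (- a)
    ball-neg {a} p = ball-resp (-1*x≈-x a) (ball-* ball--1 p)

-- A completion of F at v, characterized up to unique isomorphism.
record Completion (F : Field) (v : Field.Carrier F → ℤ) : Set₁ where
  private module F = Field F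
  field
    K   : Field
    ι   : RingHom F.ring (Field.ring K)
    val : Field.Carrier K → ℤ
  open Field K public
  open RingHom ι public using () renaming (fun to embed; ⟦⟧-cong to embed-cong)
  field
    isValuation : IsDiscreteValuation K val
    extends     : ∀ a → ¬ a F.≈ F.0# → val (embed a) ≡ v a
    dense       : ∀ a n → ∃ λ f → Ball K val n (a - embed f)
    complete    : (s : ℕ → Carrier) →
                  (∀ n → ∃ λ N → ∀ i j → N ℕ.≤ i → N ℕ.≤ j →
                     Ball K val n (s i - s j)) →
                  ∃ λ a → ∀ n → ∃ λ N → ∀ i → N ℕ.≤ i →
                     Ball K val n (s i - a)
  open Valued K isValuation public

-- T is a tensor product F ⊗_k K of k-algebras (a pushout of rings).
record IsBaseChange {k F K : CRing} (φ : RingHom k F) (ψ : RingHom k K)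
                    (T : CRing) : Set₁ where
  private
    Commutes : ∀ S → RingHom F S → RingHom K S → Set
    Commutes S i j = ∀ c → CommutativeRing._≈_ S
      (RingHom.fun i (RingHom.fun φ c)) (RingHom.fun j (RingHom.fun ψ c))
  field
    inF       : RingHom F T
    inK       : RingHom K T
    commutes  : Commutes T inF inK
    universal : ∀ S (i : RingHom F S) (j : RingHom K S) → Commutes S i j →
      let open CommutativeRing S
          Factors : RingHom T S → Set
          Factors u =
            (∀ f → RingHom.fun u (RingHom.fun inF f) ≈ RingHom.fun i f) ×
            (∀ a → RingHom.fun u (RingHom.fun inK a) ≈ RingHom.fun j a)
      in Σ (RingHom T S) λ u → Factors u ×
           (∀ u′ → Factors u′ → ∀ t → RingHom.fun u t ≈ RingHom.fun u′ t)

-- Spec T is irreducible: the nilradical is a prime ideal.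
IrreducibleSpec : CRing → Set
IrreducibleSpec T =
  ¬ Nilpotent 1# × (∀ a b → Nilpotent (a * b) → Nilpotent a ⊎ Nilpotent b)
  where
  open CommutativeRing T
  Nilpotent : Carrier → Set
  Nilpotent a = ∃ λ n → pow (RawRing.rawSemiring rawRing) a n ≈ 0#

-- A smooth projective geometrically irreducible curve over a finite field
-- k = 𝔽_q, presented (Hartshorne, Algebraic Geometry, I.6) as a complete
-- nonsingular curve: the closed points are in bijection with the discrete
-- valuations of the function field F over k, the closed sets are the finite
-- sets of closed points and the whole space, and the regular functions on U
-- are the f ∈ F with ord_x f ≥ 0 for all x ∈ U.  (Regular means smooth,
-- since k is perfect.)  Geometric irreducibility is tested at the generic
-- point: F ⊗_k K has irreducible spectrum for every field extension K / k.
record Curve : Set₁ where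
  field
    q      : ℕ
    k      : Field
    k-size : Bijection (≡.setoid (Fin q)) (Field.setoid k)
    F      : Field
    φ      : RingHom (Field.ring k) (Field.ring F)
  private
    module k = Field k
    module F = Field F

  const : k.Carrier → F.Carrier
  const = RingHom.fun φ

  eval : List k.Carrier → F.Carrier → F.Carrier
  eval p t = List.foldr (λ c r → const c F.+ t F.* r) F.0# p

  -- t is transcendental over k, and F is finite over k(t) (with denominators
  -- cleared).
  IsTranscendenceBasis : F.Carrier → Set
  IsTranscendenceBasis t =
    (∀ p → eval p t F.≈ F.0# → All (k._≈ k.0#) p) ×
    (∃ λ n → Σ (Fin n → F.Carrier) λ e → ∀ f →
      Σ (List k.Carrier) λ p → ¬ eval p t F.≈ F.0# ×
      Σ (Fin n → List k.Carrier) λ r →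
        eval p t F.* f F.≈ ∑ F._+_ F.0# (λ i → eval (r i) t F.* e i))

  IsPlace : (F.Carrier → ℤ) → Set
  IsPlace w = IsDiscreteValuation F w ×
              (∀ c → ¬ const c F.≈ F.0# → w (const c) ≡ ℤ.0ℤ)

  field
    oneDimensional         : ∃ IsTranscendenceBasis
    geometricallyIrreducible :
      ∀ (K : Field) (ψ : RingHom k.ring (Field.ring K)) (T : CRing) →
      IsBaseChange φ ψ T → IrreducibleSpec T
    Point    : Set
    ord      : Point → F.Carrier → ℤ
    isPlace  : ∀ x → IsPlace (ord x)
    complete : ∀ w → IsPlace w → ∃ λ x → ∀ a → ¬ a F.≈ F.0# → ord x a ≡ w a
    separated : ∀ x y → (∀ a → ¬ a F.≈ F.0# → ord x a ≡ ord y a) → x ≡ y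

AlmostAll : {A : Set} → (A → Set) → Set
AlmostAll P = ∃ λ L → ∀ x → P x ⊎ x ∈ L

almostAll-∩ : {A : Set} {P Q R : A → Set} → (∀ {x} → P x → Q x → R x) →
              AlmostAll P → AlmostAll Q → AlmostAll R
almostAll-∩ {R = R} f (L , p) (M , q) = L ++ M , λ x → go x (p x) (q x)
  where
  go : ∀ x → _ → _ → R x ⊎ x ∈ L ++ M
  go x (inj₁ px) (inj₁ qx) = inj₁ (f px qx)
  go x (inj₂ xL) _         = inj₂ (∈-++⁺ˡ xL)
  go x (inj₁ _)  (inj₂ xM) = inj₂ (∈-++⁺ʳ L xM)

almostAll-map : {A : Set} {P Q : A → Set} → (∀ {x} → P x → Q x) →
                AlmostAll P → AlmostAll Q
almostAll-map f (L , p) = L , λ x → map₁ f (p x)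

module Bundles (X : Curve) where
  open Curve X
  private
    module k = Field k
    module F = Field F
    module V (x : Point) = Valued F (proj₁ (isPlace x))

  -- Non-empty Zariski open sets, given by their closed points; each also
  -- contains the generic point.  The empty open set is left out: sheaves take
  -- the value 0 there, and it plays no role in their gluing since X is
  -- irreducible.
  record Open : Set₁ where
    field
      mem      : Point → Set
      cofinite : AlmostAll mem
  open Open public using (mem)

  record _⊆_ (U V : Open) : Set where
    constructor sub
    field
      incl : ∀ x → mem U x → mem V x

  _∩_ : Open → Open → Open
  U ∩ V = record
    { mem      = λ x → mem U x × mem V x
    ; cofinite = almostAll-∩ _,_ (Open.cofinite U) (Open.cofinite V)
    }

  ∩⊆ˡ : ∀ {U V} → (U ∩ V) ⊆ U
  ∩⊆ˡ = sub λ _ → proj₁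

  ∩⊆ʳ : ∀ {U V} → (U ∩ V) ⊆ V
  ∩⊆ʳ = sub λ _ → proj₂

  Regular : Open → F.Carrier → Set
  Regular U a = ∀ x → mem U x → Ball F (ord x) ℤ.0ℤ a

  private
    𝒪-raw : Open → RawRing 0ℓ 0ℓ
    𝒪-raw U = record
      { Carrier = Σ F.Carrier (Regular U)
      ; _≈_ = λ a b → proj₁ a F.≈ proj₁ b
      ; _+_ = λ (a , p) (b , q) → a F.+ b , λ x u → V.ball-+ x (p x u) (q x u)
      ; _*_ = λ (a , p) (b , q) → a F.* b , λ x u → V.ball-* x (p x u) (q x u)
      ; -_  = λ (a , p) → F.- a , λ x u → V.ball-neg x (p x u)
      ; 0#  = F.0# , λ x _ → V.ball-0 x
      ; 1#  = F.1# , λ x _ → V.ball-1 x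
      }

    𝒪-mono : ∀ U → IsRingMonomorphism (𝒪-raw U) F.rawRing proj₁
    𝒪-mono U = record
      { isRingHomomorphism = record
        { isSemiringHomomorphism = record
          { isNearSemiringHomomorphism = record
            { +-isMonoidHomomorphism = record
              { isMagmaHomomorphism = record
                { isRelHomomorphism = record { cong = λ p → p }
                ; homo = λ _ _ → F.refl
                }
              ; ε-homo = F.refl
              }
            ; *-homo = λ _ _ → F.refl
            }
          ; 1#-homo = F.refl
          }
        ; -‿homo = λ _ → F.refl
        }
      ; injective = λ p → p
      }

  𝒪 : Open → CRing
  𝒪 U = record
    { isCommutativeRing =
        RingMonomorphism.isCommutativeRing (𝒪-mono U) F.isCommutativeRing }

  restrict : ∀ {U V} → V ⊆ U → CommutativeRing.Carrier (𝒪 U) →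
             CommutativeRing.Carrier (𝒪 V)
  restrict (sub i) (a , p) = a , λ x v → p x (i x v)

  Covers : {I : Set} → Open → (I → Open) → Set
  Covers U V = ∀ x → mem U x → ∃ λ i → mem (V i) x

  record OModule : Set₁ where
    field
      sections : (U : Open) → Module (𝒪 U) 0ℓ 0ℓ
    module Γ (U : Open) = Module (sections U)
    ∣_∣ : Open → Set
    ∣ U ∣ = Γ.Carrierᴹ U
    field
      res      : ∀ {U V} → V ⊆ U → ∣ U ∣ → ∣ V ∣
      res-cong : ∀ {U V} (p : V ⊆ U) {s t} →
                 Γ._≈ᴹ_ U s t → Γ._≈ᴹ_ V (res p s) (res p t)
      res-+    : ∀ {U V} (p : V ⊆ U) s t →
                 Γ._≈ᴹ_ V (res p (Γ._+ᴹ_ U s t)) (Γ._+ᴹ_ V (res p s) (res p t))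
      res-*    : ∀ {U V} (p : V ⊆ U) a s →
                 Γ._≈ᴹ_ V (res p (Γ._*ₗ_ U a s))
                          (Γ._*ₗ_ V (restrict p a) (res p s))
      res-id   : ∀ {U} (p : U ⊆ U) s → Γ._≈ᴹ_ U (res p s) s
      res-∘    : ∀ {U V W} (p : V ⊆ U) (q : W ⊆ V) (r : W ⊆ U) s →
                 Γ._≈ᴹ_ W (res q (res p s)) (res r s)
      separation : ∀ {I : Set} {U} (V : I → Open) (p : ∀ i → V i ⊆ U) →
        Covers U V → ∀ s t →
        (∀ i → Γ._≈ᴹ_ (V i) (res (p i) s) (res (p i) t)) → Γ._≈ᴹ_ U s t
      gluing   : ∀ {I : Set} {U} (V : I → Open) (p : ∀ i → V i ⊆ U) →
        Covers U V → (s : ∀ i → ∣ V i ∣) →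
        (∀ i j → Γ._≈ᴹ_ (V i ∩ V j) (res ∩⊆ˡ (s i)) (res ∩⊆ʳ (s j))) →
        ∃ λ t → ∀ i → Γ._≈ᴹ_ (V i) (res (p i) t) (s i)

    combine : ∀ {n} U → (Fin n → CommutativeRing.Carrier (𝒪 U)) →
              (Fin n → ∣ U ∣) → ∣ U ∣
    combine U c e = ∑ (Γ._+ᴹ_ U) (Γ.0ᴹ U) (λ i → Γ._*ₗ_ U (c i) (e i))

    -- The map 𝒪ⁿ|U → M|U given by e is an isomorphism.
    IsFrame : ∀ {n} U → (Fin n → ∣ U ∣) → Set₁
    IsFrame {n} U e = ∀ V (p : V ⊆ U) (s : ∣ V ∣) →
      Σ (Fin n → CommutativeRing.Carrier (𝒪 V)) λ c →
        Γ._≈ᴹ_ V s (combine V c (res p ∘ e)) ×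
        (∀ c′ → Γ._≈ᴹ_ V s (combine V c′ (res p ∘ e)) →
           ∀ i → CommutativeRing._≈_ (𝒪 V) (c i) (c′ i))

  record Hom (M N : OModule) : Set₁ where
    private
      module M = OModule M
      module N = OModule N
    field
      fun  : ∀ U → M.∣ U ∣ → N.∣ U ∣
      cong : ∀ U {s t} → M.Γ._≈ᴹ_ U s t → N.Γ._≈ᴹ_ U (fun U s) (fun U t)
      add  : ∀ U s t → N.Γ._≈ᴹ_ U (fun U (M.Γ._+ᴹ_ U s t))
                                  (N.Γ._+ᴹ_ U (fun U s) (fun U t))
      act  : ∀ U a s → N.Γ._≈ᴹ_ U (fun U (M.Γ._*ₗ_ U a s))
                                  (N.Γ._*ₗ_ U a (fun U s))
      nat  : ∀ {U V} (p : V ⊆ U) s →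
             N.Γ._≈ᴹ_ V (fun V (M.res p s)) (N.res p (fun U s))

  record Bilinear (M N P : OModule) : Set₁ where
    private
      module M = OModule M
      module N = OModule N
      module P = OModule P
    field
      fun  : ∀ U → M.∣ U ∣ → N.∣ U ∣ → P.∣ U ∣
      cong : ∀ U {s s′ t t′} → M.Γ._≈ᴹ_ U s s′ → N.Γ._≈ᴹ_ U t t′ →
             P.Γ._≈ᴹ_ U (fun U s t) (fun U s′ t′)
      addˡ : ∀ U s s′ t → P.Γ._≈ᴹ_ U (fun U (M.Γ._+ᴹ_ U s s′) t)
                            (P.Γ._+ᴹ_ U (fun U s t) (fun U s′ t))
      addʳ : ∀ U s t t′ → P.Γ._≈ᴹ_ U (fun U s (N.Γ._+ᴹ_ U t t′))
                            (P.Γ._+ᴹ_ U (fun U s t) (fun U s t′))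
      actˡ : ∀ U a s t → P.Γ._≈ᴹ_ U (fun U (M.Γ._*ₗ_ U a s) t)
                                    (P.Γ._*ₗ_ U a (fun U s t))
      actʳ : ∀ U a s t → P.Γ._≈ᴹ_ U (fun U s (N.Γ._*ₗ_ U a t))
                                    (P.Γ._*ₗ_ U a (fun U s t))
      nat  : ∀ {U V} (p : V ⊆ U) s t →
             P.Γ._≈ᴹ_ V (fun V (M.res p s) (N.res p t)) (P.res p (fun U s t))

  -- T ≅ M ⊗ N, by the universal property of the tensor product.
  IsTensor : OModule → OModule → OModule → Set₁
  IsTensor M N T = Σ (Bilinear M N T) λ β → ∀ P (γ : Bilinear M N P) →
    let module P = OModule P
        Factors : Hom T P → Set₁
        Factors h = ∀ U s t → P.Γ._≈ᴹ_ U
          (Hom.fun h U (Bilinear.fun β U s t)) (Bilinear.fun γ U s t)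
    in Σ (Hom T P) λ h → Factors h ×
         (∀ h′ → Factors h′ → ∀ U s → P.Γ._≈ᴹ_ U (Hom.fun h U s) (Hom.fun h′ U s))

  record VectorBundle (n : ℕ) : Set₁ where
    field
      sheaf       : OModule
    open OModule sheaf public
    field
      locallyFree : ∀ x → Σ Open λ U → mem U x ×
                    Σ (Fin n → ∣ U ∣) λ e → IsFrame U e
  open VectorBundle public using (sheaf)

  LineBundle : Set₁
  LineBundle = VectorBundle 1

  -- Equality of classes in ℙBun: M′ ≅ M ⊗ L for some line bundle L.
  infix 4 _∼_
  _∼_ : ∀ {n} → VectorBundle n → VectorBundle n → Set₁
  M ∼ M′ = Σ LineBundle λ L → IsTensor (sheaf M) (sheaf L) (sheaf M′)

  -- A line bundle with an injective morphism to M and locally free cokernel: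
  -- an exact sequence of sheaves 0 → L → M → Q → 0 with Q locally free.
  record LineSubbundle {n} (M : VectorBundle n) : Set₁ where
    field
      L    : LineBundle
      rank : ℕ
      Q    : VectorBundle rank
      i    : Hom (sheaf L) (sheaf M)
      π    : Hom (sheaf M) (sheaf Q)
    private
      module L = VectorBundle L
      module M = VectorBundle M
      module Q = VectorBundle Q
      module i = Hom i
      module π = Hom π
    field
      injective  : ∀ U s t → M.Γ._≈ᴹ_ U (i.fun U s) (i.fun U t) →
                   L.Γ._≈ᴹ_ U s t
      complex    : ∀ U s → Q.Γ._≈ᴹ_ U (π.fun U (i.fun U s)) (Q.Γ.0ᴹ U)
      exact      : ∀ U t → Q.Γ._≈ᴹ_ U (π.fun U t) (Q.Γ.0ᴹ U) →
                   ∃ λ s → M.Γ._≈ᴹ_ U (i.fun U s) t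
      surjective : ∀ U r x → mem U x →
                   Σ Open λ V → mem V x × Σ (V ⊆ U) λ p →
                   ∃ λ t → Q.Γ._≈ᴹ_ V (π.fun V t) (Q.res p r)

  F-over-k : RawLeftModule k.Carrier 0ℓ 0ℓ
  F-over-k = record
    { Carrierᴹ = F.Carrier
    ; _≈ᴹ_ = F._≈_
    ; _+ᴹ_ = F._+_
    ; _*ₗ_ = λ c a → const c F.* a
    ; 0ᴹ   = F.0#
    ; -ᴹ_  = F.-_
    }

  -- deg x = [κ(x) : k], where κ(x) = 𝒪_{X,x} / 𝔪_x.
  IsPointDegree : Point → ℕ → Set
  IsPointDegree x =
    HasDim k.rawRing F-over-k (Ball F (ord x) ℤ.0ℤ) (Ball F (ord x) ℤ.1ℤ)

  -- deg M = deg (det M), computed as the degree of the divisor of the rational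
  -- section b₁ ∧ … ∧ bₙ of det M, where b is a frame of M over U: near x, if e
  -- is a local frame and b = A e, its order of vanishing is ord_x (det A),
  -- which is 0 for x ∈ U.
  record IsDegree {n} (M : VectorBundle n) (d : ℤ) : Set₁ where
    open VectorBundle M
    field
      U       : Open
      b       : Fin n → ∣ U ∣
      b-frame : IsFrame U b
      S       : List Point
      S-uniq  : Unique S
      S-rest  : ∀ x → mem U x ⊎ x ∈ S
      V       : Point → Open
      V-nbhd  : ∀ x → mem (V x) x
      e       : ∀ x → Fin n → ∣ V x ∣
      e-frame : ∀ x → IsFrame (V x) (e x)
      A       : ∀ x → Fin n → Fin n → CommutativeRing.Carrier (𝒪 (U ∩ V x))
      b≈Ae    : ∀ x i → Γ._≈ᴹ_ (U ∩ V x) (res ∩⊆ˡ (b i))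
                          (combine (U ∩ V x) (A x i) (res ∩⊆ʳ ∘ e x))
      deg     : Point → ℕ
      deg-x   : ∀ x → IsPointDegree x (deg x)
      formula : d ≡ List.foldr ℤ._+_ ℤ.0ℤ (List.map
                  (λ x → ℤ.+ deg x ℤ.* ord x (det F.ring (λ i j → proj₁ (A x i j)))) S)

  IsSlope : ∀ {n} → VectorBundle n → ℤ → Set₁
  IsSlope M s = Σ (LineSubbundle M) λ L → Σ ℤ λ l → Σ ℤ λ m →
    IsDegree (LineSubbundle.L L) l × IsDegree M m ×
    s ≡ ℤ.+ 2 ℤ.* l ℤ.- m

  Isδ : VectorBundle 2 → ℤ → Set₁
  Isδ M d = (∀ s → IsSlope M s → s ℤ.≤ d) ×
            (∀ d′ → (∀ s → IsSlope M s → s ℤ.≤ d′) → d ℤ.≤ d′)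

record Space : Set₁ where
  field
    Carrier : Set
    IsOpen  : (Carrier → Set) → Set

module _ (T : Space) where
  open Space T

  Compact : (Carrier → Set) → Set₁
  Compact S = (I : Set) (U : I → Carrier → Set) → (∀ i → IsOpen (U i)) →
    (∀ t → S t → ∃ λ i → U i t) →
    ∃ λ (J : List I) → ∀ t → S t → Any (λ i → U i t) J

module Haar (ℝ : RealField) where
  open Complex ℝ

  -- Locally constant functions with compact support.  (The set where such a
  -- function is non-zero is already closed.)
  IsTest : (T : Space) → (Space.Carrier T → ℂ) → Set₁
  IsTest T f =
    (∀ t → Σ (Carrier → Set) λ U → IsOpen U × U t × (∀ u → U u → f u ≈ f t)) ×
    Compact T (λ t → ¬ f t ≈ 0#)
    where open Space T

  -- A Haar integral on a totally disconnected locally compact space T with a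
  -- transitive action τ: a non-zero positive invariant linear functional on
  -- C_c^∞(T) (Bushnell–Henniart, The Local Langlands Conjecture for GL(2), §3).
  -- ∫ is a total operation, but nothing is assumed outside C_c^∞(T).
  record HaarIntegral (T : Space) {S : Set}
                      (τ : S → Space.Carrier T → Space.Carrier T) : Set₁ where
    open Space T
    field
      ∫         : (Carrier → ℂ) → ℂ
      cong      : ∀ f g → IsTest T f → (∀ t → f t ≈ g t) → ∫ f ≈ ∫ g
      add       : ∀ f g → IsTest T f → IsTest T g →
                  ∫ (λ t → f t + g t) ≈ ∫ f + ∫ g
      scale     : ∀ c f → IsTest T f → ∫ (λ t → c * f t) ≈ c * ∫ f
      positive  : ∀ f → IsTest T f → (∀ t → Nonnegative (f t)) →
                  Nonnegative (∫ f)
      nonzero   : ∃ λ f → IsTest T f × ¬ ∫ f ≈ 0#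
      invariant : ∀ s f → IsTest T f → ∫ (λ t → f (τ s t)) ≈ ∫ f

Completions : Curve → Set₁
Completions X = ∀ x → Completion (Curve.F X) (Curve.ord X x)

module Adeles (X : Curve) (F̂ : Completions X) where
  open Curve X
  private
    module k = Field k
    module F = Field F
    module F̂ (x : Point) = Completion (F̂ x)

  IntegralAt : (x : Point) → F̂.Carrier x → Set
  IntegralAt x = Ball (F̂.K x) (F̂.val x) ℤ.0ℤ

  record Adele : Set where
    constructor adele
    field
      at       : ∀ x → F̂.Carrier x
      integral : AlmostAll (λ x → IntegralAt x (at x))
  open Adele public using (at)

  𝔸 : CRing
  𝔸 = record
    { Carrier = Adele
    ; _≈_ = λ a b → ∀ x → F̂._≈_ x (at a x) (at b x)
    ; _+_ = λ (adele a p) (adele b q) →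
        adele (λ x → F̂._+_ x (a x) (b x)) (almostAll-∩ (λ {x} → F̂.ball-+ x) p q)
    ; _*_ = λ (adele a p) (adele b q) →
        adele (λ x → F̂._*_ x (a x) (b x)) (almostAll-∩ (λ {x} → F̂.ball-* x) p q)
    ; -_  = λ (adele a p) →
        adele (λ x → F̂.-_ x (a x)) (almostAll-map (λ {x} → F̂.ball-neg x) p)
    ; 0#  = adele F̂.0# ([] , λ x → inj₁ (F̂.ball-0 x))
    ; 1#  = adele F̂.1# ([] , λ x → inj₁ (F̂.ball-1 x))
    ; isCommutativeRing = record
      { isRing = record
        { +-isAbelianGroup = record
          { isGroup = record
            { isMonoid = record
              { isSemigroup = record
                { isMagma = record
                  { isEquivalence = record
                    { refl  = λ x → F̂.refl x
                    ; sym   = λ p x → F̂.sym x (p x)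
                    ; trans = λ p q x → F̂.trans x (p x) (q x)
                    }
                  ; ∙-cong = λ p q x → F̂.+-cong x (p x) (q x)
                  }
                ; assoc = λ a b c x → F̂.+-assoc x (at a x) (at b x) (at c x)
                }
              ; identity = (λ a x → F̂.+-identityˡ x (at a x))
                         , (λ a x → F̂.+-identityʳ x (at a x))
              }
            ; inverse = (λ a x → F̂.-‿inverseˡ x (at a x))
                      , (λ a x → F̂.-‿inverseʳ x (at a x))
            ; ⁻¹-cong = λ p x → F̂.-‿cong x (p x)
            }
          ; comm = λ a b x → F̂.+-comm x (at a x) (at b x)
          }
        ; *-cong = λ p q x → F̂.*-cong x (p x) (q x)
        ; *-assoc = λ a b c x → F̂.*-assoc x (at a x) (at b x) (at c x)
        ; *-identity = (λ a x → F̂.*-identityˡ x (at a x))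
                     , (λ a x → F̂.*-identityʳ x (at a x))
        ; distrib = (λ a b c x → F̂.distribˡ x (at a x) (at b x) (at c x))
                  , (λ a b c x → F̂.distribʳ x (at a x) (at b x) (at c x))
        }
      ; *-comm = λ a b x → F̂.*-comm x (at a x) (at b x)
      }
    }

  module 𝔸 = CommutativeRing 𝔸

  -- a ∈ F, diagonally embedded.
  Principal : Adele → Set
  Principal a = ∃ λ f → ∀ x → F̂._≈_ x (at a x) (F̂.embed x f)

  -- a ∈ 𝒪_𝔸.
  Integral : Adele → Set
  Integral a = ∀ x → IntegralAt x (at a x)

  -- The neighbourhood {ord_x a ≥ D(x) for all x} of 0, for a divisor D; these
  -- form a base of neighbourhoods.
  Divisor : Set
  Divisor = Σ (Point → ℤ) λ D → AlmostAll (λ x → D x ≡ ℤ.0ℤ)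

  Within : Divisor → Adele → Set
  Within (D , _) a = ∀ x → Ball (F̂.K x) (F̂.val x) (D x) (at a x)

  private
    const-integral : ∀ c x → IntegralAt x (F̂.embed x (const c))
    const-integral c x c≉0 = ℤₚ.≤-reflexive (≡.sym (≡.trans
      (F̂.extends x (const c) φc≉0) (proj₂ (isPlace x) c φc≉0)))
      where
      φc≉0 : ¬ const c F.≈ F.0#
      φc≉0 p = c≉0 (F̂.trans x (F̂.embed-cong x p) (RingHom.0#-homo (F̂.ι x)))

  𝔸-over-k : RawLeftModule k.Carrier 0ℓ 0ℓ
  𝔸-over-k = record
    { Carrierᴹ = Adele
    ; _≈ᴹ_ = 𝔸._≈_
    ; _+ᴹ_ = 𝔸._+_
    ; _*ₗ_ = λ c → adele (λ x → F̂.embed x (const c))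
                         ([] , λ x → inj₁ (const-integral c x)) 𝔸.*_
    ; 0ᴹ   = 𝔸.0#
    ; -ᴹ_  = 𝔸.-_
    }

  -- g_X = dim_k H¹(X, 𝒪_X), with H¹(X, 𝒪_X) = 𝔸 / (F + 𝒪_𝔸).
  IsGenus : ℕ → Set
  IsGenus = HasDim k.rawRing 𝔸-over-k
    (λ a → a 𝔸.≈ a)
    (λ a → ∃ λ f → ∃ λ o → Principal f × Integral o × a 𝔸.≈ f 𝔸.+ o)

  -- PGL₂ is GL₂ modulo its centre; over F, 𝔸 and 𝒪_𝔸 this also holds on
  -- points, so elements of PGL₂(𝔸) are given by matrices (a b ; c d) with
  -- u = det⁻¹, compared by _~_.
  record GL₂ : Set where
    field
      a b c d u : Adele
      unit : (a 𝔸.* d 𝔸.- b 𝔸.* c) 𝔸.* u 𝔸.≈ 𝔸.1#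

  infixl 7 _·_
  _·_ : GL₂ → GL₂ → GL₂
  g · h = record
    { a = g.a 𝔸.* h.a 𝔸.+ g.b 𝔸.* h.c
    ; b = g.a 𝔸.* h.b 𝔸.+ g.b 𝔸.* h.d
    ; c = g.c 𝔸.* h.a 𝔸.+ g.d 𝔸.* h.c
    ; d = g.c 𝔸.* h.b 𝔸.+ g.d 𝔸.* h.d
    ; u = g.u 𝔸.* h.u
    ; unit = det-mult-unit 𝔸 g.a g.b g.c g.d h.a h.b h.c h.d g.u h.u g.unit h.unit
    }
    where
    module g = GL₂ g
    module h = GL₂ h

  infix 4 _~_
  _~_ : GL₂ → GL₂ → Set
  g ~ h = ∃ λ z → (∃ λ z⁻¹ → z 𝔸.* z⁻¹ 𝔸.≈ 𝔸.1#) ×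
    g.a 𝔸.≈ z 𝔸.* h.a × g.b 𝔸.≈ z 𝔸.* h.b ×
    g.c 𝔸.≈ z 𝔸.* h.c × g.d 𝔸.≈ z 𝔸.* h.d
    where
    module g = GL₂ g
    module h = GL₂ h

  AllEntries : (Adele → Set) → GL₂ → Set
  AllEntries P g = P a × P b × P c × P d × P u
    where open GL₂ g

  -- The images of PGL₂(F) and K = PGL₂(𝒪_𝔸) in PGL₂(𝔸).
  InG⟨F⟩ InK : GL₂ → Set
  InG⟨F⟩ g = ∃ λ h → g ~ h × AllEntries Principal h
  InK    g = ∃ λ h → g ~ h × AllEntries Integral h

  unipotent : Adele → GL₂
  unipotent b = record
    { a = 𝔸.1# ; b = b ; c = 𝔸.0# ; d = 𝔸.1# ; u = 𝔸.1#
    ; unit = unipotent-unit 𝔸 b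
    }

  -- The quotient topology from GL₂(𝔸), which is topologized as a subspace of
  -- 𝔸⁵ by the entries and the inverse determinant.
  G⟨𝔸⟩ : Space
  G⟨𝔸⟩ = record
    { Carrier = GL₂
    ; IsOpen  = λ U →
        (∀ g → U g → Σ Divisor λ D → ∀ h →
           Within D (a h 𝔸.- a g) → Within D (b h 𝔸.- b g) →
           Within D (c h 𝔸.- c g) → Within D (d h 𝔸.- d g) →
           Within D (u h 𝔸.- u g) → U h) ×
        (∀ g h → g ~ h → U g → U h)
    }
    where open GL₂

  -- N(F)\N(𝔸) = F\𝔸, via b ↦ unipotent b, with its quotient topology.
  N⟨F⟩\N⟨𝔸⟩ : Space
  N⟨F⟩\N⟨𝔸⟩ = record
    { Carrier = Adele
    ; IsOpen  = λ U →
        (∀ a → U a → Σ Divisor λ D → ∀ b → Within D (b 𝔸.- a) → U b) ×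
        (∀ p a → Principal p → U a → U (p 𝔸.+ a))
    }

  module Automorphic (ℝ : RealField) where
    open Complex ℝ
    open Haar ℝ

    HaarG HaarN : Set₁
    HaarG = HaarIntegral G⟨𝔸⟩ _·_
    HaarN = HaarIntegral N⟨F⟩\N⟨𝔸⟩ (λ n a → a 𝔸.+ n)

    -- vol K = 1.
    Normalized : HaarG → Set
    Normalized dg = ∀ χ → (∀ g → InK g → χ g ≈ 1#) →
      (∀ g → ¬ InK g → χ g ≈ 0#) → HaarIntegral.∫ dg χ ≈ 1#

    InHecke : (GL₂ → ℂ) → Set₁
    InHecke Φ = IsTest G⟨𝔸⟩ Φ ×
      (∀ κ g κ′ → InK κ → InK κ′ → Φ (κ · g · κ′) ≈ Φ g)

    act : HaarG → (GL₂ → ℂ) → (GL₂ → ℂ) → (GL₂ → ℂ)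
    act dg Φ f g = HaarIntegral.∫ dg (λ h → Φ h * f (g · h))

    -- Functions on the double quotient are the functions on PGL₂(𝔸) invariant
    -- under both groups; the first clause makes f a function on PGL₂(𝔸).
    𝒱₀ : HaarG → HaarN → (GL₂ → ℂ) → Set₁
    𝒱₀ dg dn f =
      (∀ g h → g ~ h → f g ≈ f h) ×
      (∀ γ g → InG⟨F⟩ γ → f (γ · g) ≈ f g) ×
      (∀ g κ → InK κ → f (g · κ) ≈ f g) ×
      (∀ Φ → InHecke Φ →
         HaarIntegral.∫ dn (λ n → act dg Φ f (unipotent n)) ≈ 0#)

    Dim𝒱₀ : HaarG → HaarN → ℕ → Set₁
    Dim𝒱₀ dg dn = HasDim ℂ-ring (functions GL₂) (𝒱₀ dg dn)
      (λ f → ∀ g → f g ≈ 0#)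

m_X : ℕ → ℤ
m_X g = (ℤ.+ 2 ℤ.* ℤ.+ g ℤ.- ℤ.+ 2) ℤ.⊔ ℤ.0ℤ

module Submission where

-- A function f in 𝒱₀ that vanishes on the classes with δ ≤ m_X is 0, by induction on δ. A class with
-- δ = d > m_X is that of some h = diag(t, 1) with deg t = −d, as H¹ vanishes. Apply the condition on f to
-- the indicator of K h K: the translates n h' (h' ∈ K h) have δ ≤ d, with equality only in the class of h, so the
-- integral is a positive multiple of f(h). Reduction theory leaves finitely many classes with δ ≤ m_X, and a
-- family of them dual to a basis of 𝒱₀ gives pairwise inequivalent bundles, one for each basis vector.

open import Defs renaming (IsDiscreteValuation to IsDVal)
open import Level using (0ℓ; Setω)
open import Axiom.ExcludedMiddle using (ExcludedMiddle)
open import Algebra.Bundles using (AbelianGroup; CommutativeRing; Group)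
open import Algebra.Module.Bundles.Raw using (RawLeftModule)
open import Data.Empty using (⊥; ⊥-elim)
open import Data.Fin.Base as Fin using (Fin; zero; suc)
import Data.Fin.Properties as Finₚ
open import Data.Integer.Base as Z using (ℤ; 0ℤ; 1ℤ; -1ℤ; _≤_; _<_)
open import Data.Integer.Properties as ℤₚ using (+-mono-<; +-mono-≤; +-monoʳ-<; +-monoʳ-≤; +-monoˡ-≤; 0≤i-j⇒j≤i; <-irrefl; <-≤-trans; <⇒≤; <⇒≱; i<j⇒suc[i]≤j; i≤i⊔j; i≤j⇒0≤j-i; i≤j⊔i; neg-mono-<; neg-mono-≤; suc[i]≤j⇒i<j; ≤-antisym; ≤-refl; ≤-reflexive; ≤-trans; ≤∧≢⇒<; ≮⇒≥)
open import Data.List.Base as List using (List; []; _∷_; _++_; length)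
open import Data.List.Membership.Propositional using (_∈_)
open import Data.List.Relation.Unary.All as All using (All; []; _∷_)
open import Data.List.Relation.Unary.Any as Any using (Any; here; there)
import Data.List.Relation.Unary.Any.Properties as Anyₚ
open import Data.Nat.Base as ℕ using (ℕ; zero; suc)
import Data.Nat.Properties as ℕₚ
open import Data.Product.Base using (Σ; ∃; _×_; _,_) renaming (proj₁ to fst; proj₂ to snd)
open import Data.Sum.Base using (_⊎_) renaming (inj₁ to inl; inj₂ to inr)
import Data.Vec.Functional as Vector
open import Function.Base using (_∘_)
open import Function.Bundles using (Bijection)
open import Relation.Binary.PropositionalEquality as ≡ using (_≡_; subst) renaming (cong to ap; cong₂ to ap₂)
open import Relation.Nullary using (¬_; Dec; yes; no)
open import Algebra.Solver.Ring.AlmostCommutativeRing as ACR using (AlmostCommutativeRing; _-Raw-AlmostCommutative⟶_)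
import Algebra.Solver.Ring as RingSolver
import Algebra.Properties.Ring as RingProperties
import Algebra.Properties.Semiring.Mult.TCOptimised as Mult
open import Data.Maybe.Base using (Maybe; just; nothing; is-just)
open import Data.Bool.Base as Bool using (Bool)
import Data.Vec.Base as Vec
import Data.List.Relation.Unary.All.Properties as Allₚ
import Data.List.Properties as Listₚ
import Data.List.Membership.Setoid.Properties as SetoidMembership
import Data.Sum.Base as Sum
open import Data.List.Membership.Propositional.Properties using (∈-++⁺ˡ; ∈-++⁺ʳ)
import Algebra.Properties.Group as GroupProperties
open import Data.Maybe.Base using (Maybe; just; nothing)
open import Data.Unit.Base using (⊤; tt)
open import Relation.Binary.Structures using (IsTotalOrder)
import Data.Fin.Base as FinBase
open import Data.List.Relation.Unary.Unique.Propositional using (Unique; []; _∷_)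
open import Algebra.Module.Structures.Biased using (module IsModuleFromLeft)
open import Data.List.Relation.Unary.Unique.Propositional using (Unique)

-- A `Curve` supplies only a function field and its discrete valuations, and the genus is dim 𝔸 / (F
-- + 𝒪_𝔸). Existence of points, residue degrees and finiteness of zeros have to be proved from this;
-- they come from one source, `relation-mod-y`, which bounds dim R / yR for every k-subspace R of F
-- stable under y. In place of Serre duality there is an inequality, obtained by multiplying one
-- functional on H¹ by sections. The constant m_X has two effects. From d > 2g - 2 the extension
-- with -deg t = d splits. From d > 2g - 2 and d > 0 one gets g ≤ d, so a rational function turns t
-- into an idele with integral inverse; then the elements of K h K have representatives with
-- integral inverses, and this is what bounds the slopes of n h' by d. Compactness of cosets is read
-- off from the support of a test function with non-zero integral, which each Haar integral
-- supplies. The count of bundles rests on one implication: bundles equivalent under twisting give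
-- the same double coset, where all functions of 𝒱₀ take equal values.

EM : Setω
EM = ∀ {ℓ} -> ExcludedMiddle ℓ

-- Classical logic, ring laws and an equation solver

module Classical (em : EM) where
 dne : ∀ {ℓ} {A : Set ℓ} -> ¬ ¬ A -> A
 dne {A = A} h with em {P = A}
 ... | yes a = a
 ... | no ¬a = ⊥-elim (h ¬a)

 ¬∀⇒∃¬ : ∀ {a p} {A : Set a} {P : A -> Set p} -> ¬ (∀ x -> P x) -> ∃ λ x -> ¬ P x
 ¬∀⇒∃¬ h = dne λ k -> h λ x -> dne λ p -> k (x , p)

-- The laws of a commutative ring with their types written out: this spares Agda from unfolding the
-- library's aliases (Transitive, Congruent₂, …) at every use, which is needed to keep the memory use low.

module RingLaws (R : CRing) where
 private module R = CommutativeRing R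
 open CommutativeRing R public using (Carrier; _≈_; _+_; _*_; -_; _-_; 0#; 1#; setoid; semiring; commutativeSemiring; rawRing)

 refl : ∀ {x} -> x ≈ x
 refl = R.refl

 reflexive : ∀ {x y} -> x ≡ y -> x ≈ y
 reflexive = R.reflexive

 sym : ∀ {x y} -> x ≈ y -> y ≈ x
 sym = R.sym

 trans : ∀ {x y z} -> x ≈ y -> y ≈ z -> x ≈ z
 trans = R.trans

 +-cong : ∀ {x y u v} -> x ≈ y -> u ≈ v -> x + u ≈ y + v
 +-cong = R.+-cong

 +ˡ : ∀ {x y z} -> y ≈ z -> x + y ≈ x + z
 +ˡ = R.+-congˡ

 +ʳ : ∀ {x y z} -> y ≈ z -> y + x ≈ z + x
 +ʳ = R.+-congʳ

 *-cong : ∀ {x y u v} -> x ≈ y -> u ≈ v -> x * u ≈ y * v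
 *-cong = R.*-cong

 *ˡ : ∀ {x y z} -> y ≈ z -> x * y ≈ x * z
 *ˡ = R.*-congˡ

 *ʳ : ∀ {x y z} -> y ≈ z -> y * x ≈ z * x
 *ʳ = R.*-congʳ

 -‿cong : ∀ {x y} -> x ≈ y -> - x ≈ - y
 -‿cong = R.-‿cong

 +-assoc : ∀ x y z -> (x + y) + z ≈ x + (y + z)
 +-assoc = R.+-assoc

 +-comm : ∀ x y -> x + y ≈ y + x
 +-comm = R.+-comm

 +-idˡ : ∀ x -> 0# + x ≈ x
 +-idˡ = R.+-identityˡ

 +-idʳ : ∀ x -> x + 0# ≈ x
 +-idʳ = R.+-identityʳ

 -‿inverseˡ : ∀ x -> - x + x ≈ 0#
 -‿inverseˡ = R.-‿inverseˡ

 -‿inverseʳ : ∀ x -> x - x ≈ 0#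
 -‿inverseʳ = R.-‿inverseʳ

 *-assoc : ∀ x y z -> (x * y) * z ≈ x * (y * z)
 *-assoc = R.*-assoc

 *-comm : ∀ x y -> x * y ≈ y * x
 *-comm = R.*-comm

 *-idˡ : ∀ x -> 1# * x ≈ x
 *-idˡ = R.*-identityˡ

 *-idʳ : ∀ x -> x * 1# ≈ x
 *-idʳ = R.*-identityʳ

 distribˡ : ∀ x y z -> x * (y + z) ≈ x * y + x * z
 distribˡ = R.distribˡ

 distribʳ : ∀ x y z -> (y + z) * x ≈ y * x + z * x
 distribʳ = R.distribʳ

 zeroˡ : ∀ x -> 0# * x ≈ 0#
 zeroˡ = R.zeroˡ

 zeroʳ : ∀ x -> x * 0# ≈ 0#
 zeroʳ = R.zeroʳ

 module Reasoning where
  infix 1 begin_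
  begin_ : ∀ {x y} -> x ≈ y -> x ≈ y
  begin p = p
  infix 3 _∎
  _∎ : ∀ x -> x ≈ x
  x ∎ = refl
  infixr 2 link link⁻ link≡ link≡⁻
  link : ∀ x {y z} -> y ≈ z -> x ≈ y -> x ≈ z
  link x q p = trans p q
  link⁻ : ∀ x {y z} -> y ≈ z -> y ≈ x -> x ≈ z
  link⁻ x q p = trans (sym p) q
  link≡ : ∀ x {y z} -> y ≈ z -> x ≡ y -> x ≈ z
  link≡ x q ≡.refl = q
  link≡⁻ : ∀ x {y z} -> y ≈ z -> y ≡ x -> x ≈ z
  link≡⁻ x q ≡.refl = q
  syntax link x q p = x ≈⟨ p ⟩ q
  syntax link⁻ x q p = x ≈⟨ p ⟨ q
  syntax link≡ x q p = x ≡⟨ p ⟩ q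
  syntax link≡⁻ x q p = x ≡⟨ p ⟨ q

module RingSums (R : CRing) where
 open RingLaws R
 sum-scale : ∀ {n} c (v : Fin n -> Carrier) -> ∑ _+_ 0# (λ i -> c * v i) ≈ c * ∑ _+_ 0# v
 sum-scale {zero} c v = sym (zeroʳ c)
 sum-scale {suc n} c v = trans (+ˡ (sum-scale c (v ∘ suc))) (sym (distribˡ c _ _))

module FieldLaws (K : Field) where
 open Field K public using (ring; 1≉0; inverse)
 open RingLaws ring public

module Integers⇒ (R : CRing) where
 open RingLaws R
 open Reasoning
 open Mult semiring using (1+×; ×-homo-+; ×1-homo-*) renaming (_×_ to _⊗_)
 open RingProperties (CommutativeRing.ring R) using (-‿distribˡ-*; -‿distribʳ-*; -‿involutive; -0#≈0#; -‿+-comm)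

 ⟦_⟧ : ℤ -> Carrier
 ⟦ Z.+ n ⟧ = n ⊗ 1#
 ⟦ Z.-[1+ n ] ⟧ = - (suc n ⊗ 1#)

 minus-cancel : ∀ x y z -> (x + y) - (x + z) ≈ y - z
 minus-cancel x y z = begin
  (x + y) - (x + z) ≈⟨ +-cong (+-comm x y) (sym (-‿+-comm x z)) ⟩
  (y + x) + (- x + - z) ≈⟨ +-assoc y x _ ⟩
  y + (x + (- x + - z)) ≈⟨ +ˡ (sym (+-assoc x (- x) (- z))) ⟩
  y + ((x - x) + - z) ≈⟨ +ˡ (+ʳ (-‿inverseʳ x)) ⟩
  y + (0# + - z) ≈⟨ +ˡ (+-idˡ _) ⟩
  y - z ∎

 ⊖-homo : ∀ m n -> ⟦ m Z.⊖ n ⟧ ≈ m ⊗ 1# - n ⊗ 1#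
 ⊖-homo m zero = sym (trans (+ˡ -0#≈0#) (+-idʳ _))
 ⊖-homo zero (suc n) = sym (+-idˡ _)
 ⊖-homo (suc m) (suc n) = begin
  ⟦ suc m Z.⊖ suc n ⟧ ≡⟨ ap ⟦_⟧ (ℤₚ.[1+m]⊖[1+n]≡m⊖n m n) ⟩
  ⟦ m Z.⊖ n ⟧ ≈⟨ ⊖-homo m n ⟩
  m ⊗ 1# - n ⊗ 1# ≈⟨ minus-cancel 1# _ _ ⟨
  (1# + m ⊗ 1#) - (1# + n ⊗ 1#)
   ≈⟨ +-cong (1+× m 1#) (-‿cong (1+× n 1#)) ⟨
  suc m ⊗ 1# - suc n ⊗ 1# ∎

 +-homo : ∀ i j -> ⟦ i Z.+ j ⟧ ≈ ⟦ i ⟧ + ⟦ j ⟧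
 +-homo (Z.+ m) (Z.+ n) = ×-homo-+ 1# m n
 +-homo (Z.+ m) Z.-[1+ n ] = ⊖-homo m (suc n)
 +-homo Z.-[1+ m ] (Z.+ n) = trans (⊖-homo n (suc m)) (+-comm _ _)
 +-homo Z.-[1+ m ] Z.-[1+ n ] = begin
  - (suc (suc (m ℕ.+ n)) ⊗ 1#)
   ≡⟨ ap (λ k -> - (k ⊗ 1#)) (ap suc (≡.sym (ℕₚ.+-suc m n))) ⟩
  - ((suc m ℕ.+ suc n) ⊗ 1#) ≈⟨ -‿cong (×-homo-+ 1# (suc m) (suc n)) ⟩
  - (suc m ⊗ 1# + suc n ⊗ 1#) ≈⟨ -‿+-comm _ _ ⟨
  - (suc m ⊗ 1#) - suc n ⊗ 1# ∎

 -‿homo : ∀ i -> ⟦ Z.- i ⟧ ≈ - ⟦ i ⟧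
 -‿homo (Z.+ zero) = sym -0#≈0#
 -‿homo (Z.+ suc n) = refl
 -‿homo Z.-[1+ n ] = sym (-‿involutive _)

 *-homo-pos : ∀ m j -> ⟦ Z.+ m Z.* j ⟧ ≈ m ⊗ 1# * ⟦ j ⟧
 *-homo-pos m (Z.+ n) = begin
  ⟦ Z.+ m Z.* Z.+ n ⟧ ≡⟨ ap ⟦_⟧ (ℤₚ.pos-* m n) ⟨
  (m ℕ.* n) ⊗ 1# ≈⟨ ×1-homo-* m n ⟩
  m ⊗ 1# * n ⊗ 1# ∎
 *-homo-pos m Z.-[1+ n ] = begin
  ⟦ Z.+ m Z.* Z.- Z.+ suc n ⟧ ≡⟨ ap ⟦_⟧ (≡.sym (ℤₚ.neg-distribʳ-* (Z.+ m) (Z.+ suc n))) ⟩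
  ⟦ Z.- (Z.+ m Z.* Z.+ suc n) ⟧ ≈⟨ -‿homo (Z.+ m Z.* Z.+ suc n) ⟩
  - ⟦ Z.+ m Z.* Z.+ suc n ⟧ ≈⟨ -‿cong (*-homo-pos m (Z.+ suc n)) ⟩
  - (m ⊗ 1# * suc n ⊗ 1#) ≈⟨ -‿distribʳ-* _ _ ⟩
  m ⊗ 1# * - (suc n ⊗ 1#) ∎

 *-homo : ∀ i j -> ⟦ i Z.* j ⟧ ≈ ⟦ i ⟧ * ⟦ j ⟧
 *-homo (Z.+ m) j = *-homo-pos m j
 *-homo Z.-[1+ m ] j = begin
  ⟦ Z.- Z.+ suc m Z.* j ⟧ ≡⟨ ap ⟦_⟧ (≡.sym (ℤₚ.neg-distribˡ-* (Z.+ suc m) j)) ⟩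
  ⟦ Z.- (Z.+ suc m Z.* j) ⟧ ≈⟨ -‿homo (Z.+ suc m Z.* j) ⟩
  - ⟦ Z.+ suc m Z.* j ⟧ ≈⟨ -‿cong (*-homo-pos (suc m) j) ⟩
  - (suc m ⊗ 1# * ⟦ j ⟧) ≈⟨ -‿distribˡ-* _ _ ⟩
  - (suc m ⊗ 1#) * ⟦ j ⟧ ∎

 ACRing : AlmostCommutativeRing 0ℓ 0ℓ
 ACRing = ACR.fromCommutativeRing R

 morphism : CommutativeRing.rawRing ℤₚ.+-*-commutativeRing -Raw-AlmostCommutative⟶ ACRing
 morphism = record
  { ⟦_⟧ = ⟦_⟧ ; +-homo = +-homo ; *-homo = *-homo ; -‿homo = -‿homo
  ; 0-homo = refl ; 1-homo = refl }

 _≟'_ : ∀ i j -> Maybe (⟦ i ⟧ ≈ ⟦ j ⟧)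
 i ≟' j with i ℤₚ.≟ j
 ... | yes ≡.refl = just refl
 ... | no _ = nothing

 open RingSolver (CommutativeRing.rawRing ℤₚ.+-*-commutativeRing) ACRing morphism _≟'_ public
  using (Polynomial; ⟦_⟧N-cong; normalise; _≟N_; correct) renaming (op to binary; var to variable'; con to constant; :-_ to negated; [+] to plus; [*] to times; ⟦_⟧ to ⟦_⟧ₚ)

infix 4 _:=_
infixl 6 _:+_ _:-_
infixl 7 _:*_
infix 8 :-_

data Expr (n : ℕ) : Set where
 var : Fin n -> Expr n
 con : ℤ -> Expr n
 _:+_ _:-_ _:*_ : Expr n -> Expr n -> Expr n
 :-_ : Expr n -> Expr n

record Equation (n : ℕ) : Set where
 constructor _:=_
 field
  lhs rhs : Expr n

Equationⁿ : ℕ -> ℕ -> Set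
Equationⁿ zero m = Equation m
Equationⁿ (suc n) m = Expr m -> Equationⁿ n m

instantiate : ∀ n {m} -> Equationⁿ n m -> (Fin n -> Fin m) -> Equation m
instantiate zero e i = e
instantiate (suc n) f i = instantiate n (f (var (i zero))) (i ∘ suc)

ForAll : ∀ {A : Set} n -> (Vec.Vec A n -> Set) -> Set
ForAll zero P = P Vec.[]
ForAll (suc n) P = ∀ x -> ForAll n λ v -> P (x Vec.∷ v)

forAll : ∀ {A : Set} n {P : Vec.Vec A n -> Set} -> (∀ v -> P v) -> ForAll n P
forAll zero p = p Vec.[]
forAll (suc n) p x = forAll n λ v -> p (x Vec.∷ v)

-- The library's solver is wrapped so that its success is a closed Boolean and the equation solved does
-- not mention the solver's parameters: its terms are too large to be kept in memory at every use.

module IntSolver (R : CRing) where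
 open RingLaws R
 private
  module Hom = Integers⇒ R
  polynomial : ∀ {n} -> Expr n -> Hom.Polynomial n
  polynomial (var i) = Hom.variable' i
  polynomial (con c) = Hom.constant c
  polynomial (a :+ b) = Hom.binary Hom.plus (polynomial a) (polynomial b)
  polynomial (a :- b) = Hom.binary Hom.plus (polynomial a) (Hom.negated (polynomial b))
  polynomial (a :* b) = Hom.binary Hom.times (polynomial a) (polynomial b)
  polynomial (:- a) = Hom.negated (polynomial a)
  eval : ∀ {n} -> Expr n -> Vec.Vec Carrier n -> Carrier
  eval (var i) ρ = Vec.lookup ρ i
  eval (con c) ρ = Hom.⟦ c ⟧
  eval (a :+ b) ρ = eval a ρ + eval b ρ
  eval (a :- b) ρ = eval a ρ - eval b ρ
  eval (a :* b) ρ = eval a ρ * eval b ρ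
  eval (:- a) ρ = - eval a ρ
  eval≡ : ∀ {n} (e : Expr n) ρ -> Hom.⟦ polynomial e ⟧ₚ ρ ≡ eval e ρ
  eval≡ (var i) ρ = ≡.refl
  eval≡ (con c) ρ = ≡.refl
  eval≡ (a :+ b) ρ = ap₂ _+_ (eval≡ a ρ) (eval≡ b ρ)
  eval≡ (a :- b) ρ = ap₂ _-_ (eval≡ a ρ) (eval≡ b ρ)
  eval≡ (a :* b) ρ = ap₂ _*_ (eval≡ a ρ) (eval≡ b ρ)
  eval≡ (:- a) ρ = ap -_ (eval≡ a ρ)
  valid : ∀ {n} -> Equation n -> Bool
  valid (a := b) = is-just (Hom.normalise (polynomial a) Hom.≟N Hom.normalise (polynomial b))
  sound : ∀ {n} (e : Equation n) -> Bool.T (valid e) -> ∀ ρ -> eval (Equation.lhs e) ρ ≈ eval (Equation.rhs e) ρ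
  sound (a := b) p ρ with Hom.normalise (polynomial a) Hom.≟N Hom.normalise (polynomial b) | p
  ... | just q | _ = ≡.subst₂ _≈_ (eval≡ a ρ) (eval≡ b ρ)
   (trans (sym (Hom.correct (polynomial a) ρ)) (trans (Hom.⟦ q ⟧N-cong ρ) (Hom.correct (polynomial b) ρ)))
  ... | nothing | ()

 solve : ∀ n (f : Equationⁿ n n) -> let e = instantiate n f (λ i -> i) in
  {_ : Bool.T (valid e)} -> ForAll n λ ρ -> eval (Equation.lhs e) ρ ≈ eval (Equation.rhs e) ρ
 solve n f {p} = forAll n (sound (instantiate n f (λ i -> i)) p)

open IntSolver ℤₚ.+-*-commutativeRing using () renaming (solve to solveℤ)

-- Fields, integer inequalities and discrete valuations

module FieldLemmas (em : EM) (K : Field) where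
 open FieldLaws K
 open IntSolver ring
 open Classical em
 open Reasoning

 infix 4 _≉0
 _≉0 : Carrier -> Set
 a ≉0 = ¬ a ≈ 0#

 -- inv 0 = 0.
 inv : Carrier -> Carrier
 inv x with em {P = x ≈ 0#}
 ... | yes _ = 0#
 ... | no p = fst (inverse x p)

 inv-r : ∀ {x} -> x ≉0 -> x * inv x ≈ 1#
 inv-r {x} p with em {P = x ≈ 0#}
 ... | yes q = ⊥-elim (p q)
 ... | no q = snd (inverse x q)

 inv-l : ∀ {x} -> x ≉0 -> inv x * x ≈ 1#
 inv-l p = trans (*-comm _ _) (inv-r p)

 inv-unique : ∀ {x y} -> x * y ≈ 1# -> y ≈ inv x
 inv-unique {x} {y} e = begin
  y ≈⟨ *-idʳ y ⟨
  y * 1# ≈⟨ *ˡ (inv-r x≉0) ⟨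
  y * (x * inv x) ≈⟨ solve 3 (λ x y z -> y :* (x :* z) := (x :* y) :* z) x y (inv x) ⟩
  (x * y) * inv x ≈⟨ *ʳ e ⟩
  1# * inv x ≈⟨ *-idˡ _ ⟩
  inv x ∎
  where
  x≉0 : x ≉0
  x≉0 x≈0 = 1≉0 (trans (sym e) (trans (*ʳ x≈0) (zeroˡ y)))

 unit≉0 : ∀ {x y} -> x * y ≈ 1# -> x ≉0
 unit≉0 e x≈0 = 1≉0 (trans (sym e) (trans (*ʳ x≈0) (zeroˡ _)))

 inv≉0 : ∀ {x} -> x ≉0 -> inv x ≉0
 inv≉0 p = unit≉0 (inv-l p)

 inv-cong : ∀ {x y} -> x ≈ y -> inv x ≈ inv y
 inv-cong {x} {y} e with em {P = x ≈ 0#}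
 inv-cong {x} {y} e | yes x≈0 with em {P = y ≈ 0#}
 ... | yes _ = refl
 ... | no y≉0 = ⊥-elim (y≉0 (trans (sym e) x≈0))
 inv-cong {x} {y} e | no x≉0 = inv-unique (trans (*ʳ (sym e)) (snd (inverse x x≉0)))

 *-cancelˡ : ∀ {x y z} -> x ≉0 -> x * y ≈ x * z -> y ≈ z
 *-cancelˡ {x} {y} {z} p e = begin
  y ≈⟨ *-idˡ y ⟨
  1# * y ≈⟨ *ʳ (inv-l p) ⟨
  inv x * x * y ≈⟨ *-assoc _ _ _ ⟩
  inv x * (x * y) ≈⟨ *ˡ e ⟩
  inv x * (x * z) ≈⟨ *-assoc _ _ _ ⟨
  inv x * x * z ≈⟨ *ʳ (inv-l p) ⟩
  1# * z ≈⟨ *-idˡ z ⟩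
  z ∎

 *≈0 : ∀ {x y} -> x ≉0 -> x * y ≈ 0# -> y ≈ 0#
 *≈0 p e = *-cancelˡ p (trans e (sym (zeroʳ _)))

 *≉0 : ∀ {x y} -> x ≉0 -> y ≉0 -> x * y ≉0
 *≉0 p q e = q (*≈0 p e)

 ≉0ˡ : ∀ {x y} -> x * y ≉0 -> x ≉0
 ≉0ˡ p e = p (trans (*ʳ e) (zeroˡ _))

 ≉0ʳ : ∀ {x y} -> x * y ≉0 -> y ≉0
 ≉0ʳ p e = p (trans (*ˡ e) (zeroʳ _))

 ≉0-resp : ∀ {x y} -> x ≈ y -> x ≉0 -> y ≉0
 ≉0-resp e p q = p (trans e q)

 -≉0 : ∀ {x} -> x ≉0 -> - x ≉0
 -≉0 {x} p e = p (begin
  x ≈⟨ solve 1 (λ x -> x := :- (:- x)) x ⟩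
  - - x ≈⟨ -‿cong e ⟩
  - 0# ≈⟨ solve 0 (:- con 0ℤ := con 0ℤ) ⟩
  0# ∎)

 inv-* : ∀ {x y} -> x ≉0 -> y ≉0 -> inv (x * y) ≈ inv x * inv y
 inv-* {x} {y} p q = sym (inv-unique (begin
  x * y * (inv x * inv y)
   ≈⟨ solve 4 (λ x y a b -> x :* y :* (a :* b) := (x :* a) :* (y :* b)) x y (inv x) (inv y) ⟩
  (x * inv x) * (y * inv y) ≈⟨ *-cong (inv-r p) (inv-r q) ⟩
  1# * 1# ≈⟨ *-idˡ 1# ⟩
  1# ∎))

 inv-inv : ∀ {x} -> x ≉0 -> inv (inv x) ≈ x
 inv-inv p = sym (inv-unique (inv-l p))

 x*[y*inv-x] : ∀ {x} y -> x ≉0 -> x * (y * inv x) ≈ y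
 x*[y*inv-x] {x} y p = begin
  x * (y * inv x) ≈⟨ solve 3 (λ x y z -> x :* (y :* z) := (x :* z) :* y) x y (inv x) ⟩
  x * inv x * y ≈⟨ *ʳ (inv-r p) ⟩
  1# * y ≈⟨ *-idˡ y ⟩
  y ∎

 x-y≈0⇒x≈y : ∀ {x y} -> x - y ≈ 0# -> x ≈ y
 x-y≈0⇒x≈y {x} {y} e = begin
  x ≈⟨ solve 2 (λ x y -> x := (x :- y) :+ y) x y ⟩
  x - y + y ≈⟨ +ʳ e ⟩
  0# + y ≈⟨ +-idˡ y ⟩
  y ∎

 x≈y⇒x-y≈0 : ∀ {x y} -> x ≈ y -> x - y ≈ 0#
 x≈y⇒x-y≈0 e = trans (+ʳ e) (-‿inverseʳ _)

≤-by : ∀ {i j} k -> j ≡ i Z.+ Z.+ k -> i ≤ j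
≤-by {i} k ≡.refl = ℤₚ.i≤i+j i (Z.+ k)

≤⇒0≤ : ∀ {i j} -> i ≤ j -> 0ℤ ≤ j Z.- i
≤⇒0≤ = i≤j⇒0≤j-i

0≤⇒≤ : ∀ {i j} -> 0ℤ ≤ j Z.- i -> i ≤ j
0≤⇒≤ = 0≤i-j⇒j≤i

≤-combine : ∀ {a b c d i j} -> a ≤ b -> c ≤ d -> j Z.- i ≡ (b Z.- a) Z.+ (d Z.- c) -> i ≤ j
≤-combine p q e = 0≤⇒≤ (subst (0ℤ ≤_) (≡.sym e) (+-mono-≤ (≤⇒0≤ p) (≤⇒0≤ q)))

≤-shift : ∀ {a b i j} -> a ≤ b -> j Z.- i ≡ b Z.- a -> i ≤ j
≤-shift p e = 0≤⇒≤ (subst (0ℤ ≤_) (≡.sym e) (≤⇒0≤ p))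

+-cancelʳ : ∀ k i j -> i Z.+ k ≡ j Z.+ k -> i ≡ j
+-cancelʳ k i j e = ≡.trans (≡.sym (minus i)) (≡.trans (ap (Z._- k) e) (minus j))
 where
 minus : ∀ i -> (i Z.+ k) Z.- k ≡ i
 minus i = solveℤ 2 (λ i k -> (i :+ k) :- k := i) i k

+-cancelˡ : ∀ k i j -> k Z.+ i ≡ k Z.+ j -> i ≡ j
+-cancelˡ k i j e = +-cancelʳ k i j (≡.trans (ℤₚ.+-comm i k) (≡.trans e (ℤₚ.+-comm k j)))

<⇒1+≤ : ∀ {i j} -> i < j -> Z.suc i ≤ j
<⇒1+≤ = i<j⇒suc[i]≤j

1+≰ : ∀ {i} -> ¬ Z.suc i ≤ i
1+≰ p = <⇒≱ (suc[i]≤j⇒i<j p) ≤-refl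

module ValuationLemmas (em : EM) (K : Field) {v : Field.Carrier K -> ℤ} (isV : IsDVal K v) where
 open FieldLaws K
 open FieldLemmas em K
 open IntSolver ring
 open Classical em
 open IsDVal isV renaming (cong to v-cong; mult to v-mult)
 open Valued K isV public using (ball-resp; ball-0; ball-+; ball--1; v1≡0)

 B : ℤ -> Carrier -> Set
 B = Ball K v

 ball-≥ : ∀ {n a} -> n ≤ v a -> B n a
 ball-≥ p _ = p

 ball-v : ∀ a -> B (v a) a
 ball-v a _ = ≤-refl

 ball-mono : ∀ {m n a} -> m ≤ n -> B n a -> B m a
 ball-mono p q a≉0 = ≤-trans p (q a≉0)

 ball-≈0 : ∀ {n a} -> a ≈ 0# -> B n a
 ball-≈0 e p = ⊥-elim (p e)

 ball-*' : ∀ {m n a b} -> B m a -> B n b -> B (m Z.+ n) (a * b)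
 ball-*' p q ab≉0 = subst (_ ≤_) (≡.sym (v-mult (≉0ˡ ab≉0) (≉0ʳ ab≉0))) (+-mono-≤ (p (≉0ˡ ab≉0)) (q (≉0ʳ ab≉0)))

 ball-*-eq : ∀ {l m n a b} -> B m a -> B n b -> m Z.+ n ≡ l -> B l (a * b)
 ball-*-eq p q ≡.refl = ball-*' p q

 ball-*ˡ : ∀ {n a b} -> B 0ℤ a -> B n b -> B n (a * b)
 ball-*ˡ p q = ball-*-eq p q (ℤₚ.+-identityˡ _)

 ball-neg' : ∀ {n a} -> B n a -> B n (- a)
 ball-neg' {a = a} p = ball-resp
  (solve 1 (λ a -> :- con 1ℤ :* a := :- a) a) (ball-*ˡ ball--1 p)

 ball-- : ∀ {n a b} -> B n a -> B n b -> B n (a - b)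
 ball-- p q = ball-+ p (ball-neg' q)

 v-inv : ∀ {a} -> a ≉0 -> v (inv a) ≡ Z.- v a
 v-inv {a} p = begin
  v (inv a) ≡⟨ solveℤ 2 (λ x y -> x := (y :+ x) :- y) (v (inv a)) (v a) ⟩
  (v a Z.+ v (inv a)) Z.- v a ≡⟨ ap (Z._- v a) (v-mult p (inv≉0 p)) ⟨
  v (a * inv a) Z.- v a ≡⟨ ap (Z._- v a) (≡.trans (v-cong (inv-r p)) v1≡0) ⟩
  0ℤ Z.- v a ≡⟨ ℤₚ.+-identityˡ _ ⟩
  Z.- v a ∎
  where
  open ≡.≡-Reasoning

 -- The case a = 0 is covered because `inv` sends 0 to 0, and 0 lies in every ball.
 ball-inv : ∀ {a} -> B (Z.- v a) (inv a)
 ball-inv {a} q = ≤-reflexive (≡.sym (v-inv a≉0))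
  where
  a≉0 : a ≉0
  a≉0 e with em {P = a ≈ 0#}
  ... | yes _ = q refl
  ... | no p = p e

 ball-/ : ∀ {n a b} -> B (n Z.+ v a) b -> B n (b * inv a)
 ball-/ {n} {a} p = ball-*-eq p ball-inv (solveℤ 2 (λ n w -> (n :+ w) :+ (:- w) := n) n (v a))

 v-unit : ∀ {a b} -> a * b ≈ 1# -> B 0ℤ a -> B 0ℤ b -> v a ≡ 0ℤ
 v-unit {a} {b} e p q = ≤-antisym
  (≤-shift (q b≉0) (≡.trans (ℤₚ.+-identityˡ _) (≡.trans (≡.sym (≡.trans (v-cong b≈inv) (v-inv a≉0))) (≡.sym (ℤₚ.+-identityʳ _)))))
  (p a≉0)
  where
  a≉0 = unit≉0 e
  b≉0 = unit≉0 (trans (*-comm b a) e)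
  b≈inv = inv-unique e

 -- If a + b were 0 or of larger order than a, then a = (a + b) - b would have order at least v a +
 -- 1.
 strict : ∀ {a b} -> a ≉0 -> B (Z.suc (v a)) b -> a + b ≉0 × v (a + b) ≡ v a
 strict {a} {b} p q = s≉0 , ≤-antisym (≮⇒≥ λ lt -> 1+≰ (a-in (<⇒1+≤ lt) p)) (ball-+ (ball-v a) (ball-mono (ℤₚ.i≤suc[i] (v a)) q) s≉0)
  where
  a≈ : (a + b) - b ≈ a
  a≈ = solve 2 (λ a b -> (a :+ b) :- b := a) a b
  a-in : Z.suc (v a) ≤ v (a + b) -> B (Z.suc (v a)) a
  a-in le = ball-resp a≈ (ball-- (ball-≥ le) q)
  s≉0 : a + b ≉0
  s≉0 e = 1+≰ (ball-resp a≈ (ball-- (ball-≈0 e) q) p)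

 private
  with-value⁺ : ∀ n -> ∃ λ a -> a ≉0 × v a ≡ Z.+ n
  with-value⁺ zero = 1# , 1≉0 , v1≡0
  with-value⁺ (suc n) with with-value⁺ n | norm
  ... | a , p , e | π , q , w = π * a , *≉0 q p , ≡.trans (v-mult q p) (ap₂ Z._+_ w e)

 with-value : ∀ n -> ∃ λ a -> a ≉0 × v a ≡ n
 with-value (Z.+ n) = with-value⁺ n
 with-value Z.-[1+ n ] with with-value⁺ (suc n)
 ... | a , p , e = inv a , inv≉0 p , ≡.trans (v-inv p) (ap Z.-_ e)

-- S is an algebra over the finite field k; subspaces are k-subspaces of S.

module LinearAlgebra (em : EM) (k : Field) {q : ℕ} (k-size : Bijection (≡.setoid (Fin q)) (Field.setoid k))
 (S : CRing) (φ : RingHom (Field.ring k) S) where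
 private
  module k = FieldLaws k
  module kL = FieldLemmas em k
  module kS = IntSolver k.ring
  module size = Bijection k-size
 open RingLaws S renaming (Carrier to V)
 open RingHom φ renaming (fun to κ; ⟦⟧-cong to κ-cong; +-homo to κ-+; *-homo to κ-*; 0#-homo to κ-0; 1#-homo to κ-1; -‿homo to κ-neg)
 open IntSolver S
 open Classical em
 open Reasoning

 algebra : RawLeftModule k.Carrier 0ℓ 0ℓ
 algebra = record
  { Carrierᴹ = V ; _≈ᴹ_ = _≈_ ; _+ᴹ_ = _+_ ; _*ₗ_ = λ c a -> κ c * a ; 0ᴹ = 0# ; -ᴹ_ = -_ }

 record Sub (A : V -> Set) : Set where
  field
   resp : ∀ {x y} -> x ≈ y -> A x -> A y
   0∈ : A 0#
   +∈ : ∀ {x y} -> A x -> A y -> A (x + y)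
   *∈ : ∀ c {x} -> A x -> A (κ c * x)
  -∈ : ∀ {x} -> A x -> A (- x)
  -∈ {x} p = resp (begin
   κ (k.- k.1#) * x ≈⟨ *ʳ (trans (κ-neg k.1#) (-‿cong κ-1)) ⟩
   - 1# * x ≈⟨ solve 1 (λ x -> :- con 1ℤ :* x := :- x) x ⟩
   - x ∎) (*∈ (k.- k.1#) p)
  minus∈ : ∀ {x y} -> A x -> A y -> A (x - y)
  minus∈ p q = +∈ p (-∈ q)

 lin : ∀ {n} -> (Fin n -> V) -> (Fin n -> k.Carrier) -> V
 lin e c = ∑ _+_ 0# (λ i -> κ (c i) * e i)

 lin-congᶜ : ∀ {n} (e : Fin n -> V) {c c'} -> (∀ i -> c i k.≈ c' i) -> lin e c ≈ lin e c'
 lin-congᶜ {zero} e p = refl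
 lin-congᶜ {suc n} e p = +-cong (*ʳ (κ-cong (p zero))) (lin-congᶜ (e ∘ suc) (p ∘ suc))

 lin-cong : ∀ {n} {e e' : Fin n -> V} c -> (∀ i -> e i ≈ e' i) -> lin e c ≈ lin e' c
 lin-cong {zero} c p = refl
 lin-cong {suc n} c p = +-cong (*ˡ (p zero)) (lin-cong (c ∘ suc) (p ∘ suc))

 lin-+ : ∀ {n} (e : Fin n -> V) c c' -> lin e (λ i -> c i k.+ c' i) ≈ lin e c + lin e c'
 lin-+ {zero} e c c' = sym (+-idˡ 0#)
 lin-+ {suc n} e c c' = begin
  κ (c zero k.+ c' zero) * e zero + lin (e ∘ suc) (λ i -> c (suc i) k.+ c' (suc i))
   ≈⟨ +-cong (*ʳ (κ-+ _ _)) (lin-+ (e ∘ suc) (c ∘ suc) (c' ∘ suc)) ⟩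
  (κ (c zero) + κ (c' zero)) * e zero + (lin (e ∘ suc) (c ∘ suc) + lin (e ∘ suc) (c' ∘ suc))
   ≈⟨ solve 5 (λ a b e x y -> (a :+ b) :* e :+ (x :+ y) := (a :* e :+ x) :+ (b :* e :+ y)) _ _ _ _ _ ⟩
  (κ (c zero) * e zero + lin (e ∘ suc) (c ∘ suc)) + (κ (c' zero) * e zero + lin (e ∘ suc) (c' ∘ suc)) ∎

 lin-* : ∀ {n} (e : Fin n -> V) s c -> lin e (λ i -> s k.* c i) ≈ κ s * lin e c
 lin-* {zero} e s c = sym (zeroʳ _)
 lin-* {suc n} e s c = begin
  κ (s k.* c zero) * e zero + lin (e ∘ suc) (λ i -> s k.* c (suc i))
   ≈⟨ +-cong (*ʳ (κ-* _ _)) (lin-* (e ∘ suc) s (c ∘ suc)) ⟩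
  κ s * κ (c zero) * e zero + κ s * lin (e ∘ suc) (c ∘ suc)
   ≈⟨ solve 4 (λ s a e x -> s :* a :* e :+ s :* x := s :* (a :* e :+ x)) _ _ _ _ ⟩
  κ s * (κ (c zero) * e zero + lin (e ∘ suc) (c ∘ suc)) ∎

 lin-scale : ∀ {n} (e : Fin n -> V) y c -> lin (λ i -> y * e i) c ≈ y * lin e c
 lin-scale {zero} e y c = sym (zeroʳ _)
 lin-scale {suc n} e y c = trans (+ˡ (lin-scale (e ∘ suc) y (c ∘ suc)))
  (solve 4 (λ a y e x -> a :* (y :* e) :+ y :* x := y :* (a :* e :+ x)) _ _ _ _)

 lin-0 : ∀ {n} (e : Fin n -> V) c -> (∀ i -> c i k.≈ k.0#) -> lin e c ≈ 0#
 lin-0 {zero} e c p = refl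
 lin-0 {suc n} e c p = begin
  κ (c zero) * e zero + lin (e ∘ suc) (c ∘ suc)
   ≈⟨ +-cong (*ʳ (trans (κ-cong (p zero)) κ-0)) (lin-0 (e ∘ suc) (c ∘ suc) (p ∘ suc)) ⟩
  0# * e zero + 0# ≈⟨ solve 1 (λ e -> con 0ℤ :* e :+ con 0ℤ := con 0ℤ) (e zero) ⟩
  0# ∎

 lin-neg : ∀ {n} (e : Fin n -> V) c -> lin e (λ i -> k.- c i) ≈ - lin e c
 lin-neg e c = begin
  lin e (λ i -> k.- c i) ≈⟨ lin-congᶜ e (λ i -> kS.solve 1 (λ c -> :- c := (:- con 1ℤ) :* c) (c i)) ⟩
  lin e (λ i -> (k.- k.1#) k.* c i) ≈⟨ lin-* e _ c ⟩
  κ (k.- k.1#) * lin e c ≈⟨ *ʳ (trans (κ-neg k.1#) (-‿cong κ-1)) ⟩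
  - 1# * lin e c ≈⟨ solve 1 (λ x -> :- con 1ℤ :* x := :- x) _ ⟩
  - lin e c ∎

 lin-minus : ∀ {n} (e : Fin n -> V) c c' -> lin e (λ i -> c i k.- c' i) ≈ lin e c - lin e c'
 lin-minus e c c' = trans (lin-+ e c _) (+ˡ (lin-neg e c'))

 lin∈ : ∀ {A} -> Sub A -> ∀ {n} {e : Fin n -> V} -> (∀ i -> A (e i)) -> ∀ c -> A (lin e c)
 lin∈ sA {zero} p c = Sub.0∈ sA
 lin∈ sA {suc n} p c = Sub.+∈ sA (Sub.*∈ sA (c zero) (p zero)) (lin∈ sA (p ∘ suc) (c ∘ suc))

 Spans : ∀ {n} -> (V -> Set) -> (V -> Set) -> (Fin n -> V) -> Set
 Spans A B s = ∀ a -> A a -> ∃ λ c -> B (a - lin s c)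

 Nontrivial : ∀ {n} -> (Fin n -> k.Carrier) -> Set
 Nontrivial c = ∃ λ i -> ¬ c i k.≈ k.0#

 Indep : ∀ {n} -> (V -> Set) -> (Fin n -> V) -> Set
 Indep B e = ∀ c -> B (lin e c) -> ∀ i -> c i k.≈ k.0#

 Dependent : ∀ {n} -> (V -> Set) -> (Fin n -> V) -> Set
 Dependent B e = ∃ λ c -> Nontrivial c × B (lin e c)

 private
  code : k.Carrier -> Fin q
  code a = fst (size.surjective a)
  to-code : ∀ a -> size.to (code a) k.≈ a
  to-code a = snd (size.surjective a) ≡.refl
  code-injective : ∀ {a b} -> code a ≡ code b -> a k.≈ b
  code-injective {a} {b} e = k.trans (k.sym (to-code a)) (k.trans (size.cong e) (to-code b))
  two-elements : ∀ {n} (i j : Fin n) -> ¬ i ≡ j -> 1 ℕ.< n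
  two-elements {suc zero} zero zero ne = ⊥-elim (ne ≡.refl)
  two-elements {suc (suc _)} _ _ _ = ℕ.s≤s (ℕ.s≤s ℕ.z≤n)
  1<q : 1 ℕ.< q
  1<q = two-elements (code k.0#) (code k.1#) (λ e -> k.1≉0 (k.sym (code-injective e)))
  funToFin-cong : ∀ {m n} {f g : Fin m -> Fin n} -> (∀ i -> f i ≡ g i) -> Fin.funToFin f ≡ Fin.funToFin g
  funToFin-cong {zero} p = ≡.refl
  funToFin-cong {suc m} p = ap₂ Fin.combine (p zero) (funToFin-cong (p ∘ suc))

 decode : ∀ {n} -> Fin (q ℕ.^ n) -> Fin n -> k.Carrier
 decode i l = size.to (Fin.finToFun i l)

 encode : ∀ {n} -> (Fin n -> k.Carrier) -> Fin (q ℕ.^ n)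
 encode c = Fin.funToFin (code ∘ c)

 decode-encode : ∀ {n} (c : Fin n -> k.Carrier) i -> decode (encode c) i k.≈ c i
 decode-encode c i = k.trans (size.cong (Finₚ.finToFun-funToFin (code ∘ c) i)) (to-code (c i))

 decode-injective : ∀ {n} (i j : Fin (q ℕ.^ n)) -> (∀ l -> decode i l k.≈ decode j l) -> i ≡ j
 decode-injective {n} i j h = ≡.trans (≡.sym (Finₚ.funToFin-finToFin {n} i))
  (≡.trans (funToFin-cong {n} (λ l -> size.injective (h l))) (Finₚ.funToFin-finToFin {n} j))

 encode-injective : ∀ {n} (c c' : Fin n -> k.Carrier) -> encode c ≡ encode c' -> ∀ i -> c i k.≈ c' i
 encode-injective c c' e i = k.trans (k.sym (decode-encode c i)) (k.trans (k.reflexive (ap (λ x -> decode x i) e)) (decode-encode c' i))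

 -- There are q^m > q^n coefficient vectors, so f may be any function at all. Counting over the
 -- finite field takes the place of Gaussian elimination.
 pigeonhole : ∀ {m n} -> n ℕ.< m -> (f : (Fin m -> k.Carrier) -> (Fin n -> k.Carrier)) ->
  ∃ λ c -> ∃ λ c' -> (∃ λ i -> ¬ c i k.≈ c' i) × (∀ i -> f c i k.≈ f c' i)
 pigeonhole {m} {n} n<m f
  with i , j , i<j , e ← Finₚ.pigeonhole (ℕₚ.^-monoʳ-< q 1<q n<m) (encode ∘ f ∘ decode {m})
  = decode i , decode j
  , ¬∀⇒∃¬ (λ h -> ℕₚ.<⇒≢ i<j (ap Fin.toℕ (decode-injective {m} i j h)))
  , encode-injective _ _ e

 -- Two combinations of the v with the same coordinates modulo B differ by a non-trivial combination
 -- that lies in B.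
 dependent : ∀ {A B} -> Sub A -> Sub B -> ∀ {n m} {s : Fin n -> V} -> Spans A B s -> n ℕ.< m -> (v : Fin m -> V) -> (∀ i -> A (v i)) -> Dependent B v
 dependent {A} {B} sA sB {s = s} span n<m v v∈A
  with c , c' , (i , ne) , e ← pigeonhole n<m (λ c -> fst (span _ (lin∈ sA v∈A c)))
  = (λ i -> c i k.- c' i) , (i , λ z -> ne (kL.x-y≈0⇒x≈y z)) , Sub.resp sB eq
   (Sub.minus∈ sB (snd (span _ (lin∈ sA v∈A c))) (snd (span _ (lin∈ sA v∈A c'))))
  where
  x = fst (span _ (lin∈ sA v∈A c))
  x' = fst (span _ (lin∈ sA v∈A c'))
  eq : (lin v c - lin s x) - (lin v c' - lin s x') ≈ lin v (λ i -> c i k.- c' i)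
  eq = begin
   (lin v c - lin s x) - (lin v c' - lin s x') ≈⟨ +ʳ (+ˡ (-‿cong (lin-congᶜ s e))) ⟩
   (lin v c - lin s x') - (lin v c' - lin s x')
    ≈⟨ solve 3 (λ a b c -> (a :- c) :- (b :- c) := a :- b) _ _ _ ⟩
   lin v c - lin v c' ≈⟨ lin-minus v c c' ⟨
   lin v (λ i -> c i k.- c' i) ∎

 -- A variant of `HasDim` with independence modulo B instead of uniqueness of coordinates, which is
 -- easier to carry from one quotient to another.
 record Dim (A B : V -> Set) (n : ℕ) : Set where
  constructor mkDim
  field
   basis : Fin n -> V
   basis∈ : ∀ i -> A (basis i)
   indep : Indep B basis
   spans : Spans A B basis
 open Dim

 toHasDim : ∀ {A B} -> Sub B -> ∀ {n} -> Dim A B n -> HasDim k.rawRing algebra A B n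
 toHasDim {A} {B} sB (mkDim e e∈A ind span) = e , e∈A , λ a a∈A ->
  let c , b = span a a∈A in c , b , λ c' b' i -> kL.x-y≈0⇒x≈y (ind (λ i -> c i k.- c' i)
   (Sub.resp sB (begin
    (a - lin e c') - (a - lin e c) ≈⟨ solve 3 (λ a x y -> (a :- y) :- (a :- x) := x :- y) _ _ _ ⟩
    lin e c - lin e c' ≈⟨ lin-minus e c c' ⟨
    lin e (λ i -> c i k.- c' i) ∎) (Sub.minus∈ sB b' b)) i)

 -- If a combination with coefficients c lies in B, then both -c and 0 are coordinates of the vector
 -- 0, and uniqueness identifies them.
 fromHasDim : ∀ {A B} -> Sub A -> Sub B -> ∀ {n} -> HasDim k.rawRing algebra A B n -> Dim A B n
 fromHasDim {A} {B} sA sB (e , e∈A , coords) = mkDim e e∈A ind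
  (λ a a∈A -> let c , b , _ = coords a a∈A in c , b)
  where
  ind : Indep B e
  ind c b i with c0 , _ , uniq ← coords 0# (Sub.0∈ sA) =
   kL.x-y≈0⇒x≈y (k.trans (kS.solve 1 (λ c -> c :- con 0ℤ := :- (:- c)) (c i))
    (k.trans (k.-‿cong (k.trans (k.sym (uniq (λ i -> k.- c i) (Sub.resp sB eq b) i)) (uniq (λ _ -> k.0#) z i)))
     (kS.solve 0 (:- con 0ℤ := con 0ℤ))))
   where
   eq : lin e c ≈ 0# - lin e (λ i -> k.- c i)
   eq = trans (solve 1 (λ x -> x := con 0ℤ :- (:- x)) _) (+ˡ (-‿cong (sym (lin-neg e c))))
   z : B (0# - lin e (λ _ -> k.0#))
   z = Sub.resp sB (trans (solve 0 (con 0ℤ := con 0ℤ :- con 0ℤ)) (+ˡ (-‿cong (sym (lin-0 e (λ _ -> k.0#) (λ _ -> k.refl)))))) (Sub.0∈ sB)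

 extend-indep : ∀ {B} -> Sub B -> ∀ {n} {e : Fin n -> V} {a} -> Indep B e -> ¬ (∃ λ c -> B (a - lin e c)) -> Indep B (a Vector.∷ e)
 extend-indep {B} sB {e = e} {a} ind a∉ c b = go
  where
  c0 = c zero
  c0≈0 : c0 k.≈ k.0#
  c0≈0 = dne λ c0≉0 -> a∉ ((λ i -> k.- (kL.inv c0 k.* c (suc i))) , Sub.resp sB (begin
   κ (kL.inv c0) * (κ c0 * a + lin e (c ∘ suc))
    ≈⟨ solve 4 (λ s t a x -> s :* (t :* a :+ x) := (s :* t) :* a :+ s :* x) _ _ _ _ ⟩
   (κ (kL.inv c0) * κ c0) * a + κ (kL.inv c0) * lin e (c ∘ suc)
    ≈⟨ +-cong (*ʳ (trans (sym (κ-* _ _)) (trans (κ-cong (kL.inv-l c0≉0)) κ-1))) (sym (lin-* e _ _)) ⟩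
   1# * a + lin e (λ i -> kL.inv c0 k.* c (suc i))
    ≈⟨ solve 2 (λ a x -> con 1ℤ :* a :+ x := a :- (:- x)) _ _ ⟩
   a - (- lin e (λ i -> kL.inv c0 k.* c (suc i))) ≈⟨ +ˡ (-‿cong (lin-neg e _)) ⟨
   a - lin e (λ i -> k.- (kL.inv c0 k.* c (suc i))) ∎)
   (Sub.*∈ sB (kL.inv c0) b))
  go : ∀ i -> c i k.≈ k.0#
  go zero = c0≈0
  go (suc i) = ind (c ∘ suc) (Sub.resp sB (begin
   κ c0 * a + lin e (c ∘ suc) ≈⟨ +ʳ (*ʳ (trans (κ-cong c0≈0) κ-0)) ⟩
   0# * a + lin e (c ∘ suc) ≈⟨ solve 2 (λ a x -> con 0ℤ :* a :+ x := x) _ _ ⟩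
   lin e (c ∘ suc) ∎) b) i

 -- An independent family is enlarged as long as it fails to span. The fuel f counts the vectors
 -- still possible; at suc N vectors `dep` contradicts independence.
 finite-dim : ∀ {A B} -> Sub A -> Sub B -> ∀ N -> (∀ (v : Fin (suc N) -> V) -> (∀ i -> A (v i)) -> Dependent B v) -> ∃ (Dim A B)
 finite-dim {A} {B} sA sB N dep = go (suc N) 0 (ℕₚ.+-identityʳ _) (λ ()) (λ ()) (λ _ _ ())
  where
  go : ∀ f n -> f ℕ.+ n ≡ suc N -> (e : Fin n -> V) -> (∀ i -> A (e i)) -> Indep B e -> ∃ (Dim A B)
  go zero n ≡.refl e e∈A ind with dep e e∈A
  ... | c , (i , ne) , b = ⊥-elim (ne (ind c b i))
  go (suc f) n eq e e∈A ind with em {P = Spans A B e}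
  ... | yes span = n , mkDim e e∈A ind span
  ... | no ¬span with ¬∀⇒∃¬ ¬span
  ... | a , h = go f (suc n) (≡.trans (ℕₚ.+-suc f n) eq) (a Vector.∷ e)
   (λ { zero -> a∈A ; (suc i) -> e∈A i }) (extend-indep sB ind λ s -> h λ _ -> s)
   where
   a∈A : A a
   a∈A = dne λ a∉A -> h λ a∈ -> ⊥-elim (a∉A a∈)

 dim-≤ : ∀ {A B} -> Sub A -> Sub B -> ∀ {m n} -> Dim A B n -> (e : Fin m -> V) -> (∀ i -> A (e i)) -> Indep B e -> m ℕ.≤ n
 dim-≤ sA sB d e e∈A ind = ℕₚ.≮⇒≥ λ n<m ->
  let c , (i , ne) , b = dependent sA sB (spans d) n<m e e∈A in ne (ind c b i)

 dim-unique : ∀ {A B} -> Sub A -> Sub B -> ∀ {m n} -> Dim A B m -> Dim A B n -> m ≡ n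
 dim-unique sA sB d d' = ℕₚ.≤-antisym (dim-≤ sA sB d' (basis d) (basis∈ d) (indep d)) (dim-≤ sA sB d (basis d') (basis∈ d') (indep d'))

 -- Dependence of any suc n vectors passes from A / B to the subquotient A' / B', and `finite-dim`
 -- then finds a basis without a choice of complements.
 dim-between : ∀ {A B A' B'} -> Sub A -> Sub B -> Sub A' -> Sub B' ->
  (∀ {x} -> A' x -> A x) -> (∀ {x} -> B x -> B' x) -> ∀ {n} -> Dim A B n -> ∃ (Dim A' B')
 dim-between sA sB sA' sB' A'⊆A B⊆B' {n} d = finite-dim sA' sB' n λ v v∈ ->
  let c , ne , b = dependent sA sB (spans d) ℕₚ.≤-refl v (A'⊆A ∘ v∈) in c , ne , B⊆B' b

 append : ∀ {a} {T : Set a} {m n} -> (Fin m -> T) -> (Fin n -> T) -> Fin (m ℕ.+ n) -> T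
 append {m = zero} u v = v
 append {m = suc m} u v zero = u zero
 append {m = suc m} u v (suc i) = append (u ∘ suc) v i

 append-all : ∀ {p} m {n} {P : Fin (m ℕ.+ n) -> Set p} -> (∀ i -> P (i Fin.↑ˡ n)) -> (∀ i -> P (m Fin.↑ʳ i)) -> ∀ i -> P i
 append-all zero f g = g
 append-all (suc m) f g zero = f zero
 append-all (suc m) {P = P} f g (suc i) = append-all m {P = P ∘ suc} (f ∘ suc) g i

 append-∈ : ∀ {a p} {T : Set a} (P : T -> Set p) {m n} {u : Fin m -> T} {v : Fin n -> T} ->
  (∀ i -> P (u i)) -> (∀ i -> P (v i)) -> ∀ i -> P (append u v i)
 append-∈ P {zero} f g = g
 append-∈ P {suc m} f g zero = f zero
 append-∈ P {suc m} f g (suc i) = append-∈ P (f ∘ suc) g i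

 lin-append : ∀ {m n} (u : Fin m -> V) (v : Fin n -> V) c -> lin (append u v) c ≈ lin u (λ i -> c (i Fin.↑ˡ n)) + lin v (λ i -> c (m Fin.↑ʳ i))
 lin-append {zero} u v c = sym (+-idˡ _)
 lin-append {suc m} u v c = trans (+ˡ (lin-append (u ∘ suc) v (c ∘ suc))) (sym (+-assoc _ _ _))

 lin-append' : ∀ {m n} (u : Fin m -> V) (v : Fin n -> V) c c' -> lin (append u v) (append c c') ≈ lin u c + lin v c'
 lin-append' {zero} u v c c' = sym (+-idˡ _)
 lin-append' {suc m} u v c c' = trans (+ˡ (lin-append' (u ∘ suc) v (c ∘ suc) c')) (sym (+-assoc _ _ _))

 dim-+ : ∀ {A B C} -> Sub A -> Sub B -> Sub C -> (∀ {x} -> B x -> A x) -> (∀ {x} -> C x -> B x) -> ∀ {m n} -> Dim A B m -> Dim B C n -> Dim A C (m ℕ.+ n)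
 dim-+ {A} {B} {C} sA sB sC B⊆A C⊆B {m} {n} d d' = mkDim (append u v) (append-∈ A (basis∈ d) (λ i -> B⊆A (basis∈ d' i))) ind span
  where
  u = basis d
  v = basis d'
  ind : Indep C (append u v)
  ind c h = append-all m u0 (indep d' (λ i -> c (m Fin.↑ʳ i)) (Sub.resp sC eq h))
   where
   cᵤ = λ i -> c (i Fin.↑ˡ n)
   cᵥ = λ i -> c (m Fin.↑ʳ i)
   u0 : ∀ i -> cᵤ i k.≈ k.0#
   u0 = indep d cᵤ (Sub.resp sB (trans (+ʳ (lin-append u v c)) (solve 2 (λ x y -> (x :+ y) :- y := x) _ _))
    (Sub.minus∈ sB (C⊆B h) (lin∈ sB (basis∈ d') cᵥ)))
   eq : lin (append u v) c ≈ lin v cᵥ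
   eq = trans (lin-append u v c) (trans (+ʳ (lin-0 u cᵤ u0)) (+-idˡ _))
  span : Spans A C (append u v)
  span a a∈A with spans d a a∈A
  ... | c , b with spans d' _ b
  ... | c' , b' = append c c' , Sub.resp sC (begin
   a - lin u c - lin v c' ≈⟨ solve 3 (λ a x y -> a :- x :- y := a :- (x :+ y)) _ _ _ ⟩
   a - (lin u c + lin v c') ≈⟨ +ˡ (-‿cong (lin-append' u v c c')) ⟨
   a - lin (append u v) (append c c') ∎) b'

 -- The second isomorphism theorem in a flexible form: the hypotheses say that the inclusion induces
 -- an injective and surjective map A / B → A' / B', so the same basis serves.
 dim-transfer : ∀ {A B A' B'} -> Sub A -> Sub B -> Sub B' -> (∀ {x} -> A x -> A' x) -> (∀ {x} -> B x -> B' x) -> (∀ {x} -> A x -> B' x -> B x) ->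
  (∀ a' -> A' a' -> ∃ λ a -> A a × B' (a' - a)) ->
  ∀ {n} -> Dim A B n -> Dim A' B' n
 dim-transfer sA sB sB' A⊆A' B⊆B' ∩ sur d = mkDim (basis d) (A⊆A' ∘ basis∈ d) (λ c b' -> indep d c (∩ (lin∈ sA (basis∈ d) c) b'))
  λ a' a'∈ -> let a , a∈ , b' = sur a' a'∈ ; c , b = spans d a a∈ in
   c , Sub.resp sB' (solve 3 (λ x y z -> (x :- y) :+ (y :- z) := x :- z) _ _ _) (Sub.+∈ sB' b' (B⊆B' b))

 dim-scale : ∀ {A B A' B'} -> Sub A -> Sub B -> Sub A' -> Sub B' -> ∀ u w -> u * w ≈ 1# ->
  (∀ {x} -> A x -> A' (u * x)) -> (∀ {x} -> A' x -> A (w * x)) ->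
  (∀ {x} -> B x -> B' (u * x)) -> (∀ {x} -> B' x -> B (w * x)) ->
  ∀ {n} -> Dim A B n -> Dim A' B' n
 dim-scale {A} {B} sA sB sA' sB' u w uw f f' g g' d = mkDim (λ i -> u * basis d i) (f ∘ basis∈ d) (λ c b -> indep d c (Sub.resp sB
   (trans (*ˡ (lin-scale (basis d) u c)) (wu _)) (g' b)))
  λ a a∈ -> let c , b = spans d (w * a) (f' a∈) in c , Sub.resp sB' (begin
   u * (w * a - lin (basis d) c) ≈⟨ solve 4 (λ u w a x -> u :* (w :* a :- x) := (u :* w) :* a :- u :* x) u w a _ ⟩
   u * w * a - u * lin (basis d) c ≈⟨ +-cong (trans (*ʳ uw) (*-idˡ a)) (-‿cong (sym (lin-scale (basis d) u c))) ⟩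
   a - lin (λ i -> u * basis d i) c ∎) (g b)
  where
  wu : ∀ x -> w * (u * x) ≈ x
  wu x = begin
   w * (u * x) ≈⟨ solve 3 (λ w u x -> w :* (u :* x) := (u :* w) :* x) w u x ⟩
   u * w * x ≈⟨ *ʳ uw ⟩
   1# * x ≈⟨ *-idˡ x ⟩
   x ∎

 dim-0 : ∀ {A B} -> Sub B -> Dim A B 0 -> ∀ {x} -> A x -> B x
 dim-0 sB d {x} x∈ = Sub.resp sB (solve 1 (λ x -> x :- con 0ℤ := x) x) (snd (spans d x x∈))

 representatives : ∀ {A B n} -> Sub A -> Sub B -> Dim A B n -> Σ (Fin (q ℕ.^ n) -> V) λ ρ -> (∀ i -> A (ρ i)) × (∀ a -> A a -> ∃ λ i -> B (a - ρ i)) ×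
   (∀ i j -> B (ρ i - ρ j) -> i ≡ j)
 representatives {A} {B} {n} sA sB d = (λ i -> lin (basis d) (decode i)) , (λ i -> lin∈ sA (basis∈ d) (decode i))
  , (λ a a∈ -> let c , b = spans d a a∈ in encode c ,
   Sub.resp sB (+ˡ (-‿cong (lin-congᶜ (basis d) (λ i -> k.sym (decode-encode c i))))) b)
  , λ i j b -> decode-injective {n} i j λ l -> kL.x-y≈0⇒x≈y (indep d _ (Sub.resp sB (sym (lin-minus (basis d) (decode i) (decode j))) b) l)

 -- Used with B the functions regular at a point: a pole of one term cannot be cancelled when the
 -- sum and all other terms are regular there.
 isolate : ∀ {B} -> Sub B -> ∀ {n} (v : Fin n -> V) c i -> B (lin v c) -> (∀ j -> ¬ j ≡ i -> B (v j)) -> B (κ (c i) * v i)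
 isolate sB v c zero b h = Sub.resp sB (solve 2 (λ a l -> (a :+ l) :- l := a) _ _)
  (Sub.minus∈ sB b (lin∈ sB (λ j -> h (suc j) λ ()) (c ∘ suc)))
 isolate sB v c (suc i) b h = isolate sB (v ∘ suc) (c ∘ suc) i
  (Sub.resp sB (solve 2 (λ a l -> (a :+ l) :- a := l) _ _) (Sub.minus∈ sB b (Sub.*∈ sB (c zero) (h zero λ ()))))
  (λ j ne -> h (suc j) λ { ≡.refl -> ne ≡.refl })

 unscale : ∀ {B} -> Sub B -> ∀ {c v} -> ¬ c k.≈ k.0# -> B (κ c * v) -> B v
 unscale sB {c} {v} c≉0 b = Sub.resp sB (begin
  κ (kL.inv c) * (κ c * v) ≈⟨ *-assoc _ _ _ ⟨
  κ (kL.inv c) * κ c * v ≈⟨ *ʳ (trans (sym (κ-* _ _)) (trans (κ-cong (kL.inv-l c≉0)) κ-1)) ⟩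
  1# * v ≈⟨ *-idˡ v ⟩
  v ∎) (Sub.*∈ sB (kL.inv c) b)

-- Auxiliary constructions and matrix identities

uniform-bound : ∀ {p m} (P : Fin m -> ℕ -> Set p) -> (∀ i {d d'} -> d ℕ.≤ d' -> P i d -> P i d') -> (∀ i -> ∃ (P i)) -> ∃ λ d -> ∀ i -> P i d
uniform-bound {m = zero} P mono h = 0 , λ ()
uniform-bound {m = suc m} P mono h with uniform-bound (P ∘ suc) (mono ∘ suc) (h ∘ suc) | h zero
... | d , ps | d0 , p = d0 ℕ.⊔ d , λ
 { zero -> mono zero (ℕₚ.m≤m⊔n d0 d) p
 ; (suc i) -> mono (suc i) (ℕₚ.m≤n⊔m d0 d) (ps i) }

ringHom : (R S : CRing) (f : CommutativeRing.Carrier R -> CommutativeRing.Carrier S) ->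
 let
  module R = CommutativeRing R
  module S = CommutativeRing S
 in (∀ {a b} -> a R.≈ b -> f a S.≈ f b) -> (∀ a b -> f (a R.+ b) S.≈ f a S.+ f b) ->
  (∀ a b -> f (a R.* b) S.≈ f a S.* f b) -> f R.1# S.≈ S.1# -> RingHom R S
ringHom R S f f-cong f-+ f-* f-1 = record
 { fun = f
 ; isHom = record
  { isSemiringHomomorphism = record
   { isNearSemiringHomomorphism = record
    { +-isMonoidHomomorphism = record
     { isMagmaHomomorphism = record { isRelHomomorphism = record { cong = f-cong } ; homo = f-+ }
     ; ε-homo = f-0 }
    ; *-homo = f-* }
   ; 1#-homo = f-1 }
  ; -‿homo = λ a -> S.trans (solve 2 (λ x y -> x := (y :+ x) :- y) (f (R.- a)) (f a))
   (S.trans (S.+ʳ (S.trans (S.sym (f-+ a (R.- a))) (S.trans (f-cong (R.-‿inverseʳ a)) f-0))) (S.+-idˡ _)) } }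
 where
 module R = RingLaws R
 module S = RingLaws S
 open IntSolver S
 f-0 : f R.0# S.≈ S.0#
 f-0 = S.trans (solve 1 (λ x -> x := (x :+ x) :- x) (f R.0#))
  (S.trans (S.+ʳ (S.trans (S.sym (f-+ R.0# R.0#)) (f-cong (R.+-idˡ R.0#)))) (S.-‿inverseʳ _))

-- Each term is chosen outside the finite list of its predecessors; failure of `AlmostAll` says
-- exactly that no finite list contains all exceptions.
distinct-sequence : EM -> {A : Set} {P : A -> Set} -> ¬ AlmostAll P -> ∃ λ (xs : ℕ -> A) -> (∀ n -> ¬ P (xs n)) × (∀ {m n} -> xs m ≡ xs n -> m ≡ n)
distinct-sequence em {A} {P} none = (λ n -> fst (pick (prefix n))) , (λ n -> fst (snd (pick (prefix n)))) , injective
 where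
 open Classical em
 pick : ∀ L -> ∃ λ x -> ¬ P x × ¬ x ∈ L
 pick L = dne λ no -> none (L , λ x -> dne λ h -> no (x , (λ p -> h (inl p)) , λ x∈ -> h (inr x∈)))
 prefix : ℕ -> List A
 prefix zero = []
 prefix (suc n) = fst (pick (prefix n)) ∷ prefix n
 earlier : ∀ {m n} -> m ℕ.≤′ n -> fst (pick (prefix m)) ∈ prefix (suc n)
 earlier ℕ.≤′-refl = here ≡.refl
 earlier (ℕ.≤′-step le) = there (earlier le)
 distinct : ∀ {m n} -> m ℕ.< n -> ¬ fst (pick (prefix m)) ≡ fst (pick (prefix n))
 distinct {m} {suc n} (ℕ.s≤s le) e = snd (snd (pick (prefix (suc n)))) (subst (_∈ prefix (suc n)) e (earlier (ℕₚ.≤⇒≤′ le)))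
 injective : ∀ {m n} -> fst (pick (prefix m)) ≡ fst (pick (prefix n)) -> m ≡ n
 injective {m} {n} e = ℕₚ.≤-antisym (ℕₚ.≮⇒≥ λ lt -> distinct lt (≡.sym e)) (ℕₚ.≮⇒≥ λ lt -> distinct lt e)

module MatrixIdentities (R : CRing) where
 open RingLaws R
 open IntSolver R
 open Reasoning

 lower-row-unit : ∀ c d i -> i * c ≈ 1# -> (0# * d - (- i) * c) * 1# ≈ 1#
 lower-row-unit c d i e = trans (solve 3 (λ c d i -> (con 0ℤ :* d :- (:- i) :* c) :* con 1ℤ := i :* c) c d i) e

 lower-row-unit' : ∀ c d i -> i * d ≈ 1# -> (i * d - 0# * c) * 1# ≈ 1#
 lower-row-unit' c d i e = trans (solve 3 (λ c d i -> (i :* d :- con 0ℤ :* c) :* con 1ℤ := i :* d) c d i) e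

 lower-row : ∀ c d t b -> (c * t + d * 0# ≈ c * t) × (c * b + d * 1# ≈ c * b + d)
 lower-row c d t b = solve 3 (λ c d t -> c :* t :+ d :* con 0ℤ := c :* t) c d t
  , solve 3 (λ c d b -> c :* b :+ d :* con 1ℤ := c :* b :+ d) c d b

 u-product : ∀ z t p γ h k -> p * (γ * 1# * h * k) ≈ 1# -> p ≈ z * z * t -> (z * z * t) * (γ * h * k) ≈ 1#
 u-product z t p γ h k e e' = trans (*ʳ (sym e')) (trans (solve 4 (λ p γ h k -> p :* (γ :* h :* k) := p :* (γ :* con 1ℤ :* h :* k)) p γ h k) e)

 degenerate : ∀ {a b c d u} -> c ≈ 0# -> d ≈ 0# -> (a * d - b * c) * u ≈ 1# -> 1# ≈ 0#
 degenerate {a} {b} {c} {d} {u} c≈0 d≈0 e = trans (sym e) (trans (*ʳ (+-cong (*ˡ d≈0) (-‿cong (*ˡ c≈0))))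
  (solve 3 (λ a b u -> (a :* con 0ℤ :- b :* con 0ℤ) :* u := con 0ℤ) a b u))

 lower-unit : ∀ s -> (1# * 1# - 0# * s) * 1# ≈ 1#
 lower-unit = solve 1 (λ s -> (con 1ℤ :* con 1ℤ :- con 0ℤ :* s) :* con 1ℤ := con 1ℤ)

 swap-unit : ∀ s -> (s * 0# - 1# * 1#) * (- 1#) ≈ 1#
 swap-unit = solve 1 (λ s -> (s :* con 0ℤ :- con 1ℤ :* con 1ℤ) :* (:- con 1ℤ) := con 1ℤ)

 clear-lower : ∀ c d i -> i * d ≈ 1# -> c * 1# + d * (- (c * i)) ≈ 0#
 clear-lower c d i e = trans (solve 3 (λ c d i -> c :* con 1ℤ :+ d :* (:- (c :* i)) := c :- c :* (i :* d)) c d i)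
  (trans (+ˡ (-‿cong (*ˡ e))) (solve 1 (λ c -> c :- c :* con 1ℤ := con 0ℤ) c))

 clear-swap : ∀ c d i -> i * c ≈ 1# -> c * (- (d * i)) + d * 1# ≈ 0#
 clear-swap c d i e = trans (+-comm _ _) (clear-lower d c i e)

 upper-entries : ∀ s b t c -> (s * t + b * 0# ≈ s * t) × (s * c + b * 1# ≈ s * c + b) × (0# * t + 1# * 0# ≈ 0#) × (0# * c + 1# * 1# ≈ 1#)
 upper-entries s b t c = solve 3 (λ s b t -> s :* t :+ b :* con 0ℤ := s :* t) s b t
  , solve 3 (λ s b c -> s :* c :+ b :* con 1ℤ := s :* c :+ b) s b c
  , solve 1 (λ t -> con 0ℤ :* t :+ con 1ℤ :* con 0ℤ := con 0ℤ) t
  , solve 1 (λ c -> con 0ℤ :* c :+ con 1ℤ :* con 1ℤ := con 1ℤ) c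

 upper-unit : ∀ t w b -> t * w ≈ 1# -> (t * 1# - b * 0#) * w ≈ 1#
 upper-unit t w b e = trans (solve 3 (λ t w b -> (t :* con 1ℤ :- b :* con 0ℤ) :* w := t :* w) t w b) e

 cancel-inverse : ∀ s w t -> s * w ≈ 1# -> s * (t * w) ≈ t
 cancel-inverse s w t e = trans (solve 3 (λ s w t -> s :* (t :* w) := (s :* w) :* t) s w t) (trans (*ʳ e) (*-idˡ t))

 translate-back : ∀ s w b v -> s * w ≈ 1# -> s * ((b - v) * w) + v ≈ b
 translate-back s w b v e = trans (+ʳ (cancel-inverse s w (b - v) e)) (solve 2 (λ b v -> b :- v :+ v := b) b v)

 triangular-unit : ∀ a b c d u -> c ≈ 0# -> (a * d - b * c) * u ≈ 1# -> a * d * u ≈ 1#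
 triangular-unit a b c d u c≈0 e = trans (*ʳ (trans (solve 2 (λ x b -> x := x :- b :* con 0ℤ) (a * d) b)
  (+ˡ (-‿cong (*ˡ (sym c≈0)))))) e

 square-unit : ∀ a d u -> a * d * u ≈ 1# -> (a * (a * u)) * (d * (d * u)) ≈ 1#
 square-unit a d u e = trans (solve 3 (λ a d u -> (a :* (a :* u)) :* (d :* (d :* u)) := (a :* d :* u) :* (a :* d :* u)) a d u)
  (trans (*-cong e e) (*-idˡ 1#))

 scale-out : ∀ a d u b -> a * d * u ≈ 1# -> b ≈ d * (b * (a * u))
 scale-out a d u b e = sym (trans (solve 4 (λ a d u b -> d :* (b :* (a :* u)) := (a :* d :* u) :* b) a d u b) (trans (*ʳ e) (*-idˡ b)))

 d-unit : ∀ a d u -> a * d * u ≈ 1# -> d * (a * u) ≈ 1#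
 d-unit a d u e = trans (solve 3 (λ a d u -> d :* (a :* u) := a :* d :* u) a d u) e

 row-assoc : ∀ a b a' b' c' d' p r -> (a * a' + b * c') * p + (a * b' + b * d') * r ≈ a * (a' * p + b' * r) + b * (c' * p + d' * r)
 row-assoc = solve 8 (λ a b a' b' c' d' p r ->
  (a :* a' :+ b :* c') :* p :+ (a :* b' :+ b :* d') :* r := a :* (a' :* p :+ b' :* r) :+ b :* (c' :* p :+ d' :* r))

 scale-row : ∀ z w a b p r -> (z * a) * (w * p) + (z * b) * (w * r) ≈ (z * w) * (a * p + b * r)
 scale-row = solve 6 (λ z w a b p r -> (z :* a) :* (w :* p) :+ (z :* b) :* (w :* r) := (z :* w) :* (a :* p :+ b :* r))

 neg-scale : ∀ z x y -> x ≈ z * y -> - x ≈ z * (- y)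
 neg-scale z x y e = trans (-‿cong e) (solve 2 (λ z y -> :- (z :* y) := z :* (:- y)) z y)

 unscaled : ∀ x y -> x ≈ y -> x ≈ 1# * y
 unscaled x y e = trans e (sym (*-idˡ y))

 unit-comm : ∀ z w -> z * w ≈ 1# -> w * z ≈ 1#
 unit-comm z w e = trans (*-comm w z) e

 unit-* : ∀ z w z' w' -> z * w ≈ 1# -> z' * w' ≈ 1# -> (z * z') * (w * w') ≈ 1#
 unit-* z w z' w' e e' = begin
  (z * z') * (w * w') ≈⟨ solve 4 (λ z z' w w' -> (z :* z') :* (w :* w') := (z :* w) :* (z' :* w')) z z' w w' ⟩
  (z * w) * (z' * w') ≈⟨ *-cong e e' ⟩
  1# * 1# ≈⟨ *-idˡ 1# ⟩
  1# ∎

 scale-sym : ∀ x y z w -> z * w ≈ 1# -> x ≈ z * y -> y ≈ w * x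
 scale-sym x y z w zw e = begin
  y ≈⟨ *-idˡ y ⟨
  1# * y ≈⟨ *ʳ zw ⟨
  z * w * y ≈⟨ solve 3 (λ z w y -> z :* w :* y := w :* (z :* y)) z w y ⟩
  w * (z * y) ≈⟨ *ˡ e ⟨
  w * x ∎

 scale-trans : ∀ x y v z z' -> x ≈ z * y -> y ≈ z' * v -> x ≈ (z * z') * v
 scale-trans x y v z z' e e' = trans e (trans (*ˡ e') (sym (*-assoc z z' v)))

 scale-entry : ∀ x y v t x' y' v' t' z z' -> x ≈ z * x' -> y ≈ z * y' -> v ≈ z' * v' -> t ≈ z' * t' ->
  x * v + y * t ≈ (z * z') * (x' * v' + y' * t')
 scale-entry x y v t x' y' v' t' z z' e1 e2 e3 e4 = trans (+-cong (*-cong e1 e3) (*-cong e2 e4)) (scale-row z z' x' y' v' t')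

 scaled-unit : ∀ a b c d u -> (a * d - b * c) * u ≈ 1# -> (d * a - (- b) * (- c)) * u ≈ 1#
 scaled-unit a b c d u e = trans (*ʳ (solve 4 (λ a b c d -> d :* a :- (:- b) :* (:- c) := a :* d :- b :* c) a b c d)) e

 1x+0y : ∀ x y -> 1# * x + 0# * y ≈ x
 1x+0y = solve 2 (λ x y -> con 1ℤ :* x :+ con 0ℤ :* y := x)

 0x+1y : ∀ x y -> 0# * x + 1# * y ≈ y
 0x+1y = solve 2 (λ x y -> con 0ℤ :* x :+ con 1ℤ :* y := y)

 x1+y0 : ∀ x y -> x * 1# + y * 0# ≈ x
 x1+y0 = solve 2 (λ x y -> x :* con 1ℤ :+ y :* con 0ℤ := x)

 x0+y1 : ∀ x y -> x * 0# + y * 1# ≈ y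
 x0+y1 = solve 2 (λ x y -> x :* con 0ℤ :+ y :* con 1ℤ := y)

 module Adjugate (a b c d : Carrier) where
  r11 : a * d + b * (- c) ≈ (a * d - b * c) * 1#
  r11 = solve 4 (λ a b c d -> a :* d :+ b :* (:- c) := (a :* d :- b :* c) :* con 1ℤ) a b c d
  r12 : a * (- b) + b * a ≈ (a * d - b * c) * 0#
  r12 = solve 4 (λ a b c d -> a :* (:- b) :+ b :* a := (a :* d :- b :* c) :* con 0ℤ) a b c d
  r21 : c * d + d * (- c) ≈ (a * d - b * c) * 0#
  r21 = solve 4 (λ a b c d -> c :* d :+ d :* (:- c) := (a :* d :- b :* c) :* con 0ℤ) a b c d
  r22 : c * (- b) + d * a ≈ (a * d - b * c) * 1#
  r22 = solve 4 (λ a b c d -> c :* (:- b) :+ d :* a := (a :* d :- b :* c) :* con 1ℤ) a b c d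
  l11 : d * a + (- b) * c ≈ (a * d - b * c) * 1#
  l11 = solve 4 (λ a b c d -> d :* a :+ (:- b) :* c := (a :* d :- b :* c) :* con 1ℤ) a b c d
  l12 : d * b + (- b) * d ≈ (a * d - b * c) * 0#
  l12 = solve 4 (λ a b c d -> d :* b :+ (:- b) :* d := (a :* d :- b :* c) :* con 0ℤ) a b c d
  l21 : (- c) * a + a * c ≈ (a * d - b * c) * 0#
  l21 = solve 4 (λ a b c d -> (:- c) :* a :+ a :* c := (a :* d :- b :* c) :* con 0ℤ) a b c d
  l22 : (- c) * b + a * d ≈ (a * d - b * c) * 1#
  l22 = solve 4 (λ a b c d -> (:- c) :* b :+ a :* d := (a :* d :- b :* c) :* con 1ℤ) a b c d

 -- Cramer's rule for the row equation (p r) · (a b ; c d) = (s w), with u the inverse of the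
 -- determinant.
 cramer₁ : ∀ {a b c d u p r s w} -> (a * d - b * c) * u ≈ 1# -> p * a + r * c ≈ s -> p * b + r * d ≈ w -> p ≈ s * (u * d) - w * (u * c)
 cramer₁ {a} {b} {c} {d} {u} {p} {r} {s} {w} unit e e' = begin
  p ≈⟨ *-idʳ p ⟨
  p * 1# ≈⟨ *ˡ unit ⟨
  p * ((a * d - b * c) * u) ≈⟨ solve 7 (λ a b c d u p r -> p :* ((a :* d :- b :* c) :* u) := (p :* a :+ r :* c) :* (u :* d) :- (p :* b :+ r :* d) :* (u :* c)) a b c d u p r ⟩
  (p * a + r * c) * (u * d) - (p * b + r * d) * (u * c) ≈⟨ +-cong (*ʳ e) (-‿cong (*ʳ e')) ⟩
  s * (u * d) - w * (u * c) ∎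

 cramer₂ : ∀ {a b c d u p r s w} -> (a * d - b * c) * u ≈ 1# -> p * a + r * c ≈ s -> p * b + r * d ≈ w -> r ≈ w * (u * a) - s * (u * b)
 cramer₂ {a} {b} {c} {d} {u} {p} {r} {s} {w} unit e e' = begin
  r ≈⟨ *-idʳ r ⟨
  r * 1# ≈⟨ *ˡ unit ⟨
  r * ((a * d - b * c) * u) ≈⟨ solve 7 (λ a b c d u p r -> r :* ((a :* d :- b :* c) :* u) := (p :* b :+ r :* d) :* (u :* a) :- (p :* a :+ r :* c) :* (u :* b)) a b c d u p r ⟩
  (p * b + r * d) * (u * a) - (p * a + r * c) * (u * b) ≈⟨ +-cong (*ʳ e') (-‿cong (*ʳ e)) ⟩
  w * (u * a) - s * (u * b) ∎

 scaled-det : ∀ {a b c d z t β} -> a ≈ z * t -> b ≈ z * β -> c ≈ z * 0# -> d ≈ z * 1# -> a * d - b * c ≈ z * z * t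
 scaled-det {z = z} {t} {β} p q r s = trans (+-cong (*-cong p s) (-‿cong (*-cong q r)))
  (solve 3 (λ z t β -> z :* t :* (z :* con 1ℤ) :- z :* β :* (z :* con 0ℤ) := z :* z :* t) z t β)

-- Complex numbers and indicator functions

module ComplexNumbers (em : EM) (ℝ : RealField) where
 open Complex ℝ public
 private
  module ℝ = RealField ℝ
  module ℝ≤ = IsTotalOrder ℝ.isTotalOrder
  module ℝₗ = FieldLemmas em ℝ.fld
  module Sℝ = IntSolver (Field.ring ℝ.fld)
 open Classical em

 ℂ-ring' : CRing
 ℂ-ring' = record
  { Carrier = ℂ ; _≈_ = _≈_ ; _+_ = _+_ ; _*_ = _*_ ; -_ = -_ ; 0# = 0# ; 1# = 1#
  ; isCommutativeRing = record
   { isRing = record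
    { +-isAbelianGroup = record
     { isGroup = record
      { isMonoid = record
       { isSemigroup = record
        { isMagma = record
         { isEquivalence = record
          { refl = ℝ.refl , ℝ.refl ; sym = λ (p , q) -> ℝ.sym p , ℝ.sym q
          ; trans = λ (p , q) (p' , q') -> ℝ.trans p p' , ℝ.trans q q' }
         ; ∙-cong = λ (p , q) (p' , q') -> ℝ.+-cong p p' , ℝ.+-cong q q' }
        ; assoc = λ _ _ _ -> ℝ.+-assoc _ _ _ , ℝ.+-assoc _ _ _ }
       ; identity = (λ _ -> ℝ.+-identityˡ _ , ℝ.+-identityˡ _) , (λ _ -> ℝ.+-identityʳ _ , ℝ.+-identityʳ _) }
      ; inverse = (λ _ -> ℝ.-‿inverseˡ _ , ℝ.-‿inverseˡ _) , (λ _ -> ℝ.-‿inverseʳ _ , ℝ.-‿inverseʳ _)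
      ; ⁻¹-cong = λ (p , q) -> ℝ.-‿cong p , ℝ.-‿cong q }
     ; comm = λ _ _ -> ℝ.+-comm _ _ , ℝ.+-comm _ _ }
    ; *-cong = λ (p , q) (p' , q') -> ℝ.+-cong (ℝ.*-cong p p') (ℝ.-‿cong (ℝ.*-cong q q')) , ℝ.+-cong (ℝ.*-cong p q') (ℝ.*-cong q p')
    ; *-assoc = λ (a , b) (c , d) (e , f) ->
     solve 6 (λ a b c d e f -> (a :* c :- b :* d) :* e :- (a :* d :+ b :* c) :* f := a :* (c :* e :- d :* f) :- b :* (c :* f :+ d :* e)) a b c d e f
     , solve 6 (λ a b c d e f -> (a :* c :- b :* d) :* f :+ (a :* d :+ b :* c) :* e := a :* (c :* f :+ d :* e) :+ b :* (c :* e :- d :* f)) a b c d e f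
    ; *-identity = (λ (a , b) -> solve 2 (λ a b -> con 1ℤ :* a :- con 0ℤ :* b := a) a b , solve 2 (λ a b -> con 1ℤ :* b :+ con 0ℤ :* a := b) a b)
     , λ (a , b) -> solve 2 (λ a b -> a :* con 1ℤ :- b :* con 0ℤ := a) a b , solve 2 (λ a b -> a :* con 0ℤ :+ b :* con 1ℤ := b) a b
    ; distrib = (λ (a , b) (c , d) (e , f) ->
     solve 6 (λ a b c d e f -> a :* (c :+ e) :- b :* (d :+ f) := (a :* c :- b :* d) :+ (a :* e :- b :* f)) a b c d e f
     , solve 6 (λ a b c d e f -> a :* (d :+ f) :+ b :* (c :+ e) := (a :* d :+ b :* c) :+ (a :* f :+ b :* e)) a b c d e f)
     , λ (a , b) (c , d) (e , f) ->
      solve 6 (λ a b c d e f -> (c :+ e) :* a :- (d :+ f) :* b := (c :* a :- d :* b) :+ (e :* a :- f :* b)) a b c d e f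
      , solve 6 (λ a b c d e f -> (c :+ e) :* b :+ (d :+ f) :* a := (c :* b :+ d :* a) :+ (e :* b :+ f :* a)) a b c d e f }
   ; *-comm = λ (a , b) (c , d) -> solve 4 (λ a b c d -> a :* c :- b :* d := c :* a :- d :* b) a b c d
    , solve 4 (λ a b c d -> a :* d :+ b :* c := c :* b :+ d :* a) a b c d } }
  where open Sℝ

 private
  neg-nonneg : ∀ {x} -> x ℝ.≤ ℝ.0# -> ℝ.0# ℝ.≤ ℝ.- x
  neg-nonneg {x} p = ℝ≤.trans (ℝ≤.reflexive (ℝ.sym (ℝ.-‿inverseʳ x))) (ℝ≤.trans (ℝ.+-monoˡ-≤ (ℝ.- x) p) (ℝ≤.reflexive (ℝ.+-identityˡ _)))
  neg-nonpos : ∀ {x} -> ℝ.0# ℝ.≤ x -> ℝ.- x ℝ.≤ ℝ.0#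
  neg-nonpos {x} p = ℝ≤.trans (ℝ≤.reflexive (ℝ.sym (ℝ.+-identityˡ _))) (ℝ≤.trans (ℝ.+-monoˡ-≤ (ℝ.- x) p) (ℝ≤.reflexive (ℝ.-‿inverseʳ x)))
  square-nonneg : ∀ x -> ℝ.0# ℝ.≤ x ℝ.* x
  square-nonneg x = go (ℝ≤.total ℝ.0# x)
   where
   go : ℝ.0# ℝ.≤ x ⊎ x ℝ.≤ ℝ.0# -> ℝ.0# ℝ.≤ x ℝ.* x
   go (inl p) = ℝ.*-nonneg p p
   go (inr p) = ℝ≤.trans (ℝ.*-nonneg (neg-nonneg p) (neg-nonneg p)) (ℝ≤.reflexive (Sℝ.solve 1 (λ x -> (:- x) :* (:- x) := x :* x) x))
  +-nonneg : ∀ {x y} -> ℝ.0# ℝ.≤ x -> ℝ.0# ℝ.≤ y -> ℝ.0# ℝ.≤ x ℝ.+ y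
  +-nonneg {x} {y} p q = ℝ≤.trans q (ℝ≤.trans (ℝ≤.reflexive (ℝ.sym (ℝ.+-identityˡ y))) (ℝ.+-monoˡ-≤ y p))
  sum-zero : ∀ {x y} -> ℝ.0# ℝ.≤ x -> ℝ.0# ℝ.≤ y -> x ℝ.+ y ℝ.≈ ℝ.0# -> x ℝ.≈ ℝ.0#
  sum-zero {x} {y} p q e = ℝ≤.antisym (ℝ≤.trans (ℝ≤.reflexive x≈-y) (neg-nonpos q)) p
   where
   x≈-y : x ℝ.≈ ℝ.- y
   x≈-y = ℝ.trans (Sℝ.solve 2 (λ x y -> x := (x :+ y) :- y) x y) (ℝ.trans (ℝ.+-congʳ e) (ℝ.+-identityˡ _))
  square-zero : ∀ {x} -> x ℝ.* x ℝ.≈ ℝ.0# -> x ℝ.≈ ℝ.0#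
  square-zero e = dne λ x≉0 -> x≉0 (ℝₗ.*≈0 x≉0 e)
  0≤1 : ℝ.0# ℝ.≤ ℝ.1#
  0≤1 = ℝ≤.trans (square-nonneg ℝ.1#) (ℝ≤.reflexive (ℝ.*-identityˡ ℝ.1#))

 ℂ-field : Field
 ℂ-field = record
  { ring = ℂ-ring'
  ; 1≉0 = λ (p , _) -> ℝ.1≉0 p
  ; inverse = λ { (a , b) ne -> let
   n = a ℝ.* a ℝ.+ b ℝ.* b
   n≉0 : ℝₗ._≉0 n
   n≉0 = λ e -> ne (square-zero (sum-zero (square-nonneg a) (square-nonneg b) e)
    , square-zero (sum-zero (square-nonneg b) (square-nonneg a) (ℝ.trans (ℝ.+-comm _ _) e)))
   i = ℝₗ.inv n in
   (a ℝ.* i , ℝ.- (b ℝ.* i))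
   , ℝ.trans (solve 3 (λ a b i -> a :* (a :* i) :- b :* (:- (b :* i)) := (a :* a :+ b :* b) :* i) a b i) (ℝₗ.inv-r n≉0)
   , solve 3 (λ a b i -> a :* (:- (b :* i)) :+ b :* (a :* i) := con 0ℤ) a b i } }
  where open Sℝ

 Nonnegative-+ : ∀ {z w} -> Nonnegative z -> Nonnegative w -> Nonnegative (z + w)
 Nonnegative-+ (p , q) (p' , q') = +-nonneg p p' , ℝ.trans (ℝ.+-cong q q') (ℝ.+-identityˡ _)

 Nonnegative-0 : Nonnegative 0#
 Nonnegative-0 = ℝ≤.refl , ℝ.refl

 Nonnegative-1 : Nonnegative 1#
 Nonnegative-1 = 0≤1 , ℝ.refl

 Nonnegative-resp : ∀ {z w} -> z ≈ w -> Nonnegative z -> Nonnegative w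
 Nonnegative-resp (e , e') (p , q) = ℝ≤.trans p (ℝ≤.reflexive e) , ℝ.trans (ℝ.sym e') q

 -- The positivity arguments end here: a sum that is at least 1 cannot be 0.
 ¬Nonnegative--1 : ¬ Nonnegative (- 1#)
 ¬Nonnegative--1 (p , _) = ℝ.1≉0 (ℝ.sym (ℝ≤.antisym 0≤1 (ℝ≤.trans (ℝ≤.reflexive (Sℝ.solve 1 (λ x -> x := con 0ℤ :- (:- x)) ℝ.1#))
  (ℝ≤.trans (ℝ≤.reflexive (ℝ.+-identityˡ _)) (neg-nonpos p)))))

 private module ℂ' = RingLaws ℂ-ring'

 private
  bit : {A : Set} -> Dec A -> ℂ
  bit (yes _) = 1#
  bit (no _) = 0#

 𝟙 : ∀ {T : Set} -> (T -> Set) -> T -> ℂ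
 𝟙 P t = bit (em {P = P t})

 𝟙-in : ∀ {T : Set} {P : T -> Set} {t} -> P t -> 𝟙 P t ≈ 1#
 𝟙-in {P = P} {t} p = go em
  where
  go : (d : Dec (P t)) -> bit d ≈ 1#
  go (yes _) = ℂ'.refl
  go (no n) = ⊥-elim (n p)

 𝟙-out : ∀ {T : Set} {P : T -> Set} {t} -> ¬ P t -> 𝟙 P t ≈ 0#
 𝟙-out {P = P} {t} n = go em
  where
  go : (d : Dec (P t)) -> bit d ≈ 0#
  go (yes p) = ⊥-elim (n p)
  go (no _) = ℂ'.refl

 indicatorℂ-cong : ∀ {T T' : Set} {P : T -> Set} {P' : T' -> Set} {t t'} -> (P t -> P' t') -> (P' t' -> P t) -> 𝟙 P t ≈ 𝟙 P' t'
 indicatorℂ-cong {P = P} {P'} {t} {t'} f f' = go em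
  where
  go : Dec (P t) -> 𝟙 P t ≈ 𝟙 P' t'
  go (yes p) = ℂ'.trans (𝟙-in {P = P} p) (ℂ'.sym (𝟙-in {P = P'} (f p)))
  go (no n) = ℂ'.trans (𝟙-out {P = P} n) (ℂ'.sym (𝟙-out {P = P'} (n ∘ f')))

-- Compact sets

module Topology (em : EM) (T : Space) where
 open Space T
 open Classical em

 -- S is closed and lies in a finite union of compact sets. The complement of S, indexed by
 -- `nothing`, completes a cover of S to a cover of each `W a`, and this index is discarded
 -- afterwards.
 compact-cover : {A : Set} {S : Carrier -> Set} (W : A -> Carrier -> Set) -> (∀ a -> Compact T (W a)) ->
  IsOpen (λ t -> ¬ S t) -> (L : List A) -> (∀ t -> S t -> Any (λ a -> W a t) L) -> Compact T S
 compact-cover {A} {S} W compact closed L covers I U U-open U-covers = fst (go L) , λ t s -> snd (go L) t s (covers t s)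
  where
  U' : Maybe I -> Carrier -> Set
  U' nothing t = ¬ S t
  U' (just i) t = U i t
  open' : ∀ i -> IsOpen (U' i)
  open' nothing = closed
  open' (just i) = U-open i
  covers' : ∀ a t -> W a t -> ∃ λ i -> U' i t
  covers' a t _ = decide em
   where
   decide : Dec (S t) -> ∃ λ i -> U' i t
   decide (yes s) = just (fst (U-covers t s)) , snd (U-covers t s)
   decide (no n) = nothing , n
  select : ∀ t -> S t -> (J : List (Maybe I)) -> Any (λ i -> U' i t) J -> Any (λ i -> U i t) (List.catMaybes J)
  select t s (nothing ∷ J) (here n) = ⊥-elim (n s)
  select t s (nothing ∷ J) (there p) = select t s J p
  select t s (just i ∷ J) (here p) = here p
  select t s (just i ∷ J) (there p) = there (select t s J p)
  go : ∀ L -> ∃ λ (J : List I) -> ∀ t -> S t -> Any (λ a -> W a t) L -> Any (λ i -> U i t) J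
  go [] = [] , λ _ _ ()
  go (a ∷ L) with compact a (Maybe I) U' open' (covers' a) | go L
  ... | J , h | J' , h' = List.catMaybes J ++ J' , λ
   { t s (here w) -> Anyₚ.++⁺ˡ (select t s J (h t w))
   ; t s (there p) -> Anyₚ.++⁺ʳ (List.catMaybes J) (h' t s p) }

 -- Points are representatives of classes, so σ can be asked to be onto only up to points that lie
 -- in the same open sets.
 compact-translate : {W W' : Carrier -> Set} (σ : Carrier -> Carrier) -> (∀ U -> IsOpen U -> IsOpen (U ∘ σ)) -> Compact T W ->
  (∀ s -> W s -> W' (σ s)) -> (∀ t -> W' t -> ∃ λ s -> W s × (∀ U -> IsOpen U -> U (σ s) -> U t)) -> Compact T W'
 compact-translate σ continuous compact into onto I U U-open U-covers =
  let J , h = compact I (λ i -> U i ∘ σ) (λ i -> continuous (U i) (U-open i)) (λ s w -> U-covers (σ s) (into s w))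
  in J , λ t w' -> let s , w , back = onto t w' in Any.map (λ {i} -> back (U i) (U-open i)) (h s w)

module DifferenceIdentities (R : CRing) where
 open RingLaws R
 open IntSolver R

 sub-split : ∀ b a c -> (b - a) + (a - c) ≈ b - c
 sub-split = solve 3 (λ b a c -> (b :- a) :+ (a :- c) := b :- c)

 sub-flip : ∀ a b -> - (a - b) ≈ b - a
 sub-flip = solve 2 (λ a b -> :- (a :- b) := b :- a)

 shift-sub : ∀ p a -> (p + a) - a ≈ p
 shift-sub = solve 2 (λ p a -> (p :+ a) :- a := p)

module QuotientIdentities (R : CRing) where
 open RingLaws R
 open IntSolver R
 open Reasoning

 module _ {a b c d u : Carrier} (unit : (a * d - b * c) * u ≈ 1#) where
  entry1 : ∀ p r -> a * (u * (d * p - b * r)) + b * (u * (a * r - c * p)) ≈ p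
  entry1 p r = trans (solve 7 (λ a b c d u p r -> a :* (u :* (d :* p :- b :* r)) :+ b :* (u :* (a :* r :- c :* p)) := (a :* d :- b :* c) :* u :* p) a b c d u p r)
   (trans (*ʳ unit) (*-idˡ p))
  entry2 : ∀ p r -> c * (u * (d * p - b * r)) + d * (u * (a * r - c * p)) ≈ r
  entry2 p r = trans (solve 7 (λ a b c d u p r -> c :* (u :* (d :* p :- b :* r)) :+ d :* (u :* (a :* r :- c :* p)) := (a :* d :- b :* c) :* u :* r) a b c d u p r)
   (trans (*ʳ unit) (*-idˡ r))
  quotient-unit : ∀ {a' b' c' d' u'} -> (a' * d' - b' * c') * u' ≈ 1# ->
   ((u * (d * a' - b * c')) * (u * (a * d' - c * b')) - (u * (d * b' - b * d')) * (u * (a * c' - c * a'))) * ((a * d - b * c) * u') ≈ 1#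
  quotient-unit {a'} {b'} {c'} {d'} {u'} unit' = begin
   _ ≈⟨ solve 10 (λ a b c d u a' b' c' d' u' ->
    ((u :* (d :* a' :- b :* c')) :* (u :* (a :* d' :- c :* b')) :- (u :* (d :* b' :- b :* d')) :* (u :* (a :* c' :- c :* a'))) :* ((a :* d :- b :* c) :* u')
    := ((a :* d :- b :* c) :* u) :* ((a :* d :- b :* c) :* u) :* ((a' :* d' :- b' :* c') :* u')) a b c d u a' b' c' d' u' ⟩
   ((a * d - b * c) * u) * ((a * d - b * c) * u) * ((a' * d' - b' * c') * u') ≈⟨ *-cong (*-cong unit unit) unit' ⟩
   1# * 1# * 1# ≈⟨ trans (*-idʳ _) (*-idˡ 1#) ⟩
   1# ∎
  close-a : ∀ a' c' -> u * (d * a' - b * c') - 1# ≈ (u * d) * (a' - a) - (u * b) * (c' - c)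
  close-a a' c' = trans (+ˡ (-‿cong (sym unit))) (solve 7 (λ a b c d u a' c' ->
   u :* (d :* a' :- b :* c') :- (a :* d :- b :* c) :* u := (u :* d) :* (a' :- a) :- (u :* b) :* (c' :- c)) a b c d u a' c')
  close-b : ∀ b' d' -> u * (d * b' - b * d') - 0# ≈ (u * d) * (b' - b) - (u * b) * (d' - d)
  close-b b' d' = solve 5 (λ b d u b' d' ->
   u :* (d :* b' :- b :* d') :- con 0ℤ := (u :* d) :* (b' :- b) :- (u :* b) :* (d' :- d)) b d u b' d'
  close-c : ∀ a' c' -> u * (a * c' - c * a') - 0# ≈ (u * a) * (c' - c) - (u * c) * (a' - a)
  close-c a' c' = solve 5 (λ a c u a' c' ->
   u :* (a :* c' :- c :* a') :- con 0ℤ := (u :* a) :* (c' :- c) :- (u :* c) :* (a' :- a)) a c u a' c'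
  close-d : ∀ b' d' -> u * (a * d' - c * b') - 1# ≈ (u * a) * (d' - d) - (u * c) * (b' - b)
  close-d b' d' = trans (+ˡ (-‿cong (sym unit))) (solve 7 (λ a b c d u b' d' ->
   u :* (a :* d' :- c :* b') :- (a :* d :- b :* c) :* u := (u :* a) :* (d' :- d) :- (u :* c) :* (b' :- b)) a b c d u b' d')
  close-u : ∀ u' -> (a * d - b * c) * u' - 1# ≈ (a * d - b * c) * (u' - u)
  close-u u' = trans (+ˡ (-‿cong (sym unit))) (solve 3 (λ D u u' -> D :* u' :- D :* u := D :* (u' :- u)) (a * d - b * c) u u')

 close-product : ∀ p r p' r' -> p * p' + r * r' - 1# ≈ (p - 1#) * p' + (p' - 1#) + (r - 0#) * r'
 close-product p r p' r' = solve 4 (λ p r p' r' -> p :* p' :+ r :* r' :- con 1ℤ := (p :- con 1ℤ) :* p' :+ (p' :- con 1ℤ) :+ (r :- con 0ℤ) :* r') p r p' r'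

 close-product' : ∀ p r p' r' -> r * r' + p * p' - 1# ≈ (p - 1#) * p' + (p' - 1#) + (r - 0#) * r'
 close-product' p r p' r' = trans (+ʳ (+-comm _ _)) (close-product p r p' r')

 close-off : ∀ p r p' r' -> p * p' + r * r' - 0# ≈ p * (p' - 0#) + (r - 0#) * r'
 close-off p r p' r' = solve 4 (λ p r p' r' -> p :* p' :+ r :* r' :- con 0ℤ := p :* (p' :- con 0ℤ) :+ (r :- con 0ℤ) :* r') p r p' r'

 close-off' : ∀ p r p' r' -> r * r' + p * p' - 0# ≈ p * (p' - 0#) + (r - 0#) * r'
 close-off' p r p' r' = trans (+ʳ (+-comm _ _)) (close-off p r p' r')

 close-unit : ∀ p p' -> p * p' - 1# ≈ (p - 1#) * p' + (p' - 1#)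
 close-unit p p' = solve 2 (λ p p' -> p :* p' :- con 1ℤ := (p :- con 1ℤ) :* p' :+ (p' :- con 1ℤ)) p p'

 close-neg : ∀ p -> (- p) - 0# ≈ - (p - 0#)
 close-neg p = solve 1 (λ p -> (:- p) :- con 0ℤ := :- (p :- con 0ℤ)) p

 linear : ∀ s s' p p' r r' -> (s * p' + s' * r') - (s * p + s' * r) ≈ s * (p' - p) + s' * (r' - r)
 linear = solve 6 (λ s s' p p' r r' -> (s :* p' :+ s' :* r') :- (s :* p :+ s' :* r) := s :* (p' :- p) :+ s' :* (r' :- r))

 linear₁ : ∀ s p p' -> s * p' - s * p ≈ s * (p' - p)
 linear₁ = solve 3 (λ s p p' -> s :* p' :- s :* p := s :* (p' :- p))

 times-close-1 : ∀ s r p q -> (s * p + r * q) - s ≈ s * (p - 1#) + r * (q - 0#)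
 times-close-1 = solve 4 (λ s r p q -> (s :* p :+ r :* q) :- s := s :* (p :- con 1ℤ) :+ r :* (q :- con 0ℤ))

 times-close-2 : ∀ s r p q -> (s * p + r * q) - r ≈ s * (p - 0#) + r * (q - 1#)
 times-close-2 = solve 4 (λ s r p q -> (s :* p :+ r :* q) :- r := s :* (p :- con 0ℤ) :+ r :* (q :- con 1ℤ))

 times-close : ∀ s p -> s * p - s ≈ s * (p - 1#)
 times-close = solve 2 (λ s p -> s :* p :- s := s :* (p :- con 1ℤ))

-- Spaces of functions determined by finitely many points

module DualBases (em : EM) (ℝ : RealField) {T A : Set} (pt : A -> T) (V : (T -> Complex.ℂ ℝ) -> Set₁)
 (V-+ : ∀ {f f'} -> V f -> V f' -> V (λ t -> Complex._+_ ℝ (f t) (f' t)))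
 (V-* : ∀ c {f} -> V f -> V (λ t -> Complex._*_ ℝ c (f t))) where
 open ComplexNumbers em ℝ
 open Classical em
 private
  module ℂ = RingLaws ℂ-ring'
  module ℂₗ = FieldLemmas em ℂ-field
  module Sℂ = IntSolver ℂ-ring'
 open ℂ.Reasoning

 -- Functions and points are constructed together, so that the basis of V obtained at the end comes
 -- with one point for each basis vector.
 record DualFamily (n : ℕ) : Set₁ where
  field
   e : Fin n -> T -> ℂ
   p : Fin n -> A
   e∈ : ∀ i -> V (e i)
   diagonal : ∀ i -> e i (pt (p i)) ≈ 1#
   off : ∀ i j -> ¬ i ≡ j -> e i (pt (p j)) ≈ 0#

 Determines : List A -> ∀ {n} -> (Fin n -> A) -> Set₁
 Determines L p = ∀ f -> V f -> (∀ i -> f (pt (p i)) ≈ 0#) -> (∀ a -> a ∈ L -> f (pt a) ≈ 0#) -> ∀ t -> f t ≈ 0#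

 module _ {n} (B : DualFamily n) (f : T -> ℂ) (f∈ : V f) (a : A) (f≉0 : ¬ f (pt a) ≈ 0#) (vanish : ∀ i -> f (pt (DualFamily.p B i)) ≈ 0#) where
  open DualFamily B
  private
   f1 : T -> ℂ
   f1 t = ℂₗ.inv (f (pt a)) * f t
   f₁a : f1 (pt a) ≈ 1#
   f₁a = ℂₗ.inv-l f≉0
   f₁p : ∀ i -> f1 (pt (p i)) ≈ 0#
   f₁p i = ℂ.trans (ℂ.*ˡ {ℂₗ.inv (f (pt a))} (vanish i)) (ℂ.zeroʳ (ℂₗ.inv (f (pt a))))
   e' : Fin n -> T -> ℂ
   e' i t = e i t + - e i (pt a) * f1 t
   e'a : ∀ i -> e' i (pt a) ≈ 0#
   e'a i = ℂ.trans (ℂ.+ˡ {e i (pt a)} (ℂ.*ˡ { - e i (pt a)} f₁a)) (Sℂ.solve 1 (λ x -> x :+ (:- x) :* con 1ℤ := con 0ℤ) (e i (pt a)))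
   e'p : ∀ i j -> e' i (pt (p j)) ≈ e i (pt (p j))
   e'p i j = ℂ.trans (ℂ.+ˡ {e i (pt (p j))} (ℂ.trans (ℂ.*ˡ { - e i (pt a)} (f₁p j)) (ℂ.zeroʳ (- e i (pt a))))) (ℂ.+-idʳ (e i (pt (p j))))
  -- One step of elimination: f, normalized at a, joins the family, and a multiple of it is
  -- subtracted from every e i to make it vanish at a. The values at the old points do not change,
  -- since f vanishes there.
  extend-family : DualFamily (suc n)
  extend-family = record { e = E ; p = P ; e∈ = E∈ ; diagonal = diag ; off = off' }
   where
   E : Fin (suc n) -> T -> ℂ
   E zero = f1
   E (suc i) = e' i
   P : Fin (suc n) -> A
   P zero = a
   P (suc i) = p i
   E∈ : ∀ i -> V (E i)
   E∈ zero = V-* (ℂₗ.inv (f (pt a))) f∈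
   E∈ (suc i) = V-+ (e∈ i) (V-* (- e i (pt a)) (V-* (ℂₗ.inv (f (pt a))) f∈))
   diag : ∀ i -> E i (pt (P i)) ≈ 1#
   diag zero = f₁a
   diag (suc i) = ℂ.trans (e'p i i) (diagonal i)
   off' : ∀ i j -> ¬ i ≡ j -> E i (pt (P j)) ≈ 0#
   off' zero zero ne = ⊥-elim (ne ≡.refl)
   off' zero (suc j) ne = f₁p j
   off' (suc i) zero ne = e'a i
   off' (suc i) (suc j) ne = ℂ.trans (e'p i j) (off i j (λ { ≡.refl -> ne ≡.refl }))

 private
  extend : ∀ L {n} (B : DualFamily n) -> Determines L (DualFamily.p B) -> ∃ λ m -> Σ (DualFamily m) λ B' -> Determines [] (DualFamily.p B')
  extend [] B det = _ , B , det
  extend (a ∷ L) {n} B det = go em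
   where
   open DualFamily B
   Separates : Set₁
   Separates = Σ (T -> ℂ) λ f -> V f × (∀ i -> f (pt (p i)) ≈ 0#) × ¬ f (pt a) ≈ 0#
   go : Dec Separates -> ∃ λ m -> Σ (DualFamily m) λ B' -> Determines [] (DualFamily.p B')
   go (yes (f , f∈ , vanish , f≉0)) = extend L (extend-family B f f∈ a f≉0 vanish) λ h h∈ hp hL ->
    det h h∈ (λ i -> hp (suc i)) λ { _ (here ≡.refl) -> hp zero ; b (there b∈) -> hL b b∈ }
   go (no none) = extend L B λ h h∈ hp hL -> det h h∈ hp λ { _ (here ≡.refl) -> dne (λ ne -> none (h , h∈ , hp , ne)) ; b (there b∈) -> hL b b∈ }

 dual-family : ∀ L -> (∀ f -> V f -> (∀ a -> a ∈ L -> f (pt a) ≈ 0#) -> ∀ t -> f t ≈ 0#) -> ∃ λ n -> Σ (DualFamily n) λ B -> Determines [] (DualFamily.p B)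
 dual-family L det = extend L {0} (record { e = λ () ; p = λ () ; e∈ = λ () ; diagonal = λ () ; off = λ () }) (λ f f∈ _ -> det f f∈)

 private
  lin : ∀ {n} -> (Fin n -> T -> ℂ) -> (Fin n -> ℂ) -> T -> ℂ
  lin e c = ∑ (λ f f' t -> f t + f' t) (λ _ -> 0#) (λ i t -> c i * e i t)
  -- f minus its expansion in the e i, written as repeated additions because membership in V is
  -- known only for sums and scalar multiples.
  reduce : ∀ {n} -> (T -> ℂ) -> (Fin n -> T -> ℂ) -> (Fin n -> ℂ) -> T -> ℂ
  reduce {zero} f e c = f
  reduce {suc n} f e c = reduce (λ t -> f t + - c zero * e zero t) (e ∘ suc) (c ∘ suc)
  reduce∈ : ∀ {n} f (e : Fin n -> T -> ℂ) c -> V f -> (∀ i -> V (e i)) -> V (reduce f e c)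
  reduce∈ {zero} f e c f∈ e∈ = f∈
  reduce∈ {suc n} f e c f∈ e∈ = reduce∈ _ (e ∘ suc) (c ∘ suc) (V-+ f∈ (V-* (- c zero) (e∈ zero))) (e∈ ∘ suc)
  reduce-eq : ∀ {n} f (e : Fin n -> T -> ℂ) c t -> reduce f e c t ≈ f t + - lin e c t
  reduce-eq {zero} f e c t = Sℂ.solve 1 (λ x -> x := x :- con 0ℤ) (f t)
  reduce-eq {suc n} f e c t = ℂ.trans (reduce-eq (λ t -> f t + - c zero * e zero t) (e ∘ suc) (c ∘ suc) t)
   (Sℂ.solve 4 (λ x c e l -> (x :+ (:- c) :* e) :- l := x :- (c :* e :+ l)) (f t) (c zero) (e zero t) (lin (e ∘ suc) (c ∘ suc) t))
  lin-single : ∀ {n} (e : Fin n -> T -> ℂ) c t i -> e i t ≈ 1# -> (∀ j -> ¬ j ≡ i -> e j t ≈ 0#) -> lin e c t ≈ c i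
  lin-single {suc n} e c t zero one zeros = begin
   c zero * e zero t + lin (e ∘ suc) (c ∘ suc) t ≈⟨ ℂ.+-cong (ℂ.*ˡ {c zero} one) (lin-zero (e ∘ suc) (c ∘ suc) (λ j -> zeros (suc j) λ ())) ⟩
   c zero * 1# + 0# ≈⟨ ℂ.trans (ℂ.+-idʳ (c zero * 1#)) (ℂ.*-idʳ (c zero)) ⟩
   c zero ∎
   where
   lin-zero : ∀ {m} (e : Fin m -> T -> ℂ) c -> (∀ j -> e j t ≈ 0#) -> lin e c t ≈ 0#
   lin-zero {zero} e c h = ℂ.refl
   lin-zero {suc m} e c h = ℂ.trans (ℂ.+-cong (ℂ.trans (ℂ.*ˡ {c zero} (h zero)) (ℂ.zeroʳ (c zero))) (lin-zero (e ∘ suc) (c ∘ suc) (h ∘ suc))) (ℂ.+-idˡ 0#)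
  lin-single {suc n} e c t (suc i) one zeros = begin
   c zero * e zero t + lin (e ∘ suc) (c ∘ suc) t ≈⟨ ℂ.+-cong (ℂ.trans (ℂ.*ˡ {c zero} (zeros zero λ ())) (ℂ.zeroʳ (c zero)))
    (lin-single (e ∘ suc) (c ∘ suc) t i one (λ j ne -> zeros (suc j) λ { ≡.refl -> ne ≡.refl })) ⟩
   0# + c (suc i) ≈⟨ ℂ.+-idˡ (c (suc i)) ⟩
   c (suc i) ∎

 module _ {n} (B : DualFamily n) (determines : Determines [] (DualFamily.p B)) where
  open DualFamily B
  private
   coordinate : ∀ c i -> lin e c (pt (p i)) ≈ c i
   coordinate c i = lin-single e c (pt (p i)) i (diagonal i) (λ j ne -> off j i ne)
  family-dim : HasDim ℂ-ring (functions T) V (λ f -> ∀ t -> f t ≈ 0#) n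
  family-dim = e , e∈ , λ f f∈ -> let c = λ i -> f (pt (p i)) in c
   , (λ t -> ℂ.trans (ℂ.sym (reduce-eq f e c t)) (determines (reduce f e c) (reduce∈ f e c f∈ e∈)
    (λ i -> ℂ.trans (reduce-eq f e c (pt (p i))) (ℂₗ.x≈y⇒x-y≈0 (ℂ.sym (coordinate c i)))) (λ _ ()) t))
   , λ c' h i -> ℂ.trans (ℂₗ.x-y≈0⇒x≈y (h (pt (p i)))) (coordinate c' i)

module Theory (em : EM) (X : Curve) (F̂ : Completions X) {g : ℕ} (isGenus : Adeles.IsGenus X F̂ g) where
 open Classical em
 open Curve X using (Point; ord; isPlace)

 -- F as a finite extension of k(t), and relations modulo a function

 module Basics where
  open Curve X using (k; F; φ; const; eval)
  private module k = FieldLaws k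
  open FieldLaws F
  open FieldLemmas em F public
  open LinearAlgebra em k (Curve.k-size X) (Field.ring F) φ public
  open IntSolver (Field.ring F)
  open Reasoning
  open RingHom φ using () renaming (⟦⟧-cong to κ-cong; 0#-homo to κ-0; 1#-homo to κ-1; +-homo to κ-+; *-homo to κ-*; -‿homo to κ-neg)
  t : Carrier
  t = fst (Curve.oneDimensional X)
  zeroSubspace : Sub (_≈ 0#)
  zeroSubspace = record
   { resp = λ e -> trans (sym e) ; 0∈ = refl
   ; +∈ = λ p q -> trans (+-cong p q) (+-idˡ 0#)
   ; *∈ = λ c p -> trans (*ˡ p) (zeroʳ _) }
  δ : ∀ {n} -> Fin n -> Fin n -> k.Carrier
  δ zero zero = k.1#
  δ zero (suc j) = k.0#
  δ (suc i) zero = k.0#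
  δ (suc i) (suc j) = δ i j
  lin-δ : ∀ {n} (e : Fin n -> Carrier) i -> lin e (δ i) ≈ e i
  lin-δ e zero = trans (+-cong (*ʳ κ-1) (lin-0 (e ∘ suc) _ (λ _ -> k.refl))) (solve 1 (λ x -> con 1ℤ :* x :+ con 0ℤ := x) (e zero))
  lin-δ e (suc i) = trans (+-cong (*ʳ κ-0) (lin-δ (e ∘ suc) i)) (solve 2 (λ x y -> con 0ℤ :* x :+ y := y) (e zero) (e (suc i)))
  -- E d is the space of all Σᵢ pᵢ(t) eᵢ with deg pᵢ < d.
  module Growth {n : ℕ} (e : Fin n -> Carrier) where
   data E : ℕ -> Carrier -> Set where
    nil : ∀ {a} -> a ≈ 0# -> E zero a
    cons : ∀ {d a} c b -> E d b -> a ≈ lin e c + t * b -> E (suc d) a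
   E-sub : ∀ d -> Sub (E d)
   E-sub zero = record
    { resp = λ { eq (nil p) -> nil (trans (sym eq) p) } ; 0∈ = nil refl
    ; +∈ = λ { (nil p) (nil q) -> nil (Sub.+∈ zeroSubspace p q) }
    ; *∈ = λ { s (nil p) -> nil (Sub.*∈ zeroSubspace s p) } }
   E-sub (suc d) = record
    { resp = λ { eq (cons c b p r) -> cons c b p (trans (sym eq) r) }
    ; 0∈ = cons (λ _ -> k.0#) 0# (Sub.0∈ (E-sub d)) (sym (trans (+-cong (lin-0 e _ (λ _ -> k.refl)) (zeroʳ t)) (+-idˡ 0#)))
    ; +∈ = λ { (cons c b p r) (cons c' b' p' r') ->
     cons (λ i -> c i k.+ c' i) (b + b') (Sub.+∈ (E-sub d) p p') (begin
      _ ≈⟨ +-cong r r' ⟩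
      (lin e c + t * b) + (lin e c' + t * b')
       ≈⟨ solve 5 (λ x y t b b' -> (x :+ t :* b) :+ (y :+ t :* b') := (x :+ y) :+ t :* (b :+ b')) _ _ _ _ _ ⟩
      (lin e c + lin e c') + t * (b + b') ≈⟨ +ʳ (lin-+ e c c') ⟨
      lin e (λ i -> c i k.+ c' i) + t * (b + b') ∎) }
    ; *∈ = λ { s (cons c b p r) ->
     cons (λ i -> s k.* c i) (const s * b) (Sub.*∈ (E-sub d) s p) (begin
      _ ≈⟨ *ˡ r ⟩
      const s * (lin e c + t * b)
       ≈⟨ solve 4 (λ s x t b -> s :* (x :+ t :* b) := s :* x :+ t :* (s :* b)) _ _ _ _ ⟩
      const s * lin e c + t * (const s * b) ≈⟨ +ʳ (lin-* e s c) ⟨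
      lin e (λ i -> s k.* c i) + t * (const s * b) ∎) } }
   E-lin : ∀ d c -> E (suc d) (lin e c)
   E-lin d c = cons c 0# (Sub.0∈ (E-sub d)) (solve 2 (λ x t -> x := x :+ t :* con 0ℤ) _ t)
   E-t : ∀ d {b} -> E d b -> E (suc d) (t * b)
   E-t d {b} p = cons (λ _ -> k.0#) b p (trans (sym (+-idˡ _)) (+ʳ (sym (lin-0 e _ (λ _ -> k.refl)))))
   E-mono : ∀ {d d' a} -> d ℕ.≤ d' -> E d a -> E d' a
   E-mono {zero} {d'} ℕ.z≤n (nil p) = Sub.resp (E-sub d') (sym p) (Sub.0∈ (E-sub d'))
   E-mono (ℕ.s≤s le) (cons c b p r) = cons c b (E-mono le p) r
   E-cast : ∀ {d d' a} -> d ≡ d' -> E d a -> E d' a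
   E-cast ≡.refl p = p
   E-spans : ∀ d -> ∃ λ (s : Fin (d ℕ.* n) -> Carrier) -> Spans (E d) (_≈ 0#) s
   E-spans zero = (λ ()) , λ { a (nil p) -> (λ ()) , trans (+ʳ p) (-‿inverseʳ 0#) }
   E-spans (suc d) with E-spans d
   ... | s , span = append e (λ i -> t * s i) , go
    where
    go : Spans (E (suc d)) (_≈ 0#) (append e (λ i -> t * s i))
    go a (cons c b p r) with span b p
    ... | c' , z = append c c' , x≈y⇒x-y≈0 (begin
     a ≈⟨ r ⟩
     lin e c + t * b ≈⟨ +ˡ (*ˡ (x-y≈0⇒x≈y z)) ⟩
     lin e c + t * lin s c' ≈⟨ +ˡ (lin-scale s t c') ⟨
     lin e c + lin (λ i -> t * s i) c' ≈⟨ lin-append' e _ c c' ⟨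
     lin (append e (λ i -> t * s i)) (append c c') ∎)
  module P = Growth {1} (λ _ -> 1#)
  open P using (nil; cons) renaming (E to Poly)
  eval-poly : ∀ p -> Poly (length p) (eval p t)
  eval-poly [] = nil refl
  eval-poly (c ∷ p) = cons (λ _ -> c) (eval p t) (eval-poly p) (+ʳ (solve 1 (λ c -> c := c :* con 1ℤ :+ con 0ℤ) (const c)))
  module _ {n} (e : Fin n -> Carrier) where
   open Growth e
   poly-E : ∀ d d' {w a} -> Poly d w -> E d' a -> E (d ℕ.+ d') (w * a)
   poly-E zero d' (nil p) q = Sub.resp (E-sub d') (sym (trans (*ʳ p) (zeroˡ _))) (Sub.0∈ (E-sub d'))
   poly-E (suc d) d' {w} {a} (cons c w' p r) q = Sub.resp (E-sub (suc (d ℕ.+ d'))) (begin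
    const (c zero) * a + t * (w' * a)
     ≈⟨ solve 4 (λ c a t w -> c :* a :+ t :* (w :* a) := (c :* con 1ℤ :+ con 0ℤ :+ t :* w) :* a) _ a t w' ⟩
    (const (c zero) * 1# + 0# + t * w') * a ≈⟨ *ʳ r ⟨
    w * a ∎)
    (Sub.+∈ (E-sub (suc (d ℕ.+ d'))) (E-mono (ℕₚ.m≤n+m d' (suc d)) (Sub.*∈ (E-sub d') (c zero) q)) (E-t (d ℕ.+ d') (poly-E d d' p q)))
   poly-lin : ∀ d (c : Fin n -> Carrier) -> (∀ i -> Poly d (c i)) -> E (d ℕ.+ 1) (∑ _+_ 0# (λ i -> c i * e i))
   poly-lin d c p = go (λ i -> c i * e i) λ i -> poly-E d 1 (p i) (Sub.resp (E-sub 1) (lin-δ e i) (E-lin 0 (δ i)))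
    where
    go : ∀ {m} (a : Fin m -> Carrier) -> (∀ i -> E (d ℕ.+ 1) (a i)) -> E (d ℕ.+ 1) (∑ _+_ 0# a)
    go {zero} a h = Sub.0∈ (E-sub (d ℕ.+ 1))
    go {suc m} a h = Sub.+∈ (E-sub (d ℕ.+ 1)) (h zero) (go (a ∘ suc) (h ∘ suc))
  private
   gens : ∃ λ n -> Σ (Fin n -> Carrier) λ e -> ∀ f -> Σ (List k.Carrier) λ p -> ¬ eval p t ≈ 0# ×
    Σ (Fin n -> List k.Carrier) λ r -> eval p t * f ≈ ∑ _+_ 0# (λ i -> eval (r i) t * e i)
   gens = snd (snd (Curve.oneDimensional X))
  rank : ℕ
  rank = fst gens
  gen : Fin rank -> Carrier
  gen = fst (snd gens)
  open Growth gen
  abstract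
   denominator : ∀ f -> ∃ λ d -> ∃ λ w -> w ≉0 × Poly d w × E d (w * f)
   denominator f with snd (snd gens) f
   ... | p , p≉0 , r , eq
    with uniform-bound (λ i d -> Poly d (eval (r i) t)) (λ i le -> P.E-mono le) (λ i -> _ , eval-poly (r i))
   ... | d , h = (length p ℕ.+ (d ℕ.+ 1)) , eval p t , p≉0
    , P.E-mono (ℕₚ.m≤m+n _ _) (eval-poly p)
    , E-mono (ℕₚ.m≤n+m _ (length p)) (Sub.resp (E-sub (d ℕ.+ 1)) (sym eq) (poly-lin gen d _ h))
   common-denominator : ∀ {m} (u : Fin m -> Carrier) -> ∃ λ d -> ∃ λ w -> w ≉0 × Poly d w × (∀ i -> E d (w * u i))
   common-denominator {zero} u = 1 , 1# , 1≉0 , Sub.resp (P.E-sub 1) (lin-δ {1} (λ _ -> 1#) zero) (P.E-lin 0 (δ {1} zero)) , λ ()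
   common-denominator {suc m} u with denominator (u zero) | common-denominator (u ∘ suc)
   ... | d , w , w≉0 , p , q | d' , w' , w'≉0 , p' , q' = d ℕ.+ d' , w * w' , *≉0 w≉0 w'≉0 , poly-E (λ _ -> 1#) d d' p p' , λ
    { zero -> Sub.resp (E-sub (d ℕ.+ d')) (solve 3 (λ w w' u -> w' :* (w :* u) := w :* w' :* u) w w' (u zero))
     (E-cast (ℕₚ.+-comm d' d) (poly-E gen d' d p' q))
    ; (suc i) -> Sub.resp (E-sub (d ℕ.+ d')) (sym (*-assoc w w' (u (suc i)))) (poly-E gen d d' p (q' i)) }
  module _ (y : Carrier) where
   -- The family of all y^a u_i with a < A, in blocks of increasing a: the part without a factor y
   -- comes first.
   powers : ∀ A {m} -> (Fin m -> Carrier) -> Fin (A ℕ.* m) -> Carrier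
   powers zero u ()
   powers (suc A) u = append u (λ i -> y * powers A u i)
   private
    dy = common-denominator (λ j -> y * gen j)
    c = fst dy
    s = fst (snd dy)
    s≉0 = fst (snd (snd dy))
    s-poly = fst (snd (snd (snd dy)))
    sy∈ = snd (snd (snd (snd dy)))
    -- s clears the denominators of the matrix of multiplication by y in the generators of F, at the
    -- cost of c in the degree.
    multiply : ∀ d {a} -> E d a -> E (d ℕ.+ c) (s * (y * a))
    multiply zero (nil p) = Sub.resp (E-sub c) (sym (trans (*ˡ (trans (*ˡ p) (zeroʳ y))) (zeroʳ s))) (Sub.0∈ (E-sub c))
    multiply (suc d) {a} (cons x b p r) = Sub.resp (E-sub (suc (d ℕ.+ c))) (begin
     lin (λ j -> s * (y * gen j)) x + t * (s * (y * b))
      ≈⟨ +ʳ (trans (lin-scale (λ j -> y * gen j) s x) (*ˡ (lin-scale gen y x))) ⟩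
     s * (y * lin gen x) + t * (s * (y * b))
      ≈⟨ solve 5 (λ s y l t b -> s :* (y :* l) :+ t :* (s :* (y :* b)) := s :* (y :* (l :+ t :* b))) s y _ t b ⟩
     s * (y * (lin gen x + t * b)) ≈⟨ *ˡ (*ˡ r) ⟨
     s * (y * a) ∎)
     (Sub.+∈ (E-sub (suc (d ℕ.+ c))) (E-mono (ℕₚ.≤-trans (ℕₚ.m≤n+m c d) (ℕₚ.n≤1+n _)) (lin∈ (E-sub c) sy∈ x))
      (E-t (d ℕ.+ c) (multiply d p)))
    spow : ℕ -> Carrier
    spow zero = 1#
    spow (suc A) = s * spow A
    spow≉0 : ∀ A -> spow A ≉0
    spow≉0 zero = 1≉0
    spow≉0 (suc A) = *≉0 s≉0 (spow≉0 A)
    spow-E : ∀ A {d a} -> E d a -> E (d ℕ.+ A ℕ.* c) (spow A * a)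
    spow-E zero {d} p = E-cast (≡.sym (ℕₚ.+-identityʳ d)) (Sub.resp (E-sub d) (sym (*-idˡ _)) p)
    spow-E (suc A) {d} {a} p = E-cast eq
     (Sub.resp (E-sub (c ℕ.+ (d ℕ.+ A ℕ.* c))) (sym (*-assoc s _ a)) (poly-E gen c _ s-poly (spow-E A p)))
     where
     eq : c ℕ.+ (d ℕ.+ A ℕ.* c) ≡ d ℕ.+ (c ℕ.+ A ℕ.* c)
     eq = ≡.trans (≡.sym (ℕₚ.+-assoc c d _)) (≡.trans (ap (ℕ._+ A ℕ.* c) (ℕₚ.+-comm c d)) (ℕₚ.+-assoc d c _))
    powers∈ : ∀ A {m} (u : Fin m -> Carrier) {w c'} -> (∀ i -> E c' (w * u i)) -> ∀ i -> E (c' ℕ.+ A ℕ.* c) (spow A * (w * powers A u i))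
    powers∈ (suc A) {m} u {w} {c'} h = append-∈ (λ a -> E (c' ℕ.+ suc A ℕ.* c) (spow (suc A) * (w * a)))
     (λ i -> spow-E (suc A) {c'} {w * u i} (h i))
     λ i -> subst (λ n -> E n (spow (suc A) * (w * (y * powers A u i)))) eq (Sub.resp (E-sub (c' ℕ.+ A ℕ.* c ℕ.+ c))
      (solve 5 (λ s y p w b -> s :* (y :* (p :* (w :* b))) := s :* p :* (w :* (y :* b))) s y (spow A) w (powers A u i))
      (multiply (c' ℕ.+ A ℕ.* c) (powers∈ A u {w} {c'} h i)))
     where
     eq : c' ℕ.+ A ℕ.* c ℕ.+ c ≡ c' ℕ.+ (c ℕ.+ A ℕ.* c)
     eq = ≡.trans (ℕₚ.+-assoc c' _ c) (ap (c' ℕ.+_) (ℕₚ.+-comm (A ℕ.* c) c))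
   abstract
    degree-bound : ℕ
    degree-bound = c ℕ.* rank
    -- After clearing denominators A blocks lie in E (c' + A c), which is spanned by (c' + A c) ·
    -- rank vectors. With c · rank + 1 vectors in each block, the blocks contain more vectors than
    -- that once A > c' · rank.
    powers-dependent : (u : Fin (suc degree-bound) -> Carrier) -> ∃ λ A -> Dependent (_≈ 0#) (powers A u)
    powers-dependent u = A , x , ne , *≈0 (*≉0 (spow≉0 A) w≉0) (begin
     spow A * w * lin (powers A u) x ≈⟨ lin-scale (powers A u) (spow A * w) x ⟨
     lin (λ i -> spow A * w * powers A u i) x ≈⟨ lin-cong x (λ i -> *-assoc (spow A) w (powers A u i)) ⟩
     lin scaled x ≈⟨ z ⟩
     0# ∎)
     where
     du : ∃ λ d -> ∃ λ w -> w ≉0 × Poly d w × (∀ i -> E d (w * u i))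
     du = common-denominator u
     c' A D : ℕ
     c' = fst du
     A = suc (c' ℕ.* rank)
     D = c' ℕ.+ A ℕ.* c
     w : Carrier
     w = fst (snd du)
     w≉0 : w ≉0
     w≉0 = fst (snd (snd du))
     scaled : Fin (A ℕ.* suc degree-bound) -> Carrier
     scaled i = spow A * (w * powers A u i)
     size : D ℕ.* rank ℕ.< A ℕ.* suc degree-bound
     size = ℕₚ.<-≤-trans (ℕₚ.≤-reflexive (ap suc (≡.trans (ℕₚ.*-distribʳ-+ rank c' (A ℕ.* c))
      (ap (c' ℕ.* rank ℕ.+_) (ℕₚ.*-assoc A c rank)))))
      (ℕₚ.≤-reflexive (≡.sym (ℕₚ.*-suc A degree-bound)))
     dep : Dependent (_≈ 0#) scaled
     dep = dependent (E-sub D) zeroSubspace (snd (E-spans D)) size scaled (powers∈ A u {w} {c'} (snd (snd (snd (snd du)))))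
     x : Fin (A ℕ.* suc degree-bound) -> k.Carrier
     x = fst dep
     ne : Nontrivial x
     ne = fst (snd dep)
     z : lin scaled x ≈ 0#
     z = snd (snd dep)
    -- A bound for dim R / yR that does not depend on R. Take a relation between the y^a u_i, divide
    -- by y until the first block is non-trivial, and collect all later blocks in y w. It will make
    -- the constructed valuations discrete, residue fields finite and zeros finite in number.
    relation-mod-y : y ≉0 -> (R : Carrier -> Set) -> Sub R -> (∀ {a} -> R a -> R (y * a)) ->
     (u : Fin (suc degree-bound) -> Carrier) -> (∀ i -> R (u i)) ->
     ∃ λ c -> Nontrivial c × ∃ λ w -> R w × lin u c ≈ y * w
    relation-mod-y y≉0 R sR yR u u∈ =
     let A , x , ne , z = powers-dependent u in strip A x ne z
     where
     R-powers : ∀ A i -> R (powers A u i)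
     R-powers (suc A) = append-∈ R u∈ (λ i -> yR (R-powers A i))
     strip : ∀ A x -> Nontrivial x -> lin (powers A u) x ≈ 0# -> ∃ λ c -> Nontrivial c × ∃ λ w -> R w × lin u c ≈ y * w
     strip (suc A) x (i , ne) z = go em
      where
      x0 : Fin (suc degree-bound) -> k.Carrier
      x0 i = x (i Fin.↑ˡ (A ℕ.* suc degree-bound))
      x1 : Fin (A ℕ.* suc degree-bound) -> k.Carrier
      x1 i = x (suc degree-bound Fin.↑ʳ i)
      sum≈0 : lin u x0 + y * lin (powers A u) x1 ≈ 0#
      sum≈0 = trans (+ˡ (sym (lin-scale (powers A u) y x1))) (trans (sym (lin-append u _ x)) z)
      go : Dec (Nontrivial x0) -> ∃ λ c -> Nontrivial c × ∃ λ w -> R w × lin u c ≈ y * w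
      go (yes nt) = x0 , nt , - lin (powers A u) x1 , Sub.-∈ sR (lin∈ sR (R-powers A) x1)
       , x-y≈0⇒x≈y (trans (solve 3 (λ l y r -> l :- y :* (:- r) := l :+ y :* r) _ y _) sum≈0)
      go (no tr) = strip A x1 (dne λ tr' -> ne (append-all (suc degree-bound) {P = λ i -> x i k.≈ k.0#}
        (λ j -> dne λ h -> tr (j , h)) (λ j -> dne λ h -> tr' (j , h)) i))
       (*≈0 y≉0 (trans (sym (trans (+ʳ (lin-0 u x0 (λ j -> dne λ h -> tr (j , h)))) (+-idˡ _))) sum≈0))

 -- Existence of a place at which a given function vanishes

 module Places where
  open Curve X using (k; F; φ; const; q)
  open Basics
  private module k = FieldLaws k
  open FieldLaws F
  open IntSolver (Field.ring F)
  open Reasoning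
  open RingHom φ using () renaming (⟦⟧-cong to κ-cong; 0#-homo to κ-0; 1#-homo to κ-1; *-homo to κ-*; +-homo to κ-+; -‿homo to κ-neg)
  record Subring (R : Carrier -> Set) : Set where
   field
    resp : ∀ {a b} -> a ≈ b -> R a -> R b
    const∈ : ∀ c -> R (const c)
    +∈ : ∀ {a b} -> R a -> R b -> R (a + b)
    *∈ : ∀ {a b} -> R a -> R b -> R (a * b)
   0∈ : R 0#
   0∈ = resp κ-0 (const∈ k.0#)
   1∈ : R 1#
   1∈ = resp κ-1 (const∈ k.1#)
   neg∈ : ∀ {a} -> R a -> R (- a)
   neg∈ {a} p = resp (trans (*ʳ (trans (κ-neg k.1#) (-‿cong κ-1)))
    (solve 1 (λ a -> (:- con 1ℤ) :* a := :- a) a)) (*∈ (const∈ (k.- k.1#)) p)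
   subspace : Sub R
   subspace = record { resp = resp ; 0∈ = 0∈ ; +∈ = +∈ ; *∈ = λ c -> *∈ (const∈ c) }
  horner : List Carrier -> Carrier -> Carrier
  horner [] f = 0#
  horner (r ∷ rs) f = r + f * horner rs f
  Adjoin : (Carrier -> Set) -> Carrier -> Carrier -> Set
  Adjoin R f a = ∃ λ rs -> All R rs × a ≈ horner rs f
  module _ {R : Carrier -> Set} (sR : Subring R) (f : Carrier) where
   open Subring sR
   private
    plus : List Carrier -> List Carrier -> List Carrier
    plus [] ss = ss
    plus (r ∷ rs) [] = r ∷ rs
    plus (r ∷ rs) (s ∷ ss) = (r + s) ∷ plus rs ss
    plus∈ : ∀ {rs ss} -> All R rs -> All R ss -> All R (plus rs ss)
    plus∈ [] qs = qs
    plus∈ (p ∷ ps) [] = p ∷ ps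
    plus∈ (p ∷ ps) (q ∷ qs) = +∈ p q ∷ plus∈ ps qs
    horner-plus : ∀ rs ss -> horner (plus rs ss) f ≈ horner rs f + horner ss f
    horner-plus [] ss = sym (+-idˡ _)
    horner-plus (r ∷ rs) [] = sym (+-idʳ _)
    horner-plus (r ∷ rs) (s ∷ ss) = trans (+ˡ (*ˡ (horner-plus rs ss)))
     (solve 5 (λ r s f x y -> r :+ s :+ f :* (x :+ y) := r :+ f :* x :+ (s :+ f :* y)) r s f _ _)
   horner-scale : ∀ r ss -> horner (List.map (r *_) ss) f ≈ r * horner ss f
   horner-scale r [] = sym (zeroʳ r)
   horner-scale r (s ∷ ss) = trans (+ˡ (*ˡ (horner-scale r ss)))
    (solve 4 (λ r s f x -> r :* s :+ f :* (r :* x) := r :* (s :+ f :* x)) r s f _)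
   scale∈ : ∀ {r ss} -> R r -> All R ss -> All R (List.map (r *_) ss)
   scale∈ p qs = Allₚ.map⁺ (All.map (*∈ p) qs)
   adjoin-base : ∀ {a} -> R a -> Adjoin R f a
   adjoin-base {a} p = a ∷ [] , p ∷ [] , solve 2 (λ a f -> a := a :+ f :* con 0ℤ) a f
   adjoin-self : Adjoin R f f
   adjoin-self = 0# ∷ 1# ∷ [] , 0∈ ∷ 1∈ ∷ [] , solve 1 (λ f -> f := con 0ℤ :+ f :* (con 1ℤ :+ f :* con 0ℤ)) f
   adjoin-subring : Subring (Adjoin R f)
   adjoin-subring = record
    { resp = λ { e (rs , p , r) -> rs , p , trans (sym e) r }
    ; const∈ = λ c -> adjoin-base (const∈ c)
    ; +∈ = add
    ; *∈ = λ { (rs , p , e) q -> let ss , q' , e' = mul rs p q in ss , q' , trans (*ʳ e) e' } }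
    where
    add : ∀ {a b} -> Adjoin R f a -> Adjoin R f b -> Adjoin R f (a + b)
    add (rs , p , e) (ss , q , e') = plus rs ss , plus∈ p q , trans (+-cong e e') (sym (horner-plus rs ss))
    mul : ∀ {b} rs -> All R rs -> Adjoin R f b -> Adjoin R f (horner rs f * b)
    mul [] [] _ = [] , [] , zeroˡ _
    mul {b} (r ∷ rs) (p ∷ ps) (ss , q , e) with mul rs ps (ss , q , e)
    ... | us , u∈ , e' with add (List.map (r *_) ss , scale∈ p q , trans (*ˡ e) (sym (horner-scale r ss)))
     (0# ∷ us , 0∈ ∷ u∈ , trans (*ˡ e') (sym (+-idˡ (f * horner us f))))
    ... | vs , v∈ , e″ = vs , v∈ , trans (solve 4 (λ r f h b -> (r :+ f :* h) :* b := r :* b :+ f :* (h :* b)) r f _ b) e″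
  module ExistsPlace (z : Carrier) (z≉0 : z ≉0) where
   -- z has an inverse in R. A ring containing z in which this fails can be enlarged to a valuation
   -- ring whose maximal ideal contains z.
   Bad : (Carrier -> Set) -> Set
   Bad R = ∃ λ r -> R r × 1# ≈ z * r
   Constants : Carrier -> Set
   Constants a = ∃ λ c -> a ≈ const c
   constants-subring : Subring Constants
   constants-subring = record
    { resp = λ { e (c , p) -> c , trans (sym e) p }
    ; const∈ = λ c -> c , refl
    ; +∈ = λ { (c , p) (d , r) -> c k.+ d , trans (+-cong p r) (sym (κ-+ c d)) }
    ; *∈ = λ { (c , p) (d , r) -> c k.* d , trans (*-cong p r) (sym (κ-* c d)) } }
   k[z] : Carrier -> Set
   k[z] = Adjoin Constants z
   private
    all-combs : ∀ {n} -> (Fin n -> Carrier) -> List Carrier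
    all-combs s = List.map (λ i -> lin s (decode i)) (List.allFin _)
    all-combs-∋ : ∀ {n} (s : Fin n -> Carrier) c -> Any (lin s c ≈_) (all-combs s)
    all-combs-∋ {n} s c = Anyₚ.map⁺ (Anyₚ.tabulate⁺ {f = λ i -> i} (encode c) (lin-congᶜ s (λ i -> k.sym (decode-encode c i))))
    module G = Growth gen
    fractions : ℕ -> List Carrier
    fractions d = List.cartesianProductWith (λ a w -> a * inv w) (all-combs (fst (G.E-spans d))) (all-combs (fst (P.E-spans d)))
    fractions-∋ : ∀ f -> ∃ λ d -> Any (f ≈_) (fractions d)
    fractions-∋ f with denominator f
    ... | d , w , w≉0 , w∈ , wf∈ with snd (G.E-spans d) _ wf∈ | snd (P.E-spans d) _ w∈
    ... | c , e | c' , e' = d , Any.map (trans f≈)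
     (SetoidMembership.∈-cartesianProductWith⁺ setoid setoid setoid {f = λ a w -> a * inv w} (λ p r -> *-cong p (inv-cong r))
      (all-combs-∋ _ c) (all-combs-∋ _ c'))
     where
     f≈ : f ≈ lin (fst (G.E-spans d)) c * inv (lin (fst (P.E-spans d)) c')
     f≈ = begin
      f ≈⟨ x*[y*inv-x] f w≉0 ⟨
      w * (f * inv w) ≈⟨ *-assoc w f _ ⟨
      w * f * inv w ≈⟨ *-cong (x-y≈0⇒x≈y e) (inv-cong (x-y≈0⇒x≈y e')) ⟩
      lin (fst (G.E-spans d)) c * inv (lin (fst (P.E-spans d)) c') ∎
   -- F is countable; adjoin its elements one after the other as long as z
   -- stays a non-unit.
   chain : List Carrier -> Carrier -> Set
   chain [] = k[z]
   chain (f ∷ l) a = chain l a ⊎ (¬ Bad (Adjoin (chain l) f) × Adjoin (chain l) f a)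
   chain-subring : ∀ l -> Subring (chain l)
   chain-subring [] = adjoin-subring constants-subring z
   chain-subring (f ∷ l) with em {P = Bad (Adjoin (chain l) f)}
   ... | yes bad = record
    { resp = λ e p -> inl (S.resp e (down p)) ; const∈ = λ c -> inl (S.const∈ c)
    ; +∈ = λ p r -> inl (S.+∈ (down p) (down r)) ; *∈ = λ p r -> inl (S.*∈ (down p) (down r)) }
    where
    module S = Subring (chain-subring l)
    down : ∀ {a} -> chain (f ∷ l) a -> chain l a
    down (inl p) = p
    down (inr (nb , _)) = ⊥-elim (nb bad)
   ... | no nb = record
    { resp = λ e p -> inr (nb , A.resp e (down p)) ; const∈ = λ c -> inr (nb , A.const∈ c)
    ; +∈ = λ p r -> inr (nb , A.+∈ (down p) (down r)) ; *∈ = λ p r -> inr (nb , A.*∈ (down p) (down r)) }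
    where
    module A = Subring (adjoin-subring (chain-subring l) f)
    down : ∀ {a} -> chain (f ∷ l) a -> Adjoin (chain l) f a
    down (inl p) = adjoin-base (chain-subring l) f p
    down (inr (_ , p)) = p
   chain-good : ¬ Bad k[z] -> ∀ l -> ¬ Bad (chain l)
   chain-good nb [] = nb
   chain-good nb (f ∷ l) (r , inl p , e) = chain-good nb l (r , p , e)
   chain-good nb (f ∷ l) (r , inr (nb' , p) , e) = nb' (r , p , e)
   chain-++ : ∀ l l' {a} -> chain l' a -> chain (l ++ l') a
   chain-++ [] l' p = p
   chain-++ (f ∷ l) l' p = inl (chain-++ l l' p)
   stage : ℕ -> List Carrier
   stage zero = []
   stage (suc d) = fractions d ++ stage d
   stage-mono : ∀ {d d'} -> d ℕ.≤ d' -> ∀ {a} -> chain (stage d) a -> chain (stage d') a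
   stage-mono {d} le p with ℕₚ.≤⇒≤′ le
   ... | le' = go le'
    where
    go : ∀ {d'} -> d ℕ.≤′ d' -> chain (stage d') _
    go ℕ.≤′-refl = p
    go {suc d'} (ℕ.≤′-step le) = chain-++ (fractions d') (stage d') (go le)
   Limit : Carrier -> Set
   Limit a = ∃ λ d -> chain (stage d) a
   limit-subring : Subring Limit
   limit-subring = record
    { resp = λ { e (d , p) -> d , Subring.resp (chain-subring (stage d)) e p }
    ; const∈ = λ c -> 0 , Subring.const∈ (chain-subring []) c
    ; +∈ = λ { (d , p) (d' , r) -> d ℕ.⊔ d' , Subring.+∈ (chain-subring (stage (d ℕ.⊔ d')))
     (stage-mono (ℕₚ.m≤m⊔n d d') p) (stage-mono (ℕₚ.m≤n⊔m d d') r) }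
    ; *∈ = λ { (d , p) (d' , r) -> d ℕ.⊔ d' , Subring.*∈ (chain-subring (stage (d ℕ.⊔ d')))
     (stage-mono (ℕₚ.m≤m⊔n d d') p) (stage-mono (ℕₚ.m≤n⊔m d d') r) } }
   -- Every f occurs in some `fractions d`. When its turn came, adjoining it to a ring smaller than
   -- the limit left z a non-unit as well, so it was adjoined.
   limit-maximal : ∀ f -> ¬ Bad (Adjoin Limit f) -> Limit f
   limit-maximal f nb with fractions-∋ f
   ... | d , f∈ = suc d , go (fractions d) f∈ (λ p -> suc d , p)
    where
    go : ∀ l -> Any (f ≈_) l -> (∀ {a} -> chain (l ++ stage d) a -> Limit a) -> chain (l ++ stage d) f
    go (g ∷ l) (there p) up = inl (go l p (up ∘ inl))
    go (g ∷ l) (here e) up = inr (nb' , adj.resp (sym e) (adjoin-self (chain-subring (l ++ stage d)) g))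
     where
     module adj = Subring (adjoin-subring (chain-subring (l ++ stage d)) g)
     nb' : ¬ Bad (Adjoin (chain (l ++ stage d)) g)
     nb' (r , (rs , p , e') , e″) = nb (r , (rs , All.map (up ∘ inl) p , trans e' (horner-cong rs)) , e″)
      where
      horner-cong : ∀ rs -> horner rs g ≈ horner rs f
      horner-cong [] = refl
      horner-cong (r ∷ rs) = +ˡ (*-cong (sym e) (horner-cong rs))
   -- Chevalley's argument: a subring maximal among those in which z is not a unit is a valuation
   -- ring. Its value group is then shown to be ℤ by means of `relation-mod-y`.
   module MaximalRing (R : Carrier -> Set) (sR : Subring R) (good : ¬ Bad R) (z∈ : R z)
    (maximal : ∀ f -> ¬ Bad (Adjoin R f) -> R f) where
    open Subring sR
    pow : Carrier -> ℕ -> Carrier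
    pow a zero = 1#
    pow a (suc n) = a * pow a n
    pow-+ : ∀ a m n -> pow a (m ℕ.+ n) ≈ pow a m * pow a n
    pow-+ a zero n = sym (*-idˡ _)
    pow-+ a (suc m) n = trans (*ˡ (pow-+ a m n)) (sym (*-assoc _ _ _))
    pow≉0 : ∀ {a} n -> a ≉0 -> pow a n ≉0
    pow≉0 zero p = 1≉0
    pow≉0 (suc n) p = *≉0 p (pow≉0 n p)
    pow∈ : ∀ {a} n -> R a -> R (pow a n)
    pow∈ zero p = 1∈
    pow∈ (suc n) p = *∈ p (pow∈ n p)
    1-z≉0 : ∀ {b} -> R b -> 1# - z * b ≉0
    1-z≉0 {b} p e = good (b , p , x-y≈0⇒x≈y e)
    -- Suppose that adjoining the inverse of w = 1 - z b makes z a unit. Clearing denominators gives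
    -- w^N = z s with s in R, while w^N = 1 - z c by expansion, so 1 = z (c + s) already in R.
    1-z-unit : ∀ {b} -> R b -> R (inv (1# - z * b))
    1-z-unit {b} p = maximal (inv w) bad
     where
     w = 1# - z * b
     w∈ : R w
     w∈ = +∈ 1∈ (neg∈ (*∈ z∈ p))
     clear : ∀ rs -> All R rs -> ∃ λ N -> ∃ λ r -> R r × pow w N * horner rs (inv w) ≈ r
     clear [] [] = 0 , 0# , 0∈ , zeroʳ 1#
     clear (r ∷ rs) (r∈ ∷ rs∈) with clear rs rs∈
     ... | N , s , s∈ , e = suc N , w * pow w N * r + s , +∈ (*∈ (*∈ w∈ (pow∈ N w∈)) r∈) s∈ , (begin
      w * pow w N * (r + inv w * horner rs (inv w))
       ≈⟨ solve 5 (λ w p r i h -> w :* p :* (r :+ i :* h) := w :* p :* r :+ (w :* i) :* (p :* h)) w _ r _ _ ⟩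
      w * pow w N * r + w * inv w * (pow w N * horner rs (inv w))
       ≈⟨ +ˡ (trans (*-cong (inv-r (1-z≉0 p)) e) (*-idˡ s)) ⟩
      w * pow w N * r + s ∎)
     power : ∀ N -> ∃ λ b -> R b × pow w N ≈ 1# - z * b
     power zero = 0# , 0∈ , solve 1 (λ z -> con 1ℤ := con 1ℤ :- z :* con 0ℤ) z
     power (suc N) with power N
     ... | b' , b'∈ , e = b + b' - z * b * b' , +∈ (+∈ p b'∈) (neg∈ (*∈ (*∈ z∈ p) b'∈)) , trans (*ˡ e)
      (solve 3 (λ z b c -> (con 1ℤ :- z :* b) :* (con 1ℤ :- z :* c) := con 1ℤ :- z :* (b :+ c :- z :* b :* c)) z b b')
     bad : ¬ Bad (Adjoin R (inv w))
     bad (r , (rs , rs∈ , e) , e1) with clear rs rs∈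
     ... | N , s , s∈ , e2 with power N
     ... | c , c∈ , e3 = good (c + s , +∈ c∈ s∈ , (begin
      1# ≈⟨ solve 2 (λ z c -> con 1ℤ := z :* c :+ (con 1ℤ :- z :* c)) z c ⟩
      z * c + (1# - z * c) ≈⟨ +ˡ e3 ⟨
      z * c + pow w N ≈⟨ +ˡ (trans (sym (*-idʳ _)) (*ˡ (trans e1 (*ˡ e)))) ⟩
      z * c + pow w N * (z * horner rs (inv w))
       ≈⟨ solve 4 (λ z c p h -> z :* c :+ p :* (z :* h) := z :* c :+ z :* (p :* h)) z c _ _ ⟩
      z * c + z * (pow w N * horner rs (inv w)) ≈⟨ +ˡ (*ˡ e2) ⟩
      z * c + z * s ≈⟨ distribˡ z c s ⟨
      z * (c + s) ∎))
    -- Horner form with the leading coefficient first.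
    top : List Carrier -> Carrier -> Carrier
    top [] f = 0#
    top (r ∷ rs) f = r * pow f (length rs) + top rs f
    private
     horner-++ : ∀ rs r f -> horner (rs ++ r ∷ []) f ≈ r * pow f (length rs) + horner rs f
     horner-++ [] r f = solve 2 (λ r f -> r :+ f :* con 0ℤ := r :* con 1ℤ :+ con 0ℤ) r f
     horner-++ (s ∷ rs) r f = trans (+ˡ (*ˡ (horner-++ rs r f)))
      (solve 5 (λ s f r p h -> s :+ f :* (r :* p :+ h) := r :* (f :* p) :+ (s :+ f :* h)) s f r _ _)
     top-reverse : ∀ rs f -> top rs f ≈ horner (List.reverse rs) f
     top-reverse [] f = refl
     top-reverse (r ∷ rs) f = begin
      r * pow f (length rs) + top rs f
       ≈⟨ +-cong (reflexive (ap (λ n -> r * pow f n) (≡.sym (Listₚ.length-reverse rs)))) (top-reverse rs f) ⟩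
      r * pow f (length (List.reverse rs)) + horner (List.reverse rs) f ≈⟨ horner-++ (List.reverse rs) r f ⟨
      horner (List.reverse rs ++ r ∷ []) f ≡⟨ ap (λ l -> horner l f) (Listₚ.unfold-reverse r rs) ⟨
      horner (List.reverse (r ∷ rs)) f ∎
     reverse∈ : ∀ {rs} -> All R rs -> All R (List.reverse rs)
     reverse∈ [] = []
     reverse∈ {r ∷ rs} (p ∷ ps) = subst (All R) (≡.sym (Listₚ.unfold-reverse r rs)) (Allₚ.++⁺ (reverse∈ ps) (p ∷ []))
     add-top : List Carrier -> List Carrier -> List Carrier
     add-top [] ss = []
     add-top (r ∷ rs) [] = r ∷ rs
     add-top (r ∷ rs) (s ∷ ss) = (r + s) ∷ add-top rs ss
     length-add-top : ∀ rs ss -> length (add-top rs ss) ≡ length rs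
     length-add-top [] ss = ≡.refl
     length-add-top (r ∷ rs) [] = ≡.refl
     length-add-top (r ∷ rs) (s ∷ ss) = ap suc (length-add-top rs ss)
     add-top∈ : ∀ {rs ss} -> All R rs -> All R ss -> All R (add-top rs ss)
     add-top∈ [] _ = []
     add-top∈ (p ∷ ps) [] = p ∷ ps
     add-top∈ (p ∷ ps) (r ∷ rs) = +∈ p r ∷ add-top∈ ps rs
     top-add : ∀ {f g} -> f * g ≈ 1# -> ∀ rs ss -> length ss ℕ.≤ length rs ->
      top (add-top rs ss) f ≈ top rs f + pow f (length rs) * (g * horner ss g)
     top-add {f} {g} fg [] [] _ = solve 1 (λ g -> con 0ℤ := con 0ℤ :+ con 1ℤ :* (g :* con 0ℤ)) g
     top-add {f} {g} fg (r ∷ rs) [] _ = solve 3 (λ x p g -> x := x :+ p :* (g :* con 0ℤ)) _ _ g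
     top-add {f} {g} fg (r ∷ rs) (s ∷ ss) (ℕ.s≤s le) = begin
      (r + s) * pow f (length (add-top rs ss)) + top (add-top rs ss) f
       ≈⟨ +-cong (*ˡ (reflexive (ap (pow f) (length-add-top rs ss)))) (top-add fg rs ss le) ⟩
      (r + s) * p + (top rs f + p * (g * h))
       ≈⟨ solve 6 (λ r s p t g h -> (r :+ s) :* p :+ (t :+ p :* (g :* h)) := r :* p :+ t :+ con 1ℤ :* p :* (s :+ g :* h)) r s p _ g h ⟩
      r * p + top rs f + 1# * p * (s + g * h) ≈⟨ +ˡ (*ʳ (*ʳ fg)) ⟨
      r * p + top rs f + f * g * p * (s + g * h)
       ≈⟨ +ˡ (solve 4 (λ f g p x -> f :* g :* p :* x := f :* p :* (g :* x)) f g p _) ⟩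
      r * p + top rs f + f * p * (g * (s + g * h)) ∎
      where
      p = pow f (length rs)
      h = horner ss g
     -- The relation for g gives 1 - z s = z g h, and 1 - z s is a unit of R. Hence the top term r
     -- f^n equals a multiple of g h f^n, which by f g = 1 involves lower powers of f only.
     reduce : ∀ {f g} -> f * g ≈ 1# -> ∀ r rs s ss -> All R (r ∷ rs) -> All R (s ∷ ss) ->
      length ss ℕ.≤ length rs -> 1# ≈ z * top (r ∷ rs) f -> 1# ≈ z * horner (s ∷ ss) g ->
      ∃ λ rs' -> All R rs' × length rs' ≡ length rs × 1# ≈ z * top rs' f
     reduce {f} {g} fg r rs s ss (r∈ ∷ rs∈) (s∈ ∷ ss∈) le e e' =
      add-top rs ss' , add-top∈ rs∈ (scale∈ sR f x∈ ss∈) , length-add-top rs ss' , (begin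
       1# ≈⟨ e ⟩
       z * (r * p + top rs f) ≈⟨ *ˡ (trans (+-comm _ _) (+ˡ eq)) ⟩
       z * (top rs f + p * (g * horner ss' g))
        ≈⟨ *ˡ (top-add fg rs ss' (subst (ℕ._≤ length rs) (≡.sym (Listₚ.length-map (x *_) ss)) le)) ⟨
       z * top (add-top rs ss') f ∎)
      where
      w = 1# - z * s
      x = z * r * inv w
      x∈ = *∈ (*∈ z∈ r∈) (1-z-unit s∈)
      ss' = List.map (x *_) ss
      p = pow f (length rs)
      h = horner ss g
      w≈ : w ≈ z * (g * h)
      w≈ = begin
       1# - z * s ≈⟨ +ʳ e' ⟩
       z * (s + g * h) - z * s ≈⟨ solve 3 (λ z s y -> z :* (s :+ y) :- z :* s := z :* y) z s _ ⟩
       z * (g * h) ∎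
      eq : r * p ≈ p * (g * horner ss' g)
      eq = begin
       r * p ≈⟨ *-idˡ _ ⟨
       1# * (r * p) ≈⟨ *ʳ (trans (sym (inv-l (1-z≉0 s∈))) (*ˡ w≈)) ⟩
       inv w * (z * (g * h)) * (r * p)
        ≈⟨ solve 6 (λ i z g h r p -> i :* (z :* (g :* h)) :* (r :* p) := p :* (g :* (z :* r :* i :* h))) _ z g h r p ⟩
       p * (g * (x * h)) ≈⟨ *ˡ (*ˡ (horner-scale sR g x ss)) ⟨
       p * (g * horner ss' g) ∎
     swap-top : ∀ {rs f} -> 1# ≈ z * horner rs f -> 1# ≈ z * top (List.reverse rs) f
     swap-top {rs} {f} e = trans e (*ˡ (sym (trans (top-reverse (List.reverse rs) f)
      (reflexive (ap (λ l -> horner l f) (Listₚ.reverse-involutive rs))))))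
     -- Induction on the total length of the two relations: the longer one loses its top term by
     -- means of the other. At length 0 a relation reads 1 = 0.
     not-both : ∀ n {f g} -> f * g ≈ 1# -> ∀ rs ss -> All R rs -> All R ss ->
      length rs ℕ.+ length ss ℕ.≤ n -> 1# ≈ z * horner rs f -> 1# ≈ z * horner ss g -> ⊥
     not-both n fg [] ss _ _ _ e _ = 1≉0 (trans e (zeroʳ z))
     not-both n fg (r ∷ rs) [] _ _ _ _ e = 1≉0 (trans e (zeroʳ z))
     not-both (suc n) {f} {g} fg rs@(_ ∷ rs₀) ss@(_ ∷ ss₀) rs∈ ss∈ (ℕ.s≤s le) e e' with ℕₚ.≤-total (length ss) (length rs)
     ... | inl le' = go (List.reverse rs) (Listₚ.length-reverse rs) (reverse∈ rs∈) (swap-top {rs} e)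
      where
      go : ∀ rs' -> length rs' ≡ length rs -> All R rs' -> 1# ≈ z * top rs' f -> ⊥
      go (r ∷ rs') l rs'∈ e1 with reduce fg r rs' _ _ rs'∈ ss∈
       (ℕₚ.≤-pred (subst (length ss ℕ.≤_) (≡.sym l) le')) e1 e'
      ... | rs″ , rs″∈ , l″ , e2 = not-both n fg (List.reverse rs″) ss (reverse∈ rs″∈) ss∈
       (subst (λ m -> m ℕ.+ length ss ℕ.≤ n) (≡.sym (≡.trans (Listₚ.length-reverse rs″) (≡.trans l″ (ℕₚ.suc-injective l)))) le)
       (trans e2 (*ˡ (top-reverse rs″ f))) e'
     ... | inr le' = go (List.reverse ss) (Listₚ.length-reverse ss) (reverse∈ ss∈) (swap-top {ss} e')
      where
      go : ∀ ss' -> length ss' ≡ length ss -> All R ss' -> 1# ≈ z * top ss' g -> ⊥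
      go (s ∷ ss') l ss'∈ e1 with reduce (trans (*-comm g f) fg) s ss' _ _ ss'∈ rs∈
       (ℕₚ.≤-pred (subst (length rs ℕ.≤_) (≡.sym l) le')) e1 e
      ... | ss″ , ss″∈ , l″ , e2 = not-both n fg rs (List.reverse ss″) rs∈ (reverse∈ ss″∈)
       (subst (λ m -> length rs ℕ.+ m ℕ.≤ n) (≡.sym (≡.trans (Listₚ.length-reverse ss″) (≡.trans l″ (ℕₚ.suc-injective l))))
        (subst (ℕ._≤ n) (ℕₚ.+-suc (length rs₀) (length ss₀)) le))
       e (trans e2 (*ˡ (top-reverse ss″ g)))
    valuation-ring : ∀ {f} -> f ≉0 -> ¬ R f -> R (inv f)
    valuation-ring {f} f≉0 f∉ = dne λ f⁻¹∉ ->
     let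
      r , (rs , rs∈ , e) , e1 = dne (λ nb -> f∉ (maximal f nb))
      s , (ss , ss∈ , e') , e2 = dne (λ nb -> f⁻¹∉ (maximal (inv f) nb))
     in not-both _ (inv-r f≉0) rs ss rs∈ ss∈ ℕₚ.≤-refl (trans e1 (*ˡ e)) (trans e2 (*ˡ e'))
    M : Carrier -> Set
    M a = R a × (a ≉0 -> ¬ R (inv a))
    M-resp : ∀ {a b} -> a ≈ b -> M a -> M b
    M-resp e (p , n) = resp e p , λ b≉0 h -> n (≉0-resp (sym e) b≉0) (resp (inv-cong (sym e)) h)
    M-* : ∀ {r a} -> R r -> M a -> M (r * a)
    M-* {r} {a} r∈ (a∈ , n) = *∈ r∈ a∈ , λ ra≉0 h -> n (≉0ʳ ra≉0) (resp (trans (*ˡ (inv-* (≉0ˡ ra≉0) (≉0ʳ ra≉0)))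
      (trans (sym (*-assoc _ _ _)) (trans (*ʳ (inv-r (≉0ˡ ra≉0))) (*-idˡ _)))) (*∈ r∈ h))
    M-+ : ∀ {a b} -> M a -> M b -> M (a + b)
    M-+ {a} {b} p r = go em em em
     where
     divide : ∀ {a b} -> b ≉0 -> R (a * inv b) -> M b -> M (a + b)
     divide {a} {b} b≉0 h r = M-resp (begin
      (a * inv b + 1#) * b ≈⟨ solve 3 (λ a i b -> (a :* i :+ con 1ℤ) :* b := a :* (i :* b) :+ b) a _ b ⟩
      a * (inv b * b) + b ≈⟨ +ʳ (trans (*ˡ (inv-l b≉0)) (*-idʳ a)) ⟩
      a + b ∎) (M-* (+∈ h 1∈) r)
     go : Dec (a ≈ 0#) -> Dec (b ≈ 0#) -> Dec (R (a * inv b)) -> M (a + b)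
     go (yes e) _ _ = M-resp (trans (sym (+-idˡ b)) (+ʳ (sym e))) r
     go (no _) (yes e) _ = M-resp (trans (sym (+-idʳ a)) (+ˡ (sym e))) p
     go (no _) (no b≉0) (yes h) = divide b≉0 h r
     go (no a≉0) (no b≉0) (no h) = M-resp (+-comm b a) (divide a≉0 (resp eq (valuation-ring (*≉0 a≉0 (inv≉0 b≉0)) h)) p)
      where
      eq : inv (a * inv b) ≈ b * inv a
      eq = trans (inv-* a≉0 (inv≉0 b≉0)) (trans (*ˡ (inv-inv b≉0)) (*-comm _ _))
    M-neg : ∀ {a} -> M a -> M (- a)
    M-neg {a} p = M-resp (solve 1 (λ a -> (:- con 1ℤ) :* a := :- a) a) (M-* (neg∈ 1∈) p)
    M-const : ∀ {c} -> ¬ c k.≈ k.0# -> ¬ M (const c)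
    M-const {c} c≉0 (_ , n) = n (unit≉0 e) (resp (inv-unique e) (const∈ d))
     where
     d = fst (k.inverse c c≉0)
     e : const c * const d ≈ 1#
     e = trans (sym (κ-* c d)) (trans (κ-cong (snd (k.inverse c c≉0))) κ-1)
    0∈M : M 0#
    0∈M = 0∈ , λ p -> ⊥-elim (p refl)
    M-z : M z
    M-z = z∈ , λ p h -> good (inv z , h , sym (inv-r p))
    cancel-middle : ∀ a {b} c -> b ≉0 -> (a * inv b) * (b * c) ≈ a * c
    cancel-middle a {b} c p = begin
     a * inv b * (b * c) ≈⟨ solve 4 (λ a i b c -> a :* i :* (b :* c) := a :* (i :* b) :* c) a _ b c ⟩
     a * (inv b * b) * c ≈⟨ *ʳ (trans (*ˡ (inv-l p)) (*-idʳ a)) ⟩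
     a * c ∎
    -- The elements have strictly increasing values, all below that of y. The term of least value
    -- cannot be cancelled by the others or by y w, so its coefficient is 0, and the argument
    -- repeats.
    chain-independent : ∀ {m} (u : Fin m -> Carrier) y -> (∀ i -> u i ≉0) ->
     (∀ i j -> i Fin.< j -> M (u j * inv (u i))) -> (∀ i -> M (y * inv (u i))) ->
     ∀ c {w} -> R w -> lin u c ≈ y * w -> ∀ i -> c i k.≈ k.0#
    chain-independent {suc m} u y u≉0 incr lt c {w} w∈ e = go
     where
     i0 = inv (u zero)
     lin-M : ∀ {n} (v : Fin n -> Carrier) d -> (∀ i -> M (v i)) -> M (lin v d)
     lin-M {zero} v d h = 0∈M
     lin-M {suc n} v d h = M-+ (M-* (const∈ (d zero)) (h zero)) (lin-M (v ∘ suc) (d ∘ suc) (h ∘ suc))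
     c0≈0 : c zero k.≈ k.0#
     c0≈0 = dne λ c0≉0 -> M-const c0≉0 (M-resp (begin
      w * (y * i0) - lin (λ i -> i0 * u (suc i)) (c ∘ suc) ≈⟨ +ˡ (-‿cong (lin-scale (u ∘ suc) i0 (c ∘ suc))) ⟩
      w * (y * i0) - i0 * lin (u ∘ suc) (c ∘ suc)
       ≈⟨ solve 4 (λ w y i l -> w :* (y :* i) :- i :* l := i :* (y :* w) :- i :* l) w y i0 _ ⟩
      i0 * (y * w) - i0 * lin (u ∘ suc) (c ∘ suc) ≈⟨ +ʳ (*ˡ e) ⟨
      i0 * (const (c zero) * u zero + lin (u ∘ suc) (c ∘ suc)) - i0 * lin (u ∘ suc) (c ∘ suc)
       ≈⟨ solve 4 (λ i c u l -> i :* (c :* u :+ l) :- i :* l := c :* (u :* i)) i0 _ _ _ ⟩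
      const (c zero) * (u zero * i0) ≈⟨ trans (*ˡ (inv-r (u≉0 zero))) (*-idʳ _) ⟩
      const (c zero) ∎)
      (M-+ (M-* w∈ (lt zero)) (M-neg (lin-M _ (c ∘ suc) (λ i -> M-resp (*-comm _ _) (incr zero (suc i) (ℕ.s≤s ℕ.z≤n)))))))
     go : ∀ i -> c i k.≈ k.0#
     go zero = c0≈0
     go (suc i) = chain-independent (u ∘ suc) y (u≉0 ∘ suc) (λ i j lt -> incr (suc i) (suc j) (ℕ.s≤s lt)) (lt ∘ suc)
      (c ∘ suc) w∈ (trans (sym (trans (+ʳ (trans (*ʳ (trans (κ-cong c0≈0) κ-0)) (zeroˡ _))) (+-idˡ _))) e) i
    -- A chain of values between that of 1 and that of y.
    record Chain (y : Carrier) : Set where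
     field
      u : Fin (suc (degree-bound y)) -> Carrier
      u≉0 : ∀ i -> u i ≉0
      u∈ : ∀ i -> R (u i)
      incr : ∀ i j -> i Fin.< j -> M (u j * inv (u i))
      below : ∀ i -> M (y * inv (u i))
    -- A chain is independent modulo y R, yet it has one element more than `relation-mod-y` permits.
    chain-bounded : ∀ y -> y ≉0 -> R y -> ¬ Chain y
    chain-bounded y y≉0 y∈ r = let c , (i , ne) , w , w∈ , e = relation in ne (trivial c {w} w∈ e i)
     where
     open Chain r
     relation : ∃ λ c -> Nontrivial c × ∃ λ w -> R w × lin u c ≈ y * w
     relation = relation-mod-y y y≉0 R subspace (*∈ y∈) u u∈
     trivial : ∀ c {w} -> R w -> lin u c ≈ y * w -> ∀ i -> c i k.≈ k.0#
     trivial c {w} w∈ e = chain-independent {suc (degree-bound y)} u y u≉0 incr below c {w} w∈ e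
    -- Otherwise every element of M has a further one of smaller value in M, and descending from z
    -- produces too long a chain.
    unif : ∃ λ π -> π ≉0 × M π × (∀ {a} -> M a -> R (a * inv π))
    unif = dne λ none -> chain-bounded z z≉0 z∈ (let
     next : ∀ p -> p ≉0 -> M p -> ∃ λ a -> M a × ¬ R (a * inv p)
     next p p≉0 p∈ = dne λ no -> none (p , p≉0 , p∈ , λ {a} a∈ -> dne λ h -> no (a , a∈ , h))
     in descend next)
     where
     descend : (∀ p -> p ≉0 -> M p -> ∃ λ a -> M a × ¬ R (a * inv p)) -> Chain z
     descend next = record
      { u = u ; u≉0 = λ i -> seq≉0 (idx i) ; u∈ = λ i -> fst (seq∈ (idx i))
      ; incr = λ i j lt -> rel {idx j} {idx i} (ℕ.s≤s (ℕₚ.∸-monoʳ-< lt (ℕₚ.≤-pred (Finₚ.toℕ<n j))))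
      ; below = λ i -> rel {0} {idx i} (ℕ.s≤s ℕ.z≤n) }
      where
      nonzero : ∀ {a p} -> ¬ R (a * inv p) -> a ≉0
      nonzero h e = h (resp (sym (trans (*ʳ e) (zeroˡ _))) 0∈)
      seq : ℕ -> ∃ λ p -> p ≉0 × M p
      seq zero = z , z≉0 , M-z
      seq (suc n) with seq n
      ... | p , p≉0 , p∈ with next p p≉0 p∈
      ... | a , a∈ , h = a , nonzero h , a∈
      val : ℕ -> Carrier
      val n = fst (seq n)
      seq≉0 : ∀ n -> val n ≉0
      seq≉0 n = fst (snd (seq n))
      seq∈ : ∀ n -> M (val n)
      seq∈ n = snd (snd (seq n))
      step : ∀ n -> M (val n * inv (val (suc n)))
      step n with seq n
      ... | p , p≉0 , p∈ with next p p≉0 p∈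
      ... | a , a∈ , h = resp eq (valuation-ring (*≉0 (nonzero h) (inv≉0 p≉0)) h)
       , λ _ r -> h (resp (trans (inv-cong (sym eq)) (inv-inv (*≉0 (nonzero h) (inv≉0 p≉0)))) r)
       where
       eq : inv (a * inv p) ≈ p * inv a
       eq = trans (inv-* (nonzero h) (inv≉0 p≉0)) (trans (*ˡ (inv-inv p≉0)) (*-comm _ _))
      rel' : ∀ {m n} -> m ℕ.≤′ n -> M (val m * inv (val (suc n)))
      rel' {m} ℕ.≤′-refl = step m
      rel' {m} {suc n} (ℕ.≤′-step le) = M-resp (cancel-middle (val m) _ (seq≉0 (suc n))) (M-* (fst (rel' le)) (step (suc n)))
      rel : ∀ {m n} -> m ℕ.< n -> M (val m * inv (val n))
      rel {m} {suc n} (ℕ.s≤s le) = rel' (ℕₚ.≤⇒≤′ le)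
      -- The values of the sequence descend, so it is read backwards. Index 0 is z itself and is
      -- left out, as the chain has to stay strictly below z.
      idx : Fin (suc (degree-bound z)) -> ℕ
      idx i = suc (degree-bound z ℕ.∸ Fin.toℕ i)
      u : Fin (suc (degree-bound z)) -> Carrier
      u i = val (idx i)
    U : Carrier -> Set
    U a = a ≉0 × R a × R (inv a)
    U-* : ∀ {a b} -> U a -> U b -> U (a * b)
    U-* (p , r , s) (p' , r' , s') = *≉0 p p' , *∈ r r' , resp (sym (inv-* p p')) (*∈ s s')
    U-inv : ∀ {a} -> U a -> U (inv a)
    U-inv (p , r , s) = inv≉0 p , s , resp (sym (inv-inv p)) r
    ¬U-M : ∀ {a} -> a ≉0 -> R a -> ¬ U a -> M a
    ¬U-M p r n = r , λ _ s -> n (p , r , s)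
    π : Carrier
    π = fst unif
    π≉0 : π ≉0
    π≉0 = fst (snd unif)
    π∈M : M π
    π∈M = fst (snd (snd unif))
    π-divides : ∀ {a} -> M a -> R (a * inv π)
    π-divides = snd (snd (snd unif))
    πⁿ≉0 : ∀ n -> pow π n ≉0
    πⁿ≉0 n = pow≉0 n π≉0
    π^suc∈M : ∀ n -> M (pow π (suc n))
    π^suc∈M n = M-resp (*-comm _ _) (M-* (pow∈ n (fst π∈M)) π∈M)
    -- If no quotient of a by a power of π were a unit, all powers of π would divide a without
    -- reaching its value, and they would form an arbitrarily long chain.
    factor : ∀ {a} -> a ≉0 -> R a -> ∃ λ n -> U (a * inv (pow π n))
    factor {a} a≉0 a∈ = dne λ none -> chain-bounded a a≉0 a∈ record
     { u = u ; u≉0 = λ i -> πⁿ≉0 (Fin.toℕ i) ; u∈ = λ i -> pow∈ (Fin.toℕ i) (fst π∈M)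
     ; incr = λ i j lt -> ratio {Fin.toℕ i} {Fin.toℕ j} lt
     ; below = λ i -> ¬U-M (*≉0 a≉0 (inv≉0 (πⁿ≉0 (Fin.toℕ i)))) (quotient∈ none (Fin.toℕ i)) (λ h -> none (Fin.toℕ i , h)) }
     where
     u : Fin (suc (degree-bound a)) -> Carrier
     u i = pow π (Fin.toℕ i)
     quotient∈ : ¬ (∃ λ n -> U (a * inv (pow π n))) -> ∀ n -> R (a * inv (pow π n))
     quotient∈ none zero = resp (sym (trans (*ˡ (sym (inv-unique (*-idˡ 1#)))) (*-idʳ a))) a∈
     quotient∈ none (suc n) = resp (trans (*-assoc _ _ _) (*ˡ (trans (*-comm _ _) (sym (inv-* π≉0 (πⁿ≉0 n))))))
      (π-divides (¬U-M (*≉0 a≉0 (inv≉0 (πⁿ≉0 n))) (quotient∈ none n) (λ h -> none (n , h))))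
     ratio : ∀ {m n} -> m ℕ.< n -> M (pow π n * inv (pow π m))
     ratio {m} {n} lt = M-resp (begin
      pow π (suc d) ≈⟨ x*[y*inv-x] _ (πⁿ≉0 m) ⟨
      pow π m * (pow π (suc d) * inv (pow π m)) ≈⟨ *-assoc _ _ _ ⟨
      pow π m * pow π (suc d) * inv (pow π m) ≈⟨ *ʳ (pow-+ π m (suc d)) ⟨
      pow π (m ℕ.+ suc d) * inv (pow π m)
       ≡⟨ ap (λ l -> pow π l * inv (pow π m)) (≡.trans (ℕₚ.+-suc m d) (ℕₚ.m+[n∸m]≡n lt)) ⟩
      pow π n * inv (pow π m) ∎) (π^suc∈M d)
      where d = n ℕ.∸ suc m
    -- a has value i − j.
    V : Carrier -> ℤ -> Set
    V a n = ∃ λ i -> ∃ λ j -> n ≡ Z.+ i Z.- Z.+ j × ∃ λ u -> U u × a * pow π j ≈ u * pow π i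
    V-resp : ∀ {a b n} -> a ≈ b -> V a n -> V b n
    V-resp e (i , j , p , u , u∈ , r) = i , j , p , u , u∈ , trans (*ʳ (sym e)) r
    V-* : ∀ {a b m n} -> V a m -> V b n -> V (a * b) (m Z.+ n)
    V-* {a} {b} (i , j , ≡.refl , u , u∈ , r) (i' , j' , ≡.refl , u' , u∈' , r') = i ℕ.+ i' , j ℕ.+ j'
     , solveℤ 4 (λ i j i' j' -> (i :- j) :+ (i' :- j') := (i :+ i') :- (j :+ j')) (Z.+ i) (Z.+ j) (Z.+ i') (Z.+ j')
     , u * u' , U-* u∈ u∈' , (begin
      a * b * pow π (j ℕ.+ j') ≈⟨ *ˡ (pow-+ π j j') ⟩
      a * b * (pow π j * pow π j') ≈⟨ solve 4 (λ a b x y -> a :* b :* (x :* y) := (a :* x) :* (b :* y)) a b _ _ ⟩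
      (a * pow π j) * (b * pow π j') ≈⟨ *-cong r r' ⟩
      (u * pow π i) * (u' * pow π i') ≈⟨ solve 4 (λ a b x y -> (a :* x) :* (b :* y) := a :* b :* (x :* y)) u u' _ _ ⟩
      u * u' * (pow π i * pow π i') ≈⟨ *ˡ (pow-+ π i i') ⟨
      u * u' * pow π (i ℕ.+ i') ∎)
    V-inv : ∀ {a n} -> a ≉0 -> V a n -> V (inv a) (Z.- n)
    V-inv {a} a≉0 (i , j , ≡.refl , u , u∈ , r) = j , i , solveℤ 2 (λ i j -> :- (i :- j) := j :- i) (Z.+ i) (Z.+ j)
     , inv u , U-inv u∈ , *-cancelˡ (*≉0 a≉0 (fst u∈)) (begin
      a * u * (inv a * pow π i) ≈⟨ solve 4 (λ a u b p -> a :* u :* (b :* p) := (a :* b) :* (u :* p)) a u _ _ ⟩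
      (a * inv a) * (u * pow π i) ≈⟨ *-cong (trans (inv-r a≉0) (sym (inv-r (fst u∈)))) (sym r) ⟩
      (u * inv u) * (a * pow π j) ≈⟨ solve 4 (λ a u b p -> (u :* b) :* (a :* p) := a :* u :* (b :* p)) a u _ _ ⟩
      a * u * (inv u * pow π j) ∎)
    V-∈ : ∀ {a n} -> a ≉0 -> R a -> V a n -> 0ℤ ≤ n
    V-∈ {a} a≉0 a∈ (i , j , ≡.refl , u , u∈ , r) = i≤j⇒0≤j-i {Z.+ j} {Z.+ i} (Z.+≤+ (ℕₚ.≮⇒≥ {i} {j} i≮j))
     where
     d = j ℕ.∸ suc i
     i≮j : ¬ i ℕ.< j
     i≮j lt = snd (M-resp eq (M-* a∈ (π^suc∈M d))) (fst u∈) (snd (snd u∈))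
      where
      eq : a * pow π (suc d) ≈ u
      eq = *-cancelˡ (πⁿ≉0 i) (begin
       pow π i * (a * pow π (suc d)) ≈⟨ solve 3 (λ x a y -> x :* (a :* y) := a :* (x :* y)) (pow π i) a (pow π (suc d)) ⟩
       a * (pow π i * pow π (suc d)) ≈⟨ *ˡ (pow-+ π i (suc d)) ⟨
       a * pow π (i ℕ.+ suc d) ≡⟨ ap (λ l -> a * pow π l) (≡.trans (ℕₚ.+-suc i d) (ℕₚ.m+[n∸m]≡n lt)) ⟩
       a * pow π j ≈⟨ r ⟩
       u * pow π i ≈⟨ *-comm u _ ⟩
       pow π i * u ∎)
    V-U : ∀ {a} -> U a -> V a 0ℤ
    V-U u∈ = 0 , 0 , ≡.refl , _ , u∈ , refl
    V-unique : ∀ {a m n} -> a ≉0 -> V a m -> V a n -> m ≡ n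
    V-unique {a} {m} {n} a≉0 p r = ≤-antisym (le r p) (le p r)
     where
     le : ∀ {m n} -> V a m -> V a n -> n ≤ m
     le {m} {n} p r = 0≤i-j⇒j≤i (V-∈ 1≉0 1∈ (V-resp (inv-r a≉0) (V-* p (V-inv a≉0 r))))
    V-exists : ∀ a -> a ≉0 -> ∃ (V a)
    V-exists a a≉0 = go em
     where
     integral : ∀ {a} -> a ≉0 -> R a -> ∃ (V a)
     integral {a} a≉0 a∈ = let n , u∈ = factor a≉0 a∈ in
      Z.+ n Z.- Z.+ 0 , n , 0 , ≡.refl , a * inv (pow π n) , u∈
      , trans (*-idʳ a) (sym (trans (*-comm _ (pow π n)) (x*[y*inv-x] a (πⁿ≉0 n))))
     go : Dec (R a) -> ∃ (V a)
     go (yes a∈) = integral a≉0 a∈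
     go (no a∉) = let n , p = integral (inv≉0 a≉0) (valuation-ring a≉0 a∉) in
      Z.- n , V-resp (inv-inv a≉0) (V-inv (inv≉0 a≉0) p)
    val-dec : ∀ a -> Dec (a ≈ 0#) -> ℤ
    val-dec a (yes _) = 0ℤ
    val-dec a (no a≉0) = fst (V-exists a a≉0)
    val : Carrier -> ℤ
    val a = val-dec a em
    val-V : ∀ {a} -> a ≉0 -> V a (val a)
    val-V {a} a≉0 = go em
     where
     go : ∀ d -> V a (val-dec a d)
     go (yes e) = ⊥-elim (a≉0 e)
     go (no p) = snd (V-exists a p)
    V-ultra : ∀ {a b l m n} -> a ≉0 -> b ≉0 -> a + b ≉0 -> V a l -> V b m -> V (a + b) n -> l Z.⊓ m ≤ n
    V-ultra {a} {b} {l} {m} {n} a≉0 b≉0 s≉0 p r s = go em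
     where
     smaller : ∀ {a b l n} -> a ≉0 -> a + b ≉0 -> R (b * inv a) -> V a l -> V (a + b) n -> l ≤ n
     smaller {a} {b} a≉0 s≉0 h p s = 0≤i-j⇒j≤i (V-∈ (*≉0 s≉0 (inv≉0 a≉0))
      (resp (trans (+ʳ (sym (inv-r a≉0))) (sym (distribʳ _ a b))) (+∈ 1∈ h)) (V-* s (V-inv a≉0 p)))
     go : Dec (R (b * inv a)) -> l Z.⊓ m ≤ n
     go (yes h) = ≤-trans (ℤₚ.i⊓j≤i l m) (smaller a≉0 s≉0 h p s)
     go (no h) = ≤-trans (ℤₚ.i⊓j≤j l m) (smaller b≉0 (≉0-resp (+-comm a b) s≉0)
      (resp (trans (inv-* b≉0 (inv≉0 a≉0)) (trans (*ˡ (inv-inv a≉0)) (*-comm _ _)))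
       (valuation-ring (*≉0 b≉0 (inv≉0 a≉0)) h)) r (V-resp (+-comm a b) s))
    isPlace-val : Curve.IsPlace X val
    isPlace-val = record
     { cong = λ {a} {b} e -> val-cong e em em
     ; mult = λ p r -> V-unique (*≉0 p r) (val-V (*≉0 p r)) (V-* (val-V p) (val-V r))
     ; ultra = λ p r s -> V-ultra p r s (val-V p) (val-V r) (val-V s)
     ; norm = π , π≉0 , V-unique π≉0 (val-V π≉0) (1 , 0 , ≡.refl , 1# , (1≉0 , 1∈ , resp (inv-unique (*-idˡ 1#)) 1∈)
      , solve 1 (λ π -> π :* con 1ℤ := con 1ℤ :* (π :* con 1ℤ)) π)
     } , λ c c≉0 -> V-unique c≉0 (val-V c≉0) (V-U (dne λ n -> M-const (λ e -> c≉0 (trans (κ-cong e) κ-0)) (¬U-M c≉0 (const∈ c) n)))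
     where
     val-cong : ∀ {a b} -> a ≈ b -> (d : Dec (a ≈ 0#)) (d' : Dec (b ≈ 0#)) -> val-dec a d ≡ val-dec b d'
     val-cong e (yes _) (yes _) = ≡.refl
     val-cong e (yes p) (no n) = ⊥-elim (n (trans (sym e) p))
     val-cong e (no n) (yes p) = ⊥-elim (n (trans e p))
     val-cong e (no p) (no p') = V-unique p' (V-resp e (snd (V-exists _ p))) (snd (V-exists _ p'))
    -- Completeness of the curve enters here: the place constructed from R is the order at some
    -- closed point.
    positive-place : ∃ λ x -> 1ℤ ≤ Curve.ord X x z
    positive-place = let x , ord≡val = Curve.complete X val isPlace-val in x , subst (1ℤ ≤_) (≡.sym (ord≡val z z≉0))
     (i<j⇒suc[i]≤j (≤∧≢⇒< (V-∈ z≉0 z∈ (val-V z≉0)) λ e -> nonunit (subst (V z) (≡.sym e) (val-V z≉0))))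
     where
     nonunit : ¬ V z 0ℤ
     nonunit p = 1+≰ (≤-trans (≤-reflexive ≡.refl) (le p))
      where
      le : V z 0ℤ -> Z.suc 0ℤ ≤ 0ℤ
      le p = 0≤⇒≤ (V-∈ (*≉0 z≉0 (inv≉0 π≉0)) (π-divides M-z) (V-* p (V-inv π≉0
       (1 , 0 , ≡.refl , 1# , (1≉0 , 1∈ , resp (inv-unique (*-idˡ 1#)) 1∈)
       , solve 1 (λ π -> π :* con 1ℤ := con 1ℤ :* (π :* con 1ℤ)) π))))
   exists-place : ¬ Bad k[z] -> ∃ λ x -> 1ℤ ≤ Curve.ord X x z
   exists-place nb = MaximalRing.positive-place Limit limit-subring (λ { (r , (d , p) , e) -> chain-good nb (stage d) (r , p , e) })
    (0 , adjoin-self constants-subring z) limit-maximal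

 -- Regular functions, residue degrees and infinitude of points

 module PointTheory where
  open Curve X using (k; F; φ; const; q; eval)
  open Basics
  private module k = FieldLaws k
  open FieldLaws F
  open IntSolver (Field.ring F)
  open Reasoning
  open RingHom φ using () renaming (⟦⟧-cong to κ-cong; 0#-homo to κ-0; 1#-homo to κ-1; *-homo to κ-*; +-homo to κ-+; -‿homo to κ-neg)
  open Places using (module ExistsPlace; horner)
  module O (x : Point) = ValuationLemmas em F (fst (isPlace x))
  const-ball : ∀ x c -> O.B x 0ℤ (const c)
  const-ball x c c≉0 = ≤-reflexive (≡.sym (snd (isPlace x) c c≉0))
  const≉0 : ∀ {c} -> ¬ c k.≈ k.0# -> const c ≉0
  const≉0 {c} c≉0 = unit≉0 (trans (sym (κ-* _ _)) (trans (κ-cong (snd (k.inverse c c≉0))) κ-1))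
  ball-sub : ∀ x n -> Sub (O.B x n)
  ball-sub x n = record
   { resp = O.ball-resp x ; 0∈ = O.ball-0 x ; +∈ = O.ball-+ x ; *∈ = λ c -> O.ball-*ˡ x (const-ball x c) }
  module _ {y : Carrier} (y≉0 : y ≉0) (regular : ∀ x -> O.B x 0ℤ y) where
   private
    z = inv y
    open ExistsPlace z (inv≉0 y≉0) using (Bad; k[z]; Constants; exists-place)
   -- If z = 1 / y were not a unit of k[z], `exists-place` would give a zero of z, which is a pole
   -- of y.
   regular⇒algebraic : ∃ λ rs -> All Constants rs × 1# ≈ z * horner rs z
   regular⇒algebraic = let r , (rs , rs∈ , e) , e' = dne nb in rs , rs∈ , trans e' (*ˡ e)
    where
    nb : ¬ ¬ Bad k[z]
    nb h = let x , 1≤ = exists-place h in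
     1+≰ (≤-trans 1≤ (≤-trans (≤-reflexive (O.v-inv x y≉0)) (neg-mono-≤ (regular x y≉0))))
   -- A zero of y is a pole of z = 1 / y. A non-zero polynomial in z has order at most 0 there, so
   -- its product with z has a pole and cannot equal 1, against `regular⇒algebraic`.
   regular⇒unit : ∀ x -> ord x y ≡ 0ℤ
   regular⇒unit x = ≤-antisym (≮⇒≥ λ 0<y -> let rs , rs∈ , e = regular⇒algebraic in
    contra rs (pole 0<y) (value (pole 0<y) rs rs∈) e) (regular x y≉0)
    where
    module V = O x
    pole : 0ℤ < ord x y -> ord x z < 0ℤ
    pole lt = subst (_< 0ℤ) (≡.sym (V.v-inv y≉0)) (neg-mono-< lt)
    z* : ord x z < 0ℤ -> ∀ {h} -> h ≉0 -> ord x h ≤ 0ℤ -> ord x (z * h) < 0ℤ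
    z* neg h≉0 le = subst (_< 0ℤ) (≡.sym (IsDVal.mult (fst (isPlace x)) (inv≉0 y≉0) h≉0)) (ℤₚ.+-mono-<-≤ neg le)
    value : ord x z < 0ℤ -> ∀ rs -> All Constants rs -> horner rs z ≉0 -> ord x (horner rs z) ≤ 0ℤ
    value neg [] _ p = ⊥-elim (p refl)
    value neg (r ∷ rs) ((c , r≈c) ∷ rs∈) p = go em
     where
     cong' = IsDVal.cong (fst (isPlace x))
     go : Dec (horner rs z ≈ 0#) -> ord x (horner (r ∷ rs) z) ≤ 0ℤ
     go (yes e) = ≤-reflexive (≡.trans (cong' r≈) (snd (isPlace x) c (≉0-resp r≈ p)))
      where
      r≈ : r + z * horner rs z ≈ const c
      r≈ = trans (+-cong r≈c (trans (*ˡ e) (zeroʳ z))) (+-idʳ _)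
     go (no h≉0) = subst (_≤ 0ℤ) (≡.trans (≡.sym (snd s)) (cong' (+-comm _ r))) (<⇒≤ neg')
      where
      neg' = z* neg h≉0 (value neg rs rs∈ h≉0)
      s = V.strict (*≉0 (inv≉0 y≉0) h≉0) (V.ball-resp (sym r≈c) (V.ball-mono (i<j⇒suc[i]≤j neg') (const-ball x c)))
    contra : ∀ rs -> ord x z < 0ℤ -> (horner rs z ≉0 -> ord x (horner rs z) ≤ 0ℤ) -> 1# ≈ z * horner rs z -> ⊥
    contra rs neg val e = <-irrefl (≡.trans (≡.sym (IsDVal.cong (fst (isPlace x)) e)) V.v1≡0) (z* neg h≉0 (val h≉0))
     where
     h≉0 = ≉0ʳ (≉0-resp e 1≉0)
  abstract
   -- With R the valuation ring of x and y a uniformizer, `relation-mod-y` bounds the dimension of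
   -- the residue field.
   degree-exists : ∀ x -> ∃ (Dim (O.B x 0ℤ) (O.B x 1ℤ))
   degree-exists x = finite-dim (ball-sub x 0ℤ) (ball-sub x 1ℤ) (degree-bound π) dep
    where
    π : Carrier
    π = fst (IsDVal.norm (fst (isPlace x)))
    π≉0 : π ≉0
    π≉0 = fst (snd (IsDVal.norm (fst (isPlace x))))
    π∈ : O.B x 1ℤ π
    π∈ _ = ≤-reflexive (≡.sym (snd (snd (IsDVal.norm (fst (isPlace x))))))
    dep : (u : Fin (suc (degree-bound π)) -> Carrier) -> (∀ i -> O.B x 0ℤ (u i)) -> Dependent (O.B x 1ℤ) u
    dep u u∈ =
     let
      c , ne , w , w∈ , e = relation-mod-y π π≉0 (O.B x 0ℤ) (ball-sub x 0ℤ) (O.ball-*ˡ x (O.ball-mono x (Z.+≤+ ℕ.z≤n) π∈)) u u∈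
     in c , ne , O.ball-resp x (sym e) (O.ball-*-eq x π∈ w∈ ≡.refl)
  degree : Point -> ℕ
  degree x = fst (degree-exists x)
  residue-dim : ∀ x -> Dim (O.B x 0ℤ) (O.B x 1ℤ) (degree x)
  residue-dim x = snd (degree-exists x)
  degree>0 : ∀ x -> 0 ℕ.< degree x
  degree>0 x = go (degree x) (residue-dim x)
   where
   go : ∀ n -> Dim (O.B x 0ℤ) (O.B x 1ℤ) n -> 0 ℕ.< n
   go zero d = ⊥-elim (1+≰ (≤-trans (dim-0 (ball-sub x 1ℤ) d {1#} (λ _ -> ≤-reflexive (≡.sym (O.v1≡0 x))) 1≉0) (≤-reflexive (O.v1≡0 x))))
   go (suc n) d = ℕ.s≤s ℕ.z≤n
  t^ : ℕ -> Carrier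
  t^ zero = 1#
  t^ (suc n) = t * t^ n
  private
   transcendental : ∀ p -> eval p t ≈ 0# -> All (k._≈ k.0#) p
   transcendental = fst (snd (Curve.oneDimensional X))
   coefficients : ∀ d {a} -> P.E d a -> ∃ λ p -> length p ≡ d × eval p t ≈ a
   coefficients zero (P.nil e) = [] , ≡.refl , sym e
   coefficients (suc d) (P.cons c b b∈ e) = let p , l , e' = coefficients d b∈ in
    c zero ∷ p , ap suc l , trans (+-cong (solve 1 (λ c -> c := c :* con 1ℤ :+ con 0ℤ) (const (c zero))) (*ˡ e')) (sym e)
   negate : List k.Carrier -> List k.Carrier
   negate [] = k.1# ∷ []
   negate (c ∷ p) = k.- c ∷ negate p
   eval-negate : ∀ p -> eval (negate p) t ≈ t^ (length p) - eval p t
   eval-negate [] = trans (+ʳ κ-1) (solve 1 (λ t -> con 1ℤ :+ t :* con 0ℤ := con 1ℤ :- con 0ℤ) t)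
   eval-negate (c ∷ p) = trans (+-cong (κ-neg c) (*ˡ (eval-negate p)))
    (solve 4 (λ c t x y -> :- c :+ t :* (x :- y) := t :* x :- (c :+ t :* y)) (const c) t _ _)
   negate-nonzero : ∀ p -> ¬ All (k._≈ k.0#) (negate p)
   negate-nonzero [] (e ∷ _) = k.1≉0 e
   negate-nonzero (c ∷ p) (_ ∷ es) = negate-nonzero p es
  t^-not-poly : ∀ n {a} -> P.E n a -> ¬ t^ n ≈ a
  t^-not-poly n {a} a∈ e = let p , l , e' = coefficients n a∈ in negate-nonzero p (transcendental (negate p)
   (trans (eval-negate p) (x≈y⇒x-y≈0 (trans (reflexive (ap t^ l)) (trans e (sym e'))))))
  poly-1 : P.E 1 1#
  poly-1 = Sub.resp (P.E-sub 1) (lin-δ {1} (λ _ -> 1#) zero) (P.E-lin 0 (δ {1} zero))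
  poly-t^ : ∀ n -> P.E (suc n) (t^ n)
  poly-t^ zero = poly-1
  poly-t^ (suc n) = P.E-t (suc n) (poly-t^ n)
  t≉0 : t ≉0
  t≉0 e = t^-not-poly 1 (Sub.0∈ (P.E-sub 1)) (trans (*ʳ e) (zeroˡ _))
  -- Without poles t would satisfy 1 = z h(z) for z = 1 / t and a polynomial h. Multiplied by t^n
  -- this expresses t^n by lower powers of t, but t is transcendental.
  t-pole : ∃ λ x -> ord x t < 0ℤ
  t-pole = dne λ none ->
   let rs , rs∈ , e = regular⇒algebraic t≉0 (λ x _ -> ≮⇒≥ λ lt -> none (x , lt))
   in t^-not-poly (length rs) (shifted rs rs∈) (begin
    t^ (length rs) ≈⟨ *-idʳ _ ⟨
    t^ (length rs) * 1# ≈⟨ *ˡ e ⟩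
    t^ (length rs) * (inv t * horner rs (inv t)) ∎)
   where
   shifted : ∀ rs -> All (λ a -> ∃ λ c -> a ≈ const c) rs -> P.E (length rs) (t^ (length rs) * (inv t * horner rs (inv t)))
   shifted [] [] = P.nil (solve 1 (λ z -> con 1ℤ :* (z :* con 0ℤ) := con 0ℤ) (inv t))
   shifted (r ∷ rs) ((c , r≈c) ∷ rs∈) = Sub.resp (P.E-sub (suc n)) (begin
    const c * p + p * (z * h) ≈⟨ solve 4 (λ c p z h -> c :* p :+ p :* (z :* h) := con 1ℤ :* (p :* (c :+ z :* h))) (const c) p z h ⟩
    1# * (p * (const c + z * h)) ≈⟨ *-cong (sym (inv-r t≉0)) (*ˡ (+ʳ (sym r≈c))) ⟩
    t * z * (p * (r + z * h)) ≈⟨ solve 4 (λ t z p s -> t :* z :* (p :* s) := t :* p :* (z :* s)) t z p _ ⟩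
    t * p * (z * (r + z * h)) ∎)
    (Sub.+∈ (P.E-sub (suc n)) (Sub.*∈ (P.E-sub (suc n)) c (poly-t^ n)) (P.E-mono (ℕₚ.n≤1+n n) (shifted rs rs∈)))
    where
    n = length rs
    p = t^ n
    z = inv t
    h = horner rs z
  -- vanish M = t (t − 1) (t² − 1) ⋯ (tᴹ − 1).
  vanish : ℕ -> Carrier
  vanish zero = t
  vanish (suc M) = (t^ (suc M) - 1#) * vanish M
  t^-1≉0 : ∀ M -> t^ (suc M) - 1# ≉0
  t^-1≉0 M e = t^-not-poly (suc M) (P.E-mono (ℕ.s≤s ℕ.z≤n) poly-1) (x-y≈0⇒x≈y e)
  vanish≉0 : ∀ M -> vanish M ≉0
  vanish≉0 zero = t≉0
  vanish≉0 (suc M) = *≉0 (t^-1≉0 M) (vanish≉0 M)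
  t^≉0 : ∀ n -> t^ n ≉0
  t^≉0 zero = 1≉0
  t^≉0 (suc n) = *≉0 t≉0 (t^≉0 n)
  module _ (x : Point) where
   private
    module V = O x
    v-mult = IsDVal.mult (fst (isPlace x))
   vanish-pole : ord x t < 0ℤ -> ∀ M -> ord x (vanish M) < 0ℤ
   vanish-pole neg zero = neg
   vanish-pole neg (suc M) = subst (_< 0ℤ) (≡.sym (v-mult (t^-1≉0 M) (vanish≉0 M))) (+-mono-< (factor M) (vanish-pole neg M))
    where
    t^-pole : ∀ n -> ord x (t^ (suc n)) < 0ℤ
    t^-pole zero = subst (_< 0ℤ) (IsDVal.cong (fst (isPlace x)) (sym (*-idʳ t))) neg
    t^-pole (suc n) = subst (_< 0ℤ) (≡.sym (v-mult t≉0 (t^≉0 (suc n)))) (+-mono-< neg (t^-pole n))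
    factor : ∀ n -> ord x (t^ (suc n) - 1#) < 0ℤ
    factor n = subst (_< 0ℤ) (≡.sym (snd (V.strict (t^≉0 (suc n))
     (V.ball-mono (i<j⇒suc[i]≤j (t^-pole n)) V.ball--1)))) (t^-pole n)
   private
    t^-ball : V.B 0ℤ t -> ∀ n -> V.B 0ℤ (t^ n)
    t^-ball t∈ zero _ = ≤-reflexive (≡.sym V.v1≡0)
    t^-ball t∈ (suc n) = V.ball-*ˡ t∈ (t^-ball t∈ n)
    prime : ∀ {a b} -> V.B 0ℤ a -> V.B 0ℤ b -> V.B 1ℤ (a * b) -> V.B 1ℤ a ⊎ V.B 1ℤ b
    prime {a} {b} a∈ b∈ ab∈ = go em
     where
     go : Dec (V.B 1ℤ a) -> V.B 1ℤ a ⊎ V.B 1ℤ b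
     go (yes h) = inl h
     go (no h) = inr (V.ball-resp (trans (*-comm _ _) (trans (*-assoc _ _ _) (x*[y*inv-x] b a≉0)))
      (V.ball-*-eq {m = 0ℤ} (subst (λ n -> V.B n (inv a)) (ap Z.-_ va≡0) V.ball-inv) ab∈ ≡.refl))
      where
      a≉0 : a ≉0
      a≉0 e = h (V.ball-≈0 e)
      va≡0 : ord x a ≡ 0ℤ
      va≡0 = ≤-antisym (≮⇒≥ λ lt -> h (λ _ -> i<j⇒suc[i]≤j lt)) (a∈ a≉0)
    vanish-regular : V.B 0ℤ t -> ∀ M -> V.B 0ℤ (vanish M)
    vanish-regular t∈ zero = t∈
    vanish-regular t∈ (suc M) = V.ball-*ˡ (V.ball-- (t^-ball t∈ (suc M)) 1∈) (vanish-regular t∈ M)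
     where
     1∈ : V.B 0ℤ 1#
     1∈ _ = ≤-reflexive (≡.sym V.v1≡0)
    vanish-t : V.B 0ℤ t -> V.B 1ℤ t -> ∀ M -> V.B 1ℤ (vanish M)
    vanish-t t∈ t∈₁ zero = t∈₁
    vanish-t t∈ t∈₁ (suc M) = V.ball-*ˡ (V.ball-- (t^-ball t∈ (suc M)) (λ _ -> ≤-reflexive (≡.sym V.v1≡0))) (vanish-t t∈ t∈₁ M)
    vanish-t^ : V.B 0ℤ t -> ∀ {d M} -> d ℕ.≤′ M -> V.B 1ℤ (t^ (suc d) - 1#) -> V.B 1ℤ (vanish (suc M))
    vanish-t^ t∈ {d} ℕ.≤′-refl h = V.ball-*-eq h (vanish-regular t∈ d) ≡.refl
    vanish-t^ t∈ {d} {suc M} (ℕ.≤′-step le) h = V.ball-*ˡ (V.ball-- (t^-ball t∈ (suc (suc M))) (λ _ -> ≤-reflexive (≡.sym V.v1≡0))) (vanish-t^ t∈ le h)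
   -- Among t^0, ..., t^(q^deg x) two powers agree in the residue field, so t^i (t^j - 1) vanishes
   -- at x for some i and some j between 1 and q^deg x.
   vanish-zero : V.B 0ℤ t -> ∀ M -> q ℕ.^ degree x ℕ.≤ M -> V.B 1ℤ (vanish M)
   vanish-zero t∈ M le =
    let i , j , i<j , e = Finₚ.pigeonhole (ℕₚ.n<1+n (q ℕ.^ degree x)) (λ i -> encode (fst (coords i)))
    in conclude i j i<j (t^-difference (Fin.toℕ i) (Fin.toℕ j) i<j
     (V.ball-resp (diff i j e) (V.ball-- (snd (coords j)) (snd (coords i)))))
    where
    coords : (i : Fin (suc (q ℕ.^ degree x))) -> ∃ λ c -> V.B 1ℤ (t^ (Fin.toℕ i) - lin (Dim.basis (residue-dim x)) c)
    coords i = Dim.spans (residue-dim x) (t^ (Fin.toℕ i)) (t^-ball t∈ (Fin.toℕ i))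
    basis = Dim.basis (residue-dim x)
    diff : ∀ i j -> encode (fst (coords i)) ≡ encode (fst (coords j)) -> (t^ (Fin.toℕ j) - lin basis (fst (coords j))) - (t^ (Fin.toℕ i) - lin basis (fst (coords i))) ≈ t^ (Fin.toℕ j) - t^ (Fin.toℕ i)
    diff i j e = trans (+ʳ (+ˡ (-‿cong (lin-congᶜ basis (encode-injective _ _ (≡.sym e))))))
     (solve 3 (λ a b l -> (a :- l) :- (b :- l) := a :- b) _ _ _)
    bound : ∀ {i j : Fin (suc (q ℕ.^ degree x))} -> Fin.toℕ j ℕ.∸ Fin.toℕ i ℕ.≤ M
    bound {i} {j} = ℕₚ.≤-trans (ℕₚ.m∸n≤m (Fin.toℕ j) (Fin.toℕ i)) (ℕₚ.≤-trans (ℕₚ.≤-pred (Finₚ.toℕ<n j)) le)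
    t^-+ : ∀ m n -> t^ (m ℕ.+ n) ≈ t^ m * t^ n
    t^-+ zero n = sym (*-idˡ _)
    t^-+ (suc m) n = trans (*ˡ (t^-+ m n)) (sym (*-assoc _ _ _))
    t^-difference : ∀ m n -> m ℕ.< n -> V.B 1ℤ (t^ n - t^ m) -> V.B 1ℤ t ⊎ V.B 1ℤ (t^ (suc (n ℕ.∸ suc m)) - 1#)
    t^-difference m n lt h = split (prime (t^-ball t∈ m)
     (V.ball-- (t^-ball t∈ (suc d)) (λ _ -> ≤-reflexive (≡.sym V.v1≡0))) (V.ball-resp (begin
      t^ n - t^ m ≡⟨ ap (λ l -> t^ l - t^ m) (≡.trans (≡.sym (ℕₚ.m+[n∸m]≡n lt)) (≡.sym (ℕₚ.+-suc m d))) ⟩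
      t^ (m ℕ.+ suc d) - t^ m ≈⟨ +ʳ (t^-+ m (suc d)) ⟩
      t^ m * t^ (suc d) - t^ m ≈⟨ solve 2 (λ x y -> x :* y :- x := x :* (y :- con 1ℤ)) _ _ ⟩
      t^ m * (t^ (suc d) - 1#) ∎) h))
     where
     d = n ℕ.∸ suc m
     root : ∀ m -> V.B 1ℤ (t^ m) -> V.B 1ℤ t
     root zero p = ⊥-elim (1+≰ (≤-trans (p 1≉0) (≤-reflexive V.v1≡0)))
     root (suc m) p = go (prime t∈ (t^-ball t∈ m) p)
      where
      go : V.B 1ℤ t ⊎ V.B 1ℤ (t^ m) -> V.B 1ℤ t
      go (inl h) = h
      go (inr h) = root m h
     split : V.B 1ℤ (t^ m) ⊎ V.B 1ℤ (t^ (suc d) - 1#) -> _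
     split (inl h) = inl (root m h)
     split (inr h) = inr h
    conclude : ∀ i j -> i Fin.< j -> V.B 1ℤ t ⊎ V.B 1ℤ (t^ (suc (Fin.toℕ j ℕ.∸ suc (Fin.toℕ i))) - 1#) -> V.B 1ℤ (vanish M)
    conclude i j i<j (inl h) = vanish-t t∈ h M
    conclude i j i<j (inr h) = final M lt
     where
     d = Fin.toℕ j ℕ.∸ suc (Fin.toℕ i)
     lt : d ℕ.< M
     lt = ℕₚ.<-≤-trans (ℕₚ.∸-monoʳ-< (ℕₚ.n<1+n (Fin.toℕ i)) i<j) (bound {i} {j})
     final : ∀ M -> d ℕ.< M -> V.B 1ℤ (vanish M)
     final (suc M) (ℕ.s≤s le) = vanish-t^ t∈ (ℕₚ.≤⇒≤′ le) h
  -- Euclid's argument, with the function 1 + vanish M.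
  unbounded-degrees : ∀ M x1 -> ord x1 t < 0ℤ -> ¬ (∀ x -> q ℕ.^ degree x ℕ.≤ M)
  unbounded-degrees M x1 pole bound = <-irrefl
   (≡.trans (≡.sym (ℤₚ.neg-involutive (ord x1 w))) (ap Z.-_ (≡.trans (≡.sym (O.v-inv x1 w≉0)) unit)))
   (snd (at-pole x1 pole))
   where
   w : Carrier
   w = vanish M + 1#
   1∈ : ∀ x -> O.B x 0ℤ 1#
   1∈ x _ = ≤-reflexive (≡.sym (O.v1≡0 x))
   at-pole : ∀ x -> ord x t < 0ℤ -> w ≉0 × ord x w < 0ℤ
   at-pole x lt = fst s , subst (_< 0ℤ) (≡.sym (snd s)) (vanish-pole x lt M)
    where
    s : w ≉0 × ord x w ≡ ord x (vanish M)
    s = O.strict x {vanish M} {1#} (vanish≉0 M) (O.ball-mono x (i<j⇒suc[i]≤j (vanish-pole x lt M)) (1∈ x))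
   w≉0 : w ≉0
   w≉0 = fst (at-pole x1 pole)
   elsewhere : ∀ x -> 0ℤ ≤ ord x t -> ord x w ≤ 0ℤ
   elsewhere x le = ≤-reflexive (≡.trans (IsDVal.cong (fst (isPlace x)) (+-comm (vanish M) 1#))
    (≡.trans (snd (O.strict x {1#} {vanish M} 1≉0 (subst (λ n -> O.B x (Z.suc n) (vanish M)) (≡.sym (O.v1≡0 x))
     (vanish-zero x (λ _ -> le) M (bound x))))) (O.v1≡0 x)))
   w≤0 : ∀ x -> ord x w ≤ 0ℤ
   w≤0 x = either em
    where
    either : Dec (ord x t < 0ℤ) -> ord x w ≤ 0ℤ
    either (yes lt) = <⇒≤ (snd (at-pole x lt))
    either (no ge) = elsewhere x (≮⇒≥ ge)
   regular : ∀ x -> O.B x 0ℤ (inv w)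
   regular x _ = subst (0ℤ ≤_) (≡.sym (O.v-inv x w≉0)) (neg-mono-≤ (w≤0 x))
   unit : ord x1 (inv w) ≡ 0ℤ
   unit = regular⇒unit (inv≉0 w≉0) regular x1
  infinitely-many-points : ∀ (L : List Point) -> ∃ λ x -> ¬ x ∈ L
  infinitely-many-points L = dne λ none -> let M , bound = bound-list L ; x1 , pole = t-pole in
   unbounded-degrees M x1 pole (λ x -> bound (dne λ h -> none (x , h)))
   where
   bound-list : ∀ L -> ∃ λ M -> ∀ {x} -> x ∈ L -> q ℕ.^ degree x ℕ.≤ M
   bound-list [] = 0 , λ ()
   bound-list (x ∷ L) = let M , h = bound-list L in q ℕ.^ degree x ℕ.⊔ M , λ
    { (here ≡.refl) -> ℕₚ.m≤m⊔n _ M ; (there p) -> ℕₚ.≤-trans (h p) (ℕₚ.m≤n⊔m _ M) }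

 -- Adeles and finiteness of zeros

 module AdeleTheory where
  open Curve X using (k; F; φ; const)
  open Adeles X F̂ public
  private module k = FieldLaws k
  module Fₗ = FieldLemmas em F
  open PointTheory public using (module O; const-ball; const≉0; ball-sub; degree; residue-dim; degree>0; infinitely-many-points; regular⇒unit; regular⇒algebraic; t-pole)
  module F = FieldLaws F
  module K (x : Point) where
   open Completion (F̂ x) public using (K; ι; val; embed; embed-cong; isValuation; extends; dense; complete)
   open FieldLaws K public
  module Kₛ (x : Point) = IntSolver (K.ring x)
  module Kₗ (x : Point) = FieldLemmas em (K.K x)
  module V (x : Point) = ValuationLemmas em (K.K x) (K.isValuation x)
  B : (x : Point) -> ℤ -> K.Carrier x -> Set
  B x = Ball (K.K x) (K.val x)
  module _ (x : Point) where
   private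
    module Kx = K x
    module ι = RingHom Kx.ι
   embed-1 : Kx.embed F.1# Kx.≈ Kx.1#
   embed-1 = ι.1#-homo
   embed-0 : Kx.embed F.0# Kx.≈ Kx.0#
   embed-0 = ι.0#-homo
   embed-+ : ∀ a b -> Kx.embed (a F.+ b) Kx.≈ Kx.embed a Kx.+ Kx.embed b
   embed-+ = ι.+-homo
   embed-* : ∀ a b -> Kx.embed (a F.* b) Kx.≈ Kx.embed a Kx.* Kx.embed b
   embed-* = ι.*-homo
   embed-neg : ∀ a -> Kx.embed (F.- a) Kx.≈ Kx.- Kx.embed a
   embed-neg = ι.-‿homo
   embed-unit : ∀ {a} -> ¬ a F.≈ F.0# -> Kx.embed a Kx.* Kx.embed (Fₗ.inv a) Kx.≈ Kx.1#
   embed-unit a≉0 = Kx.trans (Kx.sym (embed-* _ _)) (Kx.trans (Kx.embed-cong (Fₗ.inv-r a≉0)) embed-1)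
   embed≉0 : ∀ {a} -> ¬ a F.≈ F.0# -> ¬ Kx.embed a Kx.≈ Kx.0#
   embed≉0 a≉0 = Kₗ.unit≉0 x (embed-unit a≉0)
   embed-ball : ∀ {n a} -> O.B x n a -> B x n (Kx.embed a)
   embed-ball {n} {a} p e≉0 = subst (n ≤_) (≡.sym (Kx.extends a a≉0)) (p a≉0)
    where
    a≉0 : ¬ a F.≈ F.0#
    a≉0 e = e≉0 (Kx.trans (Kx.embed-cong e) embed-0)
   ball-embed : ∀ {n a} -> B x n (Kx.embed a) -> O.B x n a
   ball-embed {n} {a} p a≉0 = subst (n ≤_) (Kx.extends a a≉0) (p (embed≉0 a≉0))
  constant : k.Carrier -> Adele
  constant c = adele (λ x -> K.embed x (const c)) ([] , λ x -> inl (embed-ball x (const-ball x c)))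
  constantHom : RingHom (Field.ring k) 𝔸
  constantHom = ringHom (Field.ring k) 𝔸 constant (λ e x -> K.embed-cong x (φ.⟦⟧-cong e))
   (λ a b x -> K.trans x (K.embed-cong x (φ.+-homo a b)) (embed-+ x _ _))
   (λ a b x -> K.trans x (K.embed-cong x (φ.*-homo a b)) (embed-* x _ _))
   (λ x -> K.trans x (K.embed-cong x φ.1#-homo) (embed-1 x))
   where module φ = RingHom φ
  module 𝕃 = LinearAlgebra em k (Curve.k-size X) 𝔸 constantHom
  open 𝕃 public using (Sub; Dim; Dependent; Nontrivial; lin)
  ball-at : ∀ x n -> Sub (λ a -> B x n (at a x))
  ball-at x n = record
   { resp = λ e -> V.ball-resp x (e x) ; 0∈ = V.ball-0 x ; +∈ = V.ball-+ x
   ; *∈ = λ c -> V.ball-*ˡ x (embed-ball x (const-ball x c)) }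
  All-adeles : Adele -> Set
  All-adeles a = a 𝔸.≈ a
  all-sub : Sub All-adeles
  all-sub = record
   { resp = λ _ _ x -> K.refl x ; 0∈ = λ x -> K.refl x ; +∈ = λ _ _ x -> K.refl x ; *∈ = λ _ _ x -> K.refl x }
  principal-sub : Sub Principal
  principal-sub = record
   { resp = λ { e (f , p) -> f , λ x -> K.trans x (K.sym x (e x)) (p x) }
   ; 0∈ = F.0# , λ x -> K.sym x (embed-0 x)
   ; +∈ = λ { (f , p) (h , r) -> f F.+ h , λ x -> K.trans x (K.+-cong x (p x) (r x)) (K.sym x (embed-+ x f h)) }
   ; *∈ = λ { c (f , p) -> const c F.* f , λ x -> K.trans x (K.*ˡ x (p x)) (K.sym x (embed-* x _ f)) } }
  within-sub : ∀ D -> Sub (Within D)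
  within-sub D = record
   { resp = λ e p x -> V.ball-resp x (e x) (p x) ; 0∈ = λ x -> V.ball-0 x
   ; +∈ = λ p r x -> V.ball-+ x (p x) (r x)
   ; *∈ = λ c p x -> V.ball-*ˡ x (embed-ball x (const-ball x c)) (p x) }
  0ᴰ : Divisor
  0ᴰ = (λ _ -> 0ℤ) , [] , λ _ -> inl ≡.refl
  infixl 6 _⊞_
  _⊞_ : (Adele -> Set) -> (Adele -> Set) -> Adele -> Set
  (P ⊞ Q) a = ∃ λ f -> ∃ λ o -> P f × Q o × a 𝔸.≈ f 𝔸.+ o
  ⊞-sub : ∀ {P Q} -> Sub P -> Sub Q -> Sub (P ⊞ Q)
  ⊞-sub sP sQ = record
   { resp = λ { e (f , o , p , q , r) -> f , o , p , q , λ x -> K.trans x (K.sym x (e x)) (r x) }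
   ; 0∈ = 𝔸.0# , 𝔸.0# , P.0∈ , Q.0∈ , λ x -> K.sym x (K.+-idˡ x (K.0# x))
   ; +∈ = λ { (f , o , p , q , r) (f' , o' , p' , q' , r') -> f 𝔸.+ f' , o 𝔸.+ o' , P.+∈ {f} {f'} p p' , Q.+∈ {o} {o'} q q'
    , λ x -> K.trans x (K.+-cong x (r x) (r' x)) (regroup x _ _ _ _) }
   ; *∈ = λ { c (f , o , p , q , r) -> constant c 𝔸.* f , constant c 𝔸.* o , P.*∈ c {f} p , Q.*∈ c {o} q
    , λ x -> K.trans x (K.*ˡ x (r x)) (K.distribˡ x _ _ _) } }
   where
   module P = Sub sP
   module Q = Sub sQ
   regroup : ∀ x f o f' o' -> K._≈_ x (K._+_ x (K._+_ x f o) (K._+_ x f' o')) (K._+_ x (K._+_ x f f') (K._+_ x o o'))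
   regroup x = Kₛ.solve x 4 (λ f o f' o' -> (f :+ o) :+ (f' :+ o') := (f :+ f') :+ (o :+ o'))
  ⊞-left : ∀ {P Q} -> Sub Q -> ∀ {a} -> P a -> (P ⊞ Q) a
  ⊞-left sQ {a} p = a , 𝔸.0# , p , Sub.0∈ sQ , λ x -> K.sym x (K.+-idʳ x _)
  ⊞-right : ∀ {P Q} -> Sub P -> ∀ {a} -> Q a -> (P ⊞ Q) a
  ⊞-right sP {a} q = 𝔸.0# , a , Sub.0∈ sP , q , λ x -> K.sym x (K.+-idˡ x _)
  -- F + 𝔸(D), the denominator of H¹(D) = 𝔸 / (F + 𝔸(D)).
  F+ : Divisor -> Adele -> Set
  F+ D = Principal ⊞ Within D
  F+-sub : ∀ D -> Sub (F+ D)
  F+-sub D = ⊞-sub principal-sub (within-sub D)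
  genus-dim : ∀ {g} -> IsGenus g -> Dim All-adeles (F+ 0ᴰ) g
  genus-dim (e , e∈ , coords) = 𝕃.fromHasDim all-sub (F+-sub 0ᴰ)
   (e , e∈ , λ a a∈ -> let c , b , uniq = coords a a∈ in
    c , resp {a 𝔸.- raw e c} {a 𝔸.- lin e c} (λ x -> K.+ˡ x (K.-‿cong x (same e c x))) b ,
    λ c' b' -> uniq c' (resp {a 𝔸.- lin e c'} {a 𝔸.- raw e c'} (λ x -> K.+ˡ x (K.-‿cong x (K.sym x (same e c' x)))) b'))
   where
   open Sub (F+-sub 0ᴰ)
   raw : ∀ {n} -> (Fin n -> Adele) -> (Fin n -> k.Carrier) -> Adele
   raw e c = ∑ 𝔸._+_ 𝔸.0# (λ i -> RawLeftModule._*ₗ_ 𝔸-over-k (c i) (e i))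
   same : ∀ {n} (e : Fin n -> Adele) c -> raw e c 𝔸.≈ lin e c
   same {zero} e c x = K.refl x
   same {suc n} e c x = K.+ˡ x (same (e ∘ suc) (c ∘ suc) x)
  if-dec : {P A : Set} -> A -> A -> Dec P -> A
  if-dec a b (yes _) = a
  if-dec a b (no _) = b
  spike : (p : Point) -> F.Carrier -> Adele
  spike p a = adele (λ x -> K.embed x (if-dec a F.0# (em {P = x ≡ p}))) (p ∷ [] , λ x -> go x em)
   where
   go : ∀ x -> (d : Dec (x ≡ p)) -> IntegralAt x (K.embed x (if-dec a F.0# d)) ⊎ x ∈ p ∷ []
   go x (yes e) = inr (here e)
   go x (no _) = inl (V.ball-resp x (K.sym x (embed-0 x)) (V.ball-0 x))
  spike-at : ∀ p a -> K._≈_ p (at (spike p a) p) (K.embed p a)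
  spike-at p a = go em
   where
   go : (d : Dec (p ≡ p)) -> K._≈_ p (K.embed p (if-dec a F.0# d)) (K.embed p a)
   go (yes _) = K.refl p
   go (no n) = ⊥-elim (n ≡.refl)
  spike-away : ∀ {p x} a -> ¬ x ≡ p -> K._≈_ x (at (spike p a) x) (K.0# x)
  spike-away {p} {x} a ne = go em
   where
   go : (d : Dec (x ≡ p)) -> K._≈_ x (K.embed x (if-dec a F.0# d)) (K.0# x)
   go (yes e) = ⊥-elim (ne e)
   go (no _) = embed-0 x
  unif : ∀ x -> F.Carrier
  unif x = fst (IsDVal.norm (fst (isPlace x)))
  uniformizer≉0 : ∀ x -> ¬ unif x F.≈ F.0#
  uniformizer≉0 x = fst (snd (IsDVal.norm (fst (isPlace x))))
  ord-unif : ∀ x -> ord x (unif x) ≡ 1ℤ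
  ord-unif x = snd (snd (IsDVal.norm (fst (isPlace x))))
  ord-inv-unif : ∀ x -> ord x (Fₗ.inv (unif x)) ≡ Z.- 1ℤ
  ord-inv-unif x = ≡.trans (O.v-inv x (uniformizer≉0 x)) (ap Z.-_ (ord-unif x))
  not-regular : ∀ {x a} -> ¬ a F.≈ F.0# -> ord x a ≡ Z.- 1ℤ -> ¬ O.B x 0ℤ a
  not-regular {x} {a} a≉0 e p with subst (0ℤ ≤_) e (p a≉0)
  ... | ()
  module Finiteness {g : ℕ} (isGenus : IsGenus g) where
   -- g + 1 prescribed poles are enough for a function with at least one of them.
   poles : (p : Fin (suc g) -> Point) -> (∀ {i j} -> p i ≡ p j -> i ≡ j) ->
    ∃ λ f -> (∀ x -> (∀ s -> ¬ x ≡ p s) -> O.B x 0ℤ f) × (∀ s -> O.B (p s) (Z.- 1ℤ) f) × (∃ λ s -> ¬ O.B (p s) 0ℤ f)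
   poles p p-inj = f , away , at-poles , s0 , polar
    where
    u : Fin (suc g) -> Adele
    u s = spike (p s) (Fₗ.inv (unif (p s)))
    -- g + 1 elements of the g-dimensional space 𝔸 / (F + 𝒪_𝔸). The function f is the rational part
    -- of a relation; away from the chosen points it differs from 0 by an integral adele only.
    dep : Dependent (F+ 0ᴰ) u
    dep = 𝕃.dependent all-sub (F+-sub 0ᴰ) (Dim.spans (genus-dim isGenus)) ℕₚ.≤-refl u (λ _ x -> K.refl x)
    c = fst dep
    s0 = fst (fst (snd dep))
    a o : Adele
    a = fst (snd (snd dep))
    o = fst (snd (snd (snd dep)))
    o∈ : Integral o
    o∈ = fst (snd (snd (snd (snd (snd dep)))))
    lin≈ : lin u c 𝔸.≈ a 𝔸.+ o
    lin≈ = snd (snd (snd (snd (snd (snd dep)))))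
    f : F.Carrier
    f = fst (fst (snd (snd (snd (snd dep)))))
    a≈f : ∀ x -> K._≈_ x (at a x) (K.embed x f)
    a≈f = snd (fst (snd (snd (snd (snd dep)))))
    f-ball : ∀ x n -> B x n (at (lin u c) x) -> B x n (at o x) -> O.B x n f
    f-ball x n h h' = ball-embed x (V.ball-resp x
     (K.trans x (K.+ʳ x (lin≈ x)) (K.trans x (solve 2 (λ a o -> (a :+ o) :- o := a) _ _) (a≈f x)))
     (V.ball-- x h h'))
     where open IntSolver (K.ring x)
    away : ∀ x -> (∀ s -> ¬ x ≡ p s) -> O.B x 0ℤ f
    away x ne = f-ball x 0ℤ (𝕃.lin∈ (ball-at x 0ℤ) {e = u} (λ s -> V.ball-≈0 x (spike-away _ (ne s))) c) (o∈ x)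
    spike-ball : ∀ x s -> B x (Z.- 1ℤ) (at (u s) x)
    spike-ball x s = go em
     where
     go : Dec (x ≡ p s) -> B x (Z.- 1ℤ) (at (u s) x)
     go (yes ≡.refl) = V.ball-resp x (K.sym x (spike-at x _)) (embed-ball x λ _ -> ≤-reflexive (≡.sym (ord-inv-unif x)))
     go (no ne) = V.ball-≈0 x (spike-away _ ne)
    at-poles : ∀ s -> O.B (p s) (Z.- 1ℤ) f
    at-poles s = f-ball (p s) (Z.- 1ℤ) (𝕃.lin∈ (ball-at (p s) (Z.- 1ℤ)) {e = u} (spike-ball (p s)) c) (V.ball-mono (p s) Z.-≤+ (o∈ (p s)))
    polar : ¬ O.B (p s0) 0ℤ f
    polar h = not-regular {p s0} (Fₗ.inv≉0 (uniformizer≉0 (p s0))) (ord-inv-unif (p s0))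
     (ball-embed (p s0) (V.ball-resp (p s0) (spike-at (p s0) _) (𝕃.unscale (ball-at (p s0) 0ℤ) {c s0} {u s0} (snd (fst (snd dep)))
       (𝕃.isolate (ball-at (p s0) 0ℤ) u c s0
        (V.ball-resp (p s0) (K.sym (p s0) (K.trans (p s0) (lin≈ (p s0)) (K.+ʳ (p s0) (a≈f (p s0)))))
         (V.ball-+ (p s0) (embed-ball (p s0) h) (o∈ (p s0))))
        (λ s ne -> V.ball-≈0 (p s0) (spike-away _ (λ e -> ne (≡.sym (p-inj e)))))))))
   -- From infinitely many zeros of y take N + 1 groups of g + 1, and by `poles` a function u_r with
   -- a pole in group r and regular outside it. Let R be the functions with at most simple poles at
   -- these zeros: `relation-mod-y` gives a non-trivial combination of the u_r equal to y w, which
   -- is regular at all of them, while the pole of one u_r with non-zero coefficient survives.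
   zeros-finite : ∀ y -> ¬ y F.≈ F.0# -> AlmostAll (λ x -> ord x y ≤ 0ℤ)
   zeros-finite y y≉0 = dne λ none -> let xs , zero-at , xs-inj = distinct-sequence em none in many xs zero-at xs-inj
    where
    N = Basics.degree-bound y
    many : (xs : ℕ -> Point) -> (∀ n -> ¬ ord (xs n) y ≤ 0ℤ) -> (∀ {m n} -> xs m ≡ xs n -> m ≡ n) -> ⊥
    many xs zero-at xs-inj = contradiction
     where
     pt : Fin (suc N) -> Fin (suc g) -> Point
     pt r s = xs (Fin.toℕ (Fin.combine r s))
     pt-inj : ∀ {r s r' s'} -> pt r s ≡ pt r' s' -> r ≡ r' × s ≡ s'
     pt-inj e = Finₚ.combine-injective _ _ _ _ (Finₚ.toℕ-injective (xs-inj e))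
     y∈ : ∀ r s -> O.B (pt r s) 1ℤ y
     y∈ r s _ = i<j⇒suc[i]≤j (ℤₚ.≰⇒> (zero-at (Fin.toℕ (Fin.combine r s))))
     group : ∀ r -> _
     group r = poles (pt r) (λ e -> snd (pt-inj {r} {_} {r} e))
     u : Fin (suc N) -> F.Carrier
     u r = fst (group r)
     R : F.Carrier -> Set
     R f = ∀ r s -> O.B (pt r s) (Z.- 1ℤ) f
     sR : Basics.Sub R
     sR = record
      { resp = λ e h r s -> O.ball-resp (pt r s) e (h r s) ; 0∈ = λ r s -> O.ball-0 (pt r s)
      ; +∈ = λ h h' r s -> O.ball-+ (pt r s) (h r s) (h' r s)
      ; *∈ = λ c h r s -> O.ball-*ˡ (pt r s) (const-ball (pt r s) c) (h r s) }
     elsewhere : ∀ r r' s -> ¬ r' ≡ r -> O.B (pt r s) 0ℤ (u r')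
     elsewhere r r' s ne = fst (snd (group r')) (pt r s) (λ s' e -> ne (≡.sym (fst (pt-inj {r} {s} {r'} e))))
     u∈ : ∀ r' -> R (u r')
     u∈ r' r s = go em
      where
      go : Dec (r' ≡ r) -> O.B (pt r s) (Z.- 1ℤ) (u r')
      go (yes ≡.refl) = fst (snd (snd (group r))) s
      go (no ne) = O.ball-mono (pt r s) Z.-≤+ (elsewhere r r' s ne)
     relation : ∃ λ c -> Basics.Nontrivial c × ∃ λ w -> R w × Basics.lin u c F.≈ y F.* w
     relation = Basics.relation-mod-y y y≉0 R sR (λ h r s -> O.ball-*ˡ (pt r s) (O.ball-mono (pt r s) (Z.+≤+ ℕ.z≤n) (y∈ r s)) (h r s)) u u∈
     contradiction : ⊥
     contradiction = let c , (r , c≉0) , w , w∈ , e = relation ; s , polar = snd (snd (snd (group r))) in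
      polar (Basics.unscale (ball-sub (pt r s) 0ℤ) {c r} {u r} c≉0 (Basics.isolate (ball-sub (pt r s) 0ℤ) u c r
        (O.ball-resp (pt r s) (F.sym e) (O.ball-*-eq (pt r s) (y∈ r s) (w∈ r s) ≡.refl))
        (λ r' ne -> elsewhere r r' s ne)))
   ord-almost-zero : ∀ y -> ¬ y F.≈ F.0# -> AlmostAll (λ x -> ord x y ≡ 0ℤ)
   ord-almost-zero y y≉0 = almostAll-∩
    (λ {x} p r -> ≤-antisym p (subst (0ℤ ≤_) (ℤₚ.neg-involutive (ord x y)) (neg-mono-≤ (subst (_≤ 0ℤ) (O.v-inv x y≉0) r))))
    (zeros-finite y y≉0) (zeros-finite (Fₗ.inv y) (Fₗ.inv≉0 y≉0))
   regular-almost : ∀ f -> AlmostAll (λ x -> O.B x 0ℤ f)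
   regular-almost f = go em
    where
    go : Dec (f F.≈ F.0#) -> AlmostAll (λ x -> O.B x 0ℤ f)
    go (yes e) = [] , λ x -> inl (O.ball-≈0 x e)
    go (no ne) = almostAll-map (λ e _ -> ≤-reflexive (≡.sym e)) (ord-almost-zero f ne)
   principal : F.Carrier -> Adele
   principal f = adele (λ x -> K.embed x f) (almostAll-map (λ {x} -> embed-ball x) (regular-almost f))
   principal∈ : ∀ f -> Principal (principal f)
   principal∈ f = f , λ x -> K.refl x

 -- Cohomology of divisors and the degree

 module RiemannRoch where
  open Curve X using (k; const)
  open AdeleTheory public
  open Finiteness isGenus public
  private
   module k = FieldLaws k
   module 𝔸ₛ = IntSolver 𝔸
  infix 4 _≐_
  _≐_ : Divisor -> Divisor -> Set
  D ≐ E = ∀ x -> fst D x ≡ fst E x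
  infixl 6 _⊕_
  _⊕_ : Divisor -> Divisor -> Divisor
  (D , p) ⊕ (E , q) = (λ x -> D x Z.+ E x) , almostAll-∩ (λ e e' -> ap₂ Z._+_ e e') p q
  neg : Divisor -> Divisor
  neg (D , p) = (λ x -> Z.- D x) , almostAll-map (λ e -> ap (λ n -> Z.- n) e) p
  indic : Point -> ℤ -> Point -> ℤ
  indic p n x = if-dec n 0ℤ (em {P = x ≡ p})
  indic-at : ∀ p n -> indic p n p ≡ n
  indic-at p n = go em
   where
   go : (d : Dec (p ≡ p)) -> if-dec n 0ℤ d ≡ n
   go (yes _) = ≡.refl
   go (no ne) = ⊥-elim (ne ≡.refl)
  indic-away : ∀ {p x} n -> ¬ x ≡ p -> indic p n x ≡ 0ℤ
  indic-away {p} {x} n ne = go em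
   where
   go : (d : Dec (x ≡ p)) -> if-dec n 0ℤ d ≡ 0ℤ
   go (yes e) = ⊥-elim (ne e)
   go (no _) = ≡.refl
  pointDivisor : Point -> ℤ -> Divisor
  pointDivisor p n = indic p n , p ∷ [] , λ x -> go x em
   where
   go : ∀ x -> Dec (x ≡ p) -> indic p n x ≡ 0ℤ ⊎ x ∈ p ∷ []
   go x (yes e) = inr (here e)
   go x (no ne) = inl (indic-away n ne)
  bump : Divisor -> Point -> ℤ -> Divisor
  bump D p n = D ⊕ pointDivisor p n
  indic-+ : ∀ p m n x -> indic p m x Z.+ indic p n x ≡ indic p (m Z.+ n) x
  indic-+ p m n x = go em
   where
   go : (d : Dec (x ≡ p)) -> if-dec m 0ℤ d Z.+ if-dec n 0ℤ d ≡ if-dec (m Z.+ n) 0ℤ d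
   go (yes _) = ≡.refl
   go (no _) = ≡.refl
  indic-0 : ∀ p x -> indic p 0ℤ x ≡ 0ℤ
  indic-0 p x = go em
   where
   go : (d : Dec (x ≡ p)) -> if-dec 0ℤ 0ℤ d ≡ 0ℤ
   go (yes _) = ≡.refl
   go (no _) = ≡.refl
  bump-bump : ∀ D p m n -> bump (bump D p m) p n ≐ bump D p (m Z.+ n)
  bump-bump D p m n x = ≡.trans (ℤₚ.+-assoc (fst D x) _ _) (ap (Z._+_ (fst D x)) (indic-+ p m n x))
  bump-0 : ∀ D p -> bump D p 0ℤ ≐ D
  bump-0 D p x = ≡.trans (ap (Z._+_ (fst D x)) (indic-0 p x)) (ℤₚ.+-identityʳ _)
  clear : Point -> (Point -> ℤ) -> Point -> ℤ
  clear p d x = if-dec 0ℤ (d x) (em {P = x ≡ p})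
  clear-+ : ∀ p d x -> clear p d x Z.+ indic p (d p) x ≡ d x
  clear-+ p d x = go em
   where
   go : (e : Dec (x ≡ p)) -> if-dec 0ℤ (d x) e Z.+ if-dec (d p) 0ℤ e ≡ d x
   go (yes ≡.refl) = ℤₚ.+-identityˡ _
   go (no _) = ℤₚ.+-identityʳ _
  clear-support : ∀ p d L -> (∀ x -> d x ≡ 0ℤ ⊎ x ∈ p ∷ L) -> ∀ x -> clear p d x ≡ 0ℤ ⊎ x ∈ L
  clear-support p d L h x = go em (h x)
   where
   go : (e : Dec (x ≡ p)) -> d x ≡ 0ℤ ⊎ x ∈ p ∷ L -> if-dec 0ℤ (d x) e ≡ 0ℤ ⊎ x ∈ L
   go (yes _) _ = inl ≡.refl
   go (no _) (inl z) = inl z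
   go (no ne) (inr (here e)) = ⊥-elim (ne e)
   go (no _) (inr (there p)) = inr p
  clear-nonneg : ∀ p d -> (∀ x -> 0ℤ ≤ d x) -> ∀ x -> 0ℤ ≤ clear p d x
  clear-nonneg p d h x = go em
   where
   go : (e : Dec (x ≡ p)) -> 0ℤ ≤ if-dec 0ℤ (d x) e
   go (yes _) = ≤-refl
   go (no _) = h x
  divisor-recursion : (P : Divisor -> Set) -> (∀ {D E} -> D ≐ E -> P D -> P E) -> P 0ᴰ -> (∀ D x n -> P D -> P (bump D x n)) -> ∀ D -> P D
  divisor-recursion P resp z up (d , L , h) = go L d h
   where
   go : ∀ L d h -> P (d , L , h)
   go [] d h = resp (λ x -> ≡.sym (zero-at x (h x))) z
    where
    zero-at : ∀ x -> d x ≡ 0ℤ ⊎ x ∈ [] -> d x ≡ 0ℤ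
    zero-at x (inl e) = e
   go (p ∷ L) d h = resp (clear-+ p d) (up (clear p d , L , clear-support p d L h) p (d p) (go L (clear p d) (clear-support p d L h)))
  bump-recursion : (P : Divisor -> Set) -> (∀ {D E} -> D ≐ E -> P D -> P E) -> (∀ D x -> P D -> P (bump D x 1ℤ)) -> (∀ D x -> P (bump D x 1ℤ) -> P D) ->
   ∀ D x n -> P D -> P (bump D x n)
  bump-recursion P resp up down D x = go
   where
   pos : ∀ n -> P D -> P (bump D x (Z.+ n))
   pos zero p = resp (λ y -> ≡.sym (bump-0 D x y)) p
   pos (suc n) p = resp (λ y -> ≡.trans (bump-bump D x (Z.+ n) 1ℤ y) (ap (λ m -> fst (bump D x m) y) (ℤₚ.+-comm (Z.+ n) 1ℤ))) (up _ x (pos n p))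
   back : ∀ m -> P (bump D x (1ℤ Z.+ m)) -> P (bump D x m)
   back m p = down (bump D x m) x (resp (λ y -> ≡.trans (ap (λ l -> fst (bump D x l) y) (ℤₚ.+-comm 1ℤ m)) (≡.sym (bump-bump D x m 1ℤ y))) p)
   negative : ∀ n -> P D -> P (bump D x Z.-[1+ n ])
   negative zero p = back Z.-[1+ 0 ] (pos 0 p)
   negative (suc n) p = back Z.-[1+ suc n ] (negative n p)
   go : ∀ n -> P D -> P (bump D x n)
   go (Z.+ n) = pos n
   go Z.-[1+ n ] = negative n
  Zero : Adele -> Set
  Zero a = a 𝔸.≈ 𝔸.0#
  zero-sub : Sub Zero
  zero-sub = record
   { resp = λ e p x -> K.trans x (K.sym x (e x)) (p x) ; 0∈ = λ x -> K.refl x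
   ; +∈ = λ p q x -> K.trans x (K.+-cong x (p x) (q x)) (K.+-idˡ x _)
   ; *∈ = λ c p x -> K.trans x (K.*ˡ x (p x)) (K.zeroʳ x _) }
  -- The space of sections {f ∈ F : ord f ≥ D}, embedded in 𝔸.
  record H⁰ (D : Divisor) (a : Adele) : Set where
   constructor h⁰
   field
    isPrincipal : Principal a
    isWithin : Within D a
  open H⁰
  H⁰-sub : ∀ D -> Sub (H⁰ D)
  H⁰-sub D = record
   { resp = λ { {a} {b} e (h⁰ p w) -> h⁰ (P.resp {a} {b} e p) (W.resp {a} {b} e w) }
   ; 0∈ = h⁰ P.0∈ W.0∈
   ; +∈ = λ { {a} {b} (h⁰ p w) (h⁰ p' w') -> h⁰ (P.+∈ {a} {b} p p') (W.+∈ {a} {b} w w') }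
   ; *∈ = λ { c {a} (h⁰ p w) -> h⁰ (P.*∈ c {a} p) (W.*∈ c {a} w) } }
   where
   module P = Sub principal-sub
   module W = Sub (within-sub D)
  within-mono : ∀ D E {a} -> (∀ x -> fst D x ≤ fst E x) -> Within E a -> Within D a
  within-mono D E h w x = V.ball-mono x (h x) (w x)
  F+-mono : ∀ D E {a} -> (∀ x -> fst D x ≤ fst E x) -> F+ E a -> F+ D a
  F+-mono D E h (f , o , p , w , e) = f , o , p , within-mono D E {o} h w , e
  -- `Within D` asks for ord ≥ D, so `H⁰ D` consists of the sections of 𝒪(-D), and the Euler
  -- characteristic falls by deg x when x is added to D.
  record Cohomology (D : Divisor) : Set where
   constructor cohomology
   field
    {h1 h0} : ℕ
    dim-h₁ : Dim All-adeles (F+ D) h1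
    dim-h₀ : Dim (H⁰ D) Zero h0
   χ : ℤ
   χ = Z.+ h0 Z.- Z.+ h1
  open Cohomology
  χ-unique : ∀ {D} (c c' : Cohomology D) -> χ c ≡ χ c'
  χ-unique {D} (cohomology p q) (cohomology p' q') = ap₂ (λ m n -> Z.+ m Z.- Z.+ n)
   (𝕃.dim-unique (H⁰-sub D) zero-sub q q') (𝕃.dim-unique all-sub (F+-sub D) p p')
  ≡⇒≤ : ∀ {i j} -> i ≡ j -> i ≤ j
  ≡⇒≤ = ≤-reflexive
  cohom-resp : ∀ {D E} -> D ≐ E -> (c : Cohomology D) -> Σ (Cohomology E) λ c' -> χ c' ≡ χ c
  cohom-resp {D} {E} e (cohomology p q) = cohomology
   (𝕃.dim-transfer all-sub (F+-sub D) (F+-sub E) (λ a -> a) (λ {x} -> F+-mono E D {x} ge) (λ {x} _ -> F+-mono D E {x} le)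
    (λ a _ -> a , (λ x -> K.refl x) , Sub.resp (F+-sub E) {𝔸.0#} {a 𝔸.- a} (λ x -> K.sym x (K.-‿inverseʳ x _)) (Sub.0∈ (F+-sub E))) p)
   (𝕃.dim-transfer (H⁰-sub D) zero-sub zero-sub (λ { {x} (h⁰ p w) -> h⁰ p (within-mono E D {x} ge w) }) (λ z -> z) (λ _ z -> z)
    (λ { a (h⁰ p w) -> a , h⁰ p (within-mono D E {a} le w) , λ x -> K.-‿inverseʳ x _ }) q) , ≡.refl
   where
   le : ∀ x -> fst D x ≤ fst E x
   le x = ≡⇒≤ (e x)
   ge : ∀ x -> fst E x ≤ fst D x
   ge x = ≡⇒≤ (≡.sym (e x))
  D≤bump : ∀ D p x -> fst D x ≤ fst (bump D p 1ℤ) x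
  D≤bump D p x = subst (_≤ fst D x Z.+ indic p 1ℤ x) (ℤₚ.+-identityʳ _) (+-monoʳ-≤ (fst D x) (go em))
   where
   go : (d : Dec (x ≡ p)) -> 0ℤ ≤ if-dec 1ℤ 0ℤ d
   go (yes _) = Z.+≤+ ℕ.z≤n
   go (no _) = ≤-refl
  lin-spike : ∀ p {n} (v : Fin n -> F.Carrier) c -> K._≈_ p (at (lin (spike p ∘ v) c) p) (K.embed p (Basics.lin v c))
  lin-spike p {zero} v c = K.sym p (embed-0 p)
  lin-spike p {suc n} v c = K.trans p (K.+-cong p
   (K.trans p (K.*ˡ p (spike-at p (v zero))) (K.sym p (embed-* p (const (c zero)) (v zero))))
   (lin-spike p (v ∘ suc) (c ∘ suc)))
   (K.sym p (embed-+ p (const (c zero) F.* v zero) (Basics.lin (v ∘ suc) (c ∘ suc))))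
  -- With ϖ of order D(p) at p, multiplication by ϖ identifies the residue field with the quotient.
  -- Density of F in the completion at p brings every local component to a rational function, where
  -- the residue basis applies.
  local-dim : ∀ D p -> Dim (Within D) (Within (bump D p 1ℤ)) (degree p)
  local-dim D p = 𝕃.mkDim u u∈ ind span
   where
   E = bump D p 1ℤ
   n : ℤ
   n = fst D p
   ϖ : F.Carrier
   ϖ = fst (O.with-value p n)
   ϖ≉0 : ¬ ϖ F.≈ F.0#
   ϖ≉0 = fst (snd (O.with-value p n))
   vϖ : ord p ϖ ≡ n
   vϖ = snd (snd (O.with-value p n))
   E-at : fst E p ≡ 1ℤ Z.+ n
   E-at = ≡.trans (ap (Z._+_ n) (indic-at p 1ℤ)) (ℤₚ.+-comm n 1ℤ)
   E-away : ∀ {x} -> ¬ x ≡ p -> fst E x ≡ fst D x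
   E-away {x} ne = ≡.trans (ap (Z._+_ (fst D x)) (indic-away 1ℤ ne)) (ℤₚ.+-identityʳ _)
   b : Fin (degree p) -> F.Carrier
   b = Basics.Dim.basis (residue-dim p)
   v : Fin (degree p) -> F.Carrier
   v i = ϖ F.* b i
   u : Fin (degree p) -> Adele
   u i = spike p (v i)
   ϖ-ball : O.B p n ϖ
   ϖ-ball _ = ≡⇒≤ (≡.sym vϖ)
   u∈ : ∀ i -> Within D (u i)
   u∈ i x = go em
    where
    go : Dec (x ≡ p) -> B x (fst D x) (at (u i) x)
    go (yes ≡.refl) = V.ball-resp p (K.sym p (spike-at p (v i))) (embed-ball p {n} {v i}
     (O.ball-*-eq p ϖ-ball (Basics.Dim.basis∈ (residue-dim p) i) (ℤₚ.+-identityʳ n)))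
    go (no ne) = V.ball-≈0 x (spike-away (v i) ne)
   ϖ⁻¹-ball : O.B p (Z.- n) (Fₗ.inv ϖ)
   ϖ⁻¹-ball = subst (λ m -> O.B p (Z.- m) (Fₗ.inv ϖ)) vϖ (O.ball-inv p)
   ind : 𝕃.Indep (Within E) u
   ind c w i = Basics.Dim.indep (residue-dim p) c (O.ball-resp p cancel
    (O.ball-*-eq p ϖ⁻¹-ball (ball-embed p {1ℤ Z.+ n} {ϖ F.* Basics.lin b c} (V.ball-resp p
     (K.trans p (lin-spike p v c) (K.embed-cong p (Basics.lin-scale b ϖ c)))
     (subst (λ m -> B p m (at (lin u c) p)) E-at (w p))))
     (solveℤ 1 (λ n -> :- n :+ (con 1ℤ :+ n) := con 1ℤ) n))) i
    where
    cancel : Fₗ.inv ϖ F.* (ϖ F.* Basics.lin b c) F.≈ Basics.lin b c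
    cancel = F.trans (F.sym (F.*-assoc _ _ _)) (F.trans (F.*ʳ (Fₗ.inv-l ϖ≉0)) (F.*-idˡ _))
   span : 𝕃.Spans (Within D) (Within E) u
   span a a∈ = c , within
    where
    a' : K.Carrier p
    a' = K._*_ p (K.embed p (Fₗ.inv ϖ)) (at a p)
    a'∈ : B p 0ℤ a'
    a'∈ = V.ball-*-eq p (embed-ball p {Z.- n} {Fₗ.inv ϖ} ϖ⁻¹-ball) (a∈ p) (ℤₚ.+-inverseˡ n)
    f : F.Carrier
    f = fst (K.dense p a' 1ℤ)
    a'-f : B p 1ℤ (K._-_ p a' (K.embed p f))
    a'-f = snd (K.dense p a' 1ℤ)
    f∈ : O.B p 0ℤ f
    f∈ = ball-embed p {0ℤ} {f} (V.ball-resp p (solve 2 (λ a f -> a :- (a :- f) := f) a' (K.embed p f))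
     (V.ball-- p a'∈ (V.ball-mono p (Z.+≤+ ℕ.z≤n) a'-f)))
     where open IntSolver (K.ring p)
    c : Fin (degree p) -> k.Carrier
    c = fst (Basics.Dim.spans (residue-dim p) f f∈)
    f-lin : O.B p 1ℤ (f F.- Basics.lin b c)
    f-lin = snd (Basics.Dim.spans (residue-dim p) f f∈)
    l : F.Carrier
    l = Basics.lin b c
    at-p : B p (fst E p) (at (a 𝔸.- lin u c) p)
    at-p = subst (λ m -> B p m (at (a 𝔸.- lin u c) p)) (≡.sym (≡.trans E-at (ℤₚ.+-comm 1ℤ n)))
     (V.ball-resp p eq (V.ball-*-eq p (embed-ball p {n} {ϖ} ϖ-ball) (V.ball-+ p a'-f (embed-ball p {1ℤ} {f F.- l} f-lin)) ≡.refl))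
     where
     open IntSolver (K.ring p)
     module Kp = K p
     open Kp.Reasoning
     e = K.embed p
     eq : (e ϖ Kp.* ((a' Kp.- e f) Kp.+ e (f F.- l))) Kp.≈ at (a 𝔸.- lin u c) p
     eq = begin
      e ϖ Kp.* ((a' Kp.- e f) Kp.+ e (f F.- l))
       ≈⟨ Kp.*ˡ (Kp.+ˡ (Kp.trans (embed-+ p f (F.- l)) (Kp.+ˡ (embed-neg p l)))) ⟩
      e ϖ Kp.* ((a' Kp.- e f) Kp.+ (e f Kp.- e l))
       ≈⟨ solve 5 (λ w i a f l -> w :* ((i :* a :- f) :+ (f :- l)) := (w :* i) :* a :- w :* l) (e ϖ) (e (Fₗ.inv ϖ)) (at a p) (e f) (e l) ⟩
      (e ϖ Kp.* e (Fₗ.inv ϖ)) Kp.* at a p Kp.- e ϖ Kp.* e l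
       ≈⟨ Kp.+-cong (Kp.trans (Kp.*ʳ (embed-unit p ϖ≉0)) (Kp.*-idˡ _)) (Kp.-‿cong (Kp.sym (embed-* p ϖ l))) ⟩
      at a p Kp.- e (ϖ F.* l)
       ≈⟨ Kp.+ˡ (Kp.-‿cong (Kp.sym (Kp.trans (lin-spike p v c) (Kp.embed-cong (Basics.lin-scale b ϖ c))))) ⟩
      at (a 𝔸.- lin u c) p ∎
    within : Within E (a 𝔸.- lin u c)
    within x = go em
     where
     go : Dec (x ≡ p) -> B x (fst E x) (at (a 𝔸.- lin u c) x)
     go (yes ≡.refl) = at-p
     go (no ne) = subst (λ m -> B x m (at (a 𝔸.- lin u c) x)) (≡.sym (E-away ne))
      (V.ball-- x (a∈ x) (𝕃.lin∈ (ball-at x (fst D x)) {e = u} (λ i -> u∈ i x) c))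
  -- For E ≥ D, the dimension d of 𝔸(D) / 𝔸(E) is shared between H¹ and H⁰.
  module _ (D E : Divisor) (D≤E : ∀ x -> fst D x ≤ fst E x) {d : ℕ} (dim : Dim (Within D) (Within E) d) where
   private
    -- By the modular law this is 𝔸(D) ∩ (F + 𝔸(E)). Hence 𝔸(D) / M is (F + 𝔸(D)) / (F + 𝔸(E)), the
    -- change in H¹, and M / 𝔸(E) is H⁰(D) / H⁰(E).
    M : Adele -> Set
    M = H⁰ D ⊞ Within E
    sM : Sub M
    sM = ⊞-sub (H⁰-sub D) (within-sub E)
    sD = within-sub D
    sE = within-sub E
   abstract
    h⁰-step : ∃ (Dim (H⁰ D) (H⁰ E))
    h⁰-step = 𝕃.finite-dim (H⁰-sub D) (H⁰-sub E) d λ v v∈ ->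
     let c , ne , w = 𝕃.dependent sD sE (Dim.spans dim) ℕₚ.≤-refl v (λ i -> isWithin (v∈ i))
     in c , ne , h⁰ (isPrincipal (𝕃.lin∈ (H⁰-sub D) v∈ c)) w
   private
    cancelʳ : ∀ x f o -> K._≈_ x (K._-_ x (K._+_ x f o) o) f
    cancelʳ x f o = solve 2 (λ f o -> (f :+ o) :- o := f) f o
     where open IntSolver (K.ring x)
    cancelˡ : ∀ x f o -> K._≈_ x (K._-_ x (K._+_ x f o) f) o
    cancelˡ x f o = solve 2 (λ f o -> (f :+ o) :- f := o) f o
     where open IntSolver (K.ring x)
    M⊆D : ∀ {a} -> M a -> Within D a
    M⊆D {a} (f , o , h⁰ _ w , w' , e) = Sub.resp sD {f 𝔸.+ o} {a} (λ x -> K.sym x (e x)) (Sub.+∈ sD {f} {o} w (within-mono D E {o} D≤E w'))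
    E⊆M : ∀ {a} -> Within E a -> M a
    E⊆M {a} = ⊞-right {H⁰ D} {Within E} (H⁰-sub D) {a}
    M⊆F : ∀ {a} -> M a -> F+ E a
    M⊆F (f , o , h⁰ p _ , w , e) = f , o , p , w , e
    D∩F⊆M : ∀ {a} -> Within D a -> F+ E a -> M a
    D∩F⊆M {a} w (f , o , p , w' , e) = f , o , h⁰ p (Sub.resp sD {a 𝔸.- o} {f}
     (λ x -> K.trans x (K.+ʳ x (e x)) (cancelʳ x (at f x) (at o x)))
     (Sub.minus∈ sD {a} {o} w (within-mono D E {o} D≤E w'))) , w' , e
    D->F : ∀ a' -> F+ D a' -> ∃ λ a -> Within D a × F+ E (a' 𝔸.- a)
    D->F a' (f , o , p , w , e) = o , w , Sub.resp (F+-sub E) {f} {a' 𝔸.- o}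
     (λ x -> K.sym x (K.trans x (K.+ʳ x (e x)) (cancelʳ x (at f x) (at o x)))) (⊞-left {Principal} {Within E} sE {f} p)
    H->M : ∀ a -> M a -> ∃ λ h -> H⁰ D h × Within E (a 𝔸.- h)
    H->M a (f , o , h , w , e) = f , h , Sub.resp sE {o} {a 𝔸.- f}
     (λ x -> K.sym x (K.trans x (K.+ʳ x (e x)) (cancelˡ x (at f x) (at o x)))) w
    D⊆F : ∀ {a} -> Within D a -> F+ D a
    D⊆F {a} = ⊞-right {Principal} {Within D} principal-sub {a}
    H⊆M : ∀ {a} -> H⁰ D a -> M a
    H⊆M {a} = ⊞-left {H⁰ D} {Within E} sE {a}
    upper : ∀ {r} -> Dim (Within D) M r -> Dim (F+ D) (F+ E) r
    upper = 𝕃.dim-transfer {Within D} {M} {F+ D} {F+ E} sD sM (F+-sub E) (λ {a} -> D⊆F {a}) (λ {a} -> M⊆F {a}) (λ {a} -> D∩F⊆M {a}) D->F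
    lower : ∀ {s} -> Dim (H⁰ D) (H⁰ E) s -> Dim M (Within E) s
    lower = 𝕃.dim-transfer {H⁰ D} {H⁰ E} {M} {Within E} (H⁰-sub D) (H⁰-sub E) sE (λ {a} -> H⊆M {a}) isWithin (λ { (h⁰ p _) w -> h⁰ p w }) H->M
    split : ∀ {r s} -> Dim (Within D) M r -> Dim (H⁰ D) (H⁰ E) s -> d ≡ r ℕ.+ s
    split {r} {s} dim-r dim-s = 𝕃.dim-unique {Within D} {Within E} sD sE {d} {r ℕ.+ s} dim
     (𝕃.dim-+ {Within D} {M} {Within E} sD sM sE (λ {a} -> M⊆D {a}) (λ {a} -> E⊆M {a}) {r} {s} dim-r (lower dim-s))
   abstract
    middle : ∃ (Dim (Within D) M)
    middle = 𝕃.dim-between {Within D} {Within E} {Within D} {M} sD sE sD sM (λ a -> a) (λ {a} -> E⊆M {a}) dim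
    h¹-step : ∃ λ r -> Dim (F+ D) (F+ E) r × (∀ {s} -> Dim (H⁰ D) (H⁰ E) s -> d ≡ r ℕ.+ s)
    h¹-step = fst middle , upper (snd middle) , split (snd middle)
   private
    F⊆ : ∀ {a} -> F+ E a -> F+ D a
    F⊆ {a} = F+-mono D E {a} D≤E
    H⊆ : ∀ {a} -> H⁰ E a -> H⁰ D a
    H⊆ {a} (h⁰ p w) = h⁰ p (within-mono D E {a} D≤E w)
    zero⊆ : ∀ {G a} -> Zero a -> H⁰ G a
    zero⊆ {G} {a} z = Sub.resp (H⁰-sub G) {𝔸.0#} {a} (λ x -> K.sym x (z x)) (Sub.0∈ (H⁰-sub G))
   cohomology-up : Cohomology D -> Cohomology E
   cohomology-up (cohomology p q) = cohomology
    (𝕃.dim-+ all-sub (F+-sub D) (F+-sub E) (λ _ x -> K.refl x) (λ {a} -> F⊆ {a}) p (fst (snd h¹-step)))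
    (snd (𝕃.dim-between (H⁰-sub D) zero-sub (H⁰-sub E) zero-sub (λ {a} -> H⊆ {a}) (λ z -> z) q))
   cohomology-down : Cohomology E -> Cohomology D
   cohomology-down (cohomology p q) = cohomology (snd (𝕃.dim-between all-sub (F+-sub E) all-sub (F+-sub D) (λ a -> a) (λ {a} -> F⊆ {a}) p))
    (𝕃.dim-+ (H⁰-sub D) (H⁰-sub E) zero-sub (λ {a} -> H⊆ {a}) zero⊆ (snd h⁰-step) q)
   χ-step : (c : Cohomology D) (c' : Cohomology E) -> χ c ≡ χ c' Z.+ Z.+ d
   χ-step (cohomology {h1} {h0} p q) (cohomology {h1'} {h0'} p' q') = go (fst h¹-step) (fst h⁰-step) e1 e2 e3
    where
    e1 : d ≡ fst h¹-step ℕ.+ fst h⁰-step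
    e1 = snd (snd h¹-step) (snd h⁰-step)
    e2 : h1' ≡ h1 ℕ.+ fst h¹-step
    e2 = 𝕃.dim-unique all-sub (F+-sub E) p' (𝕃.dim-+ all-sub (F+-sub D) (F+-sub E) (λ _ x -> K.refl x) (λ {a} -> F⊆ {a}) p (fst (snd h¹-step)))
    e3 : h0 ≡ fst h⁰-step ℕ.+ h0'
    e3 = 𝕃.dim-unique (H⁰-sub D) zero-sub q (𝕃.dim-+ (H⁰-sub D) (H⁰-sub E) zero-sub (λ {a} -> H⊆ {a}) zero⊆ (snd h⁰-step) q')
    go : ∀ r s -> d ≡ r ℕ.+ s -> h1' ≡ h1 ℕ.+ r -> h0 ≡ s ℕ.+ h0' -> Z.+ h0 Z.- Z.+ h1 ≡ (Z.+ h0' Z.- Z.+ h1') Z.+ Z.+ d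
    go r s ≡.refl ≡.refl ≡.refl = solveℤ 4 (λ s h r l -> (s :+ l) :- h := (l :- (h :+ r)) :+ (r :+ s)) (Z.+ s) (Z.+ h1) (Z.+ r) (Z.+ h0')
  principal-zero : ∀ {f} {a : Adele} -> (∀ x -> K._≈_ x (at a x) (K.embed x f)) -> f F.≈ F.0# -> Zero a
  principal-zero p e x = K.trans x (p x) (K.trans x (K.embed-cong x e) (embed-0 x))
  -- Evaluation at x0 embeds H⁰(0) into the residue field: an everywhere regular function that
  -- vanishes at a point is 0 by `regular⇒unit`.
  cohomology-zero : Cohomology 0ᴰ
  cohomology-zero = cohomology (genus-dim isGenus) (snd (𝕃.finite-dim (H⁰-sub 0ᴰ) zero-sub (degree x0) dep))
   where
   x0 : Point
   x0 = fst t-pole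
   dep : (v : Fin (suc (degree x0)) -> Adele) -> (∀ i -> H⁰ 0ᴰ (v i)) -> Dependent Zero v
   dep v v∈ = c , fst (snd d) , zero-sum
    where
    f : Fin (suc (degree x0)) -> F.Carrier
    f i = fst (isPrincipal (v∈ i))
    f∈ : ∀ i -> O.B x0 0ℤ (f i)
    f∈ i = ball-embed x0 (V.ball-resp x0 (snd (isPrincipal (v∈ i)) x0) (isWithin (v∈ i) x0))
    d : Basics.Dependent (O.B x0 1ℤ) f
    d = Basics.dependent (ball-sub x0 0ℤ) (ball-sub x0 1ℤ) (Basics.Dim.spans (residue-dim x0)) ℕₚ.≤-refl f f∈
    c : Fin (suc (degree x0)) -> k.Carrier
    c = fst d
    lin≈ : ∀ {n} (v : Fin n -> Adele) (f : Fin n -> F.Carrier) c -> (∀ i x -> K._≈_ x (at (v i) x) (K.embed x (f i))) ->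
     ∀ x -> K._≈_ x (at (lin v c) x) (K.embed x (Basics.lin f c))
    lin≈ {zero} v f c h x = K.sym x (embed-0 x)
    lin≈ {suc n} v f c h x = K.trans x (K.+-cong x (K.trans x (K.*ˡ x (h zero x)) (K.sym x (embed-* x (const (c zero)) (f zero))))
     (lin≈ (v ∘ suc) (f ∘ suc) (c ∘ suc) (h ∘ suc) x))
     (K.sym x (embed-+ x (const (c zero) F.* f zero) (Basics.lin (f ∘ suc) (c ∘ suc))))
    lin-v : ∀ x -> K._≈_ x (at (lin v c) x) (K.embed x (Basics.lin f c))
    lin-v = lin≈ v f c (λ i -> snd (isPrincipal (v∈ i)))
    w : H⁰ 0ᴰ (lin v c)
    w = 𝕃.lin∈ (H⁰-sub 0ᴰ) v∈ c
    zero-sum : Zero (lin v c)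
    zero-sum = principal-zero {Basics.lin f c} {lin v c} lin-v (dne λ l≉0 -> 1+≰ (≤-trans (snd (snd d) l≉0)
     (≡⇒≤ (regular⇒unit l≉0 (λ x -> ball-embed x (V.ball-resp x (lin-v x) (isWithin w x))) x0))))
  abstract
   cohom : ∀ D -> Cohomology D
   cohom = divisor-recursion Cohomology (λ e c -> fst (cohom-resp e c)) cohomology-zero
    (bump-recursion Cohomology (λ e c -> fst (cohom-resp e c)) (λ D x -> cohomology-up D (bump D x 1ℤ) (D≤bump D x) (local-dim D x))
     (λ D x -> cohomology-down D (bump D x 1ℤ) (D≤bump D x) (local-dim D x)))
  -- The degree as a difference of Euler characteristics; its invariance under
  -- linear equivalence is then immediate.
  abstract
   deg : Divisor -> ℤ
   deg D = χ (cohom 0ᴰ) Z.- χ (cohom D)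
   deg-resp : ∀ {D E} -> D ≐ E -> deg D ≡ deg E
   deg-resp {D} {E} e = ap (Z._-_ (χ (cohom 0ᴰ))) (≡.trans (≡.sym (snd (cohom-resp {D} {E} e (cohom D))))
     (χ-unique {E} (fst (cohom-resp {D} {E} e (cohom D))) (cohom E)))
   deg-zero : deg 0ᴰ ≡ 0ℤ
   deg-zero = ℤₚ.+-inverseʳ (χ (cohom 0ᴰ))
   deg-bump₁ : ∀ D x -> deg (bump D x 1ℤ) ≡ deg D Z.+ Z.+ degree x
   deg-bump₁ D x = ≡.trans (solveℤ 3 (λ z e d -> z :- e := (z :- (e :+ d)) :+ d) (χ (cohom 0ᴰ)) (χ (cohom E)) (Z.+ degree x))
    (ap (λ c -> (χ (cohom 0ᴰ) Z.- c) Z.+ Z.+ degree x) (≡.sym (χ-step D E (D≤bump D x) (local-dim D x) (cohom D) (cohom E))))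
    where
    E : Divisor
    E = bump D x 1ℤ
   deg-χ : ∀ D (c : Cohomology D) -> deg D ≡ χ (cohom 0ᴰ) Z.- χ c
   deg-χ D c = ap (Z._-_ (χ (cohom 0ᴰ))) (χ-unique (cohom D) c)
  deg-bump : ∀ D x n -> deg (bump D x n) ≡ deg D Z.+ n Z.* Z.+ degree x
  deg-bump D x n = go n
   where
   d = Z.+ degree x
   step : ∀ m -> deg (bump D x (1ℤ Z.+ m)) ≡ deg (bump D x m) Z.+ d
   step m = ≡.trans (deg-resp {bump D x (1ℤ Z.+ m)} {bump (bump D x m) x 1ℤ} (λ y -> ≡.trans (ap (λ l -> fst (bump D x l) y) (ℤₚ.+-comm 1ℤ m)) (≡.sym (bump-bump D x m 1ℤ y))))
    (deg-bump₁ (bump D x m) x)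
   pos : ∀ n -> deg (bump D x (Z.+ n)) ≡ deg D Z.+ Z.+ n Z.* d
   pos zero = ≡.trans (deg-resp {bump D x 0ℤ} {D} (bump-0 D x)) (≡.sym (≡.trans (ap (Z._+_ (deg D)) (ℤₚ.*-zeroˡ d)) (ℤₚ.+-identityʳ _)))
   pos (suc n) = ≡.trans (step (Z.+ n)) (≡.trans (ap (Z._+ d) (pos n))
    (solveℤ 3 (λ D n d -> (D :+ n :* d) :+ d := D :+ (con 1ℤ :+ n) :* d) (deg D) (Z.+ n) d))
   back : ∀ m -> deg (bump D x (1ℤ Z.+ m)) ≡ deg D Z.+ (1ℤ Z.+ m) Z.* d -> deg (bump D x m) ≡ deg D Z.+ m Z.* d
   back m e = +-cancelʳ d _ _ (≡.trans (≡.sym (step m)) (≡.trans e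
    (solveℤ 3 (λ D n d -> D :+ (con 1ℤ :+ n) :* d := (D :+ n :* d) :+ d) (deg D) m d)))
   negative : ∀ n -> deg (bump D x Z.-[1+ n ]) ≡ deg D Z.+ Z.-[1+ n ] Z.* d
   negative zero = back Z.-[1+ 0 ] (pos 0)
   negative (suc n) = back Z.-[1+ suc n ] (negative n)
   go : ∀ n -> deg (bump D x n) ≡ deg D Z.+ n Z.* d
   go (Z.+ n) = pos n
   go Z.-[1+ n ] = negative n
  deg-⊕ : ∀ D E -> deg (D ⊕ E) ≡ deg D Z.+ deg E
  deg-⊕ D = divisor-recursion (λ E -> deg (D ⊕ E) ≡ deg D Z.+ deg E)
   (λ {E} {E'} e h -> ≡.trans (≡.sym (deg-resp {D ⊕ E} {D ⊕ E'} (λ x -> ap (Z._+_ (fst D x)) (e x)))) (≡.trans h (ap (Z._+_ (deg D)) (deg-resp {E} {E'} e))))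
   (≡.trans (deg-resp {D ⊕ 0ᴰ} {D} (λ x -> ℤₚ.+-identityʳ _)) (≡.sym (≡.trans (ap (Z._+_ (deg D)) deg-zero) (ℤₚ.+-identityʳ _))))
   (λ E x n h -> ≡.trans (deg-resp {D ⊕ bump E x n} {bump (D ⊕ E) x n} (λ y -> ≡.sym (ℤₚ.+-assoc (fst D y) _ _)))
    (≡.trans (deg-bump (D ⊕ E) x n) (≡.trans (ap (Z._+ n Z.* Z.+ degree x) h)
     (≡.trans (ℤₚ.+-assoc (deg D) (deg E) _) (ap (Z._+_ (deg D)) (≡.sym (deg-bump E x n)))))))
  deg-neg : ∀ D -> deg (neg D) ≡ Z.- deg D
  deg-neg D = +-cancelˡ (deg D) _ _ (≡.trans (≡.sym (deg-⊕ D (neg D)))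
   (≡.trans (deg-resp {D ⊕ neg D} {0ᴰ} (λ x -> ℤₚ.+-inverseʳ (fst D x))) (≡.trans deg-zero (≡.sym (ℤₚ.+-inverseʳ (deg D))))))
  deg-nonneg : ∀ D -> (∀ x -> 0ℤ ≤ fst D x) -> 0ℤ ≤ deg D
  deg-nonneg (d , L , h) = go L d h
   where
   go : ∀ L d h -> (∀ x -> 0ℤ ≤ d x) -> 0ℤ ≤ deg (d , L , h)
   go [] d h _ = ≡⇒≤ (≡.trans (≡.sym deg-zero) (deg-resp {0ᴰ} {d , [] , h} (λ x -> ≡.sym (zero-at x (h x)))))
    where
    zero-at : ∀ x -> d x ≡ 0ℤ ⊎ x ∈ [] -> d x ≡ 0ℤ
    zero-at x (inl e) = e
   go (p ∷ L) d h pos = subst (0ℤ ≤_) (≡.trans (≡.sym (deg-bump D' p (d p))) (deg-resp {bump D' p (d p)} {d , p ∷ L , h} (clear-+ p d)))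
    (+-mono-≤ (go L _ _ (clear-nonneg p d pos)) (product (pos p)))
    where
    D' : Divisor
    D' = clear p d , L , clear-support p d L h
    product : ∀ {n} -> 0ℤ ≤ n -> 0ℤ ≤ n Z.* Z.+ degree p
    product {Z.+ n} _ = subst (0ℤ ≤_) (ℤₚ.pos-* n (degree p)) (Z.+≤+ ℕ.z≤n)
  deg-mono : ∀ D E -> (∀ x -> fst D x ≤ fst E x) -> deg D ≤ deg E
  deg-mono D E h = 0≤⇒≤ (subst (0ℤ ≤_) (≡.trans (deg-⊕ E (neg D)) (ap (Z._+_ (deg E)) (deg-neg D)))
   (deg-nonneg (E ⊕ neg D) (λ x -> ≤⇒0≤ (h x))))
  -- If D were smaller than E at x, then D + x ≤ E would still hold, and the positive degree of x
  -- would contradict deg E ≤ deg D.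
  deg-mono-strict : ∀ D E -> (∀ x -> fst D x ≤ fst E x) -> deg E ≤ deg D -> D ≐ E
  deg-mono-strict D E h le x = ≤-antisym (h x) (≮⇒≥ λ lt -> <⇒≱ {deg D} {deg D Z.+ Z.+ degree x}
   (subst (_< deg D Z.+ Z.+ degree x) (ℤₚ.+-identityʳ (deg D)) (+-monoʳ-< (deg D) (Z.+<+ (degree>0 x))))
   (≤-trans (subst (_≤ deg E) (deg-bump₁ D x) (deg-mono (bump D x 1ℤ) E (λ y -> go lt y em))) le))
   where
   go : fst D x < fst E x -> ∀ y -> (d : Dec (y ≡ x)) -> fst D y Z.+ if-dec 1ℤ 0ℤ d ≤ fst E y
   go lt y (yes ≡.refl) = subst (_≤ fst E y) (ℤₚ.+-comm 1ℤ (fst D y)) (i<j⇒suc[i]≤j lt)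
   go lt y (no _) = subst (_≤ fst E y) (≡.sym (ℤₚ.+-identityʳ _)) (h y)

 -- Riemann's inequality and the vanishing of H¹

 module DivisorClasses where
  open Curve X using (k; const; q)
  open RiemannRoch public
  open PointTheory using (t≉0; vanish; vanish≉0; vanish-zero)
  open H⁰
  open Cohomology
  private
   module k = FieldLaws k
  div : ∀ f -> ¬ f F.≈ F.0# -> Divisor
  div f f≉0 = (λ x -> ord x f) , ord-almost-zero f f≉0
  principal-ball : ∀ x f -> B x (ord x f) (K.embed x f)
  principal-ball x f = embed-ball x (O.ball-v x f)
  principal-unit : ∀ {f} -> ¬ f F.≈ F.0# -> principal f 𝔸.* principal (Fₗ.inv f) 𝔸.≈ 𝔸.1#
  principal-unit f≉0 x = embed-unit x f≉0
  principal-* : ∀ f {a} -> Principal a -> Principal (principal f 𝔸.* a)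
  principal-* f {a} (h , e) = f F.* h , λ x -> K.trans x (K.*ˡ x (e x)) (K.sym x (embed-* x f h))
  module _ {D E : Divisor} (f : F.Carrier) (shift : ∀ x -> fst E x ≤ ord x f Z.+ fst D x) where
   within-* : ∀ {a} -> Within D a -> Within E (principal f 𝔸.* a)
   within-* {a} w x = V.ball-mono x (shift x) (V.ball-*' x (principal-ball x f) (w x))
   H⁰-* : ∀ {a} -> H⁰ D a -> H⁰ E (principal f 𝔸.* a)
   H⁰-* {a} (h⁰ p w) = h⁰ (principal-* f {a} p) (within-* {a} w)
   F+-* : ∀ {a} -> F+ D a -> F+ E (principal f 𝔸.* a)
   F+-* {a} (h , o , p , w , e) = principal f 𝔸.* h , principal f 𝔸.* o , principal-* f {h} p , within-* {o} w
    , λ x -> K.trans x (K.*ˡ x (e x)) (K.distribˡ x _ _ _)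
  -- Multiplication by f carries H⁰ and H¹ of 0 onto those of div f, so the Euler characteristics
  -- agree.
  deg-div : ∀ f f≉0 -> deg (div f f≉0) ≡ 0ℤ
  deg-div f f≉0 = ≡.trans (deg-χ (div f f≉0) scaled) (ℤₚ.+-inverseʳ (χ (cohom 0ᴰ)))
   where
   D E : Divisor
   D = 0ᴰ
   E = div f f≉0
   f⁻¹ : F.Carrier
   f⁻¹ = Fₗ.inv f
   up : ∀ x -> fst E x ≤ ord x f Z.+ fst D x
   up x = ≡⇒≤ (≡.sym (ℤₚ.+-identityʳ _))
   down : ∀ x -> fst D x ≤ ord x f⁻¹ Z.+ fst E x
   down x = ≡⇒≤ (≡.sym (≡.trans (ap (Z._+ ord x f) (O.v-inv x f≉0)) (ℤₚ.+-inverseˡ (ord x f))))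
   zero-* : ∀ h {a} -> Zero a -> Zero (principal h 𝔸.* a)
   zero-* h z x = K.trans x (K.*ˡ x (z x)) (K.zeroʳ x _)
   scaled : Cohomology E
   scaled = cohomology (𝕃.dim-scale {All-adeles} {F+ D} {All-adeles} {F+ E} all-sub (F+-sub D) all-sub (F+-sub E)
     (principal f) (principal f⁻¹) (principal-unit f≉0) (λ _ x -> K.refl x) (λ _ x -> K.refl x)
     (λ {a} -> F+-* {D} {E} f up {a}) (λ {a} -> F+-* {E} {D} f⁻¹ down {a}) (dim-h₁ (cohom D)))
    (𝕃.dim-scale {H⁰ D} {Zero} {H⁰ E} {Zero} (H⁰-sub D) zero-sub (H⁰-sub E) zero-sub
     (principal f) (principal f⁻¹) (principal-unit f≉0) (λ {a} -> H⁰-* {D} {E} f up {a}) (λ {a} -> H⁰-* {E} {D} f⁻¹ down {a})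
     (λ {a} -> zero-* f {a}) (λ {a} -> zero-* f⁻¹ {a}) (dim-h₀ (cohom D)))
  deg-section : ∀ D {f} -> ¬ f F.≈ F.0# -> (∀ x -> O.B x (fst D x) f) -> deg D ≤ 0ℤ
  deg-section D {f} f≉0 h = subst (deg D ≤_) (deg-div f f≉0) (deg-mono D (div f f≉0) (λ x -> h x f≉0))
  section : ∀ {D a} -> H⁰ D a -> ¬ Zero a -> ∃ λ f -> ¬ f F.≈ F.0# × (∀ x -> O.B x (fst D x) f) × (∀ x -> K._≈_ x (at a x) (K.embed x f))
  section {D} {a} (h⁰ (f , e) w) ne = f , (λ z -> ne (principal-zero {f} {a} e z)) , (λ x -> ball-embed x (V.ball-resp x (e x) (w x))) , e
  χ₀ : ℤ
  χ₀ = χ (cohom 0ᴰ)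
  -- The constant 1 contributes a dimension to H⁰(0), and h¹(0) is the genus.
  χ₀-bound : 1ℤ Z.- Z.+ g ≤ χ₀
  χ₀-bound = subst (λ n -> 1ℤ Z.- Z.+ g ≤ Z.+ h0 (cohom 0ᴰ) Z.- Z.+ n)
   (𝕃.dim-unique all-sub (F+-sub 0ᴰ) (genus-dim isGenus) (dim-h₁ (cohom 0ᴰ)))
   (+-monoˡ-≤ (Z.- Z.+ g) (Z.+≤+ (go _ (dim-h₀ (cohom 0ᴰ)))))
   where
   one : H⁰ 0ᴰ 𝔸.1#
   one = h⁰ (F.1# , λ x -> K.sym x (embed-1 x)) (λ x _ -> ≤-reflexive (≡.sym (V.v1≡0 x)))
   go : ∀ n -> Dim (H⁰ 0ᴰ) Zero n -> 1 ℕ.≤ n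
   go zero d = ⊥-elim (K.1≉0 (fst t-pole) (𝕃.dim-0 zero-sub d {𝔸.1#} one (fst t-pole)))
   go (suc n) d = ℕ.s≤s ℕ.z≤n
  χ-deg : ∀ D -> χ (cohom D) ≡ χ₀ Z.- deg D
  χ-deg D = ≡.trans (solveℤ 2 (λ z c -> c := z :- (z :- c)) χ₀ (χ (cohom D))) (ap (Z._-_ χ₀) (≡.sym (deg-χ D (cohom D))))
  -- Riemann's inequality in the sign convention of `H⁰`, with χ₀ in the place of 1 - g.
  h0-bound : ∀ D -> χ₀ Z.- deg D ≤ Z.+ h0 (cohom D)
  h0-bound D = subst (_≤ Z.+ h0 (cohom D)) (χ-deg D) (ℤₚ.i-j≤i (Z.+ h0 (cohom D)) (Z.+ h1 (cohom D)))
  exists-section : ∀ D -> 0ℤ < χ₀ Z.- deg D -> ∃ λ f -> ¬ f F.≈ F.0# × (∀ x -> O.B x (fst D x) f)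
  exists-section D lt = go (h0 (cohom D)) (dim-h₀ (cohom D)) (<-≤-trans lt (h0-bound D))
   where
   go : ∀ n -> Dim (H⁰ D) Zero n -> 0ℤ < Z.+ n -> ∃ λ f -> ¬ f F.≈ F.0# × (∀ x -> O.B x (fst D x) f)
   go zero _ (Z.+<+ ())
   go (suc n) d _ = let f , ne , h , _ = section (Dim.basis∈ d zero) nonzero in f , ne , h
    where
    nonzero : ¬ Zero (Dim.basis d zero)
    nonzero z = k.1≉0 (Dim.indep d (Basics.δ zero) (λ x -> K.trans x (lin-δ-zero x) (z x)) zero)
     where
     lin-δ-zero : lin (Dim.basis d) (Basics.δ zero) 𝔸.≈ Dim.basis d zero
     lin-δ-zero x = K.trans x (K.+-cong x (K.trans x (K.*ʳ x (RingHom.1#-homo constantHom x)) (K.*-idˡ x _))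
      (𝕃.lin-0 (Dim.basis d ∘ suc) _ (λ _ -> k.refl) x))
      (K.+-idʳ x _)
  -- A non-zero functional on H¹(D), given by its kernel W: the adeles whose first coordinate in a
  -- basis vanishes. The first basis vector lies outside W.
  module Hyperplane (D : Divisor) {m : ℕ} (dim : Dim All-adeles (F+ D) (suc m)) where
   private
    e = Dim.basis dim
    module FD = Sub (F+-sub D)
    module _ (x : Point) where
     open K x
     open IntSolver ring
     sub-+ : ∀ a b y z -> (a - y) + (b - z) ≈ (a + b) - (y + z)
     sub-+ = solve 4 (λ a b y z -> (a :- y) :+ (b :- z) := (a :+ b) :- (y :+ z))
     sub-* : ∀ s a y -> s * (a - y) ≈ s * a - s * y
     sub-* = solve 3 (λ s a y -> s :* (a :- y) := s :* a :- s :* y)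
     sub-split : ∀ a y z -> a - (y + z) ≈ (a - (y + 0#)) - z
     sub-split = solve 3 (λ a y z -> a :- (y :+ z) := (a :- (y :+ con 0ℤ)) :- z)
   record W (a : Adele) : Set where
    constructor mkW
    field
     coeff : Fin (suc m) -> k.Carrier
     coeff≈0 : coeff zero k.≈ k.0#
     rest : F+ D (a 𝔸.- lin e coeff)
   F+⊆W : ∀ {a} -> F+ D a -> W a
   F+⊆W {a} p = mkW (λ _ -> k.0#) k.refl (FD.resp {a} {a 𝔸.- lin e (λ _ -> k.0#)}
    (λ x -> K.sym x (K.trans x (K.+ˡ x (K.-‿cong x (𝕃.lin-0 e _ (λ _ -> k.refl) x))) (minus-zero x (at a x)))) p)
    where
    minus-zero : ∀ x b -> K._≈_ x (K._-_ x b (K.0# x)) b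
    minus-zero x b = solve 1 (λ b -> b :- con 0ℤ := b) b
     where open IntSolver (K.ring x)
   W-sub : Sub W
   W-sub = record
    { resp = λ { {a} {b} eq (mkW c z r) -> mkW c z (FD.resp {a 𝔸.- lin e c} {b 𝔸.- lin e c} (λ x -> K.+ʳ x (eq x)) r) }
    ; 0∈ = F+⊆W {𝔸.0#} FD.0∈
    ; +∈ = λ { {a} {b} (mkW c z r) (mkW c' z' r') -> mkW (λ i -> c i k.+ c' i) (k.trans (k.+-cong z z') (k.+-idˡ _))
     (FD.resp {(a 𝔸.- lin e c) 𝔸.+ (b 𝔸.- lin e c')} {(a 𝔸.+ b) 𝔸.- lin e (λ i -> c i k.+ c' i)}
      (λ x -> K.trans x (sub-+ x _ _ _ _) (K.+ˡ x (K.-‿cong x (K.sym x (𝕃.lin-+ e c c' x)))))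
      (FD.+∈ {a 𝔸.- lin e c} {b 𝔸.- lin e c'} r r')) }
    ; *∈ = λ { s {a} (mkW c z r) -> mkW (λ i -> s k.* c i) (k.trans (k.*ˡ z) (k.zeroʳ s))
     (FD.resp {constant s 𝔸.* (a 𝔸.- lin e c)} {constant s 𝔸.* a 𝔸.- lin e (λ i -> s k.* c i)}
      (λ x -> K.trans x (sub-* x _ _ _) (K.+ˡ x (K.-‿cong x (K.sym x (𝕃.lin-* e s c x)))))
      (FD.*∈ s {a 𝔸.- lin e c} r)) } }
   generator : Fin 1 -> Adele
   generator _ = e zero
   W-spans : 𝕃.Spans All-adeles W generator
   W-spans a _ = (λ _ -> c zero) , mkW c' k.refl (FD.resp {a 𝔸.- lin e c} {(a 𝔸.- lin generator (λ _ -> c zero)) 𝔸.- lin e c'}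
    (λ x -> K.trans x (sub-split x _ _ _) (drop-zero x)) (snd (Dim.spans dim a (λ x -> K.refl x))))
    where
    c = fst (Dim.spans dim a (λ x -> K.refl x))
    c' : Fin (suc m) -> k.Carrier
    c' zero = k.0#
    c' (suc i) = c (suc i)
    r = lin (e ∘ suc) (c ∘ suc)
    drop-zero : ((a 𝔸.- lin generator (λ _ -> c zero)) 𝔸.- r) 𝔸.≈ ((a 𝔸.- lin generator (λ _ -> c zero)) 𝔸.- lin e c')
    drop-zero x = K.+ˡ x (K.-‿cong x (K.sym x (K.trans x
     (K.+ʳ x (K.trans x (K.*ʳ x (RingHom.0#-homo constantHom x)) (K.zeroˡ x _))) (K.+-idˡ x _))))
   e∉W : ¬ W (e zero)
   e∉W (mkW c z r) = k.1≉0 (k.trans (unit zero) (k.trans (Dim.indep dim d (FD.resp {e zero 𝔸.- lin e c} {lin e d} eq r) zero) k.refl))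
    where
    d : Fin (suc m) -> k.Carrier
    d zero = k.1# k.- c zero
    d (suc i) = k.- c (suc i)
    unit : ∀ (i : Fin 1) -> k.1# k.≈ d zero
    unit _ = k.sym (k.trans (k.+ˡ (k.trans (k.-‿cong z) (kₛ.solve 0 (:- con 0ℤ := con 0ℤ)))) (k.+-idʳ _))
     where module kₛ = IntSolver k.ring
    eq : (e zero 𝔸.- lin e c) 𝔸.≈ lin e d
    eq x = K.trans x (K.+ʳ x (K.sym x (lin-δ-zero x))) (K.trans x (K.sym x (𝕃.lin-minus e (Basics.δ zero) c x)) (𝕃.lin-congᶜ e same x))
     where
     same : ∀ i -> (Basics.δ zero i k.- c i) k.≈ d i
     same zero = k.refl
     same (suc i) = k.+-idˡ _
     lin-δ-zero : lin e (Basics.δ zero) 𝔸.≈ e zero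
     lin-δ-zero x = K.trans x (K.+-cong x (K.trans x (K.*ʳ x (RingHom.1#-homo constantHom x)) (K.*-idˡ x _))
      (𝕃.lin-0 (e ∘ suc) _ (λ _ -> k.refl) x))
      (K.+-idʳ x _)
  -- A section of −B maps H¹(D + B) to H¹(D), and a functional on H¹(D) embeds
  -- H⁰(−B) into the dual of H¹(D + B).
  sections≤dual : ∀ D B {m n r} -> Dim All-adeles (F+ D) (suc r) -> Dim All-adeles (F+ (D ⊕ B)) n -> Dim (H⁰ (neg B)) Zero m -> m ℕ.≤ n
  sections≤dual D B {m} {n} dim₁ dim₂ dim₃ = ℕₚ.≮⇒≥ λ n<m ->
   let c , c' , (i , ne) , same = 𝕃.pigeonhole n<m (λ c i -> coeff (lin b c 𝔸.* v i)) in contradiction c c' i ne same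
   where
   open Hyperplane D dim₁
   module Wₛ = Sub W-sub
   v : Fin n -> Adele
   v = Dim.basis dim₂
   b : Fin m -> Adele
   b = Dim.basis dim₃
   e : Adele
   e = Dim.basis dim₁ zero
   coeff : Adele -> k.Carrier
   coeff a = fst (W-spans a (λ x -> K.refl x)) zero
   coeff-W : ∀ a -> W (a 𝔸.- lin generator (λ _ -> coeff a))
   coeff-W a = snd (W-spans a (λ x -> K.refl x))
   contradiction : ∀ c c' i -> ¬ c i k.≈ c' i -> (∀ j -> coeff (lin b c 𝔸.* v j) k.≈ coeff (lin b c' 𝔸.* v j)) -> ⊥
   -- The difference h of the two sections satisfies h · 𝔸 ⊆ W, because the functionals agree on a
   -- basis of H¹(D + B). Applied to h⁻¹ e this would put e into W.
   contradiction c c' i ne same = e∉W (Wₛ.resp {h 𝔸.* (principal (Fₗ.inv f) 𝔸.* e)} {e} cancel (h-W (principal (Fₗ.inv f) 𝔸.* e)))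
    where
    h : Adele
    h = lin b (λ j -> c j k.- c' j)
    nonzero : ¬ Zero h
    nonzero z = ne (kₗ.x-y≈0⇒x≈y (Dim.indep dim₃ _ z i))
     where module kₗ = FieldLemmas em k
    sec : ∃ λ f -> ¬ f F.≈ F.0# × (∀ x -> O.B x (Z.- fst B x) f) × (∀ x -> K._≈_ x (at h x) (K.embed x f))
    sec = section {neg B} {h} (𝕃.lin∈ (H⁰-sub (neg B)) (Dim.basis∈ dim₃) _) nonzero
    f : F.Carrier
    f = fst sec
    f≉0 = fst (snd sec)
    f∈ = fst (snd (snd sec))
    h≈f : ∀ x -> K._≈_ x (at h x) (K.embed x f)
    h≈f = snd (snd (snd sec))
    h-v : ∀ j -> W (h 𝔸.* v j)
    h-v j = Wₛ.resp {(p 𝔸.- lin generator (λ _ -> coeff p)) 𝔸.- (p' 𝔸.- lin generator (λ _ -> coeff p'))} {h 𝔸.* v j} eq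
     (Wₛ.minus∈ {p 𝔸.- lin generator (λ _ -> coeff p)} {p' 𝔸.- lin generator (λ _ -> coeff p')} (coeff-W p) (coeff-W p'))
     where
     p p' : Adele
     p = lin b c 𝔸.* v j
     p' = lin b c' 𝔸.* v j
     eq : ((p 𝔸.- lin generator (λ _ -> coeff p)) 𝔸.- (p' 𝔸.- lin generator (λ _ -> coeff p'))) 𝔸.≈ (h 𝔸.* v j)
     eq x = Kx.trans (Kx.+ʳ (Kx.+ˡ (Kx.-‿cong (𝕃.lin-congᶜ generator {λ _ -> coeff p} {λ _ -> coeff p'} (λ _ -> same j) x))))
      (Kx.trans (solve 4 (λ a b v g -> (a :* v :- g) :- (b :* v :- g) := (a :- b) :* v) _ _ _ _)
       (Kx.*ʳ (Kx.sym (𝕃.lin-minus b c c' x))))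
      where
      module Kx = K x
      open IntSolver Kx.ring
    h-W : ∀ a -> W (h 𝔸.* a)
    h-W a = Wₛ.resp {principal f 𝔸.* r 𝔸.+ lin (λ j -> h 𝔸.* v j) d} {h 𝔸.* a} eq (Wₛ.+∈ {principal f 𝔸.* r} {lin (λ j -> h 𝔸.* v j) d}
      (F+⊆W {principal f 𝔸.* r} (F+-* {D ⊕ B} {D} f shift {r} (snd s))) (𝕃.lin∈ W-sub h-v d))
     where
     s : ∃ λ d -> F+ (D ⊕ B) (a 𝔸.- lin v d)
     s = Dim.spans dim₂ a (λ x -> K.refl x)
     d : Fin n -> k.Carrier
     d = fst s
     r : Adele
     r = a 𝔸.- lin v d
     shift : ∀ x -> fst D x ≤ ord x f Z.+ (fst D x Z.+ fst B x)
     shift x = ≤-shift (f∈ x f≉0) (solveℤ 3 (λ d o b -> (o :+ (d :+ b)) :- d := o :- (:- b)) (fst D x) (ord x f) (fst B x))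
     eq : (principal f 𝔸.* r 𝔸.+ lin (λ j -> h 𝔸.* v j) d) 𝔸.≈ (h 𝔸.* a)
     eq x = Kx.trans (Kx.+-cong (Kx.*ʳ (Kx.sym (h≈f x))) (𝕃.lin-scale v h d x))
      (solve 3 (λ h a l -> h :* (a :- l) :+ h :* l := h :* a) _ _ _)
      where
      module Kx = K x
      open IntSolver Kx.ring
    cancel : (h 𝔸.* (principal (Fₗ.inv f) 𝔸.* e)) 𝔸.≈ e
    cancel x = Kx.trans (Kx.sym (Kx.*-assoc _ _ _)) (Kx.trans (Kx.*ʳ (Kx.trans (Kx.*ʳ (h≈f x)) (embed-unit x f≉0))) (Kx.*-idˡ _))
     where module Kx = K x
  x0 : Point
  x0 = fst t-pole
  deg-point : ∀ x n -> deg (pointDivisor x n) ≡ n Z.* Z.+ degree x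
  deg-point x n = ≡.trans (deg-resp {pointDivisor x n} {bump 0ᴰ x n} (λ y -> ≡.sym (ℤₚ.+-identityˡ _)))
   (≡.trans (deg-bump 0ᴰ x n) (≡.trans (ap (Z._+ n Z.* Z.+ degree x) deg-zero) (ℤₚ.+-identityˡ _)))
  deg-point-≥ : ∀ x n -> Z.+ n ≤ deg (pointDivisor x (Z.+ n))
  deg-point-≥ x n = subst (Z.+ n ≤_) (≡.trans (ℤₚ.pos-* n (degree x)) (≡.sym (deg-point x (Z.+ n))))
   (Z.+≤+ (ℕₚ.m≤m*n n (degree x) ⦃ ℕ.>-nonZero (degree>0 x) ⦄))
  i≤∣i∣ : ∀ i -> i ≤ Z.+ Z.∣ i ∣
  i≤∣i∣ (Z.+ n) = ≤-refl
  i≤∣i∣ Z.-[1+ n ] = Z.-≤+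
  -i≤∣i∣ : ∀ i -> Z.- i ≤ Z.+ Z.∣ i ∣
  -i≤∣i∣ i = subst (λ n -> Z.- i ≤ Z.+ n) (ℤₚ.∣-i∣≡∣i∣ i) (i≤∣i∣ (Z.- i))
  private
   -- The sum of all inequalities collected below: deg B and 2 χ₀ cancel, and what remains says that
   -- -1 is non-negative.
   absurd : ∀ D B z g {e b} -> e ≡ D Z.+ B -> b ≡ Z.- B ->
    ¬ 0ℤ ≤ ((e Z.- z) Z.- (z Z.- b)) Z.+ (((z Z.- (1ℤ Z.- g)) Z.+ (z Z.- (1ℤ Z.- g))) Z.+ (Z.- D Z.- Z.suc (Z.+ 2 Z.* g Z.- Z.+ 2)))
   absurd D B z g ≡.refl ≡.refl le = negative (subst (0ℤ ≤_) (solveℤ 4 (λ D B z g -> (((D :+ B) :- z) :- (z :- (:- B))) :+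
     (((z :- (con 1ℤ :- g)) :+ (z :- (con 1ℤ :- g))) :+ ((:- D) :- (con 1ℤ :+ (con (Z.+ 2) :* g :- con (Z.+ 2)))))
     := :- con 1ℤ) D B z g) le)
    where
    negative : ¬ 0ℤ ≤ Z.- 1ℤ
    negative ()
  -- Suppose H¹(D) ≠ 0 and let B be a multiple of x0 with deg (D + B) > 0. Riemann's inequality and
  -- `sections≤dual` give χ₀ + deg B ≤ h⁰(-B) ≤ h¹(D + B) = deg D + deg B - χ₀. Hence 2 χ₀ ≤ deg D,
  -- and χ₀ ≥ 1 - g contradicts -deg D > 2g - 2.
  H¹-vanishing : ∀ D -> m_X g < Z.- deg D -> ∀ a -> F+ D a
  H¹-vanishing D lt a = go (h1 (cohom D)) (dim-h₁ (cohom D))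
   where
   go : ∀ n -> Dim All-adeles (F+ D) n -> F+ D a
   go zero d = 𝕃.dim-0 (F+-sub D) d {a} (λ x -> K.refl x)
   go (suc r) d = ⊥-elim (absurd (deg D) (deg B') χ₀ (Z.+ g) degE (deg-neg B') (+-mono-≤ (≤⇒0≤ step₁) (+-mono-≤ (+-mono-≤ (≤⇒0≤ χ₀-bound) (≤⇒0≤ χ₀-bound)) (≤⇒0≤ step₂))))
    where
    N : ℕ
    -- Large enough for D + N x0 to have positive degree, so that it has no sections and its h¹ is
    -- known exactly.
    N = suc Z.∣ deg D ∣
    B' E : Divisor
    B' = pointDivisor x0 (Z.+ N)
    E = D ⊕ B'
    degE : deg E ≡ deg D Z.+ deg B'
    degE = deg-⊕ D B'
    E-pos : 0ℤ < deg E
    E-pos = subst (0ℤ <_) (≡.sym degE) (<-≤-trans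
     (ℤₚ.≤-<-trans (subst (_≤ deg D Z.+ Z.+ Z.∣ deg D ∣) (ℤₚ.+-inverseʳ (deg D)) (+-monoʳ-≤ (deg D) (-i≤∣i∣ (deg D))))
      (+-monoʳ-< (deg D) (Z.+<+ (ℕₚ.n<1+n Z.∣ deg D ∣))))
     (+-monoʳ-≤ (deg D) (deg-point-≥ x0 N)))
    no-sections : ∀ n -> Dim (H⁰ E) Zero n -> n ≡ 0
    no-sections zero _ = ≡.refl
    no-sections (suc n) d = ⊥-elim (k.1≉0 (Dim.indep d (Basics.δ zero) (all-zero (lin (Dim.basis d) (Basics.δ zero)) (𝕃.lin∈ (H⁰-sub E) (Dim.basis∈ d) (Basics.δ zero))) zero))
     where
     all-zero : ∀ a -> H⁰ E a -> Zero a
     all-zero a a∈ = dne λ ne -> let f , f≉0 , h , _ = section {E} {a} a∈ ne in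
      <⇒≱ E-pos (deg-section E f≉0 h)
    h₁E : Z.+ h1 (cohom E) ≡ deg E Z.- χ₀
    h₁E = ≡.trans (solveℤ 1 (λ h -> h := :- (con 0ℤ :- h)) (Z.+ h1 (cohom E)))
     (≡.trans (ap Z.-_ (≡.trans (ap (λ n -> Z.+ n Z.- Z.+ h1 (cohom E)) (≡.sym (no-sections _ (dim-h₀ (cohom E))))) (χ-deg E)))
      (solveℤ 2 (λ z d -> :- (z :- d) := d :- z) χ₀ (deg E)))
    step₁ : χ₀ Z.- deg (neg B') ≤ deg E Z.- χ₀
    step₁ = ≤-trans (h0-bound (neg B')) (≤-trans (Z.+≤+ (sections≤dual D B' d (dim-h₁ (cohom E)) (dim-h₀ (cohom (neg B'))))) (≡⇒≤ h₁E))
    step₂ : Z.suc (Z.+ 2 Z.* Z.+ g Z.- Z.+ 2) ≤ Z.- deg D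
    step₂ = i<j⇒suc[i]≤j (ℤₚ.≤-<-trans (i≤i⊔j (Z.+ 2 Z.* Z.+ g Z.- Z.+ 2) 0ℤ) lt)

 -- Finiteness of divisor classes of bounded degree

 module ClassNumber where
  open Curve X using (q)
  open DivisorClasses public
  open PointTheory using (t≉0; vanish; vanish≉0; vanish-zero)
  -- Such a point is a zero or pole of t, or else a zero of `vanish (q ^ n)`; both functions have
  -- finitely many zeros and poles.
  points-of-degree : ∀ n -> ∃ λ L -> ∀ x -> degree x ℕ.≤ n -> x ∈ L
  points-of-degree n = fst Lₜ ++ fst Lᵥ , λ x le -> go x le (snd Lₜ x) (snd Lᵥ x)
   where
   M : ℕ
   M = q ℕ.^ n
   0<q : ∀ {n} -> Fin n -> 0 ℕ.< n
   0<q {suc n} _ = ℕ.s≤s ℕ.z≤n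
   instance
    q-nonZero : ℕ.NonZero q
    q-nonZero = ℕ.>-nonZero (0<q (fst (Bijection.surjective (Curve.k-size X) (Field.0# (Curve.k X)))))
   Lₜ = ord-almost-zero Basics.t t≉0
   Lᵥ = ord-almost-zero (vanish M) (vanish≉0 M)
   go : ∀ x -> degree x ℕ.≤ n -> ord x Basics.t ≡ 0ℤ ⊎ x ∈ fst Lₜ -> ord x (vanish M) ≡ 0ℤ ⊎ x ∈ fst Lᵥ -> x ∈ fst Lₜ ++ fst Lᵥ
   go x le (inr x∈) _ = ∈-++⁺ˡ x∈
   go x le (inl _) (inr x∈) = ∈-++⁺ʳ (fst Lₜ) x∈
   go x le (inl e) (inl e') = ⊥-elim (1+≰ (subst (1ℤ ≤_) e' (vanish-zero x (λ _ -> ≡⇒≤ (≡.sym e)) M (ℕₚ.^-monoʳ-≤ q le) (vanish≉0 M))))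
  multiples : ℕ -> Point -> Divisor -> List Divisor
  multiples zero p D = D ∷ []
  multiples (suc b) p D = bump D p (Z.+ suc b) ∷ multiples b p D
  effectives : ℕ -> List Point -> List Divisor
  effectives b [] = 0ᴰ ∷ []
  effectives b (p ∷ L) = List.concatMap (multiples b p) (effectives b L)
  effectives-∋ : ∀ b L (D : Divisor) -> (∀ x -> 0ℤ ≤ fst D x) -> (∀ x -> fst D x ≤ Z.+ b) ->
   (∀ x -> fst D x ≡ 0ℤ ⊎ x ∈ L) -> Any (D ≐_) (effectives b L)
  effectives-∋ b [] D _ _ h = here (λ x -> zero-at (h x))
   where
   zero-at : ∀ {x} -> fst D x ≡ 0ℤ ⊎ x ∈ [] -> fst D x ≡ 0ℤ
   zero-at (inl e) = e
  effectives-∋ b (p ∷ L) D pos le h = Anyₚ.concat⁺ (Anyₚ.map⁺ (Any.map inner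
   (effectives-∋ b L D' (clear-nonneg p d pos) clear-≤ (clear-support p d L h))))
   where
   d : Point -> ℤ
   d = fst D
   D' : Divisor
   D' = clear p d , L , clear-support p d L h
   clear-≤ : ∀ x -> clear p d x ≤ Z.+ b
   clear-≤ x = go em
    where
    go : (e : Dec (x ≡ p)) -> if-dec 0ℤ (d x) e ≤ Z.+ b
    go (yes _) = Z.+≤+ ℕ.z≤n
    go (no _) = le x
   inner : ∀ {E} -> D' ≐ E -> Any (D ≐_) (multiples b p E)
   inner {E} e = go b (d p) (pos p) (le p) (λ x -> ≡.trans (≡.sym (clear-+ p d x)) (ap (Z._+ indic p (d p) x) (e x)))
    where
    go : ∀ b n -> 0ℤ ≤ n -> n ≤ Z.+ b -> D ≐ bump E p n -> Any (D ≐_) (multiples b p E)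
    go zero (Z.+ zero) _ _ h = here (λ x -> ≡.trans (h x) (bump-0 E p x))
    go zero (Z.+ suc n) _ (Z.+≤+ ()) h
    go (suc b) (Z.+ n) pos (Z.+≤+ le) h with n ℕₚ.≟ suc b
    ... | yes ≡.refl = here h
    ... | no ne = there (go b (Z.+ n) pos (Z.+≤+ (ℕₚ.≤-pred (ℕₚ.≤∧≢⇒< le ne))) h)
  infix 4 _≃_
  _≃_ : Divisor -> Divisor -> Set
  D ≃ E = ∃ λ f -> ¬ f F.≈ F.0# × (∀ x -> fst D x ≡ fst E x Z.+ ord x f)
  -- The single inequality n · deg x ≤ deg D bounds the multiplicity n at x and, when n > 0, also
  -- the degree of x.
  effective-bounds : ∀ D -> (∀ x -> 0ℤ ≤ fst D x) -> ∀ b -> deg D ≤ Z.+ b -> (∀ x -> fst D x ≤ Z.+ b) × (∀ x -> fst D x ≡ 0ℤ ⊎ degree x ℕ.≤ b)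
  effective-bounds D pos b le = (λ x -> bound x (fst D x) (pos x) (multiple x)) , λ x -> small x (fst D x) (pos x) (multiple x)
   where
   multiple : ∀ x -> fst D x Z.* Z.+ degree x ≤ Z.+ b
   multiple x = ≤-trans (≡⇒≤ (≡.sym (deg-point x (fst D x)))) (≤-trans (deg-mono (pointDivisor x (fst D x)) D (λ y -> go y em)) le)
    where
    go : ∀ y -> (d : Dec (y ≡ x)) -> if-dec (fst D x) 0ℤ d ≤ fst D y
    go y (yes ≡.refl) = ≤-refl
    go y (no _) = pos y
   cast : ∀ x n -> Z.+ n Z.* Z.+ degree x ≤ Z.+ b -> n ℕ.* degree x ℕ.≤ b
   cast x n h = ℤₚ.drop‿+≤+ (subst (_≤ Z.+ b) (≡.sym (ℤₚ.pos-* n (degree x))) h)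
   bound : ∀ x n -> 0ℤ ≤ n -> n Z.* Z.+ degree x ≤ Z.+ b -> n ≤ Z.+ b
   bound x (Z.+ n) _ h = Z.+≤+ (ℕₚ.≤-trans (ℕₚ.m≤m*n n (degree x) ⦃ ℕ.>-nonZero (degree>0 x) ⦄) (cast x n h))
   small : ∀ x n -> 0ℤ ≤ n -> n Z.* Z.+ degree x ≤ Z.+ b -> n ≡ 0ℤ ⊎ degree x ℕ.≤ b
   small x (Z.+ zero) _ h = inl ≡.refl
   small x (Z.+ suc n) _ h = inr (ℕₚ.≤-trans (ℕₚ.m≤n*m (degree x) (suc n)) (cast x (suc n) h))
  abstract
   -- Shifting D by -N x0 produces a section f, and the effective divisor div f - D + N x0 has
   -- bounded degree. It is therefore one of finitely many, and it determines the class of D.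
   classes : ∀ n -> ∃ λ (Ds : List Divisor) -> ∀ D -> Z.- Z.+ n ≤ deg D -> deg D ≤ Z.+ n -> Any (D ≃_) Ds
   classes n = List.map (λ E -> B' ⊕ neg E) (effectives b L) , cover
    where
    N b : ℕ
    -- Chosen so that χ₀ - deg (D - N x0) is positive whenever deg D ≤ n.
    N = suc (Z.∣ χ₀ ∣ ℕ.+ n)
    b = n ℕ.+ N ℕ.* degree x0
    L : List Point
    L = fst (points-of-degree b)
    B' : Divisor
    B' = pointDivisor x0 (Z.+ N)
    degB' : deg B' ≡ Z.+ (N ℕ.* degree x0)
    degB' = ≡.trans (deg-point x0 (Z.+ N)) (≡.sym (ℤₚ.pos-* N (degree x0)))
    cover : ∀ D -> Z.- Z.+ n ≤ deg D -> deg D ≤ Z.+ n -> Any (D ≃_) (List.map (λ E -> B' ⊕ neg E) (effectives b L))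
    cover D lo hi = Anyₚ.map⁺ (Any.map (λ {E'} -> equivalent {E'}) (effectives-∋ b L E E-pos (fst bounds)
     (λ x -> Sum.map₂ (snd (points-of-degree b) x) (snd bounds x))))
     where
     D' : Divisor
     D' = D ⊕ neg B'
     degD' : deg D' ≡ deg D Z.- deg B'
     degD' = ≡.trans (deg-⊕ D (neg B')) (ap (Z._+_ (deg D)) (deg-neg B'))
     positive : 0ℤ < χ₀ Z.- deg D'
     positive = <-≤-trans (Z.+<+ (ℕ.s≤s (ℕ.z≤n {0}))) (subst (1ℤ ≤_) (ap (Z._-_ χ₀) (≡.sym degD'))
      (0≤⇒≤ (subst (0ℤ ≤_) (arith (deg D) (deg B') χ₀ (Z.+ Z.∣ χ₀ ∣) (Z.+ n))
       (+-mono-≤ (≤⇒0≤ (-i≤∣i∣ χ₀)) (+-mono-≤ (≤⇒0≤ hi) (≤⇒0≤ (deg-point-≥ x0 N)))))))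
      where
      arith : ∀ d b z a n -> (a Z.- (Z.- z)) Z.+ ((n Z.- d) Z.+ (b Z.- (1ℤ Z.+ (a Z.+ n)))) ≡ (z Z.- (d Z.- b)) Z.- 1ℤ
      arith = solveℤ 5 (λ d b z a n -> (a :- (:- z)) :+ ((n :- d) :+ (b :- (con 1ℤ :+ (a :+ n)))) := (z :- (d :- b)) :- con 1ℤ)
     sec : ∃ λ f -> ¬ f F.≈ F.0# × (∀ x -> O.B x (fst D' x) f)
     sec = exists-section D' positive
     f : F.Carrier
     f = fst sec
     E : Divisor
     E = div f (fst (snd sec)) ⊕ neg D'
     E-pos : ∀ x -> 0ℤ ≤ fst E x
     E-pos x = ≤⇒0≤ (snd (snd sec) x (fst (snd sec)))
     degE : deg E ≤ Z.+ b
     degE = subst (_≤ Z.+ b) (≡.sym (≡.trans (deg-⊕ (div f (fst (snd sec))) (neg D'))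
      (≡.trans (ap₂ Z._+_ (deg-div f (fst (snd sec))) (≡.trans (deg-neg D') (ap Z.-_ degD')))
       (solveℤ 2 (λ d b -> con 0ℤ :+ (:- (d :- b)) := (:- d) :+ b) (deg D) (deg B')))))
      (+-mono-≤ (subst (Z.- deg D ≤_) (ℤₚ.neg-involutive (Z.+ n)) (neg-mono-≤ lo)) (≡⇒≤ degB'))
     bounds : (∀ x -> fst E x ≤ Z.+ b) × (∀ x -> fst E x ≡ 0ℤ ⊎ degree x ℕ.≤ b)
     bounds = effective-bounds E E-pos b degE
     equivalent : ∀ {E'} -> E ≐ E' -> D ≃ (B' ⊕ neg E')
     equivalent {E'} e = f , fst (snd sec) , λ x -> ≡.trans (solveℤ 3 (λ d b f -> d := (b :- (f :- (d :- b))) :+ f) (fst D x) (fst B' x) (ord x f))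
      (ap (λ c -> (fst B' x Z.- c) Z.+ ord x f) (e x))

 -- The group PGL₂(𝔸) and its double cosets

 module Matrices where
  open AdeleTheory
  open GL₂
  private
   module I = MatrixIdentities 𝔸
   module R = RingLaws 𝔸
  private
   1·1≈1 : (R.1# R.* R.1#) R.≈ R.1#
   1·1≈1 = R.*-idˡ R.1#
  ~-entries : ∀ {g h} -> a g R.≈ a h -> b g R.≈ b h -> c g R.≈ c h -> d g R.≈ d h -> g ~ h
  ~-entries {g} {h} p q r s = R.1# , (R.1# , 1·1≈1) , I.unscaled (a g) (a h) p , I.unscaled (b g) (b h) q
   , I.unscaled (c g) (c h) r , I.unscaled (d g) (d h) s
  ~-refl : ∀ {g} -> g ~ g
  ~-refl {g} = ~-entries {g} {g} (λ x -> K.refl x) (λ x -> K.refl x) (λ x -> K.refl x) (λ x -> K.refl x)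
  ~-sym : ∀ {g h} -> g ~ h -> h ~ g
  ~-sym {g} {h} (z , (w , zw) , p , q , r , s) = w , (z , I.unit-comm z w zw) , I.scale-sym (a g) (a h) z w zw p
   , I.scale-sym (b g) (b h) z w zw q , I.scale-sym (c g) (c h) z w zw r , I.scale-sym (d g) (d h) z w zw s
  ~-trans : ∀ {g h k} -> g ~ h -> h ~ k -> g ~ k
  ~-trans {g} {h} {k} (z , (w , zw) , p , q , r , s) (z' , (w' , zw') , p' , q' , r' , s') =
   z R.* z' , (w R.* w' , I.unit-* z w z' w' zw zw')
   , I.scale-trans (a g) (a h) (a k) z z' p p' , I.scale-trans (b g) (b h) (b k) z z' q q'
   , I.scale-trans (c g) (c h) (c k) z z' r r' , I.scale-trans (d g) (d h) (d k) z z' s s'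
  ·-cong : ∀ {g g' h h'} -> g ~ g' -> h ~ h' -> (g · h) ~ (g' · h')
  ·-cong {g} {g'} {h} {h'} (z , (w , zw) , p , q , r , s) (z' , (w' , zw') , p' , q' , r' , s') =
   z R.* z' , (w R.* w' , I.unit-* z w z' w' zw zw')
   , I.scale-entry (a g) (b g) (a h) (c h) (a g') (b g') (a h') (c h') z z' p q p' r'
   , I.scale-entry (a g) (b g) (b h) (d h) (a g') (b g') (b h') (d h') z z' p q q' s'
   , I.scale-entry (c g) (d g) (a h) (c h) (c g') (d g') (a h') (c h') z z' r s p' r'
   , I.scale-entry (c g) (d g) (b h) (d h) (c g') (d g') (b h') (d h') z z' r s q' s'
  ·-assoc : ∀ g h k -> ((g · h) · k) ~ (g · (h · k))
  ·-assoc g h k = ~-entries {(g · h) · k} {g · (h · k)}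
   (I.row-assoc (a g) (b g) (a h) (b h) (c h) (d h) (a k) (c k)) (I.row-assoc (a g) (b g) (a h) (b h) (c h) (d h) (b k) (d k))
   (I.row-assoc (c g) (d g) (a h) (b h) (c h) (d h) (a k) (c k)) (I.row-assoc (c g) (d g) (a h) (b h) (c h) (d h) (b k) (d k))
  ε : GL₂
  ε = unipotent R.0#
  inverse : GL₂ -> GL₂
  inverse g = record
   { a = d g ; b = R.- b g ; c = R.- c g ; d = a g ; u = u g
   ; unit = I.scaled-unit (a g) (b g) (c g) (d g) (u g) (unit g) }
  identityˡ : ∀ g -> (ε · g) ~ g
  identityˡ g = ~-entries {ε · g} {g} (I.1x+0y (a g) (c g)) (I.1x+0y (b g) (d g)) (I.0x+1y (a g) (c g)) (I.0x+1y (b g) (d g))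
  identityʳ : ∀ g -> (g · ε) ~ g
  identityʳ g = ~-entries {g · ε} {g} (I.x1+y0 (a g) (b g)) (I.x0+y1 (a g) (b g)) (I.x1+y0 (c g) (d g)) (I.x0+y1 (c g) (d g))
  inverseʳ : ∀ g -> (g · inverse g) ~ ε
  inverseʳ g = a g R.* d g R.- b g R.* c g , (u g , unit g) , A.r11 , A.r12 , A.r21 , A.r22
   where module A = I.Adjugate (a g) (b g) (c g) (d g)
  inverseˡ : ∀ g -> (inverse g · g) ~ ε
  inverseˡ g = a g R.* d g R.- b g R.* c g , (u g , unit g) , A.l11 , A.l12 , A.l21 , A.l22
   where module A = I.Adjugate (a g) (b g) (c g) (d g)
  inverse-cong : ∀ {g h} -> g ~ h -> inverse g ~ inverse h
  inverse-cong {g} {h} (z , inv , p , q , r , s) = z , inv , s , I.neg-scale z (b g) (b h) q , I.neg-scale z (c g) (c h) r , p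
  PGL₂ : Group 0ℓ 0ℓ
  PGL₂ = record
   { Carrier = GL₂ ; _≈_ = _~_ ; _∙_ = _·_ ; ε = ε ; _⁻¹ = inverse
   ; isGroup = record
    { isMonoid = record
     { isSemigroup = record
      { isMagma = record
       { isEquivalence = record
        { refl = λ {g} -> ~-refl {g} ; sym = λ {g} {h} -> ~-sym {g} {h} ; trans = λ {g} {h} {k} -> ~-trans {g} {h} {k} }
       ; ∙-cong = λ {g} {g'} {h} {h'} -> ·-cong {g} {g'} {h} {h'} }
      ; assoc = ·-assoc }
     ; identity = identityˡ , identityʳ }
    ; inverse = inverseˡ , inverseʳ
    ; ⁻¹-cong = λ {g} {h} -> inverse-cong {g} {h} } }
  -- Predicates on 𝔸 defining a subring, hence a subgroup of PGL₂(𝔸).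
  record IsSubring (P : Adele -> Set) : Set where
   field
    0∈ : P R.0#
    1∈ : P R.1#
    +∈ : ∀ {x y} -> P x -> P y -> P (x R.+ y)
    *∈ : ∀ {x y} -> P x -> P y -> P (x R.* y)
    -∈ : ∀ {x} -> P x -> P (R.- x)
   ·∈ : ∀ {g h} -> AllEntries P g -> AllEntries P h -> AllEntries P (g · h)
   ·∈ {g} {h} (p , q , r , s , t) (p' , q' , r' , s' , t') = entry {a g} {b g} {a h} {c h} p q p' r' , entry {a g} {b g} {b h} {d h} p q q' s'
    , entry {c g} {d g} {a h} {c h} r s p' r' , entry {c g} {d g} {b h} {d h} r s q' s' , *∈ {u g} {u h} t t'
    where
    entry : ∀ {x y v t} -> P x -> P y -> P v -> P t -> P (x R.* v R.+ y R.* t)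
    entry {x} {y} {v} {t} p q r s = +∈ {x R.* v} {y R.* t} (*∈ {x} {v} p r) (*∈ {y} {t} q s)
   inverse∈ : ∀ {g} -> AllEntries P g -> AllEntries P (inverse g)
   inverse∈ {g} (p , q , r , s , t) = s , -∈ {b g} q , -∈ {c g} r , p , t
   ε∈ : AllEntries P ε
   ε∈ = 1∈ , 0∈ , 0∈ , 1∈ , 1∈
  principal-subring : IsSubring Principal
  principal-subring = record
   { 0∈ = Sub.0∈ principal-sub
   ; 1∈ = F.1# , λ x -> K.sym x (embed-1 x)
   ; +∈ = λ {x} {y} -> Sub.+∈ principal-sub {x} {y}
   ; *∈ = λ { (f , e) (f' , e') -> f F.* f' , λ x -> K.trans x (K.*-cong x (e x) (e' x)) (K.sym x (embed-* x f f')) }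
   ; -∈ = λ { (f , e) -> F.- f , λ x -> K.trans x (K.-‿cong x (e x)) (K.sym x (embed-neg x f)) } }
  integral-subring : IsSubring Integral
  integral-subring = record
   { 0∈ = λ x -> V.ball-0 x ; 1∈ = λ x _ -> ≤-reflexive (≡.sym (V.v1≡0 x))
   ; +∈ = λ p q x -> V.ball-+ x (p x) (q x) ; *∈ = λ p q x -> V.ball-*ˡ x (p x) (q x)
   ; -∈ = λ p x -> V.ball-neg' x (p x) }
  module Γ = IsSubring principal-subring
  module 𝒦 = IsSubring integral-subring
  module G = Group PGL₂
  open GroupProperties PGL₂ using (⁻¹-anti-homo-∙)
  InK-resp : ∀ {g h} -> g ~ h -> InK g -> InK h
  InK-resp {g} {h} e (k , p , k∈) = k , G.trans {h} {g} {k} (G.sym {g} {h} e) p , k∈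
  InK-· : ∀ {g h} -> InK g -> InK h -> InK (g · h)
  InK-· {g} {h} (k , p , k∈) (k' , p' , k'∈) = k · k' , ·-cong {g} {k} {h} {k'} p p' , 𝒦.·∈ {k} {k'} k∈ k'∈
  InK-inverse : ∀ {g} -> InK g -> InK (inverse g)
  InK-inverse {g} (k , p , k∈) = inverse k , inverse-cong {g} {k} p , 𝒦.inverse∈ {k} k∈
  InK-ε : InK ε
  InK-ε = ε , G.refl {ε} , 𝒦.ε∈
  entries⇒InK : ∀ {g} -> AllEntries Integral g -> InK g
  entries⇒InK {g} p = g , G.refl {g} , p
  -- g and h represent the same class in PGL₂(F)\PGL₂(𝔸)/K.
  record _≈ᴰ_ (g h : GL₂) : Set where
   constructor double
   field
    left right : GL₂
    left∈ : AllEntries Principal left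
    right∈ : AllEntries Integral right
    eq : ((left · g) · right) ~ h
  infix 4 _≈ᴰ_
  open import Relation.Binary.Reasoning.Setoid G.setoid
  ~⇒≈ᴰ : ∀ {g h} -> g ~ h -> g ≈ᴰ h
  ~⇒≈ᴰ {g} {h} e = double ε ε Γ.ε∈ 𝒦.ε∈ (begin
   (ε · g) · ε ≈⟨ identityʳ (ε · g) ⟩
   ε · g ≈⟨ identityˡ g ⟩
   g ≈⟨ e ⟩
   h ∎)
  ≈ᴰ-sym : ∀ {g h} -> g ≈ᴰ h -> h ≈ᴰ g
  ≈ᴰ-sym {g} {h} (double γ κ γ∈ κ∈ e) = double (inverse γ) (inverse κ) (Γ.inverse∈ {γ} γ∈) (𝒦.inverse∈ {κ} κ∈) (begin
   (inverse γ · h) · inverse κ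
    ≈⟨ ·-cong {inverse γ · h} {inverse γ · ((γ · g) · κ)} {inverse κ} {inverse κ} (·-cong {inverse γ} {inverse γ} {h} {(γ · g) · κ} (G.refl {inverse γ}) (G.sym {(γ · g) · κ} {h} e)) (G.refl {inverse κ}) ⟩
   (inverse γ · ((γ · g) · κ)) · inverse κ
    ≈⟨ ·-cong {inverse γ · ((γ · g) · κ)} {(inverse γ · (γ · g)) · κ} {inverse κ} {inverse κ} (G.sym {(inverse γ · (γ · g)) · κ} {inverse γ · ((γ · g) · κ)} (·-assoc (inverse γ) (γ · g) κ)) (G.refl {inverse κ}) ⟩
   ((inverse γ · (γ · g)) · κ) · inverse κ
    ≈⟨ GroupProperties.//-rightDividesʳ PGL₂ κ (inverse γ · (γ · g)) ⟩
   inverse γ · (γ · g) ≈⟨ GroupProperties.\\-leftDividesʳ PGL₂ γ g ⟩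
   g ∎)
  ≈ᴰ-trans : ∀ {g h k} -> g ≈ᴰ h -> h ≈ᴰ k -> g ≈ᴰ k
  ≈ᴰ-trans {g} {h} {k} (double γ κ γ∈ κ∈ e) (double γ' κ' γ'∈ κ'∈ e') =
   double (γ' · γ) (κ · κ') (Γ.·∈ {γ'} {γ} γ'∈ γ∈) (𝒦.·∈ {κ} {κ'} κ∈ κ'∈) (begin
    ((γ' · γ) · g) · (κ · κ')
     ≈⟨ ·-cong {(γ' · γ) · g} {γ' · (γ · g)} {κ · κ'} {κ · κ'} (·-assoc γ' γ g) (G.refl {κ · κ'}) ⟩
    (γ' · (γ · g)) · (κ · κ') ≈⟨ ·-assoc (γ' · (γ · g)) κ κ' ⟨
    ((γ' · (γ · g)) · κ) · κ'
     ≈⟨ ·-cong {(γ' · (γ · g)) · κ} {γ' · h} {κ'} {κ'} (G.trans {(γ' · (γ · g)) · κ} {γ' · ((γ · g) · κ)} {γ' · h} (·-assoc γ' (γ · g) κ) (·-cong {γ'} {γ'} {(γ · g) · κ} {h} (G.refl {γ'}) e)) (G.refl {κ'}) ⟩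
    (γ' · h) · κ' ≈⟨ e' ⟩
    k ∎)
  ≈ᴰ-left : ∀ {γ} g -> AllEntries Principal γ -> (γ · g) ≈ᴰ g
  ≈ᴰ-left {γ} g γ∈ = ≈ᴰ-sym {g} {γ · g} (double γ ε γ∈ 𝒦.ε∈ (identityʳ (γ · g)))
  ≈ᴰ-right : ∀ g {κ} -> InK κ -> (g · κ) ≈ᴰ g
  ≈ᴰ-right g {κ} (κ' , e , κ'∈) = ≈ᴰ-sym {g} {g · κ} (double ε κ' Γ.ε∈ κ'∈ (begin
   (ε · g) · κ' ≈⟨ ·-cong {ε · g} {g} {κ'} {κ} (identityˡ g) (G.sym {κ} {κ'} e) ⟩
   g · κ ∎))
  intertwine⇒≈ᴰ : ∀ {g g'} γ κ -> AllEntries Principal γ -> AllEntries Integral κ -> (γ · g') ~ (g · κ) -> g ≈ᴰ g'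
  intertwine⇒≈ᴰ {g} {g'} γ κ γ∈ κ∈ e = ≈ᴰ-sym {g'} {g} (≈ᴰ-trans {g'} {g · κ} {g}
   (double γ ε γ∈ 𝒦.ε∈ (G.trans {(γ · g') · ε} {γ · g'} {g · κ} (identityʳ (γ · g')) e)) (≈ᴰ-right g {κ} (entries⇒InK {κ} κ∈)))
  -- The first index selects the column, the second the row: the columns at x will be the local
  -- basis of a lattice.
  column : GL₂ -> Fin 2 -> Fin 2 -> Adele
  column g zero zero = GL₂.a g
  column g zero (suc _) = GL₂.c g
  column g (suc _) zero = GL₂.b g
  column g (suc _) (suc _) = GL₂.d g

 -- Triangular representatives and the Iwasawa decomposition

 module Triangular where
  open ClassNumber public
  open Matrices public
  open GL₂
  private
   module R = RingLaws 𝔸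
   module I = MatrixIdentities 𝔸
  record Idele : Set where
   field
    t t⁻¹ : Adele
    invertible : (t 𝔸.* t⁻¹) 𝔸.≈ 𝔸.1#
   t≉0 : ∀ x -> ¬ K._≈_ x (at t x) (K.0# x)
   t≉0 x = Kₗ.unit≉0 x (invertible x)
   val-t⁻¹ : ∀ x -> K.val x (at t⁻¹ x) ≡ Z.- K.val x (at t x)
   val-t⁻¹ x = ≡.trans (IsDVal.cong (K.isValuation x) (Kₗ.inv-unique x (invertible x))) (V.v-inv x (t≉0 x))
   divisor : Divisor
   divisor = (λ x -> K.val x (at t x)) , almostAll-∩ (λ {x} p q -> V.v-unit x (invertible x) p q) (Adele.integral t) (Adele.integral t⁻¹)
   ball-t : ∀ x -> B x (fst divisor x) (at t x)
   ball-t x = V.ball-v x (at t x)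
   ball-t⁻¹ : ∀ x -> B x (Z.- fst divisor x) (at t⁻¹ x)
   ball-t⁻¹ x _ = ≡⇒≤ (≡.sym (val-t⁻¹ x))
  open Idele using (divisor; t≉0; val-t⁻¹; ball-t; ball-t⁻¹)
  infixl 7 _⊙_
  _⊙_ : Idele -> Idele -> Idele
  s ⊙ t = record { t = s.t R.* t.t ; t⁻¹ = s.t⁻¹ R.* t.t⁻¹ ; invertible = I.unit-* s.t s.t⁻¹ t.t t.t⁻¹ s.invertible t.invertible }
   where
   module s = Idele s
   module t = Idele t
  ⊙-divisor : ∀ s t x -> fst (divisor (s ⊙ t)) x ≡ fst (divisor s) x Z.+ fst (divisor t) x
  ⊙-divisor s t x = IsDVal.mult (K.isValuation x) (t≉0 s x) (t≉0 t x)
  inverseIdele : Idele -> Idele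
  inverseIdele t = record { t = t.t⁻¹ ; t⁻¹ = t.t ; invertible = I.unit-comm t.t t.t⁻¹ t.invertible }
   where module t = Idele t
  principalIdele : ∀ f -> ¬ f F.≈ F.0# -> Idele
  principalIdele f f≉0 = record { t = principal f ; t⁻¹ = principal (Fₗ.inv f) ; invertible = principal-unit f≉0 }
  ideleOf : Divisor -> Idele
  ideleOf D = record
   { t = adele (λ x -> K.embed x (w x)) (almostAll-map (λ {x} e -> embed-ball x {0ℤ} {w x} (λ _ -> ≡⇒≤ (≡.sym (≡.trans (ord-w x) e)))) (snd D))
   ; t⁻¹ = adele (λ x -> K.embed x (Fₗ.inv (w x))) (almostAll-map (λ {x} e -> embed-ball x {0ℤ} {Fₗ.inv (w x)}
    (λ _ -> ≡⇒≤ (≡.sym (≡.trans (O.v-inv x (w≉0 x)) (ap Z.-_ (≡.trans (ord-w x) e)))))) (snd D))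
   ; invertible = λ x -> embed-unit x (w≉0 x) }
   where
   w : Point -> F.Carrier
   w x = fst (O.with-value x (fst D x))
   w≉0 : ∀ x -> ¬ w x F.≈ F.0#
   w≉0 x = fst (snd (O.with-value x (fst D x)))
   ord-w : ∀ x -> ord x (w x) ≡ fst D x
   ord-w x = snd (snd (O.with-value x (fst D x)))
  ideleOf-divisor : ∀ D -> divisor (ideleOf D) ≐ D
  ideleOf-divisor D x = let w , w≉0 , e = O.with-value x (fst D x) in ≡.trans (K.extends x w w≉0) e
  -- The class of the extension of 𝒪 by 𝒪(−div t) determined by b.
  τ : Idele -> Adele -> GL₂
  τ t b = record { a = t.t ; b = b ; c = R.0# ; d = R.1# ; u = t.t⁻¹ ; unit = I.upper-unit t.t t.t⁻¹ b t.invertible }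
   where module t = Idele t
  τ-· : ∀ s b t c -> (τ s b · τ t c) ~ τ (s ⊙ t) (Idele.t s R.* c R.+ b)
  τ-· s b t c = ~-entries {τ s b · τ t c} {τ (s ⊙ t) (s.t R.* c R.+ b)} (fst e) (fst (snd e)) (fst (snd (snd e))) (snd (snd (snd e)))
   where
   module s = Idele s
   module t = Idele t
   e = I.upper-entries s.t b t.t c
  -- The rational matrix (f p ; 0 1) on the left changes b to f b + p, and an integral triangular
  -- matrix on the right moves it within 𝔸(div t'). So b matters only through its class in H¹, as
  -- for extensions of line bundles.
  triangular : ∀ t b t' b' f -> (f≉0 : ¬ f F.≈ F.0#) -> ∀ p -> (∀ x -> fst (divisor t') x ≡ ord x f Z.+ fst (divisor t) x) ->
   Within (divisor t') (b' R.- (principal f R.* b R.+ principal p)) -> τ t b ≈ᴰ τ t' b'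
  triangular t b t' b' f f≉0 p shift within = double γ κ
   ((principal∈ f) , principal∈ p , Γ.0∈ , Γ.1∈ , principal∈ (Fₗ.inv f)) (ε∈ , o∈ , 𝒦.0∈ , 𝒦.1∈ , ε⁻¹∈)
   (G.trans {(γ · τ t b) · κ} {τ s v · κ} {τ t' b'} (·-cong {γ · τ t b} {τ s v} {κ} {κ} (τ-· φ (principal p) t b) (G.refl {κ}))
    (G.trans {τ s v · κ} {τ (s ⊙ ε') (s.t R.* o R.+ v)} {τ t' b'} (τ-· s v ε' o)
     (~-entries {τ (s ⊙ ε') (s.t R.* o R.+ v)} {τ t' b'} (I.cancel-inverse s.t s.t⁻¹ (Idele.t t') s.invertible)
      (I.translate-back s.t s.t⁻¹ b' v s.invertible) (λ x -> K.refl x) (λ x -> K.refl x))))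
   where
   φ s ε' : Idele
   φ = principalIdele f f≉0
   s = φ ⊙ t
   ε' = t' ⊙ inverseIdele s
   module s = Idele s
   v o : Adele
   v = principal f R.* b R.+ principal p
   o = (b' R.- v) R.* s.t⁻¹
   γ κ : GL₂
   γ = τ φ (principal p)
   κ = τ ε' o
   same : ∀ x -> fst (divisor s) x ≡ fst (divisor t') x
   same x = ≡.trans (⊙-divisor φ t x) (≡.trans (ap (Z._+ fst (divisor t) x) (K.extends x f f≉0)) (≡.sym (shift x)))
   s⁻¹∈ : ∀ x -> B x (Z.- fst (divisor t') x) (at s.t⁻¹ x)
   s⁻¹∈ x = subst (λ n -> B x (Z.- n) (at s.t⁻¹ x)) (same x) (ball-t⁻¹ s x)
   s∈ : ∀ x -> B x (fst (divisor t') x) (at s.t x)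
   s∈ x = subst (λ n -> B x n (at s.t x)) (same x) (ball-t s x)
   ε∈ : Integral (Idele.t ε')
   ε∈ x = V.ball-*-eq x (ball-t t' x) (s⁻¹∈ x) (ℤₚ.+-inverseʳ (fst (divisor t') x))
   ε⁻¹∈ : Integral (Idele.t⁻¹ ε')
   ε⁻¹∈ x = V.ball-*-eq x (ball-t⁻¹ t' x) (s∈ x) (ℤₚ.+-inverseˡ (fst (divisor t') x))
   o∈ : Integral o
   o∈ x = V.ball-*-eq x (within x) (s⁻¹∈ x) (ℤₚ.+-inverseʳ (fst (divisor t') x))
  -- At each point one entry of the bottom row is cleared by a column operation over 𝒪_x, dividing
  -- by whichever of c and d has the smaller order.
  module Iwasawa (g : GL₂) where
   private
    module J (x : Point) = MatrixIdentities (K.ring x)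
    module 𝕍 (x : Point) = IsDVal (K.isValuation x)
    c' d' : ∀ x -> K.Carrier x
    c' x = at (c g) x
    d' x = at (d g) x
    Choice : Point -> Set
    Choice x = (Kₗ._≉0 x (d' x) × B x 0ℤ (K._*_ x (c' x) (Kₗ.inv x (d' x)))) ⊎ (Kₗ._≉0 x (c' x) × B x 0ℤ (K._*_ x (d' x) (Kₗ.inv x (c' x))))
    choice : ∀ x -> Choice x
    choice x = go em em em
     where
     quotient-ball : ∀ {a b} -> K.val x a ≤ K.val x b -> B x 0ℤ (K._*_ x b (Kₗ.inv x a))
     quotient-ball {a} {b} le = V.ball-/ x (V.ball-mono x (subst (_≤ K.val x b) (≡.sym (ℤₚ.+-identityˡ (K.val x a))) le) (V.ball-v x b))
     zero-ball : ∀ {a b} -> K._≈_ x b (K.0# x) -> B x 0ℤ (K._*_ x b (Kₗ.inv x a))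
     zero-ball e = V.ball-≈0 x (K.trans x (K.*ʳ x e) (K.zeroˡ x _))
     go : Dec (K._≈_ x (c' x) (K.0# x)) -> Dec (K._≈_ x (d' x) (K.0# x)) -> Dec (K.val x (d' x) ≤ K.val x (c' x)) -> Choice x
     go (yes c≈0) (yes d≈0) _ = ⊥-elim (K.1≉0 x (J.degenerate x c≈0 d≈0 (unit g x)))
     go (yes c≈0) (no d≉0) _ = inl (d≉0 , zero-ball c≈0)
     go (no c≉0) (yes d≈0) _ = inr (c≉0 , zero-ball d≈0)
     go (no c≉0) (no d≉0) (yes le) = inl (d≉0 , quotient-ball le)
     go (no c≉0) (no d≉0) (no gt) = inr (c≉0 , quotient-ball (<⇒≤ (ℤₚ.≰⇒> gt)))
    1∈ : ∀ x -> B x 0ℤ (K.1# x)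
    1∈ x _ = ≡⇒≤ (≡.sym (V.v1≡0 x))
    κa κb κc κd κu : ∀ x -> Choice x -> K.Carrier x
    κa x (inl _) = K.1# x
    κa x (inr _) = K.-_ x (K._*_ x (d' x) (Kₗ.inv x (c' x)))
    κb x (inl _) = K.0# x
    κb x (inr _) = K.1# x
    κc x (inl _) = K.-_ x (K._*_ x (c' x) (Kₗ.inv x (d' x)))
    κc x (inr _) = K.1# x
    κd x (inl _) = K.1# x
    κd x (inr _) = K.0# x
    κu x (inl _) = K.1# x
    κu x (inr _) = K.-_ x (K.1# x)
    κa∈ : ∀ x s -> B x 0ℤ (κa x s)
    κa∈ x (inl _) = 1∈ x
    κa∈ x (inr (_ , p)) = V.ball-neg' x p
    κb∈ : ∀ x s -> B x 0ℤ (κb x s)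
    κb∈ x (inl _) = V.ball-0 x
    κb∈ x (inr _) = 1∈ x
    κc∈ : ∀ x s -> B x 0ℤ (κc x s)
    κc∈ x (inl (_ , p)) = V.ball-neg' x p
    κc∈ x (inr _) = 1∈ x
    κd∈ : ∀ x s -> B x 0ℤ (κd x s)
    κd∈ x (inl _) = 1∈ x
    κd∈ x (inr _) = V.ball-0 x
    κu∈ : ∀ x s -> B x 0ℤ (κu x s)
    κu∈ x (inl _) = 1∈ x
    κu∈ x (inr _) = V.ball-neg' x (1∈ x)
    κ-unit : ∀ x s -> K._≈_ x (K._*_ x (K._-_ x (K._*_ x (κa x s) (κd x s)) (K._*_ x (κb x s) (κc x s))) (κu x s)) (K.1# x)
    κ-unit x (inl _) = J.lower-unit x _
    κ-unit x (inr _) = J.swap-unit x _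
    integral-adele : (v : ∀ x -> K.Carrier x) -> (∀ x -> B x 0ℤ (v x)) -> Adele
    integral-adele v h = adele v ([] , λ x -> inl (h x))
   κ : GL₂
   κ = record
    { a = integral-adele (λ x -> κa x (choice x)) (λ x -> κa∈ x (choice x))
    ; b = integral-adele (λ x -> κb x (choice x)) (λ x -> κb∈ x (choice x))
    ; c = integral-adele (λ x -> κc x (choice x)) (λ x -> κc∈ x (choice x))
    ; d = integral-adele (λ x -> κd x (choice x)) (λ x -> κd∈ x (choice x))
    ; u = integral-adele (λ x -> κu x (choice x)) (λ x -> κu∈ x (choice x))
    ; unit = λ x -> κ-unit x (choice x) }
   κ∈ : AllEntries Integral κ
   κ∈ = (λ x -> κa∈ x (choice x)) , (λ x -> κb∈ x (choice x)) , (λ x -> κc∈ x (choice x)) , (λ x -> κd∈ x (choice x)) , λ x -> κu∈ x (choice x)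
   private
    h : GL₂
    h = g · κ
    lower≈0 : c h R.≈ R.0#
    lower≈0 x = go (choice x)
     where
     go : ∀ s -> K._≈_ x (K._+_ x (K._*_ x (c' x) (κa x s)) (K._*_ x (d' x) (κc x s))) (K.0# x)
     go (inl (d≉0 , _)) = J.clear-lower x (c' x) (d' x) _ (Kₗ.inv-l x d≉0)
     go (inr (c≉0 , _)) = J.clear-swap x (c' x) (d' x) _ (Kₗ.inv-l x c≉0)
    corner∈ : ∀ x m -> B x m (c' x) -> B x m (d' x) -> B x m (at (d h) x)
    corner∈ x m p q = go (choice x)
     where
     go : ∀ s -> B x m (K._+_ x (K._*_ x (c' x) (κb x s)) (K._*_ x (d' x) (κd x s)))
     go s = V.ball-+ x (V.ball-*-eq x p (κb∈ x s) (ℤₚ.+-identityʳ m)) (V.ball-*-eq x q (κd∈ x s) (ℤₚ.+-identityʳ m))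
    corner-unit : (a h R.* d h R.* u h) R.≈ R.1#
    corner-unit = I.triangular-unit (a h) (b h) (c h) (d h) (u h) lower≈0 (unit h)
   t : Idele
   -- After division by the corner d of the triangular matrix h the upper left entry is a / d, and a
   -- d u = 1 gives 1 / d = a u.
   t = record { t = a h R.* (a h R.* u h) ; t⁻¹ = d h R.* (d h R.* u h) ; invertible = I.square-unit (a h) (d h) (u h) corner-unit }
   β : Adele
   β = b h R.* (a h R.* u h)
   decompose : (g · κ) ~ τ t β
   decompose = d h , (a h R.* u h , I.d-unit (a h) (d h) (u h) corner-unit) , I.scale-out (a h) (d h) (u h) (a h) corner-unit
    , I.scale-out (a h) (d h) (u h) (b h) corner-unit , (λ x -> K.trans x (lower≈0 x) (K.sym x (K.zeroʳ x _))) , (λ x -> K.sym x (K.*-idʳ x _))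
   private
    values : ∀ x -> (K.val x (at (a h) x) Z.+ K.val x (at (d h) x)) Z.+ K.val x (at (u h) x) ≡ 0ℤ
    values x = ≡.trans (≡.sym (≡.trans (𝕍.mult x (Kₗ.≉0ˡ x adu≉0) (Kₗ.≉0ʳ x adu≉0))
     (ap (Z._+ K.val x (at (u h) x)) (𝕍.mult x (Kₗ.≉0ˡ x (Kₗ.≉0ˡ x adu≉0)) (Kₗ.≉0ʳ x (Kₗ.≉0ˡ x adu≉0))))))
     (≡.trans (𝕍.cong x (corner-unit x)) (V.v1≡0 x))
     where
     adu≉0 : Kₗ._≉0 x (at (a h R.* d h R.* u h) x)
     adu≉0 = Kₗ.≉0-resp x (K.sym x (corner-unit x)) (K.1≉0 x)
    val-u : ∀ x -> K.val x (at (u h) x) ≡ K.val x (at (u g) x)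
    val-u x = ≡.trans (𝕍.mult x (u≉0 g) (u≉0 κ)) (≡.trans (ap (Z._+_ (K.val x (at (u g) x))) κu≡0) (ℤₚ.+-identityʳ _))
     where
     u≉0 : ∀ m -> Kₗ._≉0 x (at (u m) x)
     u≉0 m = Kₗ.unit≉0 x (K.trans x (K.*-comm x _ _) (unit m x))
     κu≡0 : K.val x (at (u κ) x) ≡ 0ℤ
     κu≡0 = V.v-unit x (K.trans x (K.*-comm x _ _) (unit κ x)) (κu∈ x (choice x))
      (V.ball-- x (V.ball-*ˡ x (κa∈ x (choice x)) (κd∈ x (choice x))) (V.ball-*ˡ x (κb∈ x (choice x)) (κc∈ x (choice x))))
   -- The order of t is that of det g minus twice that of the corner d. The corner is an integral
   -- combination of the bottom row of g, hence of order at least m.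
   divisor-t : ∀ x m -> B x m (c' x) -> B x m (d' x) -> fst (divisor t) x Z.+ (m Z.+ m) ≤ Z.- K.val x (at (u g) x)
   divisor-t x m p q = subst (λ n -> fst (divisor t) x Z.+ (m Z.+ m) ≤ Z.- n) (val-u x)
    (subst (_≤ Z.- vu) (ap (Z._+ (m Z.+ m)) (≡.sym val-t)) (≤-combine m≤ m≤ (rearrange va vd vu m (values x))))
    where
    va = K.val x (at (a h) x)
    vd = K.val x (at (d h) x)
    vu = K.val x (at (u h) x)
    adu≉0 : Kₗ._≉0 x (at (a h R.* d h R.* u h) x)
    adu≉0 = Kₗ.≉0-resp x (K.sym x (corner-unit x)) (K.1≉0 x)
    a≉0 = Kₗ.≉0ˡ x (Kₗ.≉0ˡ x adu≉0)
    m≤ : m ≤ vd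
    m≤ = corner∈ x m p q (Kₗ.≉0ʳ x (Kₗ.≉0ˡ x adu≉0))
    val-t : K.val x (at (Idele.t t) x) ≡ va Z.+ (va Z.+ vu)
    val-t = ≡.trans (𝕍.mult x a≉0 (Kₗ.*≉0 x a≉0 (Kₗ.≉0ʳ x adu≉0))) (ap (Z._+_ va) (𝕍.mult x a≉0 (Kₗ.≉0ʳ x adu≉0)))
    rearrange : ∀ a d u m -> (a Z.+ d) Z.+ u ≡ 0ℤ -> (Z.- u) Z.- ((a Z.+ (a Z.+ u)) Z.+ (m Z.+ m)) ≡ (d Z.- m) Z.+ (d Z.- m)
    rearrange a d u m e = ≡.trans (solveℤ 4 (λ a d u m -> (:- u) :- ((a :+ (a :+ u)) :+ (m :+ m)) :=
     ((d :- m) :+ (d :- m)) :- (((a :+ d) :+ u) :+ ((a :+ d) :+ u))) a d u m)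
     (≡.trans (ap (λ s -> ((d Z.- m) Z.+ (d Z.- m)) Z.- (s Z.+ s)) e) (ℤₚ.+-identityʳ _))

 -- Slopes, their boundedness and reduction theory

 module Reduction where
  open Triangular public
  open GL₂
  open Idele using (divisor; t≉0; ball-t; ball-t⁻¹)
  private
   module R = RingLaws 𝔸
   module I = MatrixIdentities 𝔸
  adele-bound : ∀ (a : Adele) -> ∃ λ e -> (∀ x -> 0ℤ ≤ fst e x) × Within (neg e) a
  adele-bound a = (e , fst (Adele.integral a) , λ x -> support x (snd (Adele.integral a) x) em) , (λ x -> pos x em) , λ x -> ball x em
   where
   bound : ∀ x -> Dec (IntegralAt x (at a x)) -> ℤ
   bound x (yes _) = 0ℤ
   bound x (no _) = Z.+ Z.∣ K.val x (at a x) ∣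
   e : Point -> ℤ
   e x = bound x em
   support : ∀ x -> IntegralAt x (at a x) ⊎ x ∈ fst (Adele.integral a) -> (d : Dec (IntegralAt x (at a x))) -> bound x d ≡ 0ℤ ⊎ x ∈ fst (Adele.integral a)
   support x _ (yes _) = inl ≡.refl
   support x (inl p) (no n) = ⊥-elim (n p)
   support x (inr p) (no _) = inr p
   pos : ∀ x d -> 0ℤ ≤ bound x d
   pos x (yes _) = ≤-refl
   pos x (no _) = Z.+≤+ ℕ.z≤n
   ball : ∀ x d -> B x (Z.- bound x d) (at a x)
   ball x (yes p) = p
   ball x (no _) _ = subst (Z.- Z.+ Z.∣ K.val x (at a x) ∣ ≤_) (ℤₚ.neg-involutive (K.val x (at a x))) (neg-mono-≤ (-i≤∣i∣ (K.val x (at a x))))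
  u≉0 : ∀ g x -> Kₗ._≉0 x (at (u g) x)
  u≉0 g x = Kₗ.unit≉0 x (K.trans x (K.*-comm x _ _) (unit g x))
  -- In γ·(n·h)·κ = z·τ(t, b') with γ ∈ GL₂(F), κ ∈ GL₂(𝒪) and n unipotent, an entry
  -- of the bottom row of γ·n is a non-zero element of F, and it is bounded below by
  -- z and the entries of h⁻¹.
  module Lower (γ : GL₂) (γ∈ : AllEntries Principal γ) (n : Adele) (h κ : GL₂) (κ∈ : AllEntries Integral κ) (t : Idele) (b' : Adele)
   (eq : ((γ · (unipotent n · h)) · κ) ~ τ t b') (e : Divisor)
   (h⁻¹∈ : Within (neg e) (u h R.* a h) × Within (neg e) (u h R.* b h) × Within (neg e) (u h R.* c h) × Within (neg e) (u h R.* d h)) where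
   private
    P : GL₂
    P = (γ · (unipotent n · h)) · κ
    z z⁻¹ : Adele
    z = fst eq
    z⁻¹ = fst (fst (snd eq))
    z-unit : (z R.* z⁻¹) R.≈ R.1#
    z-unit = snd (fst (snd eq))
    module J (x : Point) = MatrixIdentities (K.ring x)
    module 𝕍 (x : Point) = IsDVal (K.isValuation x)
    c0 d0 : F.Carrier
    c0 = fst (fst (snd (snd γ∈)))
    d0 = fst (fst (snd (snd (snd γ∈))))
    u₀ : F.Carrier
    u₀ = fst (snd (snd (snd (snd γ∈))))
    c≈ : ∀ x -> K._≈_ x (at (c γ) x) (K.embed x c0)
    c≈ = snd (fst (snd (snd γ∈)))
    d≈ : ∀ x -> K._≈_ x (at (d γ) x) (K.embed x d0)
    d≈ = snd (fst (snd (snd (snd γ∈))))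
    u≈ : ∀ x -> K._≈_ x (at (u γ) x) (K.embed x u₀)
    u≈ = snd (snd (snd (snd (snd γ∈))))
    module At (x : Point) where
     open K x
     module W = V x
     ζ : ℤ
     ζ = val (at z x)
     z≉0 : ¬ at z x ≈ 0#
     z≉0 = Kₗ.unit≉0 x (z-unit x)
     p r s w : Carrier
     p = at (c γ) x
     -- (p r) is the bottom row of γ n, and (s w) that of γ n h. The entry p is rational, whereas r
     -- is so when p = 0.
     r = at (c γ) x * at n x + at (d γ) x
     s = p * at (a h) x + r * at (c h) x
     w = p * at (b h) x + r * at (d h) x
     s≈ : at (c (γ · (unipotent n · h))) x ≈ s
     s≈ = solve 5 (λ p q n α β -> p :* (con 1ℤ :* α :+ n :* β) :+ q :* (con 0ℤ :* α :+ con 1ℤ :* β) := p :* α :+ (p :* n :+ q) :* β) _ _ _ _ _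
      where open IntSolver ring
     w≈ : at (d (γ · (unipotent n · h))) x ≈ w
     w≈ = solve 5 (λ p q n α β -> p :* (con 1ℤ :* α :+ n :* β) :+ q :* (con 0ℤ :* α :+ con 1ℤ :* β) := p :* α :+ (p :* n :+ q) :* β) _ _ _ _ _
      where open IntSolver ring
     bottom1 : s * at (a κ) x + w * at (c κ) x ≈ 0#
     bottom1 = trans (+-cong (*ʳ (sym s≈)) (*ʳ (sym w≈))) (trans (fst (snd (snd (snd (snd eq)))) x) (zeroʳ _))
     bottom2 : s * at (b κ) x + w * at (d κ) x ≈ at z x
     bottom2 = trans (+-cong (*ʳ (sym s≈)) (*ʳ (sym w≈))) (trans (snd (snd (snd (snd (snd eq)))) x) (*-idʳ _))
     uκ∈ : ∀ {v} -> B x 0ℤ v -> B x 0ℤ (at (u κ) x * v)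
     uκ∈ = W.ball-*ˡ (snd (snd (snd (snd κ∈))) x)
     z-ball : ∀ {v} -> B x 0ℤ v -> B x ζ (at z x * v)
     z-ball v∈ = W.ball-*-eq (W.ball-v (at z x)) v∈ (ℤₚ.+-identityʳ ζ)
     0-ball : ∀ {v} -> B x ζ (0# * v)
     0-ball = W.ball-≈0 (zeroˡ _)
     s∈ : B x ζ s
     s∈ = W.ball-resp (sym (J.cramer₁ x (unit κ x) bottom1 bottom2))
      (W.ball-- 0-ball (z-ball (uκ∈ (fst (snd (snd κ∈)) x))))
     w∈ : B x ζ w
     w∈ = W.ball-resp (sym (J.cramer₂ x (unit κ x) bottom1 bottom2))
      (W.ball-- (z-ball (uκ∈ (fst κ∈ x))) 0-ball)
     p∈ : B x (ζ Z.- fst e x) p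
     p∈ = W.ball-resp (sym (J.cramer₁ x (unit h x) refl refl))
      (W.ball-- (W.ball-*' s∈ (snd (snd (snd h⁻¹∈)) x)) (W.ball-*' w∈ (fst (snd (snd h⁻¹∈)) x)))
     r∈ : B x (ζ Z.- fst e x) r
     r∈ = W.ball-resp (sym (J.cramer₂ x (unit h x) refl refl))
      (W.ball-- (W.ball-*' w∈ (fst h⁻¹∈ x)) (W.ball-*' s∈ (fst (snd h⁻¹∈) x)))
     -- The orders of the determinants in γ n h κ = z τ(t, b'), where n and κ contribute 0 and z
     -- enters twice.
     det-value : ((ζ Z.+ ζ) Z.+ fst (divisor t) x) Z.+ (ord x u₀ Z.+ val (at (u h) x)) ≡ 0ℤ
     det-value = ≡.trans (≡.sym (≡.trans (𝕍.mult x zzt≉0 γhκ≉0) (ap₂ Z._+_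
      (≡.trans (𝕍.mult x zz≉0 (t≉0 t x)) (ap (Z._+ fst (divisor t) x) (𝕍.mult x z≉0 z≉0)))
      (≡.trans (𝕍.mult x γh≉0 (u≉0 κ x)) (≡.trans (ap₂ Z._+_ (𝕍.mult x (u≉0 γ x) (u≉0 h x)) uκ≡0)
       (≡.trans (ℤₚ.+-identityʳ _) (ap (Z._+ val (at (u h) x)) u-val)))))))
      (≡.trans (𝕍.cong x (J.u-product x (at z x) (at (Idele.t t) x) _ (at (u γ) x) (at (u h) x) (at (u κ) x) (trans (*ˡ reassociate) (unit P x))
       (J.scaled-det x (fst (snd (snd eq)) x) (fst (snd (snd (snd eq))) x) (fst (snd (snd (snd (snd eq)))) x) (snd (snd (snd (snd (snd eq)))) x)))) (V.v1≡0 x))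
      where
      zz≉0 = Kₗ.*≉0 x z≉0 z≉0
      zzt≉0 = Kₗ.*≉0 x zz≉0 (t≉0 t x)
      γh≉0 = Kₗ.*≉0 x (u≉0 γ x) (u≉0 h x)
      γhκ≉0 = Kₗ.*≉0 x γh≉0 (u≉0 κ x)
      reassociate : at (u γ) x * 1# * at (u h) x * at (u κ) x ≈ at (u P) x
      reassociate = *ʳ (*-assoc _ _ _)
      uκ≡0 : val (at (u κ) x) ≡ 0ℤ
      uκ≡0 = V.v-unit x (trans (*-comm _ _) (unit κ x)) (snd (snd (snd (snd κ∈))) x)
       (W.ball-- (W.ball-*ˡ (fst κ∈ x) (fst (snd (snd (snd κ∈))) x)) (W.ball-*ˡ (fst (snd κ∈) x) (fst (snd (snd κ∈)) x)))
      u0≉0 : ¬ u₀ F.≈ F.0#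
      u0≉0 e0 = u≉0 γ x (trans (u≈ x) (trans (embed-cong e0) (embed-0 x)))
      u-val : val (at (u γ) x) ≡ ord x u₀
      u-val = ≡.trans (𝕍.cong x (u≈ x)) (extends u₀ u0≉0)
    u0≉0 : ¬ u₀ F.≈ F.0#
    u0≉0 e0 = u≉0 γ x0 (K.trans x0 (u≈ x0) (K.trans x0 (K.embed-cong x0 e0) (embed-0 x0)))
    -- The lower left entry of γ is used if it is non-zero. Otherwise n drops out of r, which
    -- becomes the lower right entry of γ, non-zero since γ is invertible.
    entry : ∃ λ ρ -> ¬ ρ F.≈ F.0# × (∀ x -> At.ζ x ≤ ord x ρ Z.+ fst e x)
    entry = go em em
     where
     use : ∀ ρ -> ¬ ρ F.≈ F.0# -> (∀ x -> B x (At.ζ x Z.- fst e x) (K.embed x ρ)) -> ∃ λ ρ -> ¬ ρ F.≈ F.0# × (∀ x -> At.ζ x ≤ ord x ρ Z.+ fst e x)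
     use ρ ρ≉0 h = ρ , ρ≉0 , λ x -> ≤-shift (ball-embed x (h x) ρ≉0)
      (solveℤ 3 (λ o e z -> (o :+ e) :- z := o :- (z :- e)) (ord x ρ) (fst e x) (At.ζ x))
     go : Dec (c0 F.≈ F.0#) -> Dec (d0 F.≈ F.0#) -> ∃ λ ρ -> ¬ ρ F.≈ F.0# × (∀ x -> At.ζ x ≤ ord x ρ Z.+ fst e x)
     go (no c0≉0) _ = use c0 c0≉0 (λ x -> V.ball-resp x (c≈ x) (At.p∈ x))
     go (yes c0≈0) (no d0≉0) = use d0 d0≉0 (λ x -> V.ball-resp x
      (K.trans x (K.+-cong x (K.trans x (K.*ʳ x (K.trans x (c≈ x) (K.trans x (K.embed-cong x c0≈0) (embed-0 x)))) (K.zeroˡ x _)) (d≈ x)) (K.+-idˡ x _)) (At.r∈ x))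
     go (yes c0≈0) (yes d0≈0) = ⊥-elim (K.1≉0 x0 (J.degenerate x0 (zero-at c0 (c≈ x0) c0≈0) (zero-at d0 (d≈ x0) d0≈0) (unit γ x0)))
      where
      zero-at : ∀ f {v} -> K._≈_ x0 v (K.embed x0 f) -> f F.≈ F.0# -> K._≈_ x0 v (K.0# x0)
      zero-at f p e = K.trans x0 p (K.trans x0 (K.embed-cong x0 e) (embed-0 x0))
   lower-bound : ∃ λ ρ -> ¬ ρ F.≈ F.0# × (∀ x -> (Z.- K.val x (at (u h) x) Z.- (fst e x Z.+ fst e x)) Z.+ ord x ρ ≤ fst (divisor t) x)
   lower-bound = ρ , ρ≉0 , λ x -> subst (λ o -> (Z.- K.val x (at (u h) x) Z.- (fst e x Z.+ fst e x)) Z.+ o ≤ fst (divisor t) x) (≡.sym (ord-ρ x))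
    (≤-combine (snd (snd entry) x) (snd (snd entry) x)
     (rearrange (At.ζ x) (fst (divisor t) x) (ord x u₀) (K.val x (at (u h) x)) (fst e x) (ord x ρ₀) (At.det-value x)))
    where
    ρ₀ : F.Carrier
    ρ₀ = fst entry
    ρ₀≉0 : ¬ ρ₀ F.≈ F.0#
    ρ₀≉0 = fst (snd entry)
    sq≉0 = Fₗ.*≉0 u0≉0 (Fₗ.*≉0 ρ₀≉0 ρ₀≉0)
    ρ : F.Carrier
    -- `det-value` expresses div t by -2ζ - ord u₀, and ζ ≤ ord ρ₀ + e. Eliminating ζ leaves the
    -- principal divisor of 1 / (u₀ ρ₀²), which has degree 0.
    ρ = Fₗ.inv (u₀ F.* (ρ₀ F.* ρ₀))
    ρ≉0 : ¬ ρ F.≈ F.0#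
    ρ≉0 = Fₗ.inv≉0 sq≉0
    ord-ρ : ∀ x -> ord x ρ ≡ Z.- (ord x u₀ Z.+ (ord x ρ₀ Z.+ ord x ρ₀))
    ord-ρ x = ≡.trans (O.v-inv x sq≉0) (ap Z.-_ (≡.trans (mult u0≉0 (Fₗ.*≉0 ρ₀≉0 ρ₀≉0)) (ap (Z._+_ (ord x u₀)) (mult ρ₀≉0 ρ₀≉0))))
     where open IsDVal (fst (isPlace x)) using (mult)
    rearrange : ∀ ζ t u h e r -> ((ζ Z.+ ζ) Z.+ t) Z.+ (u Z.+ h) ≡ 0ℤ ->
     t Z.- ((Z.- h Z.- (e Z.+ e)) Z.+ Z.- (u Z.+ (r Z.+ r))) ≡ ((r Z.+ e) Z.- ζ) Z.+ ((r Z.+ e) Z.- ζ)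
    rearrange ζ t u h e r eq = ≡.trans (solveℤ 6 (λ z t u h e r -> t :- ((:- h :- (e :+ e)) :+ :- (u :+ (r :+ r)))
     := (((r :+ e) :- z) :+ ((r :+ e) :- z)) :+ (((z :+ z) :+ t) :+ (u :+ h))) ζ t u h e r)
     (≡.trans (ap (Z._+_ (((r Z.+ e) Z.- ζ) Z.+ ((r Z.+ e) Z.- ζ))) eq) (ℤₚ.+-identityʳ _))
  -- Changing the line subbundle: (c d) is a row of a matrix in SL₂(F).
  change-line : ∀ t b c d -> ¬ (c F.≈ F.0# × d F.≈ F.0#) -> (Z : Divisor) -> Within Z (principal c R.* Idele.t t) ->
   Within Z (principal c R.* b R.+ principal d) -> ∃ λ t' -> ∃ λ b' -> τ t b ≈ᴰ τ t' b' × deg (divisor t') ≤ deg (divisor t) Z.- (deg Z Z.+ deg Z)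
  change-line t b c d nz Z p q = I'.t , I'.β , double γ I'.κ γ∈ I'.κ∈ I'.decompose
   , subst (deg (divisor I'.t) ≤_) degree-eq (deg-mono (divisor I'.t) (divisor t ⊕ neg (Z ⊕ Z)) bound)
   where
   L : F.Carrier -> Adele
   L = principal
   candidate : ∃ λ γ -> AllEntries Principal γ × (GL₂.c γ R.≈ L c) × (GL₂.d γ R.≈ L d) × (u γ R.≈ R.1#)
   candidate = go em
    where
    go : Dec (c F.≈ F.0#) -> ∃ λ γ -> AllEntries Principal γ × (GL₂.c γ R.≈ L c) × (GL₂.d γ R.≈ L d) × (u γ R.≈ R.1#)
    go (no c≉0) = record { a = R.0# ; b = R.- L (Fₗ.inv c) ; c = L c ; d = L d ; u = R.1#
     ; unit = I.lower-row-unit (L c) (L d) (L (Fₗ.inv c)) (I.unit-comm (L c) (L (Fₗ.inv c)) (principal-unit c≉0)) }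
     , (Γ.0∈ , Γ.-∈ {L (Fₗ.inv c)} (principal∈ (Fₗ.inv c)) , principal∈ c , principal∈ d , Γ.1∈)
     , (λ x -> K.refl x) , (λ x -> K.refl x) , (λ x -> K.refl x)
    go (yes c≈0) = record { a = L (Fₗ.inv d) ; b = R.0# ; c = L c ; d = L d ; u = R.1#
     ; unit = I.lower-row-unit' (L c) (L d) (L (Fₗ.inv d)) (I.unit-comm (L d) (L (Fₗ.inv d)) (principal-unit (λ d≈0 -> nz (c≈0 , d≈0)))) }
     , (principal∈ (Fₗ.inv d) , Γ.0∈ , principal∈ c , principal∈ d , Γ.1∈)
     , (λ x -> K.refl x) , (λ x -> K.refl x) , (λ x -> K.refl x)
   γ : GL₂
   γ = fst candidate
   γ∈ = fst (snd candidate)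
   γc = fst (snd (snd candidate))
   γd = fst (snd (snd (snd candidate)))
   γu = snd (snd (snd (snd candidate)))
   h : GL₂
   h = γ · τ t b
   module I' = Iwasawa h
   row1 : (L c R.* Idele.t t) R.≈ GL₂.c h
   row1 x = K.sym x (K.trans x (fst (J.lower-row x _ _ _ (at b x))) (K.*ʳ x (γc x)))
    where module J (x : Point) = MatrixIdentities (K.ring x)
   row2 : (L c R.* b R.+ L d) R.≈ GL₂.d h
   row2 x = K.sym x (K.trans x (snd (J.lower-row x _ _ (K.0# x) (at b x))) (K.+-cong x (K.*ʳ x (γc x)) (γd x)))
    where module J (x : Point) = MatrixIdentities (K.ring x)
   val-u : ∀ x -> Z.- K.val x (at (u h) x) ≡ fst (divisor t) x
   val-u x = ≡.trans (ap Z.-_ (≡.trans (IsDVal.cong (K.isValuation x) (K.trans x (K.*ʳ x (γu x)) (K.*-idˡ x _))) (Idele.val-t⁻¹ t x)))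
    (ℤₚ.neg-involutive _)
   bound : ∀ x -> fst (divisor I'.t) x ≤ fst (divisor t) x Z.- (fst Z x Z.+ fst Z x)
   bound x = ≤-shift (subst (fst (divisor I'.t) x Z.+ (fst Z x Z.+ fst Z x) ≤_) (val-u x)
    (I'.divisor-t x (fst Z x) (V.ball-resp x (row1 x) (p x)) (V.ball-resp x (row2 x) (q x))))
    (solveℤ 3 (λ t i z -> (t :- z) :- i := t :- (i :+ z)) (fst (divisor t) x) (fst (divisor I'.t) x) (fst Z x Z.+ fst Z x))
   degree-eq : deg (divisor t ⊕ neg (Z ⊕ Z)) ≡ deg (divisor t) Z.- (deg Z Z.+ deg Z)
   degree-eq = ≡.trans (deg-⊕ (divisor t) (neg (Z ⊕ Z))) (ap (Z._+_ (deg (divisor t))) (≡.trans (deg-neg (Z ⊕ Z)) (ap Z.-_ (deg-⊕ Z Z))))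
  -- When H¹(div t') vanishes, b' - f b lies in F + 𝔸(div t'), so all upper right entries are
  -- equivalent and the extension may be taken to be split.
  split-class : ∀ t b t' b' f -> (f≉0 : ¬ f F.≈ F.0#) -> (∀ x -> fst (divisor t') x ≡ ord x f Z.+ fst (divisor t) x) ->
   (∀ a -> F+ (divisor t') a) -> τ t b ≈ᴰ τ t' b'
  split-class t b t' b' f f≉0 shift vanishing with vanishing (b' R.- principal f R.* b)
  ... | p , o , (p0 , p≈) , w , e = triangular t b t' b' f f≉0 p0 shift
   (Sub.resp (within-sub (divisor t')) {o} {b' R.- (principal f R.* b R.+ principal p0)}
    (λ x -> K.sym x (K.trans x (regroup x _ _ _) (K.trans x (K.+ʳ x (K.trans x (e x) (K.+ʳ x (p≈ x)))) (drop x _ _)))) w)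
   where
   regroup : ∀ x a v p -> K._≈_ x (K._-_ x a (K._+_ x v p)) (K._-_ x (K._-_ x a v) p)
   regroup x = Kₛ.solve x 3 (λ a v p -> a :- (v :+ p) := a :- v :- p)
   drop : ∀ x p o -> K._≈_ x (K._-_ x (K._+_ x p o) p) o
   drop x = Kₛ.solve x 2 (λ p o -> p :+ o :- p := o)
  iwasawa-class : ∀ g -> ∃ λ t -> ∃ λ b -> g ≈ᴰ τ t b
  iwasawa-class g = I'.t , I'.β , double ε I'.κ Γ.ε∈ I'.κ∈
   (G.trans {(ε · g) · I'.κ} {g · I'.κ} {τ I'.t I'.β} (·-cong {ε · g} {g} {I'.κ} {I'.κ} (identityˡ g) (G.refl {I'.κ})) I'.decompose)
   where module I' = Iwasawa g
  uIdele : GL₂ -> Idele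
  uIdele g = record { t = u g ; t⁻¹ = a g R.* d g R.- b g R.* c g ; invertible = I.unit-comm (a g R.* d g R.- b g R.* c g) (u g) (unit g) }
  -- A presentation τ t b exhibits a line subbundle L of the bundle M of g with 2 deg L - deg M =
  -- -deg t, so this is the condition δ(M) ≥ d in terms of matrices.
  Slope : GL₂ -> ℤ -> Set
  Slope g d = ∃ λ t -> ∃ λ b -> g ≈ᴰ τ t b × d ≤ Z.- deg (divisor t)
  Slope-resp : ∀ {g h d} -> g ≈ᴰ h -> Slope h d -> Slope g d
  Slope-resp e (t , b , e' , le) = t , b , ≈ᴰ-trans e e' , le
  change-slope : ∀ {h} t b -> h ≈ᴰ τ t b -> ∀ D -> divisor t ≐ D -> ∀ c d -> ¬ (c F.≈ F.0# × d F.≈ F.0#) -> (Z : Divisor) -> Within Z (principal c R.* Idele.t t) ->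
   Within Z (principal c R.* b R.+ principal d) -> Slope h ((deg Z Z.+ deg Z) Z.- deg D)
  change-slope {h} t b e D t≐D c d nz Z p q = let t' , b' , e' , le = change-line t b c d nz Z p q in t' , b' , ≈ᴰ-trans {h} {τ t b} {τ t' b'} e e'
   , ≤-shift (subst (λ n -> deg (divisor t') ≤ n Z.- (deg Z Z.+ deg Z)) (deg-resp {divisor t} {D} t≐D) le)
    (solveℤ 3 (λ t z t' -> (:- t') :- (z :- t) := (t :- z) :- t') (deg D) (deg Z Z.+ deg Z) (deg (divisor t')))
  -- `Lower` with n = 0 and e a bound for the poles of g⁻¹: in every presentation div t is at least
  -- a divisor of fixed degree plus a principal divisor.
  slopes-bounded : ∀ g -> ∃ λ m -> ∀ d -> Slope g d -> d ≤ m
  slopes-bounded g = deg (divisor (uIdele g)) Z.+ (deg e Z.+ deg e) , bounded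
   where
   E : GL₂ -> Divisor
   E g = fst (adele-bound (u g R.* a g)) ⊕ fst (adele-bound (u g R.* b g)) ⊕ fst (adele-bound (u g R.* c g)) ⊕ fst (adele-bound (u g R.* d g))
   e e1 e2 e3 e4 : Divisor
   e1 = fst (adele-bound (u g R.* a g))
   e2 = fst (adele-bound (u g R.* b g))
   e3 = fst (adele-bound (u g R.* c g))
   e4 = fst (adele-bound (u g R.* d g))
   e = e1 ⊕ e2 ⊕ e3 ⊕ e4
   pos : ∀ a x -> 0ℤ ≤ fst (fst (adele-bound a)) x
   pos a = fst (snd (adele-bound a))
   within : ∀ a (D : Divisor) -> (∀ x -> fst (fst (adele-bound a)) x ≤ fst D x) -> Within (neg D) a
   within a D le = within-mono (neg D) (neg (fst (adele-bound a))) {a} (λ x -> neg-mono-≤ (le x)) (snd (snd (adele-bound a)))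
   ≤-left : ∀ {i j} -> 0ℤ ≤ j -> i ≤ i Z.+ j
   ≤-left {i} p = subst (_≤ i Z.+ _) (ℤₚ.+-identityʳ i) (+-monoʳ-≤ i p)
   ≤-right : ∀ {i j} -> 0ℤ ≤ i -> j ≤ i Z.+ j
   ≤-right {i} {j} p = subst (_≤ i Z.+ j) (ℤₚ.+-identityˡ j) (+-monoˡ-≤ j p)
   p1 = pos (u g R.* a g)
   p2 = pos (u g R.* b g)
   p3 = pos (u g R.* c g)
   p4 = pos (u g R.* d g)
   bounded : ∀ m -> Slope g m -> m ≤ deg (divisor (uIdele g)) Z.+ (deg e Z.+ deg e)
   bounded m (t , b' , double γ κ γ∈ κ∈ eq , le) = ≤-trans le (≤-shift (subst (_≤ deg (divisor t)) degree-eq (deg-mono D (divisor t) (snd (snd L.lower-bound))))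
    (solveℤ 3 (λ t u e -> (u :+ e) :- :- t := t :- (:- u :- e)) (deg (divisor t)) (deg (divisor (uIdele g))) (deg e Z.+ deg e)))
    where
    eq' : ((γ · (unipotent R.0# · g)) · κ) ~ τ t b'
    eq' = G.trans {(γ · (unipotent R.0# · g)) · κ} {(γ · g) · κ} {τ t b'}
     (·-cong {γ · (unipotent R.0# · g)} {γ · g} {κ} {κ} (·-cong {γ} {γ} {unipotent R.0# · g} {g} (G.refl {γ}) (identityˡ g)) (G.refl {κ})) eq
    module L = Lower γ γ∈ R.0# g κ κ∈ t b' eq' e
     ( within (u g R.* a g) e (λ x -> ≤-trans (≤-left (p2 x)) (≤-trans (≤-left (p3 x)) (≤-left (p4 x))))
     , within (u g R.* b g) e (λ x -> ≤-trans (≤-right (p1 x)) (≤-trans (≤-left (p3 x)) (≤-left (p4 x))))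
     , within (u g R.* c g) e (λ x -> ≤-trans (≤-right (+-mono-≤ (p1 x) (p2 x))) (≤-left (p4 x)))
     , within (u g R.* d g) e (λ x -> ≤-right (+-mono-≤ (+-mono-≤ (p1 x) (p2 x)) (p3 x))) )
    ρ : F.Carrier
    ρ = fst L.lower-bound
    ρ≉0 : ¬ ρ F.≈ F.0#
    ρ≉0 = fst (snd L.lower-bound)
    D : Divisor
    D = neg (divisor (uIdele g)) ⊕ neg (e ⊕ e) ⊕ div ρ ρ≉0
    degree-eq : deg D ≡ Z.- deg (divisor (uIdele g)) Z.- (deg e Z.+ deg e)
    degree-eq = ≡.trans (deg-⊕ (neg (divisor (uIdele g)) ⊕ neg (e ⊕ e)) (div ρ ρ≉0)) (≡.trans (ap₂ Z._+_
     (≡.trans (deg-⊕ (neg (divisor (uIdele g))) (neg (e ⊕ e))) (ap₂ Z._+_ (deg-neg (divisor (uIdele g))) (≡.trans (deg-neg (e ⊕ e)) (ap Z.-_ (deg-⊕ e e)))))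
     (deg-div ρ ρ≉0)) (ℤₚ.+-identityʳ _))
  private
   Z : Divisor
   Z = pointDivisor x0 1ℤ
   degZ>0 : 0ℤ < deg Z
   degZ>0 = <-≤-trans (Z.+<+ (ℕ.s≤s ℕ.z≤n)) (deg-point-≥ x0 1)
   h¹Z : ℕ
   h¹Z = Cohomology.h1 (cohom Z)
  abstract
   -- The number from which on dim H⁰(Z - div t), at least χ₀ - deg Z + deg t, exceeds h¹(Z).
   descent-bound : ℤ
   descent-bound = (Z.+ h¹Z Z.+ deg Z) Z.- χ₀
   -- The map c ↦ b c from H⁰(Z - div t) to H¹(Z) has a kernel for reasons of dimension: there are c
   -- ≠ 0 and d in F with c t and c b + d in 𝔸(Z). The row (c d) selects a line subbundle for which
   -- deg t has dropped by at least 2 deg Z.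
   descend-step : ∀ t b -> descent-bound < deg (divisor t) -> ∃ λ t' -> ∃ λ b' -> τ t b ≈ᴰ τ t' b' × deg (divisor t') < deg (divisor t)
   descend-step t b lt = let c , (i , ne) , f , o , (f0 , f≈) , o∈ , e = relation in conclude c i ne f o f0 f≈ o∈ e
    where
    D : Divisor
    D = Z ⊕ neg (divisor t)
    m : ℕ
    m = Cohomology.h0 (cohom D)
    dimD : Dim (H⁰ D) Zero m
    dimD = Cohomology.dim-h₀ (cohom D)
    n<m : h¹Z ℕ.< m
    n<m = ℤₚ.drop‿+<+ (<-≤-trans (subst (Z.+ h¹Z <_)
     (solveℤ 3 (λ t χ z -> χ :- (z :+ (:- t)) := t :+ (χ :- z)) (deg (divisor t)) χ₀ (deg Z) ⟨sym⟩ ≡.refl)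
     (subst (_< deg (divisor t) Z.+ (χ₀ Z.- deg Z)) (solveℤ 3 (λ h z χ -> ((h :+ z) :- χ) :+ (χ :- z) := h) (Z.+ h¹Z) (deg Z) χ₀)
      (ℤₚ.+-monoˡ-< (χ₀ Z.- deg Z) lt)))
     (subst (_≤ Z.+ m) (ap (Z._-_ χ₀) (≡.trans (deg-⊕ Z (neg (divisor t))) (ap (Z._+_ (deg Z)) (deg-neg (divisor t))))) (h0-bound D)))
     where
     _⟨sym⟩_ : ∀ {i j k : ℤ} -> i ≡ j -> j ≡ k -> k ≡ i
     p ⟨sym⟩ q = ≡.sym (≡.trans p q)
    v : Fin m -> Adele
    v j = b R.* Dim.basis dimD j
    relation : Dependent (F+ Z) v
    relation = 𝕃.dependent all-sub (F+-sub Z) (Dim.spans (Cohomology.dim-h₁ (cohom Z))) n<m v (λ _ x -> K.refl x)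
    conclude : ∀ c i -> ¬ Field._≈_ (Curve.k X) (c i) (Field.0# (Curve.k X)) -> ∀ f o f0 -> (∀ x -> K._≈_ x (at f x) (K.embed x f0)) -> Within Z o ->
     lin v c R.≈ (f R.+ o) -> ∃ λ t' -> ∃ λ b' -> τ t b ≈ᴰ τ t' b' × deg (divisor t') < deg (divisor t)
    conclude c i ne f o f0 f≈ o∈ e = let t' , b' , eq , le = change-line t b c1 (F.- f0) (λ z -> c1≉0 (fst z)) Z p q in
     t' , b' , eq , ℤₚ.≤-<-trans le (subst (deg (divisor t) Z.- (deg Z Z.+ deg Z) <_) (ℤₚ.+-identityʳ _)
      (+-monoʳ-< (deg (divisor t)) (neg-mono-< (+-mono-< degZ>0 degZ>0))))
     where
     h : Adele
     h = lin (Dim.basis dimD) c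
     sec : ∃ λ f -> ¬ f F.≈ F.0# × (∀ x -> O.B x (fst D x) f) × (∀ x -> K._≈_ x (at h x) (K.embed x f))
     sec = section {D} {h} (𝕃.lin∈ (H⁰-sub D) (Dim.basis∈ dimD) c) (λ z -> ne (Dim.indep dimD c z i))
     c1 : F.Carrier
     c1 = fst sec
     c1≉0 : ¬ c1 F.≈ F.0#
     c1≉0 = fst (snd sec)
     p : Within Z (principal c1 R.* Idele.t t)
     p x = V.ball-*-eq x (embed-ball x {fst D x} {c1} (fst (snd (snd sec)) x)) (ball-t t x)
      (solveℤ 2 (λ z t -> (z :+ (:- t)) :+ t := z) (fst Z x) (fst (divisor t) x))
     q : Within Z (principal c1 R.* b R.+ principal (F.- f0))
     q = Sub.resp (within-sub Z) {o} {principal c1 R.* b R.+ principal (F.- f0)} (λ x -> K.sym x (eq x)) o∈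
      where
      eq : (principal c1 R.* b R.+ principal (F.- f0)) R.≈ o
      eq x = K.trans x (K.+-cong x (K.trans x (K.*-comm x _ _) (K.trans x (K.*ˡ x (K.sym x (snd (snd (snd sec)) x)))
       (K.trans x (K.sym x (𝕃.lin-scale (Dim.basis dimD) b c x)) (K.trans x (e x) (K.+ʳ x (f≈ x))))))
       (embed-neg x f0)) (drop x _ _)
       where
       drop : ∀ x f o -> K._≈_ x (K._-_ x (K._+_ x f o) f) o
       drop x = Kₛ.solve x 2 (λ f o -> f :+ o :- f := o)
  descend : ∀ t b -> ∃ λ t' -> ∃ λ b' -> τ t b ≈ᴰ τ t' b' × deg (divisor t') ≤ descent-bound
  descend t b = go Z.∣ deg (divisor t) Z.- descent-bound ∣ t b
   (subst (_≤ descent-bound Z.+ Z.+ Z.∣ deg (divisor t) Z.- descent-bound ∣) (solveℤ 2 (λ d t -> d :+ (t :- d) := t) descent-bound (deg (divisor t)))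
    (+-monoʳ-≤ descent-bound (i≤∣i∣ (deg (divisor t) Z.- descent-bound))))
   where
   go : ∀ n t b -> deg (divisor t) ≤ descent-bound Z.+ Z.+ n -> ∃ λ t' -> ∃ λ b' -> τ t b ≈ᴰ τ t' b' × deg (divisor t') ≤ descent-bound
   go zero t b le = t , b , ~⇒≈ᴰ (G.refl {τ t b}) , subst (deg (divisor t) ≤_) (ℤₚ.+-identityʳ descent-bound) le
   go (suc n) t b le = decide em
    where
    decide : Dec (descent-bound < deg (divisor t)) -> ∃ λ t' -> ∃ λ b' -> τ t b ≈ᴰ τ t' b' × deg (divisor t') ≤ descent-bound
    decide (no ge) = t , b , ~⇒≈ᴰ (G.refl {τ t b}) , ≮⇒≥ ge
    decide (yes lt) =
     let
      t1 , b₁ , e1 , lt₁ = descend-step t b lt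
      t2 , b2 , e2 , le₂ = go n t1 b₁ (≤-shift (≤-trans (i<j⇒suc[i]≤j lt₁) le)
       (solveℤ 3 (λ d n t -> (d :+ n) :- t := (d :+ (con 1ℤ :+ n)) :- (con 1ℤ :+ t)) descent-bound (Z.+ n) (deg (divisor t1))))
     in t2 , b2 , ≈ᴰ-trans {τ t b} {τ t1 b₁} {τ t2 b2} e1 e2 , le₂
  translate-class : ∀ t β D ρ f -> (f≉0 : ¬ f F.≈ F.0#) -> (∀ x -> fst (divisor t) x ≡ fst D x Z.+ ord x f) ->
   F+ D (principal (Fₗ.inv f) R.* β R.- ρ) -> τ t β ≈ᴰ τ (ideleOf D) ρ
  translate-class t β D ρ f f≉0 shift (p , o , (p0 , p≈) , o∈ , e) = triangular t β (ideleOf D) ρ f⁻¹ (Fₗ.inv≉0 f≉0) (F.- p0) shift' within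
   where
   f⁻¹ : F.Carrier
   f⁻¹ = Fₗ.inv f
   shift' : ∀ x -> fst (divisor (ideleOf D)) x ≡ ord x f⁻¹ Z.+ fst (divisor t) x
   shift' x = ≡.trans (ideleOf-divisor D x) (≡.sym (≡.trans (ap₂ Z._+_ (O.v-inv x f≉0) (shift x))
    (solveℤ 2 (λ d f -> :- f :+ (d :+ f) := d) (fst D x) (ord x f))))
   within : Within (divisor (ideleOf D)) (ρ R.- (principal f⁻¹ R.* β R.+ principal (F.- p0)))
   within x = subst (λ n -> B x n (at (ρ R.- (principal f⁻¹ R.* β R.+ principal (F.- p0))) x)) (≡.sym (ideleOf-divisor D x))
    (V.ball-resp x (K.sym x eq) (V.ball-neg' x (o∈ x)))
    where
    module Kx = K x
    eq : at (ρ R.- (principal f⁻¹ R.* β R.+ principal (F.- p0))) x Kx.≈ (Kx.- at o x)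
    eq = Kx.trans (solve 3 (λ r v p -> r :- (v :+ p) := :- ((v :- r) :+ p)) (at ρ x) (at (principal f⁻¹ R.* β) x) (Kx.embed (F.- p0)))
     (Kx.-‿cong (Kx.trans (Kx.+-cong (Kx.trans (e x) (Kx.+ʳ (p≈ x))) (embed-neg x p0))
      (solve 2 (λ f o -> (f :+ o) :- f := o) (Kx.embed p0) (at o x))))
     where open IntSolver Kx.ring
  abstract
   -- k is finite, hence so is the set H¹(D): a given divisor admits finitely many extensions up to
   -- equivalence.
   extensions : Divisor -> List (Idele × Adele)
   extensions D = List.map (λ i -> ideleOf D , fst (𝕃.representatives all-sub (F+-sub D) (Cohomology.dim-h₁ (cohom D))) i) (List.allFin _)
   extensions-∋ : ∀ {g} t β D -> g ≈ᴰ τ t β -> divisor t ≃ D -> Any (λ (t , b) -> g ≈ᴰ τ t b) (extensions D)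
   extensions-∋ {g} t β D e (f , f≉0 , shift) =
    let
     ρ , _ , covers , _ = 𝕃.representatives all-sub (F+-sub D) (Cohomology.dim-h₁ (cohom D))
     i , rest = covers (principal (Fₗ.inv f) R.* β) (λ x -> K.refl x)
    in Anyₚ.map⁺ (Anyₚ.tabulate⁺ {f = λ i -> i} i (≈ᴰ-trans {g} {τ t β} {τ (ideleOf D) (ρ i)} e (translate-class t β D (ρ i) f f≉0 shift rest)))
   reduced : ∀ g -> ∃ λ t -> ∃ λ b -> g ≈ᴰ τ t b × deg (divisor t) ≤ descent-bound
   reduced g =
    let
     t , b , e = iwasawa-class g
     t' , b' , e' , le = descend t b
    in t' , b' , ≈ᴰ-trans {g} {τ t b} {τ t' b'} e e' , le
  -- A reduced presentation has deg t at most `descent-bound`, and the bound on slopes gives deg t ≥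
  -- -m. Finitely many divisor classes remain, each with finitely many extensions.
  finite-classes : ∀ m -> ∃ λ (L : List (Idele × Adele)) -> ∀ g -> (∀ d -> Slope g d -> d ≤ m) -> Any (λ (t , b) -> g ≈ᴰ τ t b) L
  finite-classes m = List.concatMap extensions (fst (classes n)) , λ g bounded -> let t , β , e , le = reduced g in cover g bounded t β e le
   where
   n : ℕ
   n = Z.∣ m ∣ ℕ.+ Z.∣ descent-bound ∣
   cover : ∀ g -> (∀ d -> Slope g d -> d ≤ m) -> ∀ t β -> g ≈ᴰ τ t β -> deg (divisor t) ≤ descent-bound ->
    Any (λ (t , b) -> g ≈ᴰ τ t b) (List.concatMap extensions (fst (classes n)))
   cover g bounded t β e le = Anyₚ.concat⁺ (Anyₚ.map⁺ (Any.map (λ {D} -> extensions-∋ t β D e) (snd (classes n) (divisor t) lo hi)))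
    where
    hi : deg (divisor t) ≤ Z.+ n
    hi = ≤-trans le (≤-trans (i≤∣i∣ descent-bound) (Z.+≤+ (ℕₚ.m≤n+m Z.∣ descent-bound ∣ Z.∣ m ∣)))
    lo : Z.- Z.+ n ≤ deg (divisor t)
    lo = subst (Z.- Z.+ n ≤_) (ℤₚ.neg-involutive (deg (divisor t))) (neg-mono-≤ (≤-trans (bounded (Z.- deg (divisor t)) (t , β , e , ≤-refl))
     (≤-trans (i≤∣i∣ m) (Z.+≤+ (ℕₚ.m≤m+n Z.∣ m ∣ Z.∣ descent-bound ∣)))))

 -- The Haar integral on 𝔸 modulo F

 module AdeleClasses (ℝ : RealField) (dn : Adeles.Automorphic.HaarN X F̂ ℝ) where
  open DivisorClasses
  open ComplexNumbers em ℝ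
  open Haar ℝ
  private
   module ℂ = RingLaws ℂ-ring'
   module ℂₗ = FieldLemmas em ℂ-field
   module ∫ₙ = HaarIntegral dn
  open ℂ.Reasoning
  open Topology em N⟨F⟩\N⟨𝔸⟩
  open Space N⟨F⟩\N⟨𝔸⟩ using (IsOpen)
  Coset : Divisor -> Adele -> Adele -> Set
  Coset D a b = F+ D (b 𝔸.- a)
  private module J (x : Point) = DifferenceIdentities (K.ring x)
  coset-refl : ∀ D a -> Coset D a a
  coset-refl D a = Sub.resp (F+-sub D) {𝔸.0#} {a 𝔸.- a} (λ x -> K.sym x (K.-‿inverseʳ x _)) (Sub.0∈ (F+-sub D))
  coset-sym : ∀ D {a b} -> Coset D a b -> Coset D b a
  coset-sym D {a} {b} p = Sub.resp (F+-sub D) {𝔸.- (b 𝔸.- a)} {a 𝔸.- b} (λ x -> J.sub-flip x _ _) (Sub.-∈ (F+-sub D) {b 𝔸.- a} p)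
  coset-trans : ∀ D {a b c} -> Coset D a b -> Coset D b c -> Coset D a c
  coset-trans D {a} {b} {c} p q = Sub.resp (F+-sub D) {(c 𝔸.- b) 𝔸.+ (b 𝔸.- a)} {c 𝔸.- a} (λ x -> J.sub-split x _ _ _)
   (Sub.+∈ (F+-sub D) {c 𝔸.- b} {b 𝔸.- a} q p)
  within⇒coset : ∀ D {a b} -> Within D (b 𝔸.- a) -> Coset D a b
  within⇒coset D {a} {b} w = ⊞-right {Principal} {Within D} principal-sub {b 𝔸.- a} w
  principal⇒coset : ∀ D p a -> Principal p -> Coset D a (p 𝔸.+ a)
  principal⇒coset D p a p∈ = Sub.resp (F+-sub D) {p} {(p 𝔸.+ a) 𝔸.- a} (λ x -> K.sym x (J.shift-sub x _ _))
   (⊞-left {Principal} {Within D} (within-sub D) {p} p∈)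
  Invariant : Divisor -> (Adele -> Set) -> Set
  Invariant D U = ∀ {a b} -> Coset D a b -> U a -> U b
  invariant-open : ∀ D U -> Invariant D U -> IsOpen U
  invariant-open D U inv = (λ a u -> D , λ b w -> inv (within⇒coset D {a} {b} w) u) , λ p a p∈ u -> inv (principal⇒coset D p a p∈) u
  -- Openness near a handles the component in 𝔸(D), invariance the component in F. Openness is
  -- invoked once more at the end because b agrees with p + (a + o) only up to `≈`.
  open-coset : ∀ U -> IsOpen U -> ∀ a -> U a -> ∃ λ D -> ∀ b -> Coset D a b -> U b
  open-coset U (near , invariant) a u = D , λ { b (p , o , p∈ , o∈ , e) ->
   let
    v : U (p 𝔸.+ (a 𝔸.+ o))
    v = invariant p (a 𝔸.+ o) p∈ (snd (near a u) (a 𝔸.+ o) (Sub.resp (within-sub D) {o} {(a 𝔸.+ o) 𝔸.- a}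
     (λ x -> K.sym x (cancel x (at a x) (at o x))) o∈))
    D' , near' = near (p 𝔸.+ (a 𝔸.+ o)) v
   in near' b (Sub.resp (within-sub D') {𝔸.0#} {b 𝔸.- (p 𝔸.+ (a 𝔸.+ o))}
    (λ x -> K.sym x (vanishes x (at a x) (at b x) (at p x) (at o x) (e x))) (Sub.0∈ (within-sub D'))) }
   where
   D : Divisor
   D = fst (near a u)
   cancel : ∀ x a o -> K._≈_ x (K._-_ x (K._+_ x a o) a) o
   cancel x = Kₛ.solve x 2 (λ a o -> (a :+ o) :- a := o)
   vanishes : ∀ x a b p o -> K._≈_ x (K._-_ x b a) (K._+_ x p o) -> K._≈_ x (K._-_ x b (K._+_ x p (K._+_ x a o))) (K.0# x)
   vanishes x a b p o e = K.trans x (solve 4 (λ a b p o -> b :- (p :+ (a :+ o)) := (b :- a) :- (p :+ o)) a b p o) (Kₗ.x≈y⇒x-y≈0 x e)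
    where open IntSolver (K.ring x)
  private
   f0 : Adele -> ℂ
   f0 = fst ∫ₙ.nonzero
   f0-test : IsTest N⟨F⟩\N⟨𝔸⟩ f0
   f0-test = fst (snd ∫ₙ.nonzero)
   ∫f₀≉0 : ¬ ∫ₙ.∫ f0 ≈ 0#
   ∫f₀≉0 = snd (snd ∫ₙ.nonzero)
   support-point : ∃ λ a -> ¬ f0 a ≈ 0#
   support-point = ¬∀⇒∃¬ λ all -> ∫f₀≉0 (begin
    ∫ₙ.∫ f0 ≈⟨ ∫ₙ.cong f0 (λ a -> 0# * f0 a) f0-test (λ a -> ℂ.trans (all a) (ℂ.sym (ℂ.zeroˡ (f0 a)))) ⟩
    ∫ₙ.∫ (λ a -> 0# * f0 a) ≈⟨ ∫ₙ.scale 0# f0 f0-test ⟩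
    0# * ∫ₙ.∫ f0 ≈⟨ ℂ.zeroˡ _ ⟩
    0# ∎)
   complement-open : ∀ D (S : Adele -> Set) -> Invariant D S -> IsOpen (λ a -> ¬ S a)
   complement-open D S inv = invariant-open D (λ a -> ¬ S a) (λ {a} {b} c n s -> n (inv {b} {a} (coset-sym D {a} {b} c) s))
   coset-invariant : ∀ D a -> Invariant D (Coset D a)
   coset-invariant D a {b} {c} q p = coset-trans D {a} {b} {c} p q
   -- A function of non-zero integral is non-zero at some a and constant near a, so a coset of some
   -- F + 𝔸(D) is a closed subset of its compact support.
   compact-coset₀ : ∃ λ D -> ∃ λ a -> Compact N⟨F⟩\N⟨𝔸⟩ (Coset D a)
   compact-coset₀ =
    let
     a , f₀a≉0 = support-point
     U , U-open , a∈ , const = fst f0-test a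
     D , coset⊆U = open-coset U U-open a a∈
    in D , a , compact-cover {⊤} {Coset D a} (λ _ t -> ¬ f0 t ≈ 0#) (λ _ -> snd f0-test)
     (complement-open D (Coset D a) (λ {b} {c} -> coset-invariant D a {b} {c})) (tt ∷ [])
     (λ b c -> here (λ z -> f₀a≉0 (ℂ.trans (ℂ.sym (const b (coset⊆U b c))) z)))
   translate-open : ∀ s U -> IsOpen U -> IsOpen (λ a -> U (a 𝔸.+ s))
   translate-open s U (near , invariant) =
    (λ a u -> let D , h = near (a 𝔸.+ s) u in D , λ b w -> h (b 𝔸.+ s)
     (Sub.resp (within-sub D) {b 𝔸.- a} {(b 𝔸.+ s) 𝔸.- (a 𝔸.+ s)} (λ x -> both x (at b x) (at a x) (at s x)) w))
    , λ p a p∈ u -> let v = invariant p (a 𝔸.+ s) p∈ u ; D , h = near (p 𝔸.+ (a 𝔸.+ s)) v in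
     h ((p 𝔸.+ a) 𝔸.+ s) (Sub.resp (within-sub D) {𝔸.0#} {((p 𝔸.+ a) 𝔸.+ s) 𝔸.- (p 𝔸.+ (a 𝔸.+ s))}
      (λ x -> K.sym x (Kₗ.x≈y⇒x-y≈0 x (K.+-assoc x _ _ _))) (Sub.0∈ (within-sub D)))
    where
    both : ∀ x b a s -> K._≈_ x (K._-_ x b a) (K._-_ x (K._+_ x b s) (K._+_ x a s))
    both x = Kₛ.solve x 3 (λ b a s -> b :- a := (b :+ s) :- (a :+ s))
   compact-coset : ∃ λ D -> ∀ a -> Compact N⟨F⟩\N⟨𝔸⟩ (Coset D a)
   compact-coset = let D , a0 , compact = compact-coset₀ in D , λ a ->
    compact-translate {Coset D a0} {Coset D a} (λ b -> b 𝔸.+ (a 𝔸.- a0)) (translate-open (a 𝔸.- a0)) compact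
     (λ s p -> Sub.resp (F+-sub D) {s 𝔸.- a0} {(s 𝔸.+ (a 𝔸.- a0)) 𝔸.- a} (λ x -> move x (at s x) (at a x) (at a0 x)) p)
     (λ t p -> t 𝔸.+ (a0 𝔸.- a) , Sub.resp (F+-sub D) {t 𝔸.- a} {(t 𝔸.+ (a0 𝔸.- a)) 𝔸.- a0} (λ x -> move x (at t x) (at a0 x) (at a x)) p
      , λ U U-open u -> let E , h = fst U-open _ u in h t (Sub.resp (within-sub E) {𝔸.0#} {t 𝔸.- ((t 𝔸.+ (a0 𝔸.- a)) 𝔸.+ (a 𝔸.- a0))}
       (λ x -> K.sym x (same x (at t x) (at a x) (at a0 x))) (Sub.0∈ (within-sub E))))
    where
    move : ∀ x s a a0 -> K._≈_ x (K._-_ x s a0) (K._-_ x (K._+_ x s (K._-_ x a a0)) a)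
    move x = Kₛ.solve x 3 (λ s a c -> s :- c := (s :+ (a :- c)) :- a)
    same : ∀ x t a a0 -> K._≈_ x (K._-_ x t (K._+_ x (K._+_ x t (K._-_ x a0 a)) (K._-_ x a a0))) (K.0# x)
    same x = Kₛ.solve x 3 (λ t a c -> t :- ((t :+ (c :- a)) :+ (a :- c)) := con 0ℤ)
  Everything : Adele -> Set
  Everything _ = ⊤
  module Reps (D : Divisor) where
   open Cohomology (cohom D) using (h1; dim-h₁)
   n : ℕ
   n = Curve.q X ℕ.^ h1
   ρ : Fin n -> Adele
   ρ = fst (𝕃.representatives all-sub (F+-sub D) dim-h₁)
   index : ∀ a -> ∃ λ i -> Coset D (ρ i) a
   index a = fst (snd (snd (𝕃.representatives all-sub (F+-sub D) dim-h₁))) a (λ x -> K.refl x)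
   distinct : ∀ i j -> Coset D (ρ i) (ρ j) -> i ≡ j
   distinct i j c = ≡.sym (snd (snd (snd (𝕃.representatives all-sub (F+-sub D) dim-h₁))) j i c)
  abstract
   -- Translates of one compact coset of F + 𝔸(D) cover 𝔸, and since H¹(D) is finite a finite number
   -- of them is enough.
   compact-everything : Compact N⟨F⟩\N⟨𝔸⟩ Everything
   compact-everything = let D , compact = compact-coset in
    compact-cover {Fin (Reps.n D)} {Everything} (λ i -> Coset D (Reps.ρ D i)) (λ i -> compact (Reps.ρ D i))
     ((λ a n -> ⊥-elim (n tt)) , λ _ _ _ n -> ⊥-elim (n tt)) (List.allFin (Reps.n D))
     (λ a _ -> let i , c = Reps.index D a in Anyₚ.tabulate⁺ {f = λ i -> i} i c)
  InvFun : Divisor -> (Adele -> ℂ) -> Set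
  InvFun D f = ∀ a b -> Coset D a b -> f b ≈ f a
  invariant-test : ∀ D f -> InvFun D f -> IsTest N⟨F⟩\N⟨𝔸⟩ f
  invariant-test D f inv =
   (λ a -> Coset D a , invariant-open D (Coset D a) (λ {b} {c} -> coset-invariant D a {b} {c}) , coset-refl D a , λ b c -> inv a b c)
   , compact-cover {⊤} {λ a -> ¬ f a ≈ 0#} (λ _ -> Everything) (λ _ -> compact-everything)
    (complement-open D (λ a -> ¬ f a ≈ 0#) (λ {a} {b} c ne z -> ne (ℂ.trans (ℂ.sym (inv a b c)) z))) (tt ∷ []) (λ _ _ -> here tt)
  sup : Divisor -> Divisor -> Divisor
  sup (D , p) (E , q) = (λ x -> D x Z.⊔ E x) , almostAll-∩ (λ e e' -> ap₂ Z._⊔_ e e') p q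
  coset-mono : ∀ D E {a b} -> (∀ x -> fst D x ≤ fst E x) -> Coset E a b -> Coset D a b
  coset-mono D E {a} {b} le c = F+-mono D E {b 𝔸.- a} le c
  private
   Piece : (Adele -> ℂ) -> Set
   Piece f = Σ Adele λ a -> Σ Divisor λ D -> ∀ b -> Coset D a b -> f b ≈ f a
   piece-set : ∀ {f} -> Piece f -> Adele -> Set
   piece-set (a , D , _) = Coset D a
   piece-bound : ∀ {f} (J : List (Piece f)) -> ∃ λ D -> ∀ i -> i ∈ J -> ∀ x -> fst (fst (snd i)) x ≤ fst D x
   piece-bound [] = 0ᴰ , λ _ ()
   piece-bound (i ∷ J) = let D , h = piece-bound J in sup (fst (snd i)) D , λ
    { _ (here ≡.refl) x -> i≤i⊔j _ _ ; j (there p) x -> ≤-trans (h j p x) (i≤j⊔i _ _) }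
   piece-constant : ∀ {f} (J : List (Piece f)) D a -> (∀ i -> i ∈ J -> ∀ x -> fst (fst (snd i)) x ≤ fst D x) ->
    Any (λ i -> piece-set i a) J -> ∀ b -> Coset D a b -> f b ≈ f a
   piece-constant ((a0 , D0 , h) ∷ J) D a above (here c0) b c = ℂ.trans
    (h b (coset-trans D0 {a0} {a} {b} c0 (coset-mono D0 D {a} {b} (above (a0 , D0 , h) (here ≡.refl)) c))) (ℂ.sym (h a c0))
   piece-constant (i ∷ J) D a above (there p) b c = piece-constant J D a (λ j j∈ -> above j (there j∈)) p b c
   covered : ∀ f -> IsTest N⟨F⟩\N⟨𝔸⟩ f -> ∃ λ (J : List (Piece f)) -> ∀ a -> Everything a -> Any (λ i -> piece-set i a) J
   covered f (local , _) = compact-everything (Piece f) piece-set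
    (λ { (a , D , _) -> invariant-open D (Coset D a) (λ {b} {c} -> coset-invariant D a {b} {c}) })
    (λ a _ -> piece a , coset-refl (fst (snd (piece a))) a)
    where
    piece : Adele -> Piece f
    piece a = let U , U-open , a∈ , const = local a ; D , h = open-coset U U-open a a∈ in a , D , λ b c -> const b (h b c)
  -- By compactness finitely many cosets on which f is constant cover 𝔸; the pointwise maximum of
  -- their divisors serves for all of them.
  test-invariant : ∀ f -> IsTest N⟨F⟩\N⟨𝔸⟩ f -> ∃ λ D -> InvFun D f
  test-invariant f test = conclude (covered f test)
   where
   conclude : (∃ λ (J : List (Piece f)) -> ∀ a -> Everything a -> Any (λ i -> piece-set i a) J) -> ∃ λ D -> InvFun D f
   conclude (J , covers) = fst (piece-bound J) , λ a b c -> piece-constant J (fst (piece-bound J)) a (snd (piece-bound J)) (covers a tt) b c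
  module Volume (D : Divisor) where
   open Reps D public
   θ : Adele -> ℂ
   θ = 𝟙 (F+ D)
   θ-invariant : InvFun D θ
   θ-invariant a b c = indicatorℂ-cong {P = F+ D} {P' = F+ D} {t = b} {t' = a}
    (λ p -> Sub.resp (F+-sub D) {b 𝔸.- (b 𝔸.- a)} {a} (λ x -> back x (at b x) (at a x)) (Sub.minus∈ (F+-sub D) {b} {b 𝔸.- a} p c))
    (λ p -> Sub.resp (F+-sub D) {(b 𝔸.- a) 𝔸.+ a} {b} (λ x -> forth x (at b x) (at a x)) (Sub.+∈ (F+-sub D) {b 𝔸.- a} {a} c p))
    where
    back : ∀ x b a -> K._≈_ x (K._-_ x b (K._-_ x b a)) a
    back x = Kₛ.solve x 2 (λ b a -> b :- (b :- a) := a)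
    forth : ∀ x b a -> K._≈_ x (K._+_ x (K._-_ x b a) a) b
    forth x = Kₛ.solve x 2 (λ b a -> (b :- a) :+ a := b)
   vol : ℂ
   vol = ∫ₙ.∫ θ
   shifted : Fin n -> Adele -> ℂ
   shifted i a = θ (a 𝔸.- ρ i)
   shifted-invariant : ∀ i -> InvFun D (shifted i)
   shifted-invariant i a b c = θ-invariant (a 𝔸.- ρ i) (b 𝔸.- ρ i)
    (Sub.resp (F+-sub D) {b 𝔸.- a} {(b 𝔸.- ρ i) 𝔸.- (a 𝔸.- ρ i)} (λ x -> both x (at b x) (at a x) (at (ρ i) x)) c)
    where
    both : ∀ x b a s -> K._≈_ x (K._-_ x b a) (K._-_ x (K._-_ x b s) (K._-_ x a s))
    both x = Kₛ.solve x 3 (λ b a s -> b :- a := (b :- s) :- (a :- s))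
   sumℂ : ∀ {m} -> (Fin m -> ℂ) -> ℂ
   sumℂ = ∑ _+_ 0#
   comb : ∀ {m} -> (Fin m -> ℂ) -> (Fin m -> Fin n) -> Adele -> ℂ
   comb c ι a = sumℂ (λ i -> c i * shifted (ι i) a)
   comb-invariant : ∀ {m} c (ι : Fin m -> Fin n) -> InvFun D (comb c ι)
   comb-invariant {zero} c ι a b e = ℂ.refl
   comb-invariant {suc m} c ι a b e = ℂ.+-cong (ℂ.*ˡ {c zero} (shifted-invariant (ι zero) a b e)) (comb-invariant (c ∘ suc) (ι ∘ suc) a b e)
   ∫-comb : ∀ {m} c (ι : Fin m -> Fin n) -> ∫ₙ.∫ (comb c ι) ≈ sumℂ c * vol
   ∫-comb {zero} c ι = begin
    ∫ₙ.∫ (λ _ -> 0#) ≈⟨ ∫ₙ.cong (λ _ -> 0#) (λ a -> 0# * θ a) (invariant-test D (λ _ -> 0#) (λ _ _ _ -> ℂ.refl)) (λ a -> ℂ.sym (ℂ.zeroˡ (θ a))) ⟩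
    ∫ₙ.∫ (λ a -> 0# * θ a) ≈⟨ ∫ₙ.scale 0# θ (invariant-test D θ θ-invariant) ⟩
    0# * vol ∎
   ∫-comb {suc m} c ι = begin
    ∫ₙ.∫ (comb c ι)
     ≈⟨ ∫ₙ.add (λ a -> c zero * shifted (ι zero) a) (comb (c ∘ suc) (ι ∘ suc))
      (invariant-test D (λ a -> c zero * shifted (ι zero) a) (λ a b e -> ℂ.*ˡ {c zero} (shifted-invariant (ι zero) a b e)))
      (invariant-test D (comb (c ∘ suc) (ι ∘ suc)) (comb-invariant (c ∘ suc) (ι ∘ suc))) ⟩
    ∫ₙ.∫ (λ a -> c zero * shifted (ι zero) a) + ∫ₙ.∫ (comb (c ∘ suc) (ι ∘ suc))
     ≈⟨ ℂ.+-cong (∫ₙ.scale (c zero) (shifted (ι zero)) (invariant-test D (shifted (ι zero)) (shifted-invariant (ι zero)))) (∫-comb (c ∘ suc) (ι ∘ suc)) ⟩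
    c zero * ∫ₙ.∫ (shifted (ι zero)) + sumℂ (c ∘ suc) * vol
     ≈⟨ ℂ.+ʳ (ℂ.*ˡ {c zero} (∫ₙ.invariant (𝔸.- ρ (ι zero)) θ (invariant-test D θ θ-invariant))) ⟩
    c zero * vol + sumℂ (c ∘ suc) * vol ≈⟨ ℂ.distribʳ vol (c zero) (sumℂ (c ∘ suc)) ⟨
    sumℂ c * vol ∎
   sum-single : ∀ {m} (v : Fin m -> ℂ) i -> (∀ j -> ¬ j ≡ i -> v j ≈ 0#) -> sumℂ v ≈ v i
   sum-single {suc m} v zero h = ℂ.trans (ℂ.+ˡ {v zero} (zeros (v ∘ suc) (λ j -> h (suc j) λ ()))) (ℂ.+-idʳ (v zero))
    where
    zeros : ∀ {m} (v : Fin m -> ℂ) -> (∀ j -> v j ≈ 0#) -> sumℂ v ≈ 0#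
    zeros {zero} v h = ℂ.refl
    zeros {suc m} v h = ℂ.trans (ℂ.+-cong (h zero) (zeros (v ∘ suc) (h ∘ suc))) (ℂ.+-idˡ 0#)
   sum-single {suc m} v (suc i) h = ℂ.trans (ℂ.+-cong (h zero λ ()) (sum-single (v ∘ suc) i (λ j ne -> h (suc j) λ { ≡.refl -> ne ≡.refl })))
    (ℂ.+-idˡ (v (suc i)))
   -- f is the combination of translates of θ with coefficients f(ρ i), and every translate has the
   -- integral of θ. So the Haar integral becomes a finite sum.
   ∫-invariant : ∀ f -> InvFun D f -> ∫ₙ.∫ f ≈ sumℂ (f ∘ ρ) * vol
   ∫-invariant f inv = ℂ.trans (∫ₙ.cong f (comb (f ∘ ρ) (λ i -> i)) (invariant-test D f inv) pointwise) (∫-comb (f ∘ ρ) (λ i -> i))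
    where
    pointwise : ∀ a -> f a ≈ comb (f ∘ ρ) (λ i -> i) a
    pointwise a = let i , c = index a in ℂ.sym (begin
     comb (f ∘ ρ) (λ i -> i) a ≈⟨ sum-single (λ j -> f (ρ j) * shifted j a) i (λ j ne ->
      ℂ.trans (ℂ.*ˡ {f (ρ j)} (𝟙-out {P = F+ D} {t = a 𝔸.- ρ j} (λ c' -> ne (distinct j i (coset-trans D {ρ j} {a} {ρ i} c' (coset-sym D {ρ i} {a} c)))))) (ℂ.zeroʳ (f (ρ j)))) ⟩
     f (ρ i) * shifted i a ≈⟨ ℂ.*ˡ {f (ρ i)} (𝟙-in {P = F+ D} {t = a 𝔸.- ρ i} c) ⟩
     f (ρ i) * 1# ≈⟨ ℂ.*-idʳ (f (ρ i)) ⟩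
     f (ρ i) ≈⟨ inv (ρ i) a c ⟨
     f a ∎)
  -- The given function of non-zero integral is invariant modulo F + 𝔸(D) for all sufficiently large
  -- D, and by `∫-invariant` its integral is a multiple of the volume.
  nonzero-volume : ∀ E -> ∃ λ D -> (∀ x -> fst E x ≤ fst D x) × ¬ Volume.vol D ≈ 0#
  nonzero-volume E = conclude (test-invariant f0 f0-test)
   where
   conclude : (∃ λ D0 -> InvFun D0 f0) -> ∃ λ D -> (∀ x -> fst E x ≤ fst D x) × ¬ Volume.vol D ≈ 0#
   conclude (D0 , inv) = let D = sup E D0 in D , (λ x -> i≤i⊔j _ _) , λ z -> ∫f₀≉0 (ℂ.trans
    (Volume.∫-invariant D f0 (λ a b c -> inv a b (coset-mono D0 D {a} {b} (λ x -> i≤j⊔i _ _) c)))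
    (ℂ.trans (ℂ.*ˡ {Volume.sumℂ D (f0 ∘ Volume.ρ D)} z) (ℂ.zeroʳ (Volume.sumℂ D (f0 ∘ Volume.ρ D)))))

 -- Congruence subgroups and open subsets of PGL₂(𝔸)

 module CongruenceSubgroups where
  open Reduction public
  open GL₂
  private
   module R = RingLaws 𝔸
   module Q = QuotientIdentities 𝔸
   module Qₓ (x : Point) = QuotientIdentities (K.ring x)
  open Space G⟨𝔸⟩ using (IsOpen)
  record Close (D : Divisor) (g h : GL₂) : Set where
   constructor close
   field
    a-close : Within D (a h R.- a g)
    b-close : Within D (b h R.- b g)
    c-close : Within D (c h R.- c g)
    d-close : Within D (d h R.- d g)
    u-close : Within D (u h R.- u g)
  open Close
  detG : GL₂ -> Adele
  detG g = a g R.* d g R.- b g R.* c g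
  record Bounded (e : Divisor) (g : GL₂) : Set where
   constructor bounded
   field
    ua∈ : Within (neg e) (u g R.* a g)
    ub∈ : Within (neg e) (u g R.* b g)
    uc∈ : Within (neg e) (u g R.* c g)
    ud∈ : Within (neg e) (u g R.* d g)
    detG∈ : Within (neg e) (detG g)
  quotient : GL₂ -> GL₂ -> GL₂
  quotient g h = record
   { a = u g R.* (d g R.* a h R.- b g R.* c h) ; b = u g R.* (d g R.* b h R.- b g R.* d h)
   ; c = u g R.* (a g R.* c h R.- c g R.* a h) ; d = u g R.* (a g R.* d h R.- c g R.* b h)
   ; u = detG g R.* u h
   ; unit = Q.quotient-unit {a g} {b g} {c g} {d g} {u g} (unit g) {a h} {b h} {c h} {d h} {u h} (unit h) }
  ·-quotient : ∀ g h -> (g · quotient g h) ~ h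
  ·-quotient g h = ~-entries {g · quotient g h} {h}
   (Q.entry1 {a g} {b g} {c g} {d g} {u g} (unit g) (a h) (c h)) (Q.entry1 {a g} {b g} {c g} {d g} {u g} (unit g) (b h) (d h))
   (Q.entry2 {a g} {b g} {c g} {d g} {u g} (unit g) (a h) (c h)) (Q.entry2 {a g} {b g} {c g} {d g} {u g} (unit g) (b h) (d h))
  ball-⊕ : ∀ x D e {p q} -> B x (Z.- e) p -> B x (D Z.+ e) q -> B x D (K._*_ x p q)
  ball-⊕ x D e p q = V.ball-*-eq x p q (solveℤ 2 (λ D e -> :- e :+ (D :+ e) := D) D e)
  -- g⁻¹ h - 1 = g⁻¹ (h - g), and the poles of g⁻¹ are bounded by e; the inverse determinant is
  -- compared in the same way by means of det g.
  quotient-close : ∀ D e {g h} -> Bounded e g -> Close (D ⊕ e) g h -> Close D ε (quotient g h)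
  quotient-close D e {g} {h} (bounded ua ub uc ud detG) (close pa pb pc pd pu) = close
   (λ x -> V.ball-resp x (K.sym x (Qₓ.close-a x (unit g x) (at (a h) x) (at (c h) x))) (V.ball-- x (times x (ud x) (pa x)) (times x (ub x) (pc x))))
   (λ x -> V.ball-resp x (K.sym x (Qₓ.close-b x (unit g x) (at (b h) x) (at (d h) x))) (V.ball-- x (times x (ud x) (pb x)) (times x (ub x) (pd x))))
   (λ x -> V.ball-resp x (K.sym x (Qₓ.close-c x (unit g x) (at (a h) x) (at (c h) x))) (V.ball-- x (times x (ua x) (pc x)) (times x (uc x) (pa x))))
   (λ x -> V.ball-resp x (K.sym x (Qₓ.close-d x (unit g x) (at (b h) x) (at (d h) x))) (V.ball-- x (times x (ua x) (pd x)) (times x (uc x) (pb x))))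
   (λ x -> V.ball-resp x (K.sym x (Qₓ.close-u x (unit g x) (at (u h) x))) (times x (detG x) (pu x)))
   where
   times : ∀ x {p q} -> B x (Z.- fst e x) p -> B x (fst D x Z.+ fst e x) q -> B x (fst D x) (K._*_ x p q)
   times x = ball-⊕ x (fst D x) (fst e x)
  module _ (D : Divisor) (D≥0 : ∀ x -> 0ℤ ≤ fst D x) where
   private
    integral1 : ∀ x {p} -> B x (fst D x) (K._-_ x p (K.1# x)) -> B x 0ℤ p
    integral1 x {p} h = V.ball-resp x (restore x p) (V.ball-+ x (V.ball-mono x (D≥0 x) h) (λ _ -> ≡⇒≤ (≡.sym (V.v1≡0 x))))
     where
     restore : ∀ x p -> K._≈_ x (K._+_ x (K._-_ x p (K.1# x)) (K.1# x)) p
     restore x = Kₛ.solve x 1 (λ p -> (p :- con 1ℤ) :+ con 1ℤ := p)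
    integral0 : ∀ x {p} -> B x (fst D x) (K._-_ x p (K.0# x)) -> B x 0ℤ p
    integral0 x {p} h = V.ball-resp x (restore x p) (V.ball-mono x (D≥0 x) h)
     where
     restore : ∀ x p -> K._≈_ x (K._-_ x p (K.0# x)) p
     restore x = Kₛ.solve x 1 (λ p -> p :- con 0ℤ := p)
    _*D_ : ∀ {x p q} -> B x (fst D x) p -> B x 0ℤ q -> B x (fst D x) (K._*_ x p q)
    _*D_ {x} p q = V.ball-*-eq x p q (ℤₚ.+-identityʳ _)
    _D*_ : ∀ {x p q} -> B x 0ℤ p -> B x (fst D x) q -> B x (fst D x) (K._*_ x p q)
    _D*_ {x} p q = V.ball-*ˡ x p q
   close⇒integral : ∀ {κ} -> Close D ε κ -> AllEntries Integral κ
   close⇒integral (close p q r s t) = (λ x -> integral1 x (p x)) , (λ x -> integral0 x (q x)) , (λ x -> integral0 x (r x)) , (λ x -> integral1 x (s x)) , λ x -> integral1 x (t x)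
   close-· : ∀ {κ κ'} -> Close D ε κ -> Close D ε κ' -> Close D ε (κ · κ')
   close-· {κ} {κ'} k@(close p q r s t) k'@(close p' q' r' s' t') = close
    (λ x -> V.ball-resp x (K.sym x (Qₓ.close-product x _ _ _ _)) (V.ball-+ x (V.ball-+ x (_*D_ {x} (p x) (ia x)) (p' x)) (_*D_ {x} (q x) (ic x))))
    (λ x -> V.ball-resp x (K.sym x (Qₓ.close-off x _ _ _ _)) (V.ball-+ x (_D*_ {x} (ja x) (q' x)) (_*D_ {x} (q x) (id' x))))
    (λ x -> V.ball-resp x (K.sym x (Qₓ.close-off' x _ _ _ _)) (V.ball-+ x (_D*_ {x} (jd x) (r' x)) (_*D_ {x} (r x) (ia x))))
    (λ x -> V.ball-resp x (K.sym x (Qₓ.close-product' x _ _ _ _)) (V.ball-+ x (V.ball-+ x (_*D_ {x} (s x) (id' x)) (s' x)) (_*D_ {x} (r x) (ib x))))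
    (λ x -> V.ball-resp x (K.sym x (Qₓ.close-unit x _ _)) (V.ball-+ x (_*D_ {x} (t x) (iu x)) (t' x)))
    where
    ia = fst (close⇒integral k')
    ib = fst (snd (close⇒integral k'))
    ic = fst (snd (snd (close⇒integral k')))
    id' = fst (snd (snd (snd (close⇒integral k'))))
    iu = snd (snd (snd (snd (close⇒integral k'))))
    ja = fst (close⇒integral k)
    jd = fst (snd (snd (snd (close⇒integral k))))
   close-inverse : ∀ {κ} -> Close D ε κ -> Close D ε (inverse κ)
   close-inverse (close p q r s t) = close s (λ x -> V.ball-resp x (K.sym x (Qₓ.close-neg x _)) (V.ball-neg' x (q x)))
    (λ x -> V.ball-resp x (K.sym x (Qₓ.close-neg x _)) (V.ball-neg' x (r x))) p t
  5-bound : ∀ a1 a2 a3 a4 a₅ -> ∃ λ e -> (∀ x -> 0ℤ ≤ fst e x) × Within (neg e) a1 × Within (neg e) a2 × Within (neg e) a3 × Within (neg e) a4 × Within (neg e) a₅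
  5-bound a1 a2 a3 a4 a₅ = e , (λ x -> +-mono-≤ (+-mono-≤ (+-mono-≤ (+-mono-≤ (p1 x) (p2 x)) (p3 x)) (p4 x)) (p₅ x))
   , within a1 (λ x -> ≤-trans (≤-left (p2 x)) (≤-trans (≤-left (p3 x)) (≤-trans (≤-left (p4 x)) (≤-left (p₅ x)))))
   , within a2 (λ x -> ≤-trans (≤-right (p1 x)) (≤-trans (≤-left (p3 x)) (≤-trans (≤-left (p4 x)) (≤-left (p₅ x)))))
   , within a3 (λ x -> ≤-trans (≤-right (+-mono-≤ (p1 x) (p2 x))) (≤-trans (≤-left (p4 x)) (≤-left (p₅ x))))
   , within a4 (λ x -> ≤-trans (≤-right (+-mono-≤ (+-mono-≤ (p1 x) (p2 x)) (p3 x))) (≤-left (p₅ x)))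
   , within a₅ (λ x -> ≤-right (+-mono-≤ (+-mono-≤ (+-mono-≤ (p1 x) (p2 x)) (p3 x)) (p4 x)))
   where
   e : Divisor
   e = fst (adele-bound a1) ⊕ fst (adele-bound a2) ⊕ fst (adele-bound a3) ⊕ fst (adele-bound a4) ⊕ fst (adele-bound a₅)
   pos : ∀ a x -> 0ℤ ≤ fst (fst (adele-bound a)) x
   pos a = fst (snd (adele-bound a))
   p1 = pos a1
   p2 = pos a2
   p3 = pos a3
   p4 = pos a4
   p₅ = pos a₅
   within : ∀ a -> (∀ x -> fst (fst (adele-bound a)) x ≤ fst e x) -> Within (neg e) a
   within a le = within-mono (neg e) (neg (fst (adele-bound a))) {a} (λ x -> neg-mono-≤ (le x)) (snd (snd (adele-bound a)))
   ≤-left : ∀ {i j} -> 0ℤ ≤ j -> i ≤ i Z.+ j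
   ≤-left {i} p = subst (_≤ i Z.+ _) (ℤₚ.+-identityʳ i) (+-monoʳ-≤ i p)
   ≤-right : ∀ {i j} -> 0ℤ ≤ i -> j ≤ i Z.+ j
   ≤-right {i} {j} p = subst (_≤ i Z.+ j) (ℤₚ.+-identityˡ j) (+-monoˡ-≤ j p)
  exists-bounded : ∀ g -> ∃ λ e -> Bounded e g
  exists-bounded g = let e , _ , p , q , r , s , t = 5-bound (u g R.* a g) (u g R.* b g) (u g R.* c g) (u g R.* d g) (detG g) in e , bounded p q r s t
  RightInvariant : Divisor -> (GL₂ -> Set) -> Set
  RightInvariant D U = (∀ g h -> g ~ h -> U g -> U h) × (∀ g κ -> Close D ε κ -> U g -> U (g · κ))
  -- A matrix h close enough to g lies in g times the congruence subgroup of level D. How close is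
  -- enough depends on the poles e of g⁻¹.
  right-invariant-open : ∀ D U -> RightInvariant D U -> IsOpen U
  right-invariant-open D U (~-inv , inv) = (λ g u -> let e , bnd = exists-bounded g in D ⊕ e , λ h pa pb pc pd pu ->
   ~-inv (g · quotient g h) h (·-quotient g h) (inv g (quotient g h) (quotient-close D e {g} {h} bnd (close pa pb pc pd pu)) u)) , ~-inv
  record CosetOf (D : Divisor) (g h : GL₂) : Set where
   constructor cosetOf
   field
    κ : GL₂
    κ∈ : Close D ε κ
    eq : h ~ (g · κ)
  module _ (D : Divisor) (D≥0 : ∀ x -> 0ℤ ≤ fst D x) (g : GL₂) where
   coset-right-invariant : RightInvariant D (CosetOf D g)
   coset-right-invariant = (λ { h h' e (cosetOf κ κ∈ eq) -> cosetOf κ κ∈ (G.trans {h'} {h} {g · κ} (G.sym {h} {h'} e) eq) })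
    , λ { h κ' κ'∈ (cosetOf κ κ∈ eq) -> cosetOf (κ · κ') (close-· D D≥0 {κ} {κ'} κ∈ κ'∈)
     (G.trans {h · κ'} {(g · κ) · κ'} {g · (κ · κ')} (·-cong {h} {g · κ} {κ'} {κ'} eq (G.refl {κ'})) (·-assoc g κ κ')) }
  complement-invariant : ∀ D -> (∀ x -> 0ℤ ≤ fst D x) -> ∀ U -> RightInvariant D U -> RightInvariant D (λ g -> ¬ U g)
  complement-invariant D D≥0 U (~-inv , inv) = (λ g h e n u -> n (~-inv h g (G.sym {g} {h} e) u))
   , λ g κ κ∈ n u -> n (~-inv ((g · κ) · inverse κ) g (GroupProperties.//-rightDividesʳ PGL₂ κ g) (inv (g · κ) (inverse κ) (close-inverse D D≥0 {κ} κ∈) u))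
  open-respects : ∀ U -> IsOpen U -> ∀ {g h} -> g ~ h -> U g -> U h
  open-respects U (_ , ~-inv) {g} {h} = ~-inv g h
  translate-open : ∀ s U -> IsOpen U -> IsOpen (λ g -> U (s · g))
  translate-open s U (near , ~-inv) = (λ g v -> let D , h = near (s · g) v in D ⊕ e , λ g' pa pb pc pd pu -> h (s · g')
   (entry D {a s} {b s} {a g} {a g'} {c g} {c g'} (fst bnd) (fst (snd bnd)) pa pc)
   (entry D {a s} {b s} {b g} {b g'} {d g} {d g'} (fst bnd) (fst (snd bnd)) pb pd)
   (entry D {c s} {d s} {a g} {a g'} {c g} {c g'} (fst (snd (snd bnd))) (fst (snd (snd (snd bnd)))) pa pc)
   (entry D {c s} {d s} {b g} {b g'} {d g} {d g'} (fst (snd (snd bnd))) (fst (snd (snd (snd bnd)))) pb pd)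
   (λ x -> V.ball-resp x (K.sym x (Qₓ.linear₁ x (at (u s) x) (at (u g) x) (at (u g') x))) (ball-⊕ x (fst D x) (fst e x) (snd (snd (snd (snd bnd))) x) (pu x))))
   , λ g g' eq -> ~-inv (s · g) (s · g') (·-cong {s} {s} {g} {g'} (G.refl {s}) eq)
   where
   e : Divisor
   e = fst (5-bound (a s) (b s) (c s) (d s) (u s))
   bnd : Within (neg e) (a s) × Within (neg e) (b s) × Within (neg e) (c s) × Within (neg e) (d s) × Within (neg e) (u s)
   bnd = snd (snd (5-bound (a s) (b s) (c s) (d s) (u s)))
   entry : ∀ D {s s' p p' r r'} -> Within (neg e) s -> Within (neg e) s' -> Within (D ⊕ e) (p' R.- p) -> Within (D ⊕ e) (r' R.- r) ->
    Within D ((s R.* p' R.+ s' R.* r') R.- (s R.* p R.+ s' R.* r))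
   entry D {s} {s'} {p} {p'} {r} {r'} q q' w w' x = V.ball-resp x (K.sym x (Qₓ.linear x (at s x) (at s' x) (at p x) (at p' x) (at r x) (at r' x)))
    (V.ball-+ x (ball-⊕ x (fst D x) (fst e x) (q x) (w x)) (ball-⊕ x (fst D x) (fst e x) (q' x) (w' x)))
  open-contains-coset : ∀ U -> IsOpen U -> ∀ g -> U g -> ∃ λ D -> (∀ x -> 0ℤ ≤ fst D x) × (∀ h -> CosetOf D g h -> U h)
  open-contains-coset U (near , ~-inv) g v = D⁺ ⊕ e , (λ x -> +-mono-≤ (i≤j⊔i (fst D x) 0ℤ) (fst (snd (5-bound (a g) (b g) (c g) (d g) (u g))) x))
   , λ { h (cosetOf κ (close p q r s t) eq) -> ~-inv (g · κ) h (G.sym {h} {g · κ} eq) (snd (near g v) (g · κ)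
    (λ x -> V.ball-resp x (K.sym x (Qₓ.times-close-1 x (at (a g) x) (at (b g) x) (at (a κ) x) (at (c κ) x))) (V.ball-+ x (times x (fst bnd x) (p x)) (times x (fst (snd bnd) x) (r x))))
    (λ x -> V.ball-resp x (K.sym x (Qₓ.times-close-2 x (at (a g) x) (at (b g) x) (at (b κ) x) (at (d κ) x))) (V.ball-+ x (times x (fst bnd x) (q x)) (times x (fst (snd bnd) x) (s x))))
    (λ x -> V.ball-resp x (K.sym x (Qₓ.times-close-1 x (at (c g) x) (at (d g) x) (at (a κ) x) (at (c κ) x))) (V.ball-+ x (times x (fst (snd (snd bnd)) x) (p x)) (times x (fst (snd (snd (snd bnd))) x) (r x))))
    (λ x -> V.ball-resp x (K.sym x (Qₓ.times-close-2 x (at (c g) x) (at (d g) x) (at (b κ) x) (at (d κ) x))) (V.ball-+ x (times x (fst (snd (snd bnd)) x) (q x)) (times x (fst (snd (snd (snd bnd))) x) (s x))))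
    (λ x -> V.ball-resp x (K.sym x (Qₓ.times-close x (at (u g) x) (at (u κ) x))) (times x (snd (snd (snd (snd bnd))) x) (t x)))) }
   where
   D D⁺ e : Divisor
   D = fst (near g v)
   -- Raising the level to be non-negative makes the congruence subgroup consist of integral
   -- matrices, as the later lemmas on cosets require.
   D⁺ = (λ x -> fst D x Z.⊔ 0ℤ) , almostAll-map (λ e -> ap (Z._⊔ 0ℤ) e) (snd D)
   e = fst (5-bound (a g) (b g) (c g) (d g) (u g))
   bnd : Within (neg e) (a g) × Within (neg e) (b g) × Within (neg e) (c g) × Within (neg e) (d g) × Within (neg e) (u g)
   bnd = snd (snd (5-bound (a g) (b g) (c g) (d g) (u g)))
   times : ∀ x {p q} -> B x (Z.- fst e x) p -> B x (fst (D⁺ ⊕ e) x) q -> B x (fst D x) (K._*_ x p q)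
   times x p q = V.ball-mono x (i≤i⊔j (fst D x) 0ℤ) (ball-⊕ x (fst D⁺ x) (fst e x) p q)
  within-dim : ∀ D E -> (∀ x -> 0ℤ ≤ fst E x) -> ∃ (Dim (Within D) (Within (D ⊕ E)))
  within-dim D (e , L , h) pos = go L e h pos
   where
   resp : ∀ {E E'} -> E ≐ E' -> ∃ (Dim (Within D) (Within (D ⊕ E))) -> ∃ (Dim (Within D) (Within (D ⊕ E')))
   resp {E} {E'} eq (n , dim) = n , 𝕃.dim-transfer {Within D} {Within (D ⊕ E)} {Within D} {Within (D ⊕ E')} (within-sub D) (within-sub (D ⊕ E)) (within-sub (D ⊕ E'))
    (λ w -> w) (λ {a} -> within-mono (D ⊕ E') (D ⊕ E) {a} (λ x -> ≡⇒≤ (ap (Z._+_ (fst D x)) (≡.sym (eq x)))))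
    (λ {a} _ -> within-mono (D ⊕ E) (D ⊕ E') {a} (λ x -> ≡⇒≤ (ap (Z._+_ (fst D x)) (eq x))))
    (λ a w -> a , w , Sub.resp (within-sub (D ⊕ E')) {R.0#} {a R.- a} (λ x -> K.sym x (K.-‿inverseʳ x _)) (Sub.0∈ (within-sub (D ⊕ E')))) dim
   up : ∀ E p n -> (∀ x -> 0ℤ ≤ fst E x) -> ∃ (Dim (Within D) (Within (D ⊕ E))) -> ∃ (Dim (Within D) (Within (D ⊕ bump E p (Z.+ n))))
   up E p zero pos d = resp {E} {bump E p 0ℤ} (λ x -> ≡.sym (bump-0 E p x)) d
   up E p (suc n) pos d = let m , dim = up E p n pos d ; E' = bump E p (Z.+ n) in
    resp {bump E' p 1ℤ} {bump E p (Z.+ suc n)} (λ x -> ≡.trans (bump-bump E p (Z.+ n) 1ℤ x) (ap (λ m -> fst (bump E p m) x) (ℤₚ.+-comm (Z.+ n) 1ℤ)))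
     (m ℕ.+ degree p , 𝕃.dim-transfer {Within D} {Within (bump (D ⊕ E') p 1ℤ)} {Within D} {Within (D ⊕ bump E' p 1ℤ)}
      (within-sub D) (within-sub (bump (D ⊕ E') p 1ℤ)) (within-sub (D ⊕ bump E' p 1ℤ)) (λ w -> w)
      (λ {a} -> within-mono (D ⊕ bump E' p 1ℤ) (bump (D ⊕ E') p 1ℤ) {a} (λ x -> ≡⇒≤ (≡.sym (ℤₚ.+-assoc (fst D x) _ _))))
      (λ {a} _ -> within-mono (bump (D ⊕ E') p 1ℤ) (D ⊕ bump E' p 1ℤ) {a} (λ x -> ≡⇒≤ (ℤₚ.+-assoc (fst D x) _ _)))
      (λ a w -> a , w , Sub.resp (within-sub (D ⊕ bump E' p 1ℤ)) {R.0#} {a R.- a} (λ x -> K.sym x (K.-‿inverseʳ x _)) (Sub.0∈ (within-sub (D ⊕ bump E' p 1ℤ))))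
      (𝕃.dim-+ {Within D} {Within (D ⊕ E')} {Within (bump (D ⊕ E') p 1ℤ)} (within-sub D) (within-sub (D ⊕ E')) (within-sub (bump (D ⊕ E') p 1ℤ))
       (λ {a} -> within-mono D (D ⊕ E') {a} (λ x -> subst (_≤ fst (D ⊕ E') x) (ℤₚ.+-identityʳ (fst D x)) (+-monoʳ-≤ (fst D x) (+-mono-≤ (pos x) (nonneg x em)))))
       (λ {a} -> within-mono (D ⊕ E') (bump (D ⊕ E') p 1ℤ) {a} (D≤bump (D ⊕ E') p)) dim (local-dim (D ⊕ E') p)))
    where
    nonneg : ∀ x -> (d : Dec (x ≡ p)) -> 0ℤ ≤ if-dec (Z.+ n) 0ℤ d
    nonneg x (yes _) = Z.+≤+ ℕ.z≤n
    nonneg x (no _) = ≤-refl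
   go : ∀ L e h -> (∀ x -> 0ℤ ≤ e x) -> ∃ (Dim (Within D) (Within (D ⊕ (e , L , h))))
   go [] e h _ = 0 , 𝕃.mkDim (λ ()) (λ ()) (λ _ _ ()) (λ a w -> (λ ()) , Sub.resp (within-sub (D ⊕ (e , [] , h))) {a} {a R.- R.0#} (λ x -> K.sym x (minus-zero x (at a x)))
    (within-mono (D ⊕ (e , [] , h)) D {a} (λ x -> ≡⇒≤ (≡.trans (ap (Z._+_ (fst D x)) (zero-at (h x))) (ℤₚ.+-identityʳ _))) w))
    where
    zero-at : ∀ {x} -> e x ≡ 0ℤ ⊎ x ∈ [] -> e x ≡ 0ℤ
    zero-at (inl z) = z
    minus-zero : ∀ x a -> K._≈_ x (K._-_ x a (K.0# x)) a
    minus-zero x = Kₛ.solve x 1 (λ a -> a :- con 0ℤ := a)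
   go (p ∷ L) e h pos = resp {bump D' p (e p)} {e , p ∷ L , h} (clear-+ p e) (add (e p) (pos p))
    where
    D' : Divisor
    D' = clear p e , L , clear-support p e L h
    add : ∀ n -> 0ℤ ≤ n -> ∃ (Dim (Within D) (Within (D ⊕ bump D' p n)))
    add (Z.+ n) _ = up D' p n (clear-nonneg p e pos) (go L (clear p e) (clear-support p e L h) (clear-nonneg p e pos))

 -- Compact cosets and test functions on PGL₂(𝔸)

 module GroupMeasure (ℝ : RealField) (dg : Adeles.Automorphic.HaarG X F̂ ℝ) where
  open CongruenceSubgroups public
  open ComplexNumbers em ℝ public
  open Haar ℝ public
  open GL₂
  private
   module R = RingLaws 𝔸
   module ℂ = RingLaws ℂ-ring'
   module ∫ᴳ = HaarIntegral dg
  open ℂ.Reasoning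
  open Topology em G⟨𝔸⟩
  open Space G⟨𝔸⟩ using (IsOpen)
  private
   f0 : GL₂ -> ℂ
   f0 = fst ∫ᴳ.nonzero
   f0-test : IsTest G⟨𝔸⟩ f0
   f0-test = fst (snd ∫ᴳ.nonzero)
   support-point : ∃ λ g -> ¬ f0 g ≈ 0#
   support-point = ¬∀⇒∃¬ λ all -> snd (snd ∫ᴳ.nonzero) (begin
    ∫ᴳ.∫ f0 ≈⟨ ∫ᴳ.cong f0 (λ g -> 0# * f0 g) f0-test (λ g -> ℂ.trans (all g) (ℂ.sym (ℂ.zeroˡ (f0 g)))) ⟩
    ∫ᴳ.∫ (λ g -> 0# * f0 g) ≈⟨ ∫ᴳ.scale 0# f0 f0-test ⟩
    0# * ∫ᴳ.∫ f0 ≈⟨ ℂ.zeroˡ _ ⟩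
    0# ∎)
  -- As for 𝔸 modulo F: the function of non-zero integral supplies one compact coset of a congruence
  -- subgroup, and left translation carries it to all others.
  compact-coset : ∃ λ D -> (∀ x -> 0ℤ ≤ fst D x) × (∀ g -> Compact G⟨𝔸⟩ (CosetOf D g))
  compact-coset = D , D≥0 , λ g -> compact-translate {CosetOf D g0} {CosetOf D g} ((g · inverse g0) ·_) (translate-open (g · inverse g0)) compact₀
   (λ { s (cosetOf κ κ∈ eq) -> cosetOf κ κ∈ (≈-> (g · inverse g0) {s} {g0 · κ} {g · κ} eq (cancel g g0 κ)) })
   (λ { t (cosetOf κ κ∈ eq) -> g0 · κ , cosetOf κ κ∈ (G.refl {g0 · κ})
    , λ U U-open -> open-respects U U-open {(g · inverse g0) · (g0 · κ)} {t} (G.trans {(g · inverse g0) · (g0 · κ)} {g · κ} {t} (cancel g g0 κ) (G.sym {t} {g · κ} eq)) })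
   where
   g0 : GL₂
   g0 = fst support-point
   U : GL₂ -> Set
   U = fst (fst f0-test g0)
   nbhd = snd (fst f0-test g0)
   inside : ∃ λ D -> (∀ x -> 0ℤ ≤ fst D x) × (∀ h -> CosetOf D g0 h -> U h)
   inside = open-contains-coset U (fst nbhd) g0 (fst (snd nbhd))
   D : Divisor
   D = fst inside
   D≥0 : ∀ x -> 0ℤ ≤ fst D x
   D≥0 = fst (snd inside)
   compact₀ : Compact G⟨𝔸⟩ (CosetOf D g0)
   compact₀ = compact-cover {⊤} {CosetOf D g0} (λ _ t -> ¬ f0 t ≈ 0#) (λ _ -> snd f0-test)
    (right-invariant-open D (λ t -> ¬ CosetOf D g0 t) (complement-invariant D D≥0 (CosetOf D g0) (coset-right-invariant D D≥0 g0))) (tt ∷ [])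
    (λ t c -> here (λ z -> snd support-point (ℂ.trans (ℂ.sym (snd (snd nbhd) t (snd (snd inside) t c))) z)))
   cancel : ∀ g g0 κ -> ((g · inverse g0) · (g0 · κ)) ~ (g · κ)
   cancel g g0 κ = G.trans {(g · inverse g0) · (g0 · κ)} {((g · inverse g0) · g0) · κ} {g · κ}
    (G.sym {((g · inverse g0) · g0) · κ} {(g · inverse g0) · (g0 · κ)} (·-assoc (g · inverse g0) g0 κ))
    (·-cong {(g · inverse g0) · g0} {g} {κ} {κ} (GroupProperties.//-rightDividesˡ PGL₂ g0 g) (G.refl {κ}))
   ≈-> : ∀ k {s s' t} -> s ~ s' -> (k · s') ~ t -> (k · s) ~ t
   ≈-> k {s} {s'} {t} e e' = G.trans {k · s} {k · s'} {t} (·-cong {k} {k} {s} {s'} (G.refl {k}) e) e'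
  finite-colours : ∀ {A : Set} {n m} (colour : A -> Fin m -> Fin n) -> ∃ λ (L : List A) -> ∀ a -> Any (λ b -> ∀ i -> colour b i ≡ colour a i) L
  finite-colours {A} {n} {m} colour = List.concatMap pick (List.allFin (n ℕ.^ m)) , λ a ->
   Anyₚ.concat⁺ (Anyₚ.map⁺ (Anyₚ.tabulate⁺ {f = λ i -> i} (FinBase.funToFin (colour a)) (found a em)))
   where
   Has : Fin (n ℕ.^ m) -> A -> Set
   Has k a = ∀ i -> colour a i ≡ FinBase.finToFun k i
   take : ∀ {k} -> Dec (∃ (Has k)) -> List A
   take (yes (a , _)) = a ∷ []
   take (no _) = []
   pick : Fin (n ℕ.^ m) -> List A
   pick k = take {k} em
   found : ∀ a (d : Dec (∃ (Has (FinBase.funToFin (colour a))))) -> Any (λ b -> ∀ i -> colour b i ≡ colour a i) (take d)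
   found a (yes (b , h)) = here λ i -> ≡.trans (h i) (Finₚ.finToFun-funToFin (colour a) i)
   found a (no h) = ⊥-elim (h (a , λ i -> ≡.sym (Finₚ.finToFun-funToFin (colour a) i)))
  AllWithin : Divisor -> GL₂ -> Set
  AllWithin D = AllEntries (Within D)
  module _ (e0 : Divisor) (e₀≥0 : ∀ x -> 0ℤ ≤ fst e0 x) (D : Divisor) (D≥0 : ∀ x -> 0ℤ ≤ fst D x) where
   private
    e E : Divisor
    e = e0 ⊕ e0
    -- Then -e0 + E = D + e, so matrices whose entries agree modulo 𝔸(-e0 + E) are close of level D
    -- + e. The term e = 2 e0 bounds the poles of the inverses, whose entries are products of two
    -- entries.
    E = e0 ⊕ (D ⊕ e)
    dims : ∃ (Dim (Within (neg e0)) (Within (neg e0 ⊕ E)))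
    dims = within-dim (neg e0) E (λ x -> +-mono-≤ (e₀≥0 x) (+-mono-≤ (D≥0 x) (+-mono-≤ (e₀≥0 x) (e₀≥0 x))))
    reps = 𝕃.representatives (within-sub (neg e0)) (within-sub (neg e0 ⊕ E)) (snd dims)
    ρ = fst reps
    index : ∀ a -> Within (neg e0) a -> ∃ λ i -> Within (neg e0 ⊕ E) (a R.- ρ i)
    index = fst (snd (snd reps))
    J : Set
    J = Σ GL₂ (AllWithin (neg e0))
    entry : (p : J) -> Fin 5 -> Σ Adele (Within (neg e0))
    entry (g , p , q , r , s , t) zero = a g , p
    entry (g , p , q , r , s , t) (suc zero) = b g , q
    entry (g , p , q , r , s , t) (suc (suc zero)) = c g , r
    entry (g , p , q , r , s , t) (suc (suc (suc zero))) = d g , s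
    entry (g , p , q , r , s , t) (suc (suc (suc (suc zero)))) = u g , t
    colour : J -> Fin 5 -> Fin (Curve.q X ℕ.^ fst dims)
    colour p i = fst (index (fst (entry p i)) (snd (entry p i)))
    near : ∀ p p' i -> colour p i ≡ colour p' i -> Within (D ⊕ e) (fst (entry p' i) R.- fst (entry p i))
    near p p' i eq x = subst (λ n -> B x n (at (fst (entry p' i) R.- fst (entry p i)) x))
     (solveℤ 3 (λ d e0 e -> :- e0 :+ (e0 :+ (d :+ e)) := d :+ e) (fst D x) (fst e0 x) (fst e x))
     (V.ball-resp x (rearrange x _ _ _) (V.ball-- x (snd (index _ (snd (entry p' i))) x)
      (subst (λ j -> B x (fst (neg e0 ⊕ E) x) (K._-_ x (at (fst (entry p i)) x) (at (ρ j) x))) eq (snd (index _ (snd (entry p i))) x))))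
     where
     rearrange : ∀ x a b c -> K._≈_ x (K._-_ x (K._-_ x a c) (K._-_ x b c)) (K._-_ x a b)
     rearrange x = Kₛ.solve x 3 (λ a b c -> (a :- c) :- (b :- c) := a :- b)
    bounded-by : ∀ g -> AllWithin (neg e0) g -> Bounded e g
    bounded-by g (p , q , r , s , t) = bounded (λ x -> times x (t x) (p x)) (λ x -> times x (t x) (q x)) (λ x -> times x (t x) (r x)) (λ x -> times x (t x) (s x))
     (λ x -> V.ball-- x (times x (p x) (s x)) (times x (q x) (r x)))
     where
     times : ∀ x {v w} -> B x (Z.- fst e0 x) v -> B x (Z.- fst e0 x) w -> B x (Z.- fst e x) (K._*_ x v w)
     times x p q = V.ball-*-eq x p q (≡.sym (ℤₚ.neg-distrib-+ (fst e0 x) (fst e0 x)))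
   -- Matrices with poles bounded by e0 are sorted by the residue classes of their five entries, the
   -- inverse determinant included. Matrices with the same classes lie in one coset, and there are
   -- finitely many classes.
   finite-cosets : ∃ λ (L : List GL₂) -> ∀ g -> AllWithin (neg e0) g -> Any (λ h -> CosetOf D h g) L
   finite-cosets = List.map fst (fst (finite-colours colour)) , λ g w -> Anyₚ.map⁺ (Any.map (λ {p} -> conclude p g w) (snd (finite-colours colour) (g , w)))
    where
    conclude : ∀ p g w -> (∀ i -> colour p i ≡ colour (g , w) i) -> CosetOf D (fst p) g
    conclude p@(h , v) g w eq = cosetOf (quotient h g) (quotient-close D e {h} {g} (bounded-by h v)
     (close (n zero) (n (suc zero)) (n (suc (suc zero))) (n (suc (suc (suc zero)))) (n (suc (suc (suc (suc zero)))))))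
     (G.sym {h · quotient h g} {g} (·-quotient h g))
     where
     n : ∀ i -> Within (D ⊕ e) (fst (entry (g , w) i) R.- fst (entry p i))
     n i = near p (g , w) i (eq i)
  record DCoset (h0 h : GL₂) : Set where
   constructor dcoset
   field
    κ1 κ2 : GL₂
    κ1∈ : AllEntries Integral κ1
    κ2∈ : AllEntries Integral κ2
    eq : h ~ ((κ1 · h0) · κ2)
  DCoset-resp : ∀ h0 {h h'} -> h ~ h' -> DCoset h0 h -> DCoset h0 h'
  DCoset-resp h0 {h} {h'} e (dcoset κ1 κ2 κ1∈ κ2∈ eq) = dcoset κ1 κ2 κ1∈ κ2∈ (G.trans {h'} {h} {(κ1 · h0) · κ2} (G.sym {h} {h'} e) eq)
  DCoset-·ʳ : ∀ h0 {h κ} -> InK κ -> DCoset h0 h -> DCoset h0 (h · κ)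
  DCoset-·ʳ h0 {h} {κ} (k , κ~k , k∈) (dcoset κ1 κ2 κ1∈ κ2∈ eq) = dcoset κ1 (κ2 · k) κ1∈ (𝒦.·∈ {κ2} {k} κ2∈ k∈)
   (G.trans {h · κ} {((κ1 · h0) · κ2) · k} {(κ1 · h0) · (κ2 · k)} (·-cong {h} {(κ1 · h0) · κ2} {κ} {k} eq κ~k) (·-assoc (κ1 · h0) κ2 k))
  DCoset-·ˡ : ∀ h0 {h κ} -> InK κ -> DCoset h0 h -> DCoset h0 (κ · h)
  DCoset-·ˡ h0 {h} {κ} (k , κ~k , k∈) (dcoset κ1 κ2 κ1∈ κ2∈ eq) = dcoset (k · κ1) κ2 (𝒦.·∈ {k} {κ1} k∈ κ1∈) κ2∈
   (G.trans {κ · h} {k · ((κ1 · h0) · κ2)} {((k · κ1) · h0) · κ2} (·-cong {κ} {k} {h} {(κ1 · h0) · κ2} κ~k eq)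
    (G.sym {((k · κ1) · h0) · κ2} {k · ((κ1 · h0) · κ2)} (G.trans {((k · κ1) · h0) · κ2} {(k · (κ1 · h0)) · κ2} {k · ((κ1 · h0) · κ2)}
     (·-cong {(k · κ1) · h0} {k · (κ1 · h0)} {κ2} {κ2} (·-assoc k κ1 h0) (G.refl {κ2})) (·-assoc k (κ1 · h0) κ2))))
  private
   -- The representatives κ1 h0 κ2 of K h0 K have no worse poles than h0, so `finite-cosets` applies
   -- to the whole double coset.
   finite-cover : ∀ h0 -> ∃ λ (L : List GL₂) -> ∀ h -> DCoset h0 h -> Any (λ g -> CosetOf (fst compact-coset) g h) L
   finite-cover h0 = L , λ { h (dcoset κ1 κ2 κ1∈ κ2∈ eq) ->
    Any.map (λ { {g} (cosetOf κ κ∈ e) -> cosetOf κ κ∈ (G.trans {h} {(κ1 · h0) · κ2} {g · κ} eq e) }) (covers ((κ1 · h0) · κ2) (within κ1 κ2 κ1∈ κ2∈)) }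
    where
    bound : ∃ λ e -> (∀ x -> 0ℤ ≤ fst e x) × AllWithin (neg e) h0
    bound = 5-bound (a h0) (b h0) (c h0) (d h0) (u h0)
    e0 : Divisor
    e0 = fst bound
    D : Divisor
    D = fst compact-coset
    cosets : ∃ λ (L : List GL₂) -> ∀ g -> AllWithin (neg e0) g -> Any (λ h -> CosetOf D h g) L
    cosets = finite-cosets e0 (fst (snd bound)) D (fst (snd compact-coset))
    L = fst cosets
    covers = snd cosets
    left : ∀ {κ g} -> AllEntries Integral κ -> AllWithin (neg e0) g -> AllWithin (neg e0) (κ · g)
    left (p , q , r , s , t) (p' , q' , r' , s' , t') =
     (λ x -> V.ball-+ x (V.ball-*ˡ x (p x) (p' x)) (V.ball-*ˡ x (q x) (r' x))) , (λ x -> V.ball-+ x (V.ball-*ˡ x (p x) (q' x)) (V.ball-*ˡ x (q x) (s' x)))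
     , (λ x -> V.ball-+ x (V.ball-*ˡ x (r x) (p' x)) (V.ball-*ˡ x (s x) (r' x))) , (λ x -> V.ball-+ x (V.ball-*ˡ x (r x) (q' x)) (V.ball-*ˡ x (s x) (s' x)))
     , λ x -> V.ball-*ˡ x (t x) (t' x)
    right : ∀ {κ g} -> AllEntries Integral κ -> AllWithin (neg e0) g -> AllWithin (neg e0) (g · κ)
    right (p , q , r , s , t) (p' , q' , r' , s' , t') =
     (λ x -> V.ball-+ x (times x (p' x) (p x)) (times x (q' x) (r x))) , (λ x -> V.ball-+ x (times x (p' x) (q x)) (times x (q' x) (s x)))
     , (λ x -> V.ball-+ x (times x (r' x) (p x)) (times x (s' x) (r x))) , (λ x -> V.ball-+ x (times x (r' x) (q x)) (times x (s' x) (s x)))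
     , λ x -> times x (t' x) (t x)
     where
     times : ∀ x {v w} -> B x (Z.- fst e0 x) v -> B x 0ℤ w -> B x (Z.- fst e0 x) (K._*_ x v w)
     times x p q = V.ball-*-eq x p q (ℤₚ.+-identityʳ _)
    within : ∀ κ1 κ2 -> AllEntries Integral κ1 -> AllEntries Integral κ2 -> AllWithin (neg e0) ((κ1 · h0) · κ2)
    within κ1 κ2 κ1∈ κ2∈ = right {κ2} {κ1 · h0} κ2∈ (left {κ1} {h0} κ1∈ (snd (snd bound)))
  K-invariant-open : ∀ U -> (∀ g h -> g ~ h -> U g -> U h) -> (∀ g κ -> InK κ -> U g -> U (g · κ)) -> IsOpen U
  K-invariant-open U ~-inv inv = right-invariant-open 0ᴰ U
   (~-inv , λ g κ κ∈ -> inv g κ (entries⇒InK {κ} (close⇒integral 0ᴰ (λ x -> ≤-refl) {κ} κ∈)))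
  module _ (φ : GL₂ -> ℂ) (~-inv : ∀ g h -> g ~ h -> φ g ≈ φ h) (K-inv : ∀ g κ -> InK κ -> φ (g · κ) ≈ φ g) where
   K-invariant-support : ∀ {A : Set} (W : A -> GL₂ -> Set) -> (∀ a -> Compact G⟨𝔸⟩ (W a)) -> (L : List A) -> (∀ h -> ¬ φ h ≈ 0# -> Any (λ a -> W a h) L) -> IsTest G⟨𝔸⟩ φ
   K-invariant-support W compact L covers =
    (λ g -> (λ h -> φ h ≈ φ g) , K-invariant-open (λ h -> φ h ≈ φ g) (λ h h' e p -> ℂ.trans (ℂ.sym (~-inv h h' e)) p) (λ h κ κ∈ p -> ℂ.trans (K-inv h κ κ∈) p)
     , ℂ.refl , λ _ p -> p)
    , compact-cover {_} {λ g -> ¬ φ g ≈ 0#} W compact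
     (K-invariant-open (λ g -> ¬ ¬ φ g ≈ 0#) (λ g h e n ne -> n (λ z -> ne (ℂ.trans (ℂ.sym (~-inv g h e)) z)))
      (λ g κ κ∈ n ne -> n (λ z -> ne (ℂ.trans (K-inv g κ κ∈) z)))) L covers
   K-invariant-test : ∀ h0 -> (∀ h -> ¬ DCoset h0 h -> φ h ≈ 0#) -> IsTest G⟨𝔸⟩ φ
   K-invariant-test h0 outside = K-invariant-support (CosetOf (fst compact-coset)) (snd (snd compact-coset))
    (fst (finite-cover h0)) (λ h ne -> snd (finite-cover h0) h (dne λ n -> ne (outside h n)))

 -- Functions of 𝒱₀ are determined on classes of small slope

 module Vanishing (ℝ : RealField) (dg : Adeles.Automorphic.HaarG X F̂ ℝ) (normalized : Adeles.Automorphic.Normalized X F̂ ℝ dg) (dn : Adeles.Automorphic.HaarN X F̂ ℝ) where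
  open GroupMeasure ℝ dg public
  open AdeleClasses ℝ dn using (Coset; coset-sym; InvFun; invariant-test; nonzero-volume; module Volume)
  open Automorphic ℝ using (act; 𝒱₀; InHecke)
  open GL₂
  open Idele using (divisor)
  private
   module R = RingLaws 𝔸
   module ℂ = RingLaws ℂ-ring'
   module ℂₗ = FieldLemmas em ℂ-field
   module ∫ᴳ = HaarIntegral dg
   module ∫ₙ = HaarIntegral dn
   module I = MatrixIdentities 𝔸
  open ℂ.Reasoning
  unipotent-cong : ∀ {a b} -> a R.≈ b -> unipotent a ~ unipotent b
  unipotent-cong {a} {b} e = ~-entries {unipotent a} {unipotent b} (λ x -> K.refl x) e (λ x -> K.refl x) (λ x -> K.refl x)
  unipotent-· : ∀ a b -> (unipotent a · unipotent b) ~ unipotent (b R.+ a)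
  unipotent-· a b = ~-entries {unipotent a · unipotent b} {unipotent (b R.+ a)}
   (I.x1+y0 R.1# a) (λ x -> K.+-cong x (K.*-idˡ x _) (K.*-idʳ x _)) (I.0x+1y R.1# R.0#) (I.0x+1y b R.1#)
  unipotent-integral : ∀ {o} -> Integral o -> AllEntries Integral (unipotent o)
  unipotent-integral o∈ = 𝒦.1∈ , o∈ , 𝒦.0∈ , 𝒦.1∈ , 𝒦.1∈
  unipotent-principal : ∀ {p} -> Principal p -> AllEntries Principal (unipotent p)
  unipotent-principal {p} p∈ = Γ.1∈ , p∈ , Γ.0∈ , Γ.1∈ , Γ.1∈
  ·-congˡ : ∀ g {h h'} -> h ~ h' -> (g · h) ~ (g · h')
  ·-congˡ g {h} {h'} e = ·-cong {g} {g} {h} {h'} (G.refl {g}) e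
  infixr 8 _▹_
  abstract
   _▹_ : Adele -> GL₂ -> GL₂
   n ▹ h = unipotent n · h
   ▹-eq : ∀ n h -> (unipotent n · h) ~ (n ▹ h)
   ▹-eq n h = ~-entries {unipotent n · h} {n ▹ h} (λ x -> K.refl x) (λ x -> K.refl x) (λ x -> K.refl x) (λ x -> K.refl x)
   ▹-cong : ∀ n {h h'} -> h ~ h' -> (n ▹ h) ~ (n ▹ h')
   ▹-cong n {h} {h'} e = ·-congˡ (unipotent n) {h} {h'} e
   ▹-assoc : ∀ n h κ -> (n ▹ (h · κ)) ~ ((n ▹ h) · κ)
   ▹-assoc n h κ = G.sym {(n ▹ h) · κ} {n ▹ (h · κ)} (·-assoc (unipotent n) h κ)
   ▹-zero : ∀ h -> (R.0# ▹ h) ~ h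
   ▹-zero h = G.identityˡ h
   ▹-▹ : ∀ p n h -> (p ▹ n ▹ h) ~ ((n R.+ p) ▹ h)
   ▹-▹ p n h = G.trans {unipotent p · (unipotent n · h)} {(unipotent p · unipotent n) · h} {unipotent (n R.+ p) · h}
    (G.sym {(unipotent p · unipotent n) · h} {unipotent p · (unipotent n · h)} (·-assoc (unipotent p) (unipotent n) h))
    (·-cong {unipotent p · unipotent n} {unipotent (n R.+ p)} {h} {h} (unipotent-· p n) (G.refl {h}))
   ▹-congˡ : ∀ {a b} h -> a R.≈ b -> (a ▹ h) ~ (b ▹ h)
   ▹-congˡ {a} {b} h e = ·-cong {unipotent a} {unipotent b} {h} {h} (unipotent-cong {a} {b} e) (G.refl {h})
  principal-left : ∀ γ {h h'} -> AllEntries Principal γ -> (γ · h) ~ h' -> h' ≈ᴰ h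
  principal-left γ {h} {h'} γ∈ e = ≈ᴰ-trans {h'} {γ · h} {h} (~⇒≈ᴰ {h'} {γ · h} (G.sym {γ · h} {h'} e)) (≈ᴰ-left {γ} h γ∈)
  ▹-principal : ∀ {p} h -> Principal p -> (p ▹ h) ≈ᴰ h
  ▹-principal {p} h p∈ = principal-left (unipotent p) {h} {p ▹ h} (unipotent-principal {p} p∈) (▹-eq p h)
  K-indic : ∀ (P : GL₂ -> Set) -> (∀ g h -> g ~ h -> P g -> P h) -> (∀ g κ -> InK κ -> P g -> P (g · κ)) -> ∀ g κ -> InK κ -> 𝟙 P (g · κ) ≈ 𝟙 P g
  K-indic P resp inv g κ κ∈ = indicatorℂ-cong {P = P} {P' = P} {t = g · κ} {t' = g}
   (λ p -> resp ((g · κ) · inverse κ) g (GroupProperties.//-rightDividesʳ PGL₂ κ g) (inv (g · κ) (inverse κ) (InK-inverse {κ} κ∈) p)) (inv g κ κ∈)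
  ~-indic : ∀ (P : GL₂ -> Set) -> (∀ g h -> g ~ h -> P g -> P h) -> ∀ g h -> g ~ h -> 𝟙 P g ≈ 𝟙 P h
  ~-indic P resp g h e = indicatorℂ-cong {P = P} {P' = P} {t = g} {t' = h} (resp g h e) (resp h g (G.sym {g} {h} e))
  indic-test : ∀ (P : GL₂ -> Set) -> (∀ g h -> g ~ h -> P g -> P h) -> (∀ g κ -> InK κ -> P g -> P (g · κ)) ->
   ∀ h0 -> (∀ h -> P h -> DCoset h0 h) -> IsTest G⟨𝔸⟩ (𝟙 P)
  indic-test P resp inv h0 inside = K-invariant-test (𝟙 P) (~-indic P resp) (K-indic P resp inv) h0
   (λ h n -> 𝟙-out {P = P} {t = h} (n ∘ inside h))
  indicatorℂ-nonneg : ∀ (P : GL₂ -> Set) h -> Nonnegative (𝟙 P h)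
  indicatorℂ-nonneg P h = go em
   where
   go : Dec (P h) -> Nonnegative (𝟙 P h)
   go (yes p) = Nonnegative-resp (ℂ.sym (𝟙-in {P = P} {t = h} p)) Nonnegative-1
   go (no n) = Nonnegative-resp (ℂ.sym (𝟙-out {P = P} {t = h} n)) Nonnegative-0
  sumℂ : ∀ {n} -> (Fin n -> ℂ) -> ℂ
  sumℂ = ∑ _+_ 0#
  sum-scale : ∀ {n} c (v : Fin n -> ℂ) -> sumℂ (λ i -> c * v i) ≈ c * sumℂ v
  sum-scale = RingSums.sum-scale ℂ-ring'
  sum-cong : ∀ {n} {v w : Fin n -> ℂ} -> (∀ i -> v i ≈ w i) -> sumℂ v ≈ sumℂ w
  sum-cong {zero} e = ℂ.refl
  sum-cong {suc n} e = ℂ.+-cong (e zero) (sum-cong (e ∘ suc))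
  sum-nonneg : ∀ {n} (v : Fin n -> ℂ) -> (∀ i -> Nonnegative (v i)) -> Nonnegative (sumℂ v)
  sum-nonneg {zero} v h = Nonnegative-0
  sum-nonneg {suc n} v h = Nonnegative-+ (h zero) (sum-nonneg (v ∘ suc) (h ∘ suc))
  sum-≥1 : ∀ {n} (v : Fin n -> ℂ) -> (∀ i -> Nonnegative (v i)) -> ∀ i -> Nonnegative (v i + - 1#) -> Nonnegative (sumℂ v + - 1#)
  sum-≥1 v h zero p = Nonnegative-resp (begin
   (v zero + - 1#) + sumℂ (v ∘ suc) ≈⟨ ℂ.+-assoc (v zero) (- 1#) _ ⟩
   v zero + (- 1# + sumℂ (v ∘ suc)) ≈⟨ ℂ.+ˡ {v zero} (ℂ.+-comm (- 1#) (sumℂ (v ∘ suc))) ⟩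
   v zero + (sumℂ (v ∘ suc) + - 1#) ≈⟨ ℂ.+-assoc (v zero) _ (- 1#) ⟨
   sumℂ v + - 1# ∎) (Nonnegative-+ p (sum-nonneg (v ∘ suc) (h ∘ suc)))
  sum-≥1 v h (suc i) p = Nonnegative-resp (ℂ.sym (ℂ.+-assoc (v zero) (sumℂ (v ∘ suc)) (- 1#))) (Nonnegative-+ (h zero) (sum-≥1 (v ∘ suc) (h ∘ suc) i p))
  sum-≉0 : ∀ {n} (v : Fin n -> ℂ) -> (∀ i -> Nonnegative (v i)) -> ∀ i -> Nonnegative (v i + - 1#) -> ¬ sumℂ v ≈ 0#
  sum-≉0 v h i p z = ¬Nonnegative--1 (Nonnegative-resp (ℂ.trans (ℂ.+ʳ { - 1# } z) (ℂ.+-idˡ (- 1#))) (sum-≥1 v h i p))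
  -- If n' = p + n + o, the unipotent matrices multiply accordingly: the factor of p in F is
  -- absorbed by the double coset, and the factor of o in 𝒪_𝔸 is an element of K acting on h.
  coset-class : ∀ {n n'} -> Coset 0ᴰ n n' -> ∃ λ k -> InK k × (∀ h -> (n' ▹ h) ≈ᴰ (n ▹ (k · h)))
  coset-class {n} {n'} (p , o , p∈ , o∈ , e) = conclude (unipotent o) (entries⇒InK {unipotent o} (unipotent-integral {o} o∈)) (▹-eq o)
   where
   move : ∀ x n n' p o -> K._≈_ x (K._-_ x n' n) (K._+_ x p o) -> K._≈_ x (K._+_ x (K._+_ x o n) p) n'
   move x n n' p o e = K.trans x (solve 3 (λ n p o -> (o :+ n) :+ p := (p :+ o) :+ n) n p o)
    (K.trans x (K.+ʳ x (K.sym x e)) (solve 2 (λ n n' -> (n' :- n) :+ n := n') n n'))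
    where open IntSolver (K.ring x)
   factor : ∀ h h' -> h' ~ (o ▹ h) -> (p ▹ n ▹ h') ~ (n' ▹ h)
   factor h h' e' = G.trans {p ▹ n ▹ h'} {p ▹ n ▹ o ▹ h} {n' ▹ h} (▹-cong p {n ▹ h'} {n ▹ o ▹ h} (▹-cong n {h'} {o ▹ h} e'))
    (G.trans {p ▹ n ▹ o ▹ h} {p ▹ (o R.+ n) ▹ h} {n' ▹ h} (▹-cong p {n ▹ o ▹ h} {(o R.+ n) ▹ h} (▹-▹ n o h))
     (G.trans {p ▹ (o R.+ n) ▹ h} {((o R.+ n) R.+ p) ▹ h} {n' ▹ h} (▹-▹ p (o R.+ n) h)
      (▹-congˡ {(o R.+ n) R.+ p} {n'} h (λ x -> move x (at n x) (at n' x) (at p x) (at o x) (e x)))))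
   same : ∀ h h' -> h' ~ (o ▹ h) -> (n' ▹ h) ≈ᴰ (n ▹ h')
   same h h' e' = ≈ᴰ-trans (~⇒≈ᴰ (G.sym {p ▹ n ▹ h'} {n' ▹ h} (factor h h' e'))) (▹-principal (n ▹ h') p∈)
   conclude : ∀ k -> InK k -> (∀ h -> (k · h) ~ (o ▹ h)) -> ∃ λ k -> InK k × (∀ h -> (n' ▹ h) ≈ᴰ (n ▹ (k · h)))
   conclude k k∈ e' = k , k∈ , λ h -> same h _ (e' h)
  Invariances : (GL₂ -> ℂ) -> Set
  Invariances f = (∀ g h -> g ~ h -> f g ≈ f h) × (∀ γ g -> InG⟨F⟩ γ -> f (γ · g) ≈ f g) × (∀ g κ -> InK κ -> f (g · κ) ≈ f g)
  module Average (f : GL₂ -> ℂ) (f-inv : Invariances f) where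
   f-~ : ∀ g h -> g ~ h -> f g ≈ f h
   f-~ = fst f-inv
   f-K : ∀ g κ -> InK κ -> f (g · κ) ≈ f g
   f-K = snd (snd f-inv)
   class-invariant : ∀ {g h} -> g ≈ᴰ h -> f g ≈ f h
   class-invariant {g} {h} (double γ κ γ∈ κ∈ eq) = begin
    f g ≈⟨ fst (snd f-inv) γ g (γ , G.refl {γ} , γ∈) ⟨
    f (γ · g) ≈⟨ f-K (γ · g) κ (entries⇒InK {κ} κ∈) ⟨
    f ((γ · g) · κ) ≈⟨ f-~ ((γ · g) · κ) h eq ⟩
    f h ∎
   module _ (Φ : GL₂ -> ℂ) (Φ∈ : InHecke Φ) where
    private
     Φ-~ : ∀ g h -> g ~ h -> Φ g ≈ Φ h
     Φ-~ g h e = let U , U-open , g∈ , const = fst (fst Φ∈) g in ℂ.sym (const h (open-respects U U-open {g} {h} e g∈))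
     Φ-K : ∀ g κ -> InK κ -> Φ (g · κ) ≈ Φ g
     Φ-K g κ κ∈ = ℂ.trans (ℂ.sym (Φ-~ ((ε · g) · κ) (g · κ) (·-cong {ε · g} {g} {κ} {κ} (G.identityˡ g) (G.refl {κ})))) (snd Φ∈ ε g κ InK-ε κ∈)
     K-Φ : ∀ κ g -> InK κ -> Φ (κ · g) ≈ Φ g
     K-Φ κ g κ∈ = ℂ.trans (ℂ.sym (Φ-~ ((κ · g) · ε) (κ · g) (G.identityʳ (κ · g)))) (snd Φ∈ κ g ε κ∈ InK-ε)
    integrand : Adele -> GL₂ -> ℂ
    integrand n h = Φ h * f (n ▹ h)
    integrand-test : ∀ n -> IsTest G⟨𝔸⟩ (integrand n)
    integrand-test n = K-invariant-support (integrand n) (λ g h e -> ℂ.*-cong (Φ-~ g h e) (f-~ (n ▹ g) (n ▹ h) (▹-cong n {g} {h} e)))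
     (λ g κ κ∈ -> ℂ.*-cong (Φ-K g κ κ∈) (ℂ.trans (f-~ (n ▹ (g · κ)) ((n ▹ g) · κ) (▹-assoc n g κ)) (f-K (n ▹ g) κ κ∈)))
     {⊤} (λ _ h -> ¬ Φ h ≈ 0#) (λ _ -> snd (fst Φ∈)) (tt ∷ [])
     (λ h ne -> here λ z -> ne (ℂ.trans (ℂ.*ʳ {f (n ▹ h)} z) (ℂ.zeroˡ (f (n ▹ h)))))
    avg : Adele -> ℂ
    avg n = ∫ᴳ.∫ (integrand n)
    -- The substitution h ↦ k h removes the element k of K supplied by `coset-class`, since Φ is
    -- left K-invariant and the integral is left invariant.
    avg-invariant : InvFun 0ᴰ avg
    avg-invariant n n' c = conclude (coset-class {n} {n'} c)
     where
     conclude : (∃ λ k -> InK k × (∀ h -> (n' ▹ h) ≈ᴰ (n ▹ (k · h)))) -> avg n' ≈ avg n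
     conclude (k , k∈ , same) = ℂ.trans
      (∫ᴳ.cong (integrand n') (λ h -> integrand n (k · h)) (integrand-test n') (λ h -> ℂ.*-cong (ℂ.sym (K-Φ k h k∈)) (class-invariant (same h))))
      (∫ᴳ.invariant k (integrand n) (integrand-test n))
    avg-test : IsTest N⟨F⟩\N⟨𝔸⟩ avg
    avg-test = invariant-test 0ᴰ avg avg-invariant
    avg-cong : ∀ F -> (∀ n -> F n ≈ avg n) -> ∫ₙ.∫ avg ≈ ∫ₙ.∫ F
    avg-cong F e = ∫ₙ.cong avg F avg-test (λ n -> ℂ.sym (e n))
  invariances : ∀ {f} -> 𝒱₀ dg dn f -> Invariances f
  invariances (p , q , r , _) = p , q , r
  avg-zero : ∀ {f} (f∈ : 𝒱₀ dg dn f) Φ Φ∈ -> ∫ₙ.∫ (Average.avg f (invariances f∈) Φ Φ∈) ≈ 0#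
  avg-zero {f} f∈ Φ Φ∈ = ℂ.trans (A.avg-cong Φ Φ∈ _
   (λ n -> ℂ.sym (∫ᴳ.cong (A.integrand Φ Φ∈ n) _ (A.integrand-test Φ Φ∈ n) (λ h -> ℂ.*ˡ {Φ h} (ℂ.sym (A.f-~ _ _ (▹-eq n h)))))))
   (snd (snd (snd f∈)) Φ Φ∈)
   where module A = Average f (invariances f∈)
  fromInvariances : ∀ {f} (f-inv : Invariances f) -> (∀ Φ Φ∈ -> ∫ₙ.∫ (Average.avg f f-inv Φ Φ∈) ≈ 0#) -> 𝒱₀ dg dn f
  fromInvariances {f} f-inv zero' = fst f-inv , fst (snd f-inv) , snd (snd f-inv) , λ Φ Φ∈ -> ℂ.trans (ℂ.sym (A.avg-cong Φ Φ∈ _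
   (λ n -> ℂ.sym (∫ᴳ.cong (A.integrand Φ Φ∈ n) _ (A.integrand-test Φ Φ∈ n) (λ h -> ℂ.*ˡ {Φ h} (ℂ.sym (A.f-~ _ _ (▹-eq n h))))))))
   (zero' Φ Φ∈)
   where module A = Average f f-inv
  -- The integrals are additive on test functions, so linearity of the defining condition rests on
  -- `integrand-test` over the group and `avg-test` over 𝔸 modulo F.
  𝒱₀-+ : ∀ {f f'} -> 𝒱₀ dg dn f -> 𝒱₀ dg dn f' -> 𝒱₀ dg dn (λ h -> f h + f' h)
  𝒱₀-+ {f} {f'} f∈ f'∈ = fromInvariances sum-inv λ Φ Φ∈ -> begin
   ∫ₙ.∫ (S'.avg Φ Φ∈) ≈⟨ S'.avg-cong Φ Φ∈ (λ n -> A.avg Φ Φ∈ n + A'.avg Φ Φ∈ n) (λ n -> ℂ.sym (split Φ Φ∈ n)) ⟩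
   ∫ₙ.∫ (λ n -> A.avg Φ Φ∈ n + A'.avg Φ Φ∈ n) ≈⟨ ∫ₙ.add (A.avg Φ Φ∈) (A'.avg Φ Φ∈) (A.avg-test Φ Φ∈) (A'.avg-test Φ Φ∈) ⟩
   ∫ₙ.∫ (A.avg Φ Φ∈) + ∫ₙ.∫ (A'.avg Φ Φ∈) ≈⟨ ℂ.+-cong (avg-zero f∈ Φ Φ∈) (avg-zero f'∈ Φ Φ∈) ⟩
   0# + 0# ≈⟨ ℂ.+-idˡ 0# ⟩
   0# ∎
   where
   sum-inv : Invariances (λ h -> f h + f' h)
   sum-inv = let p , q , r = invariances f∈ ; p' , q' , r' = invariances f'∈ in
    (λ g h e -> ℂ.+-cong (p g h e) (p' g h e)) , (λ γ g γ∈ -> ℂ.+-cong (q γ g γ∈) (q' γ g γ∈)) , λ g κ κ∈ -> ℂ.+-cong (r g κ κ∈) (r' g κ κ∈)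
   module A = Average f (invariances f∈)
   module A' = Average f' (invariances f'∈)
   module S' = Average (λ h -> f h + f' h) sum-inv
   split : ∀ Φ Φ∈ n -> S'.avg Φ Φ∈ n ≈ A.avg Φ Φ∈ n + A'.avg Φ Φ∈ n
   split Φ Φ∈ n = ℂ.trans (∫ᴳ.cong (S'.integrand Φ Φ∈ n) (λ h -> A.integrand Φ Φ∈ n h + A'.integrand Φ Φ∈ n h) (S'.integrand-test Φ Φ∈ n)
    (λ h -> ℂ.distribˡ (Φ h) (f (n ▹ h)) (f' (n ▹ h))))
    (∫ᴳ.add (A.integrand Φ Φ∈ n) (A'.integrand Φ Φ∈ n) (A.integrand-test Φ Φ∈ n) (A'.integrand-test Φ Φ∈ n))
  𝒱₀-scale : ∀ c {f} -> 𝒱₀ dg dn f -> 𝒱₀ dg dn (λ h -> c * f h)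
  𝒱₀-scale c {f} f∈ = fromInvariances scale-inv λ Φ Φ∈ -> begin
   ∫ₙ.∫ (S'.avg Φ Φ∈) ≈⟨ S'.avg-cong Φ Φ∈ (λ n -> c * A.avg Φ Φ∈ n) (λ n -> ℂ.sym (pull Φ Φ∈ n)) ⟩
   ∫ₙ.∫ (λ n -> c * A.avg Φ Φ∈ n) ≈⟨ ∫ₙ.scale c (A.avg Φ Φ∈) (A.avg-test Φ Φ∈) ⟩
   c * ∫ₙ.∫ (A.avg Φ Φ∈) ≈⟨ ℂ.*ˡ {c} (avg-zero f∈ Φ Φ∈) ⟩
   c * 0# ≈⟨ ℂ.zeroʳ c ⟩
   0# ∎
   where
   scale-inv : Invariances (λ h -> c * f h)
   scale-inv = let p , q , r = invariances f∈ in
    (λ g h e -> ℂ.*ˡ {c} (p g h e)) , (λ γ g γ∈ -> ℂ.*ˡ {c} (q γ g γ∈)) , λ g κ κ∈ -> ℂ.*ˡ {c} (r g κ κ∈)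
   module A = Average f (invariances f∈)
   module S' = Average (λ h -> c * f h) scale-inv
   swap : ∀ a b -> a * (c * b) ≈ c * (a * b)
   swap a b = ℂ.trans (ℂ.sym (ℂ.*-assoc a c b)) (ℂ.trans (ℂ.*ʳ {b} (ℂ.*-comm a c)) (ℂ.*-assoc c a b))
   pull : ∀ Φ Φ∈ n -> S'.avg Φ Φ∈ n ≈ c * A.avg Φ Φ∈ n
   pull Φ Φ∈ n = ℂ.trans (∫ᴳ.cong (S'.integrand Φ Φ∈ n) (λ h -> c * A.integrand Φ Φ∈ n h) (S'.integrand-test Φ Φ∈ n) (λ h -> swap (Φ h) (f (n ▹ h))))
    (∫ᴳ.scale c (A.integrand Φ Φ∈ n) (A.integrand-test Φ Φ∈ n))
  module _ (f : GL₂ -> ℂ) (f∈ : 𝒱₀ dg dn f) where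
   open Average f (invariances f∈)
   -- For Φ the indicator of K h0 K, a point h contributes to Φ(f)(n) only if n h has slope s, and
   -- then n h is equivalent to h0. Thus the integrand is f(h0) times the indicator χₙ, and the
   -- condition on f reads f(h0) · ∫ ψ = 0.
   module Step (h0 : GL₂) (s : ℤ) (maximal-slope : ∀ n h -> DCoset h0 h -> Slope (n ▹ h) s -> (n ▹ h) ≈ᴰ h0)
    (vanish : ∀ h -> ¬ Slope h s -> f h ≈ 0#) where
    private
     C : GL₂ -> Set
     C = DCoset h0
     Meets : Adele -> GL₂ -> Set
     Meets n h = C h × (n ▹ h) ≈ᴰ h0
     Φ : GL₂ -> ℂ
     Φ = 𝟙 C
     χₙ : Adele -> GL₂ -> ℂ
     χₙ n = 𝟙 (Meets n)
     C-~ : ∀ g h -> g ~ h -> C g -> C h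
     C-~ g h e = DCoset-resp h0 {g} {h} e
     C-K : ∀ g κ -> InK κ -> C g -> C (g · κ)
     C-K g κ κ∈ = DCoset-·ʳ h0 {g} {κ} κ∈
     Meets-~ : ∀ n g h -> g ~ h -> Meets n g -> Meets n h
     Meets-~ n g h e (p , q) = C-~ g h e p , ≈ᴰ-trans (~⇒≈ᴰ (▹-cong n {h} {g} (G.sym {g} {h} e))) q
     Meets-K : ∀ n g κ -> InK κ -> Meets n g -> Meets n (g · κ)
     Meets-K n g κ κ∈ (p , q) = C-K g κ κ∈ p , ≈ᴰ-trans (~⇒≈ᴰ (▹-assoc n g κ)) (≈ᴰ-trans (≈ᴰ-right (n ▹ g) {κ} κ∈) q)
     Φ-test : IsTest G⟨𝔸⟩ Φ
     Φ-test = indic-test C C-~ C-K h0 (λ _ p -> p)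
     Φ∈ : InHecke Φ
     Φ∈ = Φ-test , λ κ g κ' κ∈ κ'∈ -> ℂ.trans (K-indic C C-~ C-K (κ · g) κ' κ'∈) (indicatorℂ-cong {P = C} {P' = C} {t = κ · g} {t' = g}
      (λ p -> C-~ (inverse κ · (κ · g)) g (GroupProperties.\\-leftDividesʳ PGL₂ κ g) (DCoset-·ˡ h0 {κ · g} {inverse κ} (InK-inverse {κ} κ∈) p))
      (DCoset-·ˡ h0 {g} {κ} κ∈))
     χ-test : ∀ n -> IsTest G⟨𝔸⟩ (χₙ n)
     χ-test n = indic-test (Meets n) (Meets-~ n) (Meets-K n) h0 (λ _ -> fst)
     integrand-eq : ∀ n h -> integrand Φ Φ∈ n h ≈ f h0 * χₙ n h
     integrand-eq n h = go em em
      where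
      go : Dec (C h) -> Dec ((n ▹ h) ≈ᴰ h0) -> integrand Φ Φ∈ n h ≈ f h0 * χₙ n h
      go (no p) _ = ℂ.trans (ℂ.*ʳ {f (n ▹ h)} (𝟙-out {P = C} {t = h} p)) (ℂ.trans (ℂ.zeroˡ (f (n ▹ h)))
       (ℂ.sym (ℂ.trans (ℂ.*ˡ {f h0} (𝟙-out {P = Meets n} {t = h} (p ∘ fst))) (ℂ.zeroʳ (f h0)))))
      go (yes p) (no q) = ℂ.trans (ℂ.*ˡ {Φ h} (vanish (n ▹ h) (λ s -> q (maximal-slope n h p s)))) (ℂ.trans (ℂ.zeroʳ (Φ h))
       (ℂ.sym (ℂ.trans (ℂ.*ˡ {f h0} (𝟙-out {P = Meets n} {t = h} (q ∘ snd))) (ℂ.zeroʳ (f h0)))))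
      go (yes p) (yes q) = ℂ.trans (ℂ.*-cong (𝟙-in {P = C} {t = h} p) (class-invariant q)) (ℂ.trans (ℂ.*-comm 1# (f h0))
       (ℂ.*ˡ {f h0} (ℂ.sym (𝟙-in {P = Meets n} {t = h} (p , q)))))
     ψ : Adele -> ℂ
     ψ n = ∫ᴳ.∫ (χₙ n)
     avg-eq : ∀ n -> avg Φ Φ∈ n ≈ f h0 * ψ n
     avg-eq n = ℂ.trans (∫ᴳ.cong (integrand Φ Φ∈ n) (λ h -> f h0 * χₙ n h) (integrand-test Φ Φ∈ n) (integrand-eq n)) (∫ᴳ.scale (f h0) (χₙ n) (χ-test n))
     ψ-nonneg : ∀ n -> Nonnegative (ψ n)
     ψ-nonneg n = ∫ᴳ.positive (χₙ n) (χ-test n) (indicatorℂ-nonneg (Meets n))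
     -- χ₀ dominates the indicator function of h0 K, whose integral is vol K = 1.
     ψ₀-≥1 : Nonnegative (ψ R.0# + - 1#)
     ψ₀-≥1 = Nonnegative-resp (begin
      ∫ᴳ.∫ difference ≈⟨ ∫ᴳ.add (χₙ R.0#) (λ h -> - 1# * κ0 h) (χ-test R.0#) minus-test ⟩
      ψ R.0# + ∫ᴳ.∫ (λ h -> - 1# * κ0 h) ≈⟨ ℂ.+ˡ {ψ R.0#} (∫ᴳ.scale (- 1#) κ0 κ0-test) ⟩
      ψ R.0# + - 1# * ∫ᴳ.∫ κ0 ≈⟨ ℂ.+ˡ {ψ R.0#} (ℂ.*ˡ { - 1# } (∫ᴳ.invariant (inverse h0) κ κ-test)) ⟩
      ψ R.0# + - 1# * ∫ᴳ.∫ κ ≈⟨ ℂ.+ˡ {ψ R.0#} (ℂ.*ˡ { - 1# } (normalized κ (λ h p -> 𝟙-in {P = InK} {t = h} p) (λ h n -> 𝟙-out {P = InK} {t = h} n))) ⟩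
      ψ R.0# + - 1# * 1# ≈⟨ ℂ.+ˡ {ψ R.0#} (ℂ.*-idʳ (- 1#)) ⟩
      ψ R.0# + - 1# ∎)
      (∫ᴳ.positive difference difference-test nonneg)
      where
      κ κ0 difference : GL₂ -> ℂ
      κ = 𝟙 InK
      κ0 h = κ (inverse h0 · h)
      difference h = χₙ R.0# h + - 1# * κ0 h
      In0 : GL₂ -> Set
      In0 h = InK (inverse h0 · h)
      InK-~ : ∀ g h -> g ~ h -> InK g -> InK h
      InK-~ g h = InK-resp {g} {h}
      κ-test : IsTest G⟨𝔸⟩ κ
      κ-test = K-invariant-test κ (~-indic InK InK-~) (K-indic InK InK-~ (λ g k k∈ g∈ -> InK-· {g} {k} g∈ k∈)) ε
       (λ h n -> 𝟙-out {P = InK} {t = h} (λ (k , e , k∈) -> n (dcoset ε k 𝒦.ε∈ k∈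
        (G.trans {h} {k} {(ε · ε) · k} e (G.sym {(ε · ε) · k} {k} (G.trans {(ε · ε) · k} {ε · k} {k} (·-cong {ε · ε} {ε} {k} {k} (G.identityˡ ε) (G.refl {k})) (G.identityˡ k)))))))
      split : ∀ {h} -> In0 h -> ∃ λ k -> AllEntries Integral k × h ~ (h0 · k)
      split {h} (k , e , k∈) = k , k∈ , G.trans {h} {h0 · (inverse h0 · h)} {h0 · k}
       (G.sym {h0 · (inverse h0 · h)} {h} (GroupProperties.\\-leftDividesˡ PGL₂ h0 h)) (·-congˡ h0 {inverse h0 · h} {k} e)
      In₀⇒C : ∀ {h} -> In0 h -> C h
      In₀⇒C {h} p = let k , k∈ , e = split {h} p in dcoset ε k 𝒦.ε∈ k∈
       (G.trans {h} {h0 · k} {(ε · h0) · k} e (·-cong {h0} {ε · h0} {k} {k} (G.sym {ε · h0} {h0} (G.identityˡ h0)) (G.refl {k})))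
      In₀⇒Meets : ∀ {h} -> In0 h -> Meets R.0# h
      In₀⇒Meets {h} p = let k , k∈ , e = split {h} p in In₀⇒C {h} p
       , ≈ᴰ-trans (~⇒≈ᴰ {R.0# ▹ h} {h} (▹-zero h)) (≈ᴰ-trans (~⇒≈ᴰ {h} {h0 · k} e) (≈ᴰ-right h0 {k} (entries⇒InK {k} k∈)))
      κ0-~ : ∀ g h -> g ~ h -> κ0 g ≈ κ0 h
      κ0-~ g h e = ~-indic InK InK-~ (inverse h0 · g) (inverse h0 · h) (·-congˡ (inverse h0) {g} {h} e)
      κ0-K : ∀ g k -> InK k -> κ0 (g · k) ≈ κ0 g
      κ0-K g k k∈ = ℂ.trans (~-indic InK InK-~ (inverse h0 · (g · k)) ((inverse h0 · g) · k) (G.sym {(inverse h0 · g) · k} {inverse h0 · (g · k)} (·-assoc (inverse h0) g k)))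
       (K-indic InK InK-~ (λ g k k∈ g∈ -> InK-· {g} {k} g∈ k∈) (inverse h0 · g) k k∈)
      κ0-out : ∀ h -> ¬ C h -> κ0 h ≈ 0#
      κ0-out h n = 𝟙-out {P = InK} {t = inverse h0 · h} (λ p -> n (In₀⇒C {h} p))
      κ0-test : IsTest G⟨𝔸⟩ κ0
      κ0-test = K-invariant-test κ0 κ0-~ κ0-K h0 κ0-out
      minus-test : IsTest G⟨𝔸⟩ (λ h -> - 1# * κ0 h)
      minus-test = K-invariant-test (λ h -> - 1# * κ0 h) (λ g h e -> ℂ.*ˡ { - 1# } (κ0-~ g h e)) (λ g k k∈ -> ℂ.*ˡ { - 1# } (κ0-K g k k∈)) h0
       (λ h n -> ℂ.trans (ℂ.*ˡ { - 1# } (κ0-out h n)) (ℂ.zeroʳ (- 1#)))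
      difference-test : IsTest G⟨𝔸⟩ difference
      difference-test = K-invariant-test difference
       (λ g h e -> ℂ.+-cong (~-indic (Meets R.0#) (Meets-~ R.0#) g h e) (ℂ.*ˡ { - 1# } (κ0-~ g h e)))
       (λ g k k∈ -> ℂ.+-cong (K-indic (Meets R.0#) (Meets-~ R.0#) (Meets-K R.0#) g k k∈) (ℂ.*ˡ { - 1# } (κ0-K g k k∈))) h0
       (λ h n -> ℂ.trans (ℂ.+-cong (𝟙-out {P = Meets R.0#} {t = h} (n ∘ fst)) (ℂ.trans (ℂ.*ˡ { - 1# } (κ0-out h n)) (ℂ.zeroʳ (- 1#)))) (ℂ.+-idˡ 0#))
      nonneg : ∀ h -> Nonnegative (difference h)
      nonneg h = go em
       where
       go : Dec (In0 h) -> Nonnegative (difference h)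
       go (yes p) = Nonnegative-resp (ℂ.sym (ℂ.trans (ℂ.+-cong (𝟙-in {P = Meets R.0#} {t = h} (In₀⇒Meets {h} p))
        (ℂ.trans (ℂ.*ˡ { - 1# } (𝟙-in {P = InK} {t = inverse h0 · h} p)) (ℂ.*-idʳ (- 1#)))) (ℂ.-‿inverseʳ 1#))) Nonnegative-0
       go (no n) = Nonnegative-resp (ℂ.sym (ℂ.trans (ℂ.+ˡ {χₙ R.0# h} (ℂ.trans (ℂ.*ˡ { - 1# } (𝟙-out {P = InK} {t = inverse h0 · h} n)) (ℂ.zeroʳ (- 1#))))
        (ℂ.+-idʳ (χₙ R.0# h)))) (indicatorℂ-nonneg (Meets R.0#) h)
    -- A level D ≥ 0 of non-zero volume turns the vanishing integral into a finite sum over cosets.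
    -- No value of ψ is negative, and the coset of 0 contributes at least 1, so f(h0) is the factor
    -- that vanishes.
    vanishes-at-h₀ : f h0 ≈ 0#
    vanishes-at-h₀ = conclude (nonzero-volume 0ᴰ)
     where
     conclude : (∃ λ D -> (∀ x -> 0ℤ ≤ fst D x) × ¬ Volume.vol D ≈ 0#) -> f h0 ≈ 0#
     conclude (D , D≥0 , vol≉0) = dne λ ne -> ℂₗ.*≉0 (ℂₗ.*≉0 ne (sum≉0 ne)) vol≉0 (begin
      (f h0 * sumℂ (ψ ∘ Vol.ρ)) * Vol.vol ≈⟨ ℂ.*ʳ {Vol.vol} (sum-scale (f h0) (ψ ∘ Vol.ρ)) ⟨
      sumℂ (λ i -> f h0 * ψ (Vol.ρ i)) * Vol.vol ≈⟨ ℂ.*ʳ {Vol.vol} (sum-cong (λ i -> avg-eq (Vol.ρ i))) ⟨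
      sumℂ (avg Φ Φ∈ ∘ Vol.ρ) * Vol.vol ≈⟨ Vol.∫-invariant (avg Φ Φ∈) (λ n n' c -> avg-invariant Φ Φ∈ n n' (down n n' c)) ⟨
      ∫ₙ.∫ (avg Φ Φ∈) ≈⟨ avg-zero f∈ Φ Φ∈ ⟩
      0# ∎)
      where
      module Vol = Volume D
      down : ∀ n n' -> Coset D n n' -> Coset 0ᴰ n n'
      down n n' = F+-mono 0ᴰ D {n' R.- n} D≥0
      i0 : ∃ λ i -> Coset D (Vol.ρ i) R.0#
      i0 = Vol.index R.0#
      -- ψ inherits the invariance of the average f(h0) · ψ once f(h0) is cancelled; this moves the
      -- estimate at 0 to the representative of its coset.
      ψ-eq : ¬ f h0 ≈ 0# -> ψ R.0# ≈ ψ (Vol.ρ (fst i0))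
      ψ-eq ne = ℂₗ.*-cancelˡ ne (ℂ.trans (ℂ.sym (avg-eq R.0#))
       (ℂ.trans (avg-invariant Φ Φ∈ (Vol.ρ (fst i0)) R.0# (down (Vol.ρ (fst i0)) R.0# (snd i0))) (avg-eq (Vol.ρ (fst i0)))))
      sum≉0 : ¬ f h0 ≈ 0# -> ¬ sumℂ (ψ ∘ Vol.ρ) ≈ 0#
      sum≉0 ne = sum-≉0 (ψ ∘ Vol.ρ) (λ i -> ψ-nonneg (Vol.ρ i)) (fst i0) (Nonnegative-resp (ℂ.+ʳ { - 1# } (ψ-eq ne)) ψ₀-≥1)
  -- For h = κ1 diag(t0, 1) κ2 and n ∈ N(𝔸), the slopes of n h are at most −deg t0,
  -- with equality only if n h is equivalent to diag(t0, 1).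
  module DiagonalCoset (t0 : Idele) (t₀≤0 : ∀ x -> fst (divisor t0) x ≤ 0ℤ) (m< : m_X g < Z.- deg (divisor t0)) where
   h0 : GL₂
   h0 = τ t0 R.0#
   private
    -- Up to sign and position these are the entries of h⁻¹. They are integral for diag(t0, 1)
    -- because div t0 ≤ 0, and this is preserved by K on both sides.
    InvInt : GL₂ -> Set
    InvInt h = Integral (u h R.* a h) × Integral (u h R.* b h) × Integral (u h R.* c h) × Integral (u h R.* d h)
    entries⇒inverse : ∀ {κ} -> AllEntries Integral κ -> InvInt κ
    entries⇒inverse {κ} (p , q , r , s , t) = 𝒦.*∈ {u κ} {a κ} t p , 𝒦.*∈ {u κ} {b κ} t q , 𝒦.*∈ {u κ} {c κ} t r , 𝒦.*∈ {u κ} {d κ} t s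
    inverse-· : ∀ {g h} -> InvInt g -> InvInt h -> InvInt (g · h)
    inverse-· {g} {h} (p , q , r , s) (p' , q' , r' , s') =
     entry {a g} {b g} {a h} {c h} p q p' r' , entry {a g} {b g} {b h} {d h} p q q' s'
     , entry {c g} {d g} {a h} {c h} r s p' r' , entry {c g} {d g} {b h} {d h} r s q' s'
     where
     regroup : ∀ x u u' a a' b b' -> K._≈_ x (K._+_ x (K._*_ x (K._*_ x u a) (K._*_ x u' a')) (K._*_ x (K._*_ x u b) (K._*_ x u' b')))
      (K._*_ x (K._*_ x u u') (K._+_ x (K._*_ x a a') (K._*_ x b b')))
     regroup x = Kₛ.solve x 6 (λ u u' a a' b b' -> (u :* a) :* (u' :* a') :+ (u :* b) :* (u' :* b') := (u :* u') :* (a :* a' :+ b :* b'))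
     entry : ∀ {p q p' q'} -> Integral (u g R.* p) -> Integral (u g R.* q) -> Integral (u h R.* p') -> Integral (u h R.* q') ->
      Integral ((u g R.* u h) R.* (p R.* p' R.+ q R.* q'))
     entry {p} {q} {p'} {q'} i j i' j' x = V.ball-resp x (regroup x (at (u g) x) (at (u h) x) (at p x) (at p' x) (at q x) (at q' x))
      (V.ball-+ x (V.ball-*ˡ x (i x) (i' x)) (V.ball-*ˡ x (j x) (j' x)))
    t₀⁻¹∈ : Integral (Idele.t⁻¹ t0)
    t₀⁻¹∈ x = V.ball-mono x (neg-mono-≤ (t₀≤0 x)) (Idele.ball-t⁻¹ t0 x)
    inverse-h₀ : InvInt h0
    inverse-h₀ = (λ x -> V.ball-resp x (K.sym x (K.trans x (K.*-comm x _ _) (Idele.invertible t0 x))) (𝒦.1∈ x))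
     , 𝒦.*∈ {Idele.t⁻¹ t0} {R.0#} t₀⁻¹∈ 𝒦.0∈ , 𝒦.*∈ {Idele.t⁻¹ t0} {R.0#} t₀⁻¹∈ 𝒦.0∈ , 𝒦.*∈ {Idele.t⁻¹ t0} {R.1#} t₀⁻¹∈ 𝒦.1∈
    val-u-integral : ∀ {κ} -> AllEntries Integral κ -> ∀ x -> K.val x (at (u κ) x) ≡ 0ℤ
    val-u-integral {κ} (p , q , r , s , t) x = V.v-unit x (K.trans x (K.*-comm x _ _) (unit κ x)) (t x)
     (V.ball-- x (V.ball-*ˡ x (p x) (s x)) (V.ball-*ˡ x (q x) (r x)))
    val-u : ∀ κ1 κ2 -> AllEntries Integral κ1 -> AllEntries Integral κ2 -> ∀ x -> Z.- K.val x (at (u ((κ1 · h0) · κ2)) x) ≡ fst (divisor t0) x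
    val-u κ1 κ2 κ1∈ κ2∈ x = ≡.trans (ap Z.-_ value) (ℤₚ.neg-involutive _)
     where
     open IsDVal (K.isValuation x) using (mult)
     value : K.val x (at (u ((κ1 · h0) · κ2)) x) ≡ Z.- fst (divisor t0) x
     value = ≡.trans (mult (Kₗ.*≉0 x (u≉0 κ1 x) (u≉0 h0 x)) (u≉0 κ2 x)) (≡.trans (ap₂ Z._+_ (mult (u≉0 κ1 x) (u≉0 h0 x)) (val-u-integral {κ2} κ2∈ x))
      (≡.trans (ℤₚ.+-identityʳ _) (≡.trans (ap₂ Z._+_ (val-u-integral {κ1} κ1∈ x) (Idele.val-t⁻¹ t0 x)) (ℤₚ.+-identityˡ _))))
    transfer : ∀ n {h h' k} -> h ~ h' -> (n ▹ h) ≈ᴰ k -> (unipotent n · h') ≈ᴰ k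
    transfer n {h} {h'} {k} e p = ≈ᴰ-trans (~⇒≈ᴰ {_} {n ▹ h'} (▹-eq n h')) (≈ᴰ-trans (~⇒≈ᴰ {n ▹ h'} {n ▹ h} (▹-cong n {h'} {h} (G.sym {h} {h'} e))) p)
    -- `Lower` with e = 0 gives div t0 + div ρ ≤ div t. The assumption on slopes forces equal
    -- degrees, hence equal divisors, and since H¹(div t) = 0 the extension τ t b' is equivalent to
    -- the split one.
    extremal : ∀ n h -> InvInt h -> (∀ x -> Z.- K.val x (at (u h) x) ≡ fst (divisor t0) x) ->
     ∀ t b' -> (unipotent n · h) ≈ᴰ τ t b' -> Z.- deg (divisor t0) ≤ Z.- deg (divisor t) -> h0 ≈ᴰ τ t b'
    extremal n h h⁻¹∈ val-h t b' (double γ κ γ∈ κ∈ eq) le = split-class t0 R.0# t b' ρ ρ≉0 (λ x -> ≡.trans (≡.sym (same x)) (ℤₚ.+-comm (fst (divisor t0) x) (ord x ρ)))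
     (H¹-vanishing (divisor t) (subst (m_X g <_) (ap (λ n -> Z.- n) (≡.trans (≡.sym deg-shift) (deg-resp {divisor t0 ⊕ div ρ ρ≉0} {divisor t} same))) m<))
     where
     lower : ∃ λ ρ -> ¬ ρ F.≈ F.0# × (∀ x -> (Z.- K.val x (at (u h) x) Z.- (0ℤ Z.+ 0ℤ)) Z.+ ord x ρ ≤ fst (divisor t) x)
     lower = Lower.lower-bound γ γ∈ n h κ κ∈ t b' eq 0ᴰ h⁻¹∈
     ρ : F.Carrier
     ρ = fst lower
     ρ≉0 : ¬ ρ F.≈ F.0#
     ρ≉0 = fst (snd lower)
     below : ∀ x -> fst (divisor t0) x Z.+ ord x ρ ≤ fst (divisor t) x
     below x = subst (λ v -> v Z.+ ord x ρ ≤ fst (divisor t) x) (≡.trans (ℤₚ.+-identityʳ _) (val-h x)) (snd (snd lower) x)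
     deg-shift : deg (divisor t0 ⊕ div ρ ρ≉0) ≡ deg (divisor t0)
     deg-shift = ≡.trans (deg-⊕ (divisor t0) (div ρ ρ≉0)) (≡.trans (ap (Z._+_ (deg (divisor t0))) (deg-div ρ ρ≉0)) (ℤₚ.+-identityʳ _))
     same : (divisor t0 ⊕ div ρ ρ≉0) ≐ divisor t
     same = deg-mono-strict (divisor t0 ⊕ div ρ ρ≉0) (divisor t) below (subst (deg (divisor t) ≤_) (≡.sym deg-shift) (ℤₚ.neg-cancel-≤ le))
    coset-data : ∀ h -> DCoset h0 h -> ∃ λ h' -> h ~ h' × InvInt h' × (∀ x -> Z.- K.val x (at (u h') x) ≡ fst (divisor t0) x)
    coset-data h (dcoset κ1 κ2 κ1∈ κ2∈ eq) = (κ1 · h0) · κ2 , eq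
     , inverse-· {κ1 · h0} {κ2} (inverse-· {κ1} {h0} (entries⇒inverse {κ1} κ1∈) inverse-h₀) (entries⇒inverse {κ2} κ2∈) , val-u κ1 κ2 κ1∈ κ2∈
   maximal-slope : ∀ n h -> DCoset h0 h -> Slope (n ▹ h) (Z.- deg (divisor t0)) -> (n ▹ h) ≈ᴰ h0
   maximal-slope n h c (t , b' , nh≈τ , le) = ≈ᴰ-trans nh≈τ (≈ᴰ-sym (conclude (coset-data h c)))
    where
    conclude : (∃ λ h' -> h ~ h' × InvInt h' × (∀ x -> Z.- K.val x (at (u h') x) ≡ fst (divisor t0) x)) -> h0 ≈ᴰ τ t b'
    conclude (h' , eq , i , v) = extremal n h' i v t b' (transfer n {h} {h'} eq nh≈τ) le
  module _ (f : GL₂ -> ℂ) (f∈ : 𝒱₀ dg dn f) where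
   -- A class that has slope d but not d + 1 has a presentation with -deg t = d exactly. It is
   -- split, and a section ρ turns t into an idele t0 with div t0 ≤ 0, to which `DiagonalCoset` and
   -- `Step` apply.
   vanish-step : ∀ d -> m_X g < d -> (∀ h -> ¬ Slope h d -> f h ≈ 0#) -> ∀ h -> ¬ Slope h (Z.suc d) -> f h ≈ 0#
   vanish-step d m<d vanish h small = go em
    where
    exact : ∀ t -> d ≤ Z.- deg (divisor t) -> ¬ Z.suc d ≤ Z.- deg (divisor t) -> Z.- deg (divisor t) ≡ d
    exact t le n = ≤-antisym (≮⇒≥ (λ lt -> n (i<j⇒suc[i]≤j lt))) le
    m⊔0<d : ∀ {i} -> i ≤ m_X g -> Z.suc i ≤ d
    m⊔0<d le = ≤-trans (+-monoʳ-≤ 1ℤ le) (i<j⇒suc[i]≤j m<d)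
    -- The sum of d ≥ 2g - 1 and d ≥ 1: here the maximum with 0 in `m_X` is used.
    2g≤2d : Z.+ g Z.+ Z.+ g ≤ d Z.+ d
    2g≤2d = ≤-combine (m⊔0<d (i≤i⊔j (Z.+ 2 Z.* Z.+ g Z.- Z.+ 2) 0ℤ)) (m⊔0<d (i≤j⊔i (Z.+ 2 Z.* Z.+ g Z.- Z.+ 2) 0ℤ))
     (solveℤ 2 (λ g d -> (d :+ d) :- (g :+ g) := (d :- (con 1ℤ :+ (con (Z.+ 2) :* g :- con (Z.+ 2)))) :+ (d :- (con 1ℤ :+ con 0ℤ))) (Z.+ g) d)
    g≤d : Z.+ g ≤ d
    g≤d = ≮⇒≥ λ lt -> 1+≰ {d Z.+ d} (≤-trans (≤-by 1 (solveℤ 1 (λ d -> (con 1ℤ :+ d) :+ (con 1ℤ :+ d) := (con 1ℤ :+ (d :+ d)) :+ con 1ℤ) d))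
     (≤-trans (+-mono-≤ (i<j⇒suc[i]≤j lt) (i<j⇒suc[i]≤j lt)) 2g≤2d))
    split : ∀ t b -> Z.- deg (divisor t) ≡ d -> f (τ t b) ≈ 0#
    split t b deg≡ = ℂ.trans (Average.class-invariant f (invariances f∈) (split-class t b t0 R.0# (Fₗ.inv ρ) (Fₗ.inv≉0 ρ≉0) divisor-t₀
     (H¹-vanishing (divisor t0) m<))) (Step.vanishes-at-h₀ f f∈ (τ t0 R.0#) (Z.- deg (divisor t0)) (DiagonalCoset.maximal-slope t0 t₀≤0 m<) (λ k n -> vanish k (λ s -> n (subst (Slope k) (≡.sym deg-t₀) s))))
     where
     -- χ₀ - deg (div t) = χ₀ + d is positive because χ₀ ≥ 1 - g and g ≤ d.
     chosen = exists-section (divisor t) (suc[i]≤j⇒i<j (≤-combine χ₀-bound (subst (Z.+ g ≤_) (≡.sym deg≡) g≤d)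
      (solveℤ 3 (λ c g e -> (c :- e) :- con 1ℤ := (c :- (con 1ℤ :- g)) :+ (:- e :- g)) χ₀ (Z.+ g) (deg (divisor t)))))
     ρ : F.Carrier
     ρ = fst chosen
     ρ≉0 : ¬ ρ F.≈ F.0#
     ρ≉0 = fst (snd chosen)
     t0 : Idele
     t0 = principalIdele (Fₗ.inv ρ) (Fₗ.inv≉0 ρ≉0) ⊙ t
     divisor-t₀ : ∀ x -> fst (divisor t0) x ≡ ord x (Fₗ.inv ρ) Z.+ fst (divisor t) x
     divisor-t₀ x = ≡.trans (⊙-divisor (principalIdele (Fₗ.inv ρ) (Fₗ.inv≉0 ρ≉0)) t x)
      (ap (Z._+ fst (divisor t) x) (K.extends x (Fₗ.inv ρ) (Fₗ.inv≉0 ρ≉0)))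
     t₀≤0 : ∀ x -> fst (divisor t0) x ≤ 0ℤ
     t₀≤0 x = subst (_≤ 0ℤ) (≡.sym (≡.trans (divisor-t₀ x) (ap (Z._+ fst (divisor t) x) (O.v-inv x ρ≉0))))
      (≤-shift (snd (snd chosen) x ρ≉0) (solveℤ 2 (λ r t -> con 0ℤ :- (:- r :+ t) := r :- t) (ord x ρ) (fst (divisor t) x)))
     deg-t₀ : Z.- deg (divisor t0) ≡ d
     deg-t₀ = ≡.trans (ap (λ n -> Z.- n) (≡.trans (deg-resp {divisor t0} {div (Fₗ.inv ρ) (Fₗ.inv≉0 ρ≉0) ⊕ divisor t} divisor-t₀)
      (≡.trans (deg-⊕ (div (Fₗ.inv ρ) (Fₗ.inv≉0 ρ≉0)) (divisor t)) (≡.trans (ap (Z._+ deg (divisor t)) (deg-div (Fₗ.inv ρ) (Fₗ.inv≉0 ρ≉0))) (ℤₚ.+-identityˡ _))))) deg≡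
     m< : m_X g < Z.- deg (divisor t0)
     m< = subst (m_X g <_) (≡.sym deg-t₀) m<d
    go : Dec (Slope h d) -> f h ≈ 0#
    go (no n) = vanish h n
    go (yes (t , b , e , le)) = ℂ.trans (Average.class-invariant f (invariances f∈) e) (split t b (exact t le (λ le' -> small (t , b , e , le'))))
   -- The slopes of each single class are bounded, so the induction by `vanish-step` reaches it
   -- after finitely many steps.
   vanishes : (∀ h -> ¬ Slope h (Z.suc (m_X g)) -> f h ≈ 0#) -> ∀ h -> f h ≈ 0#
   vanishes vanish h = up n h (λ s -> 1+≰ (≤-trans too-big (snd (slopes-bounded h) _ s)))
    where
    n : ℕ
    n = Z.∣ fst (slopes-bounded h) Z.- m_X g ∣
    too-big : Z.suc (fst (slopes-bounded h)) ≤ Z.+ n Z.+ Z.suc (m_X g)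
    too-big = ≤-shift (i≤∣i∣ (fst (slopes-bounded h) Z.- m_X g)) (solveℤ 3 (λ n m b -> (n :+ (con 1ℤ :+ m)) :- (con 1ℤ :+ b) := n :- (b :- m))
     (Z.+ n) (m_X g) (fst (slopes-bounded h)))
    up : ∀ n h -> ¬ Slope h (Z.+ n Z.+ Z.suc (m_X g)) -> f h ≈ 0#
    up zero h small = vanish h (λ s -> small (subst (Slope h) (≡.sym (ℤₚ.+-identityˡ (Z.suc (m_X g)))) s))
    up (suc n) h small = vanish-step (Z.+ n Z.+ Z.suc (m_X g)) (suc[i]≤j⇒i<j (≤-by n (ℤₚ.+-comm (Z.+ n) (Z.suc (m_X g))))) (up n) h
     (λ s -> small (subst (Slope h) (≡.sym (ℤₚ.+-assoc 1ℤ (Z.+ n) (Z.suc (m_X g)))) s))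

 -- Vector bundles from lattices in Fⁿ

 module LatticeSheaves where
  open Bundles X
  open RiemannRoch
  private module SF = IntSolver F.ring
  Vec : ℕ -> Set
  Vec n = Fin n -> F.Carrier
  infix 4 _≋_
  _≋_ : ∀ {n} -> Vec n -> Vec n -> Set
  v ≋ w = ∀ i -> v i F.≈ w i
  sumF : ∀ {m} -> (Fin m -> F.Carrier) -> F.Carrier
  sumF = ∑ F._+_ F.0#
  δ : ∀ {n} -> Fin n -> Fin n -> F.Carrier
  δ zero zero = F.1#
  δ zero (suc j) = F.0#
  δ (suc i) zero = F.0#
  δ (suc i) (suc j) = δ i j
  sumF-cong : ∀ {m} {v w : Vec m} -> v ≋ w -> sumF v F.≈ sumF w
  sumF-cong {zero} e = F.refl
  sumF-cong {suc m} e = F.+-cong (e zero) (sumF-cong (e ∘ suc))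
  sum-δ : ∀ {n} (c : Vec n) j -> sumF (λ i -> c i F.* δ i j) F.≈ c j
  sum-δ {suc n} c zero = F.trans (F.+-cong (F.*-idʳ _) (zeros (c ∘ suc))) (F.+-idʳ _)
   where
   zeros : ∀ {m} (c : Vec m) -> sumF (λ i -> c i F.* F.0#) F.≈ F.0#
   zeros {zero} c = F.refl
   zeros {suc m} c = F.trans (F.+-cong (F.zeroʳ _) (zeros (c ∘ suc))) (F.+-idˡ _)
  sum-δ {suc n} c (suc j) = F.trans (F.+-cong (F.zeroʳ _) (sum-δ (c ∘ suc) j)) (F.+-idˡ _)
  1-integral : ∀ x -> O.B x 0ℤ F.1#
  1-integral x _ = ≡⇒≤ (≡.sym (O.v1≡0 x))
  δ-integral : ∀ x {n} (i j : Fin n) -> O.B x 0ℤ (δ i j)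
  δ-integral x zero zero = 1-integral x
  δ-integral x zero (suc j) = O.ball-0 x
  δ-integral x (suc i) zero = O.ball-0 x
  δ-integral x (suc i) (suc j) = δ-integral x i j
  -- An 𝒪_x-submodule of Fⁿ for every closed point x.
  record Lattice (n : ℕ) : Set₁ where
   field
    Λ : Point -> Vec n -> Set
    resp : ∀ x {v w} -> v ≋ w -> Λ x v -> Λ x w
    0∈ : ∀ x -> Λ x (λ _ -> F.0#)
    +∈ : ∀ x {v w} -> Λ x v -> Λ x w -> Λ x (λ i -> v i F.+ w i)
    *∈ : ∀ x {a v} -> O.B x 0ℤ a -> Λ x v -> Λ x (λ i -> a F.* v i)
  module _ {n} (𝓛 : Lattice n) where
   open Lattice 𝓛
   -- An open set omits finitely many points of an infinite set. Gluing needs such a point, to have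
   -- a local section whose vector can be taken as the global one.
   open-point : ∀ U -> ∃ (mem U)
   open-point U = let L , h = Open.cofinite U ; x , x∉ = infinitely-many-points L in x , away (h x) x∉
    where
    away : ∀ {x L} -> mem U x ⊎ x ∈ L -> ¬ x ∈ L -> mem U x
    away (inl m) _ = m
    away (inr p) n = ⊥-elim (n p)
   -- Restriction leaves the vector in Fⁿ unchanged, so local sections that agree on overlaps are
   -- one and the same vector, and gluing only collects the conditions at the points.
   latticeSheaf : OModule
   latticeSheaf = record
    { sections = λ U -> record
     { Carrierᴹ = Σ (Vec n) λ v -> ∀ x -> mem U x -> Λ x v
     ; _≈ᴹ_ = λ s t -> fst s ≋ fst t
     ; _+ᴹ_ = λ (v , p) (w , q) -> (λ i -> v i F.+ w i) , λ x u -> +∈ x (p x u) (q x u)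
     ; _*ₗ_ = λ (a , r) (v , p) -> (λ i -> a F.* v i) , λ x u -> *∈ x (r x u) (p x u)
     ; _*ᵣ_ = λ (v , p) (a , r) -> (λ i -> a F.* v i) , λ x u -> *∈ x (r x u) (p x u)
     ; 0ᴹ = (λ _ -> F.0#) , λ x _ -> 0∈ x
     ; -ᴹ_ = λ (v , p) -> (λ i -> F.- v i) , λ x u -> resp x (λ i -> SF.solve 1 (λ a -> con (Z.- 1ℤ) :* a := :- a) (v i))
      (*∈ x (O.ball-neg' x (1-integral x)) (p x u))
     ; isModule = IsModuleFromLeft.isModule {commutativeRing = 𝒪 U} record
      { isLeftModule = record
       { isLeftSemimodule = record
        { +ᴹ-isCommutativeMonoid = record
         { isMonoid = record
          { isSemigroup = record
           { isMagma = record
            { isEquivalence = record { refl = λ _ -> F.refl ; sym = λ e i -> F.sym (e i) ; trans = λ e e' i -> F.trans (e i) (e' i) }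
            ; ∙-cong = λ e e' i -> F.+-cong (e i) (e' i) }
           ; assoc = λ _ _ _ i -> F.+-assoc _ _ _ }
          ; identity = (λ _ i -> F.+-idˡ _) , λ _ i -> F.+-idʳ _ }
         ; comm = λ _ _ i -> F.+-comm _ _ }
        ; isPreleftSemimodule = record
         { *ₗ-cong = λ e e' i -> F.*-cong e (e' i) ; *ₗ-zeroˡ = λ _ i -> F.zeroˡ _ ; *ₗ-distribʳ = λ _ _ _ i -> F.distribʳ _ _ _
         ; *ₗ-identityˡ = λ _ i -> F.*-idˡ _ ; *ₗ-assoc = λ _ _ _ i -> F.*-assoc _ _ _ ; *ₗ-zeroʳ = λ _ i -> F.zeroʳ _
         ; *ₗ-distribˡ = λ _ _ _ i -> F.distribˡ _ _ _ } }
       ; -ᴹ‿cong = λ e i -> F.-‿cong (e i)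
       ; -ᴹ‿inverse = (λ _ i -> F.-‿inverseˡ _) , λ _ i -> F.-‿inverseʳ _ } } }
    ; res = λ (sub i) (v , p) -> v , λ x u -> p x (i x u)
    ; res-cong = λ _ e -> e
    ; res-+ = λ _ _ _ _ -> F.refl
    ; res-* = λ _ _ _ _ -> F.refl
    ; res-id = λ _ _ _ -> F.refl
    ; res-∘ = λ _ _ _ _ _ -> F.refl
    ; separation = λ {_} {U} V p covers s t e -> let x , u = open-point U in e (fst (covers x u))
    ; gluing = λ {_} {U} V p covers s agree -> let x0 , u₀ = open-point U ; i0 = fst (covers x0 u₀) in
     (fst (s i0) , λ x u -> let i , v = covers x u in resp x (agree i i0) (snd (s i) x v)) , λ i -> agree i0 i }
  -- A lattice free at every point, given there by the coordinates ψ x with respect to a basis e x.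
  record Frames (n : ℕ) : Set₁ where
   field
    ψ : Point -> Vec n -> Vec n
    ψ-cong : ∀ x {v w} -> v ≋ w -> ψ x v ≋ ψ x w
    ψ-+ : ∀ x v w -> ψ x (λ i -> v i F.+ w i) ≋ λ i -> ψ x v i F.+ ψ x w i
    ψ-* : ∀ x a v -> ψ x (λ i -> a F.* v i) ≋ λ i -> a F.* ψ x v i
    injective : ∀ x {v w} -> ψ x v ≋ ψ x w -> v ≋ w
    e : Point -> Fin n -> Vec n
    dual : ∀ x i j -> ψ x (e x i) j F.≈ δ i j
   Integral-at : (x y : Point) -> Vec n -> Set
   Integral-at x y v = ∀ i -> O.B y 0ℤ (ψ x v i)
   -- The basis at x is also a basis at y.
   Near : Point -> Point -> Set
   Near x y = (∀ v -> Integral-at y y v -> Integral-at x y v) × (∀ v -> Integral-at x y v -> Integral-at y y v)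
   field
    near : ∀ x -> AlmostAll (Near x)
   ψ-0 : ∀ x i -> ψ x (λ _ -> F.0#) i F.≈ F.0#
   ψ-0 x i = F.trans (ψ-cong x (λ _ -> F.sym (F.zeroˡ F.0#)) i) (F.trans (ψ-* x F.0# (λ _ -> F.0#) i) (F.zeroˡ _))
   lattice : Lattice n
   lattice = record
    { Λ = λ x -> Integral-at x x
    ; resp = λ x e p i -> O.ball-resp x (ψ-cong x e i) (p i)
    ; 0∈ = λ x i -> O.ball-resp x (F.sym (ψ-0 x i)) (O.ball-0 x)
    ; +∈ = λ x {v} {w} p q i -> O.ball-resp x (F.sym (ψ-+ x v w i)) (O.ball-+ x (p i) (q i))
    ; *∈ = λ x {a} {v} r p i -> O.ball-resp x (F.sym (ψ-* x a v i)) (O.ball-*ˡ x r (p i)) }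
   M : OModule
   M = latticeSheaf lattice
   open OModule M using (∣_∣; combine; res; IsFrame)
   nbhd : Point -> Open
   nbhd x = record { mem = Near x ; cofinite = near x }
   near-self : ∀ x -> Near x x
   near-self x = (λ _ p -> p) , λ _ p -> p
   basis : ∀ x -> Fin n -> ∣ nbhd x ∣
   basis x i = e x i , λ y n -> snd n (e x i) (λ j -> O.ball-resp y (F.sym (dual x i j)) (δ-integral y i j))
   ψ-combine : ∀ x V {m} (c : Fin m -> CommutativeRing.Carrier (𝒪 V)) (s : Fin m -> ∣ V ∣) k ->
    ψ x (fst (combine V c s)) k F.≈ sumF (λ j -> fst (c j) F.* ψ x (fst (s j)) k)
   ψ-combine x V {zero} c s k = ψ-0 x k
   ψ-combine x V {suc m} c s k = F.trans (ψ-+ x _ _ k) (F.+-cong (ψ-* x _ _ k) (ψ-combine x V (c ∘ suc) (s ∘ suc) k))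
   coordinates : ∀ x V (p : V ⊆ nbhd x) (c : Fin n -> CommutativeRing.Carrier (𝒪 V)) k -> ψ x (fst (combine V c (res p ∘ basis x))) k F.≈ fst (c k)
   coordinates x V p c k = F.trans (ψ-combine x V c (res p ∘ basis x) k)
    (F.trans (sumF-cong (λ j -> F.*ˡ (dual x j k))) (sum-δ (λ j -> fst (c j)) k))
   basis-frame : ∀ x -> IsFrame (nbhd x) (basis x)
   basis-frame x V p@(sub i) s = c , injective x (λ k -> F.sym (coordinates x V p c k))
    , λ c' eq k -> F.trans (ψ-cong x eq k) (coordinates x V p c' k)
    where
    c : Fin n -> CommutativeRing.Carrier (𝒪 V)
    c j = ψ x (fst s) j , λ y v -> fst (i y v) (fst s) (snd s y v) j
   bundle : VectorBundle n
   bundle = record { sheaf = M ; locallyFree = λ x -> nbhd x , near-self x , basis x , basis-frame x }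
  point-degree : ∀ x -> IsPointDegree x (degree x)
  point-degree x = Basics.toHasDim (ball-sub x 1ℤ) (residue-dim x)
  point-degree-unique : ∀ x n -> IsPointDegree x n -> n ≡ degree x
  point-degree-unique x n h = Basics.dim-unique (ball-sub x 0ℤ) (ball-sub x 1ℤ)
   (Basics.fromHasDim (ball-sub x 0ℤ) (ball-sub x 1ℤ) h) (residue-dim x)
  wsum : (Point -> ℕ) -> (Point -> ℤ) -> List Point -> ℤ
  wsum d e S = List.foldr Z._+_ 0ℤ (List.map (λ x -> Z.+ d x Z.* e x) S)
  wsum-cong : ∀ {d d' e e'} S -> (∀ x -> x ∈ S -> d x ≡ d' x) -> (∀ x -> x ∈ S -> e x ≡ e' x) -> wsum d e S ≡ wsum d' e' S
  wsum-cong [] _ _ = ≡.refl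
  wsum-cong (x ∷ S) p q = ap₂ Z._+_ (ap₂ (λ m n -> Z.+ m Z.* n) (p x (here ≡.refl)) (q x (here ≡.refl))) (wsum-cong S (λ y -> p y ∘ there) (λ y -> q y ∘ there))
  -- Reconciles the explicit sum over points in `IsDegree` with `deg`, which was defined by Euler
  -- characteristics. Uniqueness of S ensures that each point is counted once.
  wsum-deg : ∀ S -> Unique S -> ∀ e (h : ∀ x -> e x ≡ 0ℤ ⊎ x ∈ S) -> wsum degree e S ≡ deg (e , S , h)
  wsum-deg [] _ e h = ≡.sym (≡.trans (deg-resp {e , [] , h} {0ᴰ} (λ x -> zero-at (h x))) deg-zero)
   where
   zero-at : ∀ {x} -> e x ≡ 0ℤ ⊎ x ∈ [] -> e x ≡ 0ℤ
   zero-at (inl z) = z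
  wsum-deg (p ∷ S) (p∉ ∷ unique) e h = ≡.trans (ap₂ Z._+_ (ℤₚ.*-comm (Z.+ degree p) (e p))
   (≡.trans (wsum-cong {degree} {degree} {e} {clear p e} S (λ _ _ -> ≡.refl) (λ x x∈ -> ≡.sym (unchanged x em (λ { ≡.refl -> All.lookup p∉ x∈ ≡.refl }))))
    (wsum-deg S unique (clear p e) (clear-support p e S h))))
   (≡.trans (ℤₚ.+-comm (e p Z.* Z.+ degree p) (deg D)) (≡.sym (≡.trans (deg-resp {e , p ∷ S , h} {bump D p (e p)} (λ x -> ≡.sym (clear-+ p e x))) (deg-bump D p (e p)))))
   where
   D : Divisor
   D = clear p e , S , clear-support p e S h
   unchanged : ∀ x (d : Dec (x ≡ p)) -> ¬ x ≡ p -> if-dec 0ℤ (e x) d ≡ e x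
   unchanged x (yes q) n = ⊥-elim (n q)
   unchanged x (no _) _ = ≡.refl
  private
   dedup : (L : List Point) -> ∃ λ S -> Unique S × (∀ x -> x ∈ L -> x ∈ S)
   dedup [] = [] , [] , λ _ ()
   dedup (x ∷ L) = let S , u , h = dedup L in go S u h em
    where
    go : ∀ S -> Unique S -> (∀ y -> y ∈ L -> y ∈ S) -> Dec (x ∈ S) -> ∃ λ S -> Unique S × (∀ y -> y ∈ x ∷ L -> y ∈ S)
    go S u h (yes x∈) = S , u , λ { _ (here ≡.refl) -> x∈ ; y (there p) -> h y p }
    go S u h (no x∉) = x ∷ S , All.tabulate (λ { y∈ ≡.refl -> x∉ y∈ }) ∷ u , λ { _ (here e) -> here e ; y (there p) -> there (h y p) }
  -- The degree computed with the basis at x0 as rational frame.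
  module _ {n} (B : Frames n) where
   open Frames B
   frames-degree : ∀ x0 E -> (∀ x -> ord x (det F.ring (λ i j -> ψ x (e x0 i) j)) ≡ fst E x) -> IsDegree bundle (deg E)
   frames-degree x0 E ord-det = record
    { U = nbhd x0 ; b = basis x0 ; b-frame = basis-frame x0
    ; S = S ; S-uniq = fst (snd support) ; S-rest = rest
    ; V = nbhd ; V-nbhd = near-self ; e = basis ; e-frame = basis-frame
    ; A = λ x i -> fst (expand x i) ; b≈Ae = λ x i -> fst (snd (expand x i))
    ; deg = degree ; deg-x = point-degree
    ; formula = ≡.sym (≡.trans (wsum-cong {degree} {degree} {λ x -> ord x (det F.ring (λ i j -> ψ x (e x0 i) j))} {fst E} S (λ _ _ -> ≡.refl) (λ x _ -> ord-det x))
     (≡.trans (wsum-deg S (fst (snd support)) (fst E) zeros) (deg-resp {fst E , S , zeros} {E} (λ _ -> ≡.refl)))) }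
    where
    open OModule M using (res)
    L1 L2 : List Point
    L1 = fst (near x0)
    L2 = fst (snd E)
    support = dedup (L1 ++ L2)
    S : List Point
    S = fst support
    include : ∀ {P : Set} x -> P ⊎ x ∈ L1 ++ L2 -> P ⊎ x ∈ S
    include x (inl p) = inl p
    include x (inr q) = inr (snd (snd support) x q)
    rest : ∀ x -> Near x0 x ⊎ x ∈ S
    rest x = include x (go (snd (near x0) x))
     where
     go : Near x0 x ⊎ x ∈ L1 -> Near x0 x ⊎ x ∈ L1 ++ L2
     go (inl p) = inl p
     go (inr q) = inr (Anyₚ.++⁺ˡ q)
    zeros : ∀ x -> fst E x ≡ 0ℤ ⊎ x ∈ S
    zeros x = include x (go (snd (snd E) x))
     where
     go : fst E x ≡ 0ℤ ⊎ x ∈ L2 -> fst E x ≡ 0ℤ ⊎ x ∈ L1 ++ L2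
     go (inl p) = inl p
     go (inr q) = inr (Anyₚ.++⁺ʳ L1 q)
    expand : ∀ x i -> _
    expand x i = basis-frame x (nbhd x0 ∩ nbhd x) (∩⊆ʳ {nbhd x0} {nbhd x}) (res (∩⊆ˡ {nbhd x0} {nbhd x}) (basis x0 i))
  det1 : ∀ A -> det F.ring {1} A F.≈ A zero zero
  det1 A = SF.solve 1 (λ a -> a :* con 1ℤ :- con 0ℤ := a) (A zero zero)
  det2 : ∀ A -> det F.ring {2} A F.≈ A zero zero F.* A (suc zero) (suc zero) F.- A zero (suc zero) F.* A (suc zero) zero
  det2 A = SF.solve 4 (λ a b c d -> a :* (d :* con 1ℤ :- con 0ℤ) :- (b :* (c :* con 1ℤ :- con 0ℤ) :- con 0ℤ)
   := a :* d :- b :* c) (A zero zero) (A zero (suc zero)) (A (suc zero) zero) (A (suc zero) (suc zero))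

 -- Rank two bundles attached to triangular matrices

 module PlaneBundles where
  open Bundles X
  open Reduction public
  open LatticeSheaves public
  open Idele using (divisor)
  private
   module SF = IntSolver F.ring
   module R = RingLaws 𝔸
  pattern 0F = zero
  pattern 1F = suc zero
  -- Local bases (p x , 0), (f x , 1) of a rank two lattice.
  record Datum : Set where
   field
    p f : Point -> F.Carrier
    p≉0 : ∀ x -> ¬ p x F.≈ F.0#
    p-almost : AlmostAll (λ x -> ord x (p x) ≡ 0ℤ)
    f-almost : AlmostAll (λ x -> O.B x 0ℤ (f x))
  /-* : ∀ {p} a -> ¬ p F.≈ F.0# -> (a F.* Fₗ.inv p) F.* p F.≈ a
  /-* {p} a p≉0 = F.trans (F.*-assoc _ _ _) (F.trans (F.*ˡ (Fₗ.inv-l p≉0)) (F.*-idʳ a))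
  /-cancel : ∀ {p a b} -> ¬ p F.≈ F.0# -> a F.* Fₗ.inv p F.≈ b F.* Fₗ.inv p -> a F.≈ b
  /-cancel {p} {a} {b} p≉0 e = F.trans (F.sym (/-* a p≉0)) (F.trans (F.*ʳ e) (/-* b p≉0))
  /-integral : ∀ x {p a} -> ord x p ≡ 0ℤ -> O.B x 0ℤ a -> O.B x 0ℤ (a F.* Fₗ.inv p)
  /-integral x {p} {a} e h = O.ball-/ x {0ℤ} {p} {a} (subst (λ n -> O.B x n a) (≡.sym (≡.trans (ℤₚ.+-identityˡ (ord x p)) e)) h)
  integral-/ : ∀ x {p a} -> ¬ p F.≈ F.0# -> ord x p ≡ 0ℤ -> O.B x 0ℤ (a F.* Fₗ.inv p) -> O.B x 0ℤ a
  integral-/ x {p} {a} p≉0 e h = O.ball-resp x (/-* a p≉0) (O.ball-*ˡ x h (λ _ -> ≡⇒≤ (≡.sym e)))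
  module _ (p : Point -> F.Carrier) (p≉0 : ∀ x -> ¬ p x F.≈ F.0#) (p-almost : AlmostAll (λ x -> ord x (p x) ≡ 0ℤ)) where
   orders : Divisor
   orders = (λ x -> ord x (p x)) , p-almost
   both-units : ∀ x -> AlmostAll (λ y -> ord y (p x) ≡ 0ℤ × ord y (p y) ≡ 0ℤ)
   both-units x = almostAll-∩ _,_ (ord-almost-zero (p x) (p≉0 x)) p-almost
   line : Frames 1
   line = record
    { ψ = λ x v _ -> v 0F F.* Fₗ.inv (p x)
    ; ψ-cong = λ x e _ -> F.*ʳ (e 0F) ; ψ-+ = λ x v w _ -> F.distribʳ _ _ _ ; ψ-* = λ x a v _ -> F.*-assoc _ _ _
    ; injective = λ { x e 0F -> /-cancel (p≉0 x) (e 0F) }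
    ; e = λ x _ _ -> p x ; dual = λ { x 0F 0F -> Fₗ.inv-r (p≉0 x) }
    ; near = λ x -> almostAll-map (λ {y} (e , e') -> (λ v h _ -> /-integral y e (integral-/ y (p≉0 y) e' (h 0F))) , λ v h _ -> /-integral y e' (integral-/ y (p≉0 x) e (h 0F))) (both-units x) }
   ratio-degree : ∀ x0 (c : Point -> F.Carrier) -> (∀ x -> c x F.≈ p x0 F.* Fₗ.inv (p x)) -> ∀ x -> ord x (c x) ≡ fst (div (p x0) (p≉0 x0) ⊕ neg orders) x
   ratio-degree x0 c e x = ≡.trans (cong (e x)) (≡.trans (mult (p≉0 x0) (Fₗ.inv≉0 (p≉0 x))) (ap (Z._+_ (ord x (p x0))) (O.v-inv x (p≉0 x))))
    where open IsDVal (fst (isPlace x)) using (cong; mult)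
   deg-ratio : ∀ β β≉0 -> deg (div β β≉0 ⊕ neg orders) ≡ Z.- deg orders
   deg-ratio β β≉0 = ≡.trans (deg-⊕ (div β β≉0) (neg orders)) (≡.trans (ap₂ Z._+_ (deg-div β β≉0) (deg-neg orders)) (ℤₚ.+-identityˡ _))
   line-degree : IsDegree (Frames.bundle line) (Z.- deg orders)
   line-degree = subst (IsDegree (Frames.bundle line)) (deg-ratio (p x0) (p≉0 x0)) (frames-degree line x0 (div (p x0) (p≉0 x0) ⊕ neg orders)
    (ratio-degree x0 _ (λ x -> det1 (λ i j -> Frames.ψ line x (Frames.e line x0 i) j))))
  trivial-line : Frames 1
  trivial-line = line (λ _ -> F.1#) (λ _ -> F.1≉0) ([] , λ x -> inl (O.v1≡0 x))
  wsum-degree : ∀ {d a} S -> Unique S -> (∀ x -> IsPointDegree x (d x)) -> ∀ E -> (∀ x -> a x ≡ fst E x) -> (∀ x -> fst E x ≡ 0ℤ ⊎ x ∈ S) -> wsum d a S ≡ deg E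
  wsum-degree {d} {a} S unique isDeg E eq zeros = ≡.trans (wsum-cong {d} {degree} {a} {fst E} S (λ x _ -> point-degree-unique x (d x) (isDeg x)) (λ x _ -> eq x))
   (≡.trans (wsum-deg S unique (fst E) zeros) (deg-resp {fst E , S , zeros} {E} (λ _ -> ≡.refl)))
  D2 : (Fin 2 -> Vec 2) -> F.Carrier
  D2 A = A 0F 0F F.* A 1F 1F F.- A 0F 1F F.* A 1F 0F
  D₂-cong : ∀ {A A'} -> (∀ i -> A i ≋ A' i) -> D2 A F.≈ D2 A'
  D₂-cong e = F.+-cong (F.*-cong (e 0F 0F) (e 1F 1F)) (F.-‿cong (F.*-cong (e 0F 1F) (e 1F 0F)))
  D₂-· : ∀ A B -> D2 (λ i k -> A i 0F F.* B 0F k F.+ (A i 1F F.* B 1F k F.+ F.0#)) F.≈ D2 A F.* D2 B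
  D₂-· A B = SF.solve 8 (λ a b c d a' b' c' d' -> (a :* a' :+ (b :* c' :+ con 0ℤ)) :* (c :* b' :+ (d :* d' :+ con 0ℤ)) :- (a :* b' :+ (b :* d' :+ con 0ℤ)) :* (c :* a' :+ (d :* c' :+ con 0ℤ))
   := (a :* d :- b :* c) :* (a' :* d' :- b' :* c')) (A 0F 0F) (A 0F 1F) (A 1F 0F) (A 1F 1F) (B 0F 0F) (B 0F 1F) (B 1F 0F) (B 1F 1F)
  D₂-integral : ∀ x A -> (∀ i j -> O.B x 0ℤ (A i j)) -> O.B x 0ℤ (D2 A)
  D₂-integral x A h = O.ball-- x (O.ball-*ˡ x (h 0F 0F) (h 1F 1F)) (O.ball-*ˡ x (h 0F 1F) (h 1F 0F))
  entries⇒≈ᴰ : ∀ {g h} -> GL₂.a g R.≈ GL₂.a h -> GL₂.b g R.≈ GL₂.b h -> GL₂.c g R.≈ GL₂.c h -> GL₂.d g R.≈ GL₂.d h -> g ≈ᴰ h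
  entries⇒≈ᴰ {g} {h} p q r s = ~⇒≈ᴰ {g} {h} (~-entries {g} {h} p q r s)
  module Plane (𝒹 : Datum) where
   open Datum 𝒹
   D : Divisor
   D = orders p p≉0 p-almost
   abstract
    idele : Idele
    idele = record
     { t = adele (λ x -> K.embed x (p x)) (almostAll-map (λ {x} e -> embed-ball x {0ℤ} {p x} (λ _ -> ≡⇒≤ (≡.sym e))) p-almost)
     ; t⁻¹ = adele (λ x -> K.embed x (Fₗ.inv (p x))) (almostAll-map (λ {x} e -> embed-ball x {0ℤ} {Fₗ.inv (p x)}
      (λ _ -> ≡⇒≤ (≡.sym (≡.trans (O.v-inv x (p≉0 x)) (ap (λ n -> Z.- n) e))))) p-almost)
     ; invertible = λ x -> embed-unit x (p≉0 x) }
    shear : Adele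
    shear = adele (λ x -> K.embed x (f x)) (almostAll-map (λ {x} -> embed-ball x) f-almost)
    idele-at : ∀ x -> K._≈_ x (at (Idele.t idele) x) (K.embed x (p x))
    idele-at x = K.refl x
    shear-at : ∀ x -> K._≈_ x (at shear x) (K.embed x (f x))
    shear-at x = K.refl x
   idele-divisor : divisor idele ≐ D
   idele-divisor x = ≡.trans (IsDVal.cong (K.isValuation x) (idele-at x)) (K.extends x (p x) (p≉0 x))
   private
    ψ : Point -> Vec 2 -> Vec 2
    ψ x v 0F = (v 0F F.- f x F.* v 1F) F.* Fₗ.inv (p x)
    ψ x v 1F = v 1F
    recover : ∀ x v -> v 0F F.≈ ψ x v 0F F.* p x F.+ v 1F F.* f x
    recover x v = F.sym (F.trans (F.+ʳ (/-* _ (p≉0 x))) (SF.solve 3 (λ a f b -> (a :- f :* b) :+ b :* f := a) (v 0F) (f x) (v 1F)))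
    standard⇒ : ∀ x y v -> ord y (p x) ≡ 0ℤ -> O.B y 0ℤ (f x) -> (∀ i -> O.B y 0ℤ (ψ x v i)) -> O.B y 0ℤ (v 0F) × O.B y 0ℤ (v 1F)
    standard⇒ x y v e h i = O.ball-resp y (F.sym (recover x v)) (O.ball-+ y (O.ball-*ˡ y (i 0F) (λ _ -> ≡⇒≤ (≡.sym e))) (O.ball-*ˡ y (i 1F) h)) , i 1F
    standard⇐ : ∀ x y v -> ord y (p x) ≡ 0ℤ -> O.B y 0ℤ (f x) -> O.B y 0ℤ (v 0F) × O.B y 0ℤ (v 1F) -> ∀ i -> O.B y 0ℤ (ψ x v i)
    standard⇐ x y v e h (i , j) 0F = /-integral y e (O.ball-- y i (O.ball-*ˡ y h j))
    standard⇐ x y v e h (i , j) 1F = j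
   plane : Frames 2
   plane = record
    { ψ = ψ
    ; ψ-cong = λ { x e 0F -> F.*ʳ (F.+-cong (e 0F) (F.-‿cong (F.*ˡ (e 1F)))) ; x e 1F -> e 1F }
    ; ψ-+ = λ { x v w 0F -> SF.solve 6 (λ a b a' b' f i -> ((a :+ a') :- f :* (b :+ b')) :* i := (a :- f :* b) :* i :+ (a' :- f :* b') :* i) (v 0F) (v 1F) (w 0F) (w 1F) (f x) (Fₗ.inv (p x)) ; x v w 1F -> F.refl }
    ; ψ-* = λ { x c v 0F -> SF.solve 5 (λ a b c f i -> (c :* a :- f :* (c :* b)) :* i := c :* ((a :- f :* b) :* i)) (v 0F) (v 1F) c (f x) (Fₗ.inv (p x))
     ; x c v 1F -> F.refl }
    ; injective = λ { x {v} {w} e 0F -> F.trans (recover x v) (F.trans (F.+-cong (F.*ʳ (e 0F)) (F.*ʳ (e 1F))) (F.sym (recover x w))) ; x e 1F -> e 1F }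
    ; e = e2
    ; dual = λ { x 0F 0F -> F.trans (SF.solve 3 (λ p f i -> (p :- f :* con 0ℤ) :* i := p :* i) (p x) (f x) (Fₗ.inv (p x))) (Fₗ.inv-r (p≉0 x))
     ; x 0F 1F -> F.refl
     ; x 1F 0F -> SF.solve 2 (λ f i -> (f :- f :* con 1ℤ) :* i := con 0ℤ) (f x) (Fₗ.inv (p x))
     ; x 1F 1F -> F.refl }
    ; near = λ x -> almostAll-∩ (λ {y} (e , e') (h , h') -> (λ v i -> standard⇐ x y v e h (standard⇒ y y v e' h' i)) , λ v i -> standard⇐ y y v e' h' (standard⇒ x y v e h i))
     (both-units p p≉0 p-almost x) (almostAll-∩ _,_ (regular-almost (f x)) f-almost) }
    where
    e2 : Point -> Fin 2 -> Vec 2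
    e2 x 0F 0F = p x
    e2 x 0F 1F = F.0#
    e2 x 1F 0F = f x
    e2 x 1F 1F = F.1#
   open Frames plane using (bundle; M; basis; nbhd; near-self; e; lattice)
   open OModule M using (∣_∣; combine; res; IsFrame)
   plane-degree : IsDegree bundle (Z.- deg D)
   plane-degree = subst (IsDegree bundle) (deg-ratio p p≉0 p-almost (p x0) (p≉0 x0)) (frames-degree plane x0 (div (p x0) (p≉0 x0) ⊕ neg D)
    (ratio-degree p p≉0 p-almost x0 _ (λ x -> F.trans (det2 (λ i j -> ψ x (e x0 i) j))
     (SF.solve 4 (λ p f i r -> ((p :- f :* con 0ℤ) :* i) :* con 1ℤ :- con 0ℤ :* r := p :* i) (p x0) (f x) (Fₗ.inv (p x)) (ψ x (e x0 1F) 0F)))))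
   abstract
    point : GL₂
    point = τ idele shear
    point-eq : point ≈ᴰ τ idele shear
    point-eq = entries⇒≈ᴰ (λ x -> K.refl x) (λ x -> K.refl x) (λ x -> K.refl x) (λ x -> K.refl x)
    point-column : ∀ x i j -> K._≈_ x (at (column point i j) x) (K.embed x (e x i j))
    point-column x 0F 0F = idele-at x
    point-column x 0F 1F = K.sym x (embed-0 x)
    point-column x 1F 0F = shear-at x
    point-column x 1F 1F = K.sym x (embed-1 x)
   det-basis : ∀ x -> D2 (e x) F.≈ p x
   det-basis x = SF.solve 2 (λ p f -> p :* con 1ℤ :- con 0ℤ :* f := p) (p x) (f x)
   expand-basis : ∀ x v -> v ≋ λ k -> ψ x v 0F F.* e x 0F k F.+ (ψ x v 1F F.* e x 1F k F.+ F.0#)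
   expand-basis x v 0F = F.trans (recover x v) (F.+ˡ (F.sym (F.+-idʳ _)))
   expand-basis x v 1F = SF.solve 2 (λ a b -> b := a :* con 0ℤ :+ (b :* con 1ℤ :+ con 0ℤ)) (ψ x v 0F) (v 1F)
   private
    -- The frame and the standard basis at x express each other by integral matrices, so their
    -- determinants have the same order at x.
    frame-det : ∀ W (s : Fin 2 -> ∣ W ∣) -> IsFrame W s -> ∀ x -> mem W x -> ¬ D2 (fst ∘ s) F.≈ F.0# × ord x (D2 (fst ∘ s)) ≡ ord x (p x)
    frame-det W s frame x x∈ = E≉0 , ≤-antisym
     (subst (ord x (D2 E) ≤_) (≡.sym (≡.trans (cong p≈) (mult C'≉0 E≉0))) (subst (_≤ ord x (D2 C') Z.+ ord x (D2 E)) (ℤₚ.+-identityˡ _)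
      (+-monoˡ-≤ (ord x (D2 E)) (D₂-integral x C' (λ i j -> snd (fst (expand i) j) x (x∈ , near-self x)) C'≉0))))
     (subst (ord x (p x) ≤_) (≡.sym (≡.trans (cong E≈) (mult C≉0 (p≉0 x)))) (subst (_≤ ord x (D2 C) Z.+ ord x (p x)) (ℤₚ.+-identityˡ _)
      (+-monoˡ-≤ (ord x (p x)) (D₂-integral x C (λ i -> snd (s i) x x∈) C≉0))))
     where
     open IsDVal (fst (isPlace x)) using (cong; mult)
     E C C' : Fin 2 -> Vec 2
     E i = fst (s i)
     C i = ψ x (E i)
     expand : ∀ i -> _
     expand i = frame (W ∩ nbhd x) (∩⊆ˡ {W} {nbhd x}) (res (∩⊆ʳ {W} {nbhd x}) (basis x i))
     C' i j = fst (fst (expand i) j)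
     p≈ : p x F.≈ D2 C' F.* D2 E
     p≈ = F.trans (F.sym (det-basis x)) (F.trans (D₂-cong (λ i -> fst (snd (expand i)))) (D₂-· C' E))
     E≈ : D2 E F.≈ D2 C F.* p x
     E≈ = F.trans (D₂-cong (λ i -> expand-basis x (E i))) (F.trans (D₂-· C (e x)) (F.*ˡ (det-basis x)))
     C'≉0 : ¬ D2 C' F.≈ F.0#
     C'≉0 z = p≉0 x (F.trans p≈ (F.trans (F.*ʳ z) (F.zeroˡ _)))
     E≉0 : ¬ D2 E F.≈ F.0#
     E≉0 z = p≉0 x (F.trans p≈ (F.trans (F.*ˡ z) (F.zeroʳ _)))
     C≉0 : ¬ D2 C F.≈ F.0#
     C≉0 z = E≉0 (F.trans E≈ (F.trans (F.*ʳ z) (F.zeroˡ _)))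
   -- Any rational frame computes the same degree: its determinant β contributes deg (div β) = 0,
   -- and the local frames have determinants of order ord p by `frame-det`.
   degree-unique : ∀ m -> IsDegree bundle m -> m ≡ Z.- deg D
   degree-unique m isDeg = ≡.trans I.formula (≡.trans (wsum-degree I.S I.S-uniq I.deg-x (div β β≉0 ⊕ neg D) value zeros) (deg-ratio p p≉0 p-almost β β≉0))
    where
    module I = IsDegree isDeg
    β : F.Carrier
    β = D2 (fst ∘ I.b)
    β≉0 : ¬ β F.≈ F.0#
    β≉0 = let x , x∈ = open-point lattice I.U in fst (frame-det I.U I.b I.b-frame x x∈)
    value : ∀ x -> ord x (det F.ring (λ i j -> fst (I.A x i j))) ≡ ord x β Z.- ord x (p x)
    value x = ≡.trans (cong (det2 A)) (≡.sym (≡.trans (ap (Z._- ord x (p x)) (≡.trans (cong (F.trans (D₂-cong (λ i -> I.b≈Ae x i)) (D₂-· A (fst ∘ I.e x)))) (mult A≉0 E≉0)))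
     (≡.trans (ap (λ n -> (ord x (D2 A) Z.+ n) Z.- ord x (p x)) (snd (frame-det (I.V x) (I.e x) (I.e-frame x) x (I.V-nbhd x)))) (solveℤ 2 (λ a p -> (a :+ p) :- p := a) (ord x (D2 A)) (ord x (p x))))))
     where
     open IsDVal (fst (isPlace x)) using (cong; mult)
     A : Fin 2 -> Vec 2
     A i j = fst (I.A x i j)
     E≉0 = fst (frame-det (I.V x) (I.e x) (I.e-frame x) x (I.V-nbhd x))
     A≉0 : ¬ D2 A F.≈ F.0#
     A≉0 z = β≉0 (F.trans (F.trans (D₂-cong (λ i -> I.b≈Ae x i)) (D₂-· A (fst ∘ I.e x))) (F.trans (F.*ʳ z) (F.zeroˡ _)))
    zeros : ∀ x -> fst (div β β≉0 ⊕ neg D) x ≡ 0ℤ ⊎ x ∈ I.S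
    zeros x = go (I.S-rest x)
     where
     go : mem I.U x ⊎ x ∈ I.S -> ord x β Z.- ord x (p x) ≡ 0ℤ ⊎ x ∈ I.S
     go (inl x∈) = inl (ℤₚ.i≡j⇒i-j≡0 (snd (frame-det I.U I.b I.b-frame x x∈)))
     go (inr x∈) = inr x∈

 -- Line subbundles and δ

 module PlaneSlopes where
  open Bundles X
  open PlaneBundles public
  open Idele using (divisor)
  private
   module SF = IntSolver F.ring
   module R = RingLaws 𝔸
  private
   twice-minus : ∀ l d -> ((l Z.+ d) Z.+ (l Z.+ d)) Z.- d ≡ Z.+ 2 Z.* l Z.+ d
   twice-minus = solveℤ 2 (λ l d -> ((l :+ d) :+ (l :+ d)) :- d := con (Z.+ 2) :* l :+ d)
  module _ (𝒹 : Datum) where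
   open Datum 𝒹
   open Plane 𝒹
   open Frames plane using (bundle; nbhd; near-self; e; M)
   -- The first coordinate axis, with the second coordinate as quotient map onto 𝒪; near x a section
   -- r of 𝒪 lifts to (f x · r, r). It shows that the set of slopes is not empty.
   coordinate-subbundle : LineSubbundle bundle
   coordinate-subbundle = record
    { L = Frames.bundle (line p p≉0 p-almost) ; rank = 1 ; Q = Frames.bundle trivial-line
    ; i = record
     { fun = λ U (v , h) -> include (v 0F) , λ x u -> λ { 0F -> O.ball-resp x (F.*ʳ (drop x (v 0F) F.refl)) (h x u 0F) ; 1F -> O.ball-0 x }
     ; cong = λ { U e 0F -> e 0F ; U e 1F -> F.refl } ; add = λ { U s t 0F -> F.refl ; U s t 1F -> F.sym (F.+-idˡ _) }
     ; act = λ { U a s 0F -> F.refl ; U a s 1F -> F.sym (F.zeroʳ _) } ; nat = λ { p s 0F -> F.refl ; p s 1F -> F.refl } }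
    ; π = record
     { fun = λ U (v , h) -> (λ _ -> v 1F) , λ x u _ -> /-integral x (O.v1≡0 x) (h x u 1F)
     ; cong = λ U e _ -> e 1F ; add = λ _ _ _ _ -> F.refl ; act = λ _ _ _ _ -> F.refl ; nat = λ _ _ _ -> F.refl }
    ; injective = λ { U s t e 0F -> e 0F }
    ; complex = λ _ _ _ -> F.refl
    ; exact = λ U (v , h) z -> ((λ _ -> v 0F) , λ x u _ -> O.ball-resp x (F.*ʳ (F.sym (drop x (v 0F) (z 0F)))) (h x u 0F))
     , λ { 0F -> F.refl ; 1F -> F.sym (z 0F) }
    ; surjective = λ U (r , h) x x∈ -> U ∩ nbhd x , (x∈ , near-self x) , ∩⊆ˡ {U} {nbhd x}
     , (lift x (r 0F) , λ y (u , n) -> snd n (lift x (r 0F)) (λ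
      { 0F -> O.ball-≈0 y (SF.solve 3 (λ f r i -> (f :* r :- f :* r) :* i := con 0ℤ) (f x) (r 0F) (Fₗ.inv (p x)))
      ; 1F -> integral-/ y F.1≉0 (O.v1≡0 y) (h y u 0F) }))
     , λ { 0F -> F.refl } }
    where
    include : F.Carrier -> Vec 2
    include a 0F = a
    include a 1F = F.0#
    lift : Point -> F.Carrier -> Vec 2
    lift x r 0F = f x F.* r
    lift x r 1F = r
    drop : ∀ x a {b} -> b F.≈ F.0# -> a F.≈ a F.- f x F.* b
    drop x a e = F.trans (SF.solve 2 (λ a f -> a := a :- f :* con 0ℤ) a (f x)) (F.+ˡ (F.-‿cong (F.*ˡ (F.sym e))))
   coordinate-slope : IsSlope bundle (Z.- deg D)
   coordinate-slope = coordinate-subbundle , Z.- deg D , Z.- deg D , line-degree p p≉0 p-almost , plane-degree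
    , solveℤ 1 (λ d -> d := con (Z.+ 2) :* d :- d) (Z.- deg D)
   module _ (𝓈 : LineSubbundle bundle) {l : ℤ} (isDeg : IsDegree (LineSubbundle.L 𝓈) l) where
    private
     open LineSubbundle 𝓈 using (i; injective)
     module L = VectorBundle (LineSubbundle.L 𝓈)
     module I = IsDegree isDeg
     open Hom i using (fun; cong; add; act; nat)
     proportional : ∀ W (s s' : L.∣ W ∣) a -> L.Γ._≈ᴹ_ W s (L.Γ._+ᴹ_ W (L.Γ._*ₗ_ W a s') (L.Γ.0ᴹ W)) ->
      fst (fun W s) ≋ λ k -> fst a F.* fst (fun W s') k
     proportional W s s' a eq k = F.trans (cong W (L.Γ.≈ᴹ-trans W eq (L.Γ.+ᴹ-identityʳ W _)) k) (act W a s' k)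
     -- v is a rational section of L seen inside F², and w x a generator of L near x. Their ratio a
     -- x measures the order of v, so its divisor computes deg L.
     v : Vec 2
     v = fst (fun I.U (I.b 0F))
     w : Point -> Vec 2
     w x = fst (fun (I.V x) (I.e x 0F))
     a : Point -> F.Carrier
     a x = fst (I.A x 0F 0F)
     v≈aw : ∀ x -> v ≋ λ k -> a x F.* w x k
     v≈aw x k = F.trans (F.sym (nat (∩⊆ˡ {I.U} {I.V x}) (I.b 0F) k))
      (F.trans (proportional (I.U ∩ I.V x) _ _ (I.A x 0F 0F) (I.b≈Ae x 0F) k) (F.*ˡ (nat (∩⊆ʳ {I.U} {I.V x}) (I.e x 0F) k)))
     v≉0 : ¬ (∀ k -> v k F.≈ F.0#)
     v≉0 z = F.1≉0 (F.trans (F.sym (unique (λ _ -> R0.1#) b≈b 0F)) (unique (λ _ -> R0.0#) b≈0 0F))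
      where
      module R0 = CommutativeRing (𝒪 I.U)
      module Γ₀ = L.Γ I.U
      whole : I.U ⊆ I.U
      whole = sub λ _ u -> u
      b0 : L.∣ I.U ∣
      b0 = L.res whole (I.b 0F)
      unique = snd (snd (I.b-frame I.U whole b0))
      b≈b : b0 Γ₀.≈ᴹ ((R0.1# Γ₀.*ₗ b0) Γ₀.+ᴹ Γ₀.0ᴹ)
      b≈b = Γ₀.≈ᴹ-sym (Γ₀.≈ᴹ-trans (Γ₀.+ᴹ-identityʳ _) (Γ₀.*ₗ-identityˡ b0))
      b≈0 : b0 Γ₀.≈ᴹ ((R0.0# Γ₀.*ₗ b0) Γ₀.+ᴹ Γ₀.0ᴹ)
      b≈0 = Γ₀.≈ᴹ-trans (injective I.U b0 (R0.0# Γ₀.*ₗ b0) (λ k -> F.trans (nat whole (I.b 0F) k)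
       (F.trans (z k) (F.trans (F.sym (F.zeroˡ _)) (F.sym (act I.U R0.0# b0 k)))))) (Γ₀.≈ᴹ-sym (Γ₀.+ᴹ-identityʳ _))
     nonzero-entry : ∃ λ k -> ¬ v k F.≈ F.0#
     nonzero-entry = ¬∀⇒∃¬ v≉0
     a≉0 : ∀ x -> ¬ a x F.≈ F.0#
     a≉0 x z = v≉0 λ k -> F.trans (v≈aw x k) (F.trans (F.*ʳ z) (F.zeroˡ _))
     a-unit : ∀ x -> mem I.U x -> ord x (a x) ≡ 0ℤ
     a-unit x u = O.v-unit x ac≈1 (snd (I.A x 0F 0F) x (u , I.V-nbhd x)) (snd c x (u , I.V-nbhd x))
      where
      W : Open
      W = I.U ∩ I.V x
      expand = I.b-frame W (∩⊆ˡ {I.U} {I.V x}) (L.res (∩⊆ʳ {I.U} {I.V x}) (I.e x 0F))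
      c = fst expand 0F
      w≈cv : w x ≋ λ k -> fst c F.* v k
      w≈cv k = F.trans (F.sym (nat (∩⊆ʳ {I.U} {I.V x}) (I.e x 0F) k))
       (F.trans (proportional W _ _ c (fst (snd expand)) k) (F.*ˡ (nat (∩⊆ˡ {I.U} {I.V x}) (I.b 0F) k)))
      ac≈1 : a x F.* fst c F.≈ F.1#
      ac≈1 = let k , ne = nonzero-entry in Fₗ.*-cancelˡ ne (F.trans (F.*-comm _ _)
       (F.trans (F.trans (F.*-assoc _ _ _) (F.trans (F.*ˡ (F.sym (w≈cv k))) (F.sym (v≈aw x k)))) (F.sym (F.*-idʳ _))))
     abstract
      Z : Divisor
      Z = (λ x -> ord x (a x)) , I.S , λ x -> go (I.S-rest x)
       where
       go : ∀ {x} -> mem I.U x ⊎ x ∈ I.S -> ord x (a x) ≡ 0ℤ ⊎ x ∈ I.S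
       go (inl u) = inl (a-unit _ u)
       go (inr s) = inr s
      l≡ : l ≡ deg Z
      l≡ = ≡.trans I.formula (wsum-degree I.S I.S-uniq I.deg-x Z (λ x -> IsDVal.cong (fst (isPlace x)) (det1 (λ j k -> fst (I.A x j k)))) (snd (snd Z)))
      Z-at : ∀ x -> ord x (a x) ≡ fst Z x
      Z-at x = ≡.refl
     Z' : Divisor
     Z' = Z ⊕ D
     w∈ : ∀ x -> O.B x 0ℤ ((w x 0F F.- f x F.* w x 1F) F.* Fₗ.inv (p x)) × O.B x 0ℤ (w x 1F)
     w∈ x = let h = snd (fun (I.V x) (I.e x 0F)) x (I.V-nbhd x) in h 0F , h 1F
     -- The row (v 1, - v 0) annihilates the line spanned by v. As v = a w with w in the lattice,
     -- its products with the columns of τ are divisible by Z + D, which is the input of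
     -- `change-slope`.
     row1 : Within Z' (principal (v 1F) R.* Idele.t idele)
     row1 x = V.ball-*' x {fst Z x} (embed-ball x (O.ball-resp x (F.sym (v≈aw x 1F)) (O.ball-*-eq x (O.ball-v x (a x)) (snd (w∈ x)) (≡.trans (ℤₚ.+-identityʳ _) (Z-at x))))) (subst (λ n -> B x n (at (Idele.t idele) x)) (idele-divisor x) (Idele.ball-t idele x))
     row2 : Within Z' (principal (v 1F) R.* shear R.+ principal (F.- v 0F))
     row2 x = V.ball-resp x (K.trans x (embed-+ x _ _) (K.+ʳ x (K.trans x (embed-* x _ _) (K.*ˡ x (K.sym x (shear-at x)))))) (embed-ball x (subst (λ n -> O.B x n (v 1F F.* f x F.+ F.- v 0F)) (ap (Z._+ ord x (p x)) (Z-at x))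
      (O.ball-resp x (F.sym eq) (O.ball-neg' x (O.ball-*' x (O.ball-v x (a x)) (O.ball-*ˡ x (fst (w∈ x)) (O.ball-v x (p x))))))))
      where
      eq : v 1F F.* f x F.+ F.- v 0F F.≈ F.- (a x F.* (((w x 0F F.- f x F.* w x 1F) F.* Fₗ.inv (p x)) F.* p x))
      eq = F.trans (F.+-cong (F.*ʳ (v≈aw x 1F)) (F.-‿cong (v≈aw x 0F))) (F.trans
       (SF.solve 4 (λ a w w' f -> (a :* w') :* f :+ (:- (a :* w)) := :- (a :* (w :- f :* w'))) (a x) (w x 0F) (w x 1F) (f x))
       (F.-‿cong (F.*ˡ (F.sym (/-* _ (p≉0 x))))))
    subbundle-slope : Slope point (Z.+ 2 Z.* l Z.+ deg D)
    subbundle-slope = subst (Slope point) (≡.trans (ap (λ z -> (z Z.+ z) Z.- deg D) (≡.trans (deg-⊕ Z D) (ap (Z._+ deg D) (≡.sym l≡)))) (twice-minus l (deg D)))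
     (change-slope idele shear point-eq D idele-divisor (v 1F) (F.- v 0F) nonzero Z' row1 row2)
     where
     nonzero : ¬ (v 1F F.≈ F.0# × F.- v 0F F.≈ F.0#)
     nonzero (z , z') = v≉0 λ { 0F -> F.trans (SF.solve 1 (λ x -> x := :- (:- x)) (v 0F)) (F.trans (F.-‿cong z') (SF.solve 0 (:- con 0ℤ := con 0ℤ))) ; 1F -> z }
   slope-bound : ∀ s -> IsSlope bundle s -> Slope point s
   slope-bound s (𝓈 , l , m , isDegL , isDegM , s≡) = subst (Slope point) (≡.sym (≡.trans s≡ (≡.trans (ap (λ n -> Z.+ 2 Z.* l Z.- n) (degree-unique m isDegM))
    (solveℤ 2 (λ l d -> con (Z.+ 2) :* l :- (:- d) := con (Z.+ 2) :* l :+ d) l (deg D))))) (subbundle-slope 𝓈 isDegL)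
   -- The slopes are bounded by N and include -deg D, so a maximum is found by descending from N.
   -- The fuel n bounds the distance from the current M to -deg D.
   exists-δ : ∀ N -> (∀ d -> Slope point d -> d ≤ N) -> ∃ λ δ -> Isδ bundle δ × δ ≤ N
   exists-δ N bound = go Z.∣ N Z.+ deg D ∣ N (λ s h -> bound s (slope-bound s h)) (i≤∣i∣ (N Z.+ deg D)) ≤-refl
    where
    go : ∀ n M -> (∀ s -> IsSlope bundle s -> s ≤ M) -> M Z.+ deg D ≤ Z.+ n -> M ≤ N -> ∃ λ δ -> Isδ bundle δ × δ ≤ N
    attained : ∀ M -> (∀ s -> IsSlope bundle s -> s ≤ M) -> M ≤ N -> IsSlope bundle M -> ∃ λ δ -> Isδ bundle δ × δ ≤ N
    attained M above le h = M , (above , λ d' above' -> above' M h) , le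
    go zero M above le M≤N = attained M above M≤N (subst (IsSlope bundle) (≤-antisym (above _ coordinate-slope)
     (≤-shift le (solveℤ 2 (λ m d -> (:- d) :- m := con 0ℤ :- (m :+ d)) M (deg D)))) coordinate-slope)
    go (suc n) M above le M≤N = decide em
     where
     decide : Dec (IsSlope bundle M) -> ∃ λ δ -> Isδ bundle δ × δ ≤ N
     decide (yes h) = attained M above M≤N h
     decide (no ne) = go n (Z.pred M) (λ s h -> ℤₚ.i<j⇒i≤pred[j] (≤∧≢⇒< (above s h) λ { ≡.refl -> ne h }))
      (≤-shift le (solveℤ 3 (λ m d n -> n :- ((con -1ℤ :+ m) :+ d) := (con 1ℤ :+ n) :- (m :+ d)) M (deg D) (Z.+ n)))
      (≤-trans (ℤₚ.i≤j⇒pred[i]≤j ≤-refl) M≤N)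

 -- Bundles equivalent under twisting lie in one double coset

 module PlaneTensor where
  open Bundles X
  open PlaneSlopes public
  private
   module SF = IntSolver F.ring
   module R = RingLaws 𝔸
  -- Sections of a line bundle as rational functions, by means of a fixed rational section.
  module LineCoordinates (𝓁 : LineBundle) where
   private
    module L = VectorBundle 𝓁
    U : Point -> Open
    U x = fst (L.locallyFree x)
    x∈U : ∀ x -> mem (U x) x
    x∈U x = fst (snd (L.locallyFree x))
    e : ∀ x -> L.∣ U x ∣
    e x = fst (snd (snd (L.locallyFree x))) 0F
    frame : ∀ x -> L.IsFrame (U x) (fst (snd (snd (L.locallyFree x))))
    frame x = snd (snd (snd (L.locallyFree x)))
    U0 : Open
    U0 = U x0
    expand : ∀ x W -> (W ∩ U x) ⊆ W -> (l : L.∣ W ∣) -> Σ (CommutativeRing.Carrier (𝒪 (W ∩ U x))) λ c ->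
     L.Γ._≈ᴹ_ (W ∩ U x) (L.res (∩⊆ˡ {W} {U x}) l) (L.Γ._*ₗ_ (W ∩ U x) c (L.res (∩⊆ʳ {W} {U x}) (e x)))
    expand x W _ l = let c , eq , _ = frame x (W ∩ U x) (∩⊆ʳ {W} {U x}) (L.res (∩⊆ˡ {W} {U x}) l) in c 0F , L.Γ.≈ᴹ-trans (W ∩ U x) eq (L.Γ.+ᴹ-identityʳ (W ∩ U x) _)
   coord : ∀ W -> L.∣ W ∣ -> F.Carrier
   coord W l = fst (fst (expand x0 W ∩⊆ˡ l))
   private
    coord-unique : ∀ W l c -> L.Γ._≈ᴹ_ (W ∩ U0) (L.res (∩⊆ˡ {W} {U0}) l) (L.Γ._*ₗ_ (W ∩ U0) c (L.res (∩⊆ʳ {W} {U0}) (e x0))) -> coord W l F.≈ fst c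
    coord-unique W l c eq = snd (snd (frame x0 (W ∩ U0) (∩⊆ʳ {W} {U0}) (L.res (∩⊆ˡ {W} {U0}) l))) (λ _ -> c)
     (L.Γ.≈ᴹ-trans (W ∩ U0) eq (L.Γ.≈ᴹ-sym (W ∩ U0) (L.Γ.+ᴹ-identityʳ (W ∩ U0) _))) 0F
    coord-eq : ∀ W l -> L.Γ._≈ᴹ_ (W ∩ U0) (L.res (∩⊆ˡ {W} {U0}) l) (L.Γ._*ₗ_ (W ∩ U0) (fst (expand x0 W ∩⊆ˡ l)) (L.res (∩⊆ʳ {W} {U0}) (e x0)))
    coord-eq W l = snd (expand x0 W ∩⊆ˡ l)
   coord-cong : ∀ W {l l'} -> L.Γ._≈ᴹ_ W l l' -> coord W l F.≈ coord W l'
   coord-cong W {l} {l'} eq = coord-unique W l _ (L.Γ.≈ᴹ-trans (W ∩ U0) (L.res-cong (∩⊆ˡ {W} {U0}) eq) (coord-eq W l'))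
   coord-+ : ∀ W l l' -> coord W (L.Γ._+ᴹ_ W l l') F.≈ coord W l F.+ coord W l'
   coord-+ W l l' = coord-unique W _ (CommutativeRing._+_ (𝒪 (W ∩ U0)) (fst (expand x0 W ∩⊆ˡ l)) (fst (expand x0 W ∩⊆ˡ l')))
    (trans (L.res-+ (∩⊆ˡ {W} {U0}) l l') (trans (+ᴹ-cong (coord-eq W l) (coord-eq W l')) (sym (*ₗ-distribʳ _ _ _))))
    where open L.Γ (W ∩ U0) using (+ᴹ-cong; *ₗ-distribʳ) renaming (≈ᴹ-trans to trans; ≈ᴹ-sym to sym)
   coord-* : ∀ W a l -> coord W (L.Γ._*ₗ_ W a l) F.≈ fst a F.* coord W l
   coord-* W a l = coord-unique W _ (CommutativeRing._*_ (𝒪 (W ∩ U0)) (restrict (∩⊆ˡ {W} {U0}) a) (fst (expand x0 W ∩⊆ˡ l)))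
    (trans (L.res-* (∩⊆ˡ {W} {U0}) a l) (trans (*ₗ-congˡ (coord-eq W l)) (sym (*ₗ-assoc _ _ _))))
    where open L.Γ (W ∩ U0) using (*ₗ-congˡ; *ₗ-assoc) renaming (≈ᴹ-trans to trans; ≈ᴹ-sym to sym)
   coord-res : ∀ {W W'} (q : W' ⊆ W) l -> coord W' (L.res q l) F.≈ coord W l
   coord-res {W} {W'} q@(sub i) l = coord-unique W' _ (restrict both (fst (expand x0 W ∩⊆ˡ l)))
    (trans (L.res-∘ q (∩⊆ˡ {W'} {U0}) (sub λ x u -> i x (fst u)) l) (trans (sym (L.res-∘ (∩⊆ˡ {W} {U0}) both (sub λ x u -> i x (fst u)) l))
     (trans (L.res-cong both (coord-eq W l)) (trans (L.res-* both _ _) (*ₗ-congˡ (L.res-∘ (∩⊆ʳ {W} {U0}) both (∩⊆ʳ {W'} {U0}) (e x0)))))))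
    where
    open L.Γ (W' ∩ U0) using (*ₗ-congˡ) renaming (≈ᴹ-trans to trans; ≈ᴹ-sym to sym)
    both : (W' ∩ U0) ⊆ (W ∩ U0)
    both = sub λ x u -> i x (fst u) , snd u
   generator : Point -> F.Carrier
   generator x = coord (U x) (e x)
   local-section : ∀ x -> Σ Open λ W -> mem W x × Σ L.∣ W ∣ λ l -> coord W l F.≈ generator x
   local-section x = U x , x∈U x , e x , F.refl
   coord-generator : ∀ W l x -> mem W x -> ∃ λ d -> O.B x 0ℤ d × coord W l F.≈ d F.* generator x
   coord-generator W l x x∈ = let d , eq = expand x W ∩⊆ˡ l in fst d , snd d x (x∈ , x∈U x)
    , F.trans (F.sym (coord-res (∩⊆ˡ {W} {U x}) l)) (F.trans (coord-cong (W ∩ U x) eq) (F.trans (coord-* (W ∩ U x) d _) (F.*ˡ (coord-res (∩⊆ʳ {W} {U x}) (e x)))))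
   private
    coord-e₀ : coord U0 (e x0) F.≈ F.1#
    coord-e₀ = coord-unique U0 (e x0) (CommutativeRing.1# (𝒪 (U0 ∩ U0)))
     (trans (sym (L.res-∘ whole (∩⊆ˡ {U0} {U0}) (∩⊆ˡ {U0} {U0}) (e x0))) (trans (L.res-∘ whole (∩⊆ˡ {U0} {U0}) (∩⊆ˡ {U0} {U0}) (e x0))
      (trans (sym (trans (L.res-∘ whole (∩⊆ʳ {U0} {U0}) (∩⊆ˡ {U0} {U0}) (e x0)) (≈ᴹ-refl))) (trans (L.res-∘ whole (∩⊆ʳ {U0} {U0}) (∩⊆ʳ {U0} {U0}) (e x0)) (sym (*ₗ-identityˡ _))))))
     where
     open L.Γ (U0 ∩ U0) using (*ₗ-identityˡ; ≈ᴹ-refl) renaming (≈ᴹ-trans to trans; ≈ᴹ-sym to sym)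
     whole : U0 ⊆ U0
     whole = sub λ _ u -> u
   generator≉0 : ∀ x -> ¬ generator x F.≈ F.0#
   generator≉0 x z = let d , eq = expand x U0 ∩⊆ˡ (e x0) in F.1≉0 (F.trans (F.sym coord-e₀)
    (F.trans (F.sym (coord-res (∩⊆ˡ {U0} {U x}) (e x0))) (F.trans (coord-cong (U0 ∩ U x) eq) (F.trans (coord-* (U0 ∩ U x) d _)
     (F.trans (F.*ˡ (F.trans (coord-res (∩⊆ʳ {U0} {U x}) (e x)) z)) (F.zeroʳ _))))))
   generator-almost : AlmostAll (λ x -> ord x (generator x) ≡ 0ℤ)
   generator-almost = almostAll-map (λ {x} u -> let d , d∈ , eq = coord-generator U0 (e x0) x u in
    O.v-unit x (F.trans (F.*-comm _ _) (F.trans (F.sym eq) coord-e₀)) (snd (fst (expand x0 (U x) ∩⊆ˡ (e x))) x (x∈U x , u)) d∈) (Open.cofinite U0)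
  -- The lattice with stalks c_x Λ_x: for c the local generators of a line bundle it receives the
  -- multiplication map from the tensor product.
  scaled : ∀ {n} -> (Point -> F.Carrier) -> Lattice n -> Lattice n
  scaled c 𝓛 = record
   { Λ = λ x v -> Λ x (λ i -> Fₗ.inv (c x) F.* v i)
   ; resp = λ x e -> resp x (λ i -> F.*ˡ (e i))
   ; 0∈ = λ x -> resp x (λ i -> F.sym (F.zeroʳ _)) (0∈ x)
   ; +∈ = λ x p q -> resp x (λ i -> F.sym (F.distribˡ _ _ _)) (+∈ x p q)
   ; *∈ = λ x {a} {v} r p -> resp x (λ i -> SF.solve 3 (λ a c v -> a :* (c :* v) := c :* (a :* v)) a (Fₗ.inv (c x)) (v i)) (*∈ x r p) }
   where open Lattice 𝓛
  -- A morphism of lattice sheaves is determined generically: on every open set it is given by the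
  -- single F-linear map `Tv`, computed from the frame near x0 by restricting to an overlap.
  module HomMatrix (𝓕 : Frames 2) (𝓣 : Lattice 2) (h : Hom (Frames.M 𝓕) (latticeSheaf 𝓣)) where
   open Frames 𝓕 using (nbhd; basis; basis-frame; ψ; ψ-cong; ψ-+; ψ-*)
   open Hom h using (fun; cong; add; act; nat)
   private module M = OModule (Frames.M 𝓕)
   image : ∀ x -> Fin 2 -> Vec 2
   image x j = fst (fun (nbhd x) (basis x j))
   Tv : Vec 2 -> Vec 2
   Tv v k = ψ x0 v 0F F.* image x0 0F k F.+ ψ x0 v 1F F.* image x0 1F k
   h-linear : ∀ W (s : M.∣ W ∣) -> fst (fun W s) ≋ Tv (fst s)
   h-linear W s k = F.trans (F.sym (nat (∩⊆ˡ {W} {nbhd x0}) s k)) (F.trans (cong V {M.res (∩⊆ˡ {W} {nbhd x0}) s} {Γ'._+ᴹ_ (a 0F Γ'.*ₗ b 0F) (a 1F Γ'.*ₗ b 1F)}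
    (λ i -> F.trans (fst (snd frame) i) (F.+ˡ (F.+-idʳ _))) k)
    (F.trans (add V _ _ k) (F.+-cong (part 0F) (part 1F))))
    where
    V : Open
    V = W ∩ nbhd x0
    module Γ' = M.Γ V
    frame = basis-frame x0 V (∩⊆ʳ {W} {nbhd x0}) (M.res (∩⊆ˡ {W} {nbhd x0}) s)
    a = fst frame
    b : Fin 2 -> M.∣ V ∣
    b j = M.res (∩⊆ʳ {W} {nbhd x0}) (basis x0 j)
    part : ∀ j -> fst (fun V (a j Γ'.*ₗ b j)) k F.≈ ψ x0 (fst s) j F.* image x0 j k
    part j = F.trans (act V (a j) (b j) k) (F.*ˡ (nat (∩⊆ʳ {W} {nbhd x0}) (basis x0 j) k))
   N : Fin 2 -> Vec 2
   N i = Tv (δ i)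
   Tv-matrix : ∀ v k -> Tv v k F.≈ v 0F F.* N 0F k F.+ v 1F F.* N 1F k
   Tv-matrix v k = F.trans (F.+-cong (F.*ʳ (coords 0F)) (F.*ʳ (coords 1F)))
    (SF.solve 8 (λ v w a b c d h i -> (v :* a :+ w :* c) :* h :+ (v :* b :+ w :* d) :* i := v :* (a :* h :+ b :* i) :+ w :* (c :* h :+ d :* i)) (v 0F) (v 1F) (ψ x0 (δ 0F) 0F) (ψ x0 (δ 0F) 1F) (ψ x0 (δ 1F) 0F) (ψ x0 (δ 1F) 1F) (image x0 0F k) (image x0 1F k))
    where
    split : v ≋ λ i -> v 0F F.* δ 0F i F.+ v 1F F.* δ 1F i
    split 0F = SF.solve 2 (λ a b -> a := a :* con 1ℤ :+ b :* con 0ℤ) (v 0F) (v 1F)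
    split 1F = SF.solve 2 (λ a b -> b := a :* con 0ℤ :+ b :* con 1ℤ) (v 0F) (v 1F)
    coords : ∀ j -> ψ x0 v j F.≈ v 0F F.* ψ x0 (δ 0F) j F.+ v 1F F.* ψ x0 (δ 1F) j
    coords j = F.trans (ψ-cong x0 split j) (F.trans (ψ-+ x0 (λ i -> v 0F F.* δ 0F i) (λ i -> v 1F F.* δ 1F i) j) (F.+-cong (ψ-* x0 (v 0F) (δ 0F) j) (ψ-* x0 (v 1F) (δ 1F) j)))
   Tv-cong : ∀ {v w} -> v ≋ w -> Tv v ≋ Tv w
   Tv-cong {v} {w} eq k = F.trans (Tv-matrix v k) (F.trans (F.+-cong (F.*ʳ (eq 0F)) (F.*ʳ (eq 1F))) (F.sym (Tv-matrix w k)))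
  module _ (𝒹 𝒹' : Datum) where
   private
    module P = Plane 𝒹
    module P' = Plane 𝒹'
    module E = Frames P.plane
    module E' = Frames P'.plane
    module M' = OModule E'.M
   -- Multiplication sends M ⊗ L into the lattice c M, so the universal property gives a morphism M'
   -- → c M, generically a matrix T over F. At every point it takes the basis of M' to a basis of c
   -- M, whence T P' = z P κ with κ in GL₂(𝒪_𝔸) and z the idele c.
   tensor-class : E.bundle ∼ E'.bundle -> P.point ≈ᴰ P'.point
   tensor-class (𝓁 , β , universal) = intertwine⇒≈ᴰ {P.point} {P'.point} T κ T∈ κ∈ same
    where
    open LineCoordinates 𝓁
    module L = VectorBundle 𝓁
    target : Lattice 2
    target = scaled generator E.lattice
    c : Point -> F.Carrier
    c = generator
    multiply : Bilinear E.M (sheaf 𝓁) (latticeSheaf target)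
    multiply = record
     { fun = λ W (m , m∈) l -> (λ k -> coord W l F.* m k) , λ x x∈ -> let d , d∈ , eq = coord-generator W l x x∈ in
      Lattice.resp E.lattice x (λ k -> F.sym (F.trans (F.*ˡ (F.*ʳ eq)) (F.trans
       (SF.solve 4 (λ i d c m -> i :* ((d :* c) :* m) := (c :* i) :* (d :* m)) (Fₗ.inv (c x)) d (c x) (m k))
       (F.trans (F.*ʳ (Fₗ.inv-r (generator≉0 x))) (F.*-idˡ _))))) (Lattice.*∈ E.lattice x {d} {m} d∈ (m∈ x x∈))
     ; cong = λ W e e' k -> F.*-cong (coord-cong W e') (e k)
     ; addˡ = λ _ _ _ _ k -> F.distribˡ _ _ _
     ; addʳ = λ W s l l' k -> F.trans (F.*ʳ (coord-+ W l l')) (F.distribʳ _ _ _)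
     ; actˡ = λ W a s l k -> SF.solve 3 (λ a c m -> c :* (a :* m) := a :* (c :* m)) (fst a) (coord W l) (fst s k)
     ; actʳ = λ W a s l k -> F.trans (F.*ʳ (coord-* W a l)) (F.*-assoc _ _ _)
     ; nat = λ q s l k -> F.*ʳ (coord-res q l) }
    h : Hom E'.M (latticeSheaf target)
    h = fst (universal (latticeSheaf target) multiply)
    factors : ∀ W m l -> fst (Hom.fun h W (Bilinear.fun β W m l)) ≋ λ k -> coord W l F.* fst m k
    factors = fst (snd (universal (latticeSheaf target) multiply))
    open HomMatrix P'.plane target h
    module At (x : Point) where
     c⁻¹ : F.Carrier
     c⁻¹ = Fₗ.inv (c x)
     local : Σ Open λ W -> mem W x × Σ L.∣ W ∣ λ l -> coord W l F.≈ c x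
     local = local-section x
     W : Open
     W = E.nbhd x ∩ fst local
     l : L.∣ W ∣
     l = L.res (∩⊆ʳ {E.nbhd x} {fst local}) (fst (snd (snd local)))
     s : Fin 2 -> M'.∣ W ∣
     s i = Bilinear.fun β W (OModule.res E.M (∩⊆ˡ {E.nbhd x} {fst local}) (E.basis x i)) l
     -- λ-mat writes the tensors e_i ⊗ l in the basis of M' at x, and κ-mat writes the images of
     -- that basis in the basis of c M. Both are integral, and since the composite is the identity
     -- their determinants are inverse to each other.
     λ-mat Y κ-mat : Fin 2 -> Vec 2
     λ-mat i = E'.ψ x (fst (s i))
     Y j k = c⁻¹ F.* Tv (E'.e x j) k
     κ-mat j = E.ψ x (Y j)
     λ∈ : ∀ i j -> O.B x 0ℤ (λ-mat i j)
     λ∈ i j = snd (s i) x (E.near-self x , fst (snd local)) j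
     κ∈ : ∀ j k -> O.B x 0ℤ (κ-mat j k)
     κ∈ j k = O.ball-resp x (E.ψ-cong x (λ i -> F.*ˡ (h-linear (E'.nbhd x) (E'.basis x j) i)) k) (snd (Hom.fun h (E'.nbhd x) (E'.basis x j)) x (E'.near-self x) k)
     image-eq : ∀ i k -> Tv (fst (s i)) k F.≈ c x F.* E.e x i k
     image-eq i k = F.trans (F.sym (h-linear W (s i) k)) (F.trans (factors W (OModule.res E.M (∩⊆ˡ {E.nbhd x} {fst local}) (E.basis x i)) l k)
      (F.*ʳ (F.trans (coord-res (∩⊆ʳ {E.nbhd x} {fst local}) (fst (snd (snd local)))) (snd (snd (snd local))))))
     cancel-c : ∀ a -> c⁻¹ F.* (c x F.* a) F.≈ a
     cancel-c a = F.trans (F.sym (F.*-assoc c⁻¹ (c x) a)) (F.trans (F.*ʳ (Fₗ.inv-l (generator≉0 x))) (F.*-idˡ a))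
     basis-eq : ∀ i -> E.e x i ≋ λ k -> λ-mat i 0F F.* Y 0F k F.+ (λ-mat i 1F F.* Y 1F k F.+ F.0#)
     basis-eq i k = F.trans (F.sym (F.trans (F.*ˡ {c⁻¹} (image-eq i k)) (cancel-c (E.e x i k))))
      (F.trans (F.*ˡ (F.trans (Tv-cong (P'.expand-basis x (fst (s i))) k) (Tv-matrix (λ k -> λ-mat i 0F F.* E'.e x 0F k F.+ (λ-mat i 1F F.* E'.e x 1F k F.+ F.0#)) k))) (F.trans
       (SF.solve 9 (λ z a b p q r t m n -> z :* ((a :* p :+ (b :* q :+ con 0ℤ)) :* m :+ (a :* r :+ (b :* t :+ con 0ℤ)) :* n)
        := a :* (z :* (p :* m :+ r :* n)) :+ (b :* (z :* (q :* m :+ t :* n)) :+ con 0ℤ))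
        c⁻¹ (λ-mat i 0F) (λ-mat i 1F) (E'.e x 0F 0F) (E'.e x 1F 0F) (E'.e x 0F 1F) (E'.e x 1F 1F) (N 0F k) (N 1F k))
       (F.+-cong (F.*ˡ (F.*ˡ (F.sym (Tv-matrix (E'.e x 0F) k)))) (F.+ʳ (F.*ˡ (F.*ˡ (F.sym (Tv-matrix (E'.e x 1F) k))))))))
     p : F.Carrier
     p = Datum.p 𝒹 x
     p≉0 : ¬ p F.≈ F.0#
     p≉0 = Datum.p≉0 𝒹 x
     p-eq : p F.≈ D2 λ-mat F.* D2 Y
     p-eq = F.trans (F.sym (P.det-basis x)) (F.trans (D₂-cong basis-eq) (D₂-· λ-mat Y))
     inverse-det : D2 κ-mat F.* D2 λ-mat F.≈ F.1#
     inverse-det = Fₗ.*-cancelˡ p≉0 (F.trans (SF.solve 3 (λ p a b -> p :* (a :* b) := b :* (a :* p)) p (D2 κ-mat) (D2 λ-mat))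
      (F.trans (F.*ˡ (F.sym (F.trans (D₂-cong (λ j -> P.expand-basis x (Y j))) (F.trans (D₂-· κ-mat (E.e x)) (F.*ˡ (P.det-basis x))))))
       (F.trans (F.sym p-eq) (F.sym (F.*-idʳ p)))))
     Y-det : D2 Y F.≈ (c⁻¹ F.* c⁻¹) F.* (D2 (E'.e x) F.* D2 N)
     Y-det = F.trans (D₂-cong {Y} {λ j k -> c⁻¹ F.* (E'.e x j 0F F.* N 0F k F.+ E'.e x j 1F F.* N 1F k)} (λ j k -> F.*ˡ (Tv-matrix (E'.e x j) k)))
      (SF.solve 9 (λ z a b c d m n q r -> (z :* (a :* m :+ b :* q)) :* (z :* (c :* n :+ d :* r)) :- (z :* (a :* n :+ b :* r)) :* (z :* (c :* m :+ d :* q))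
       := (z :* z) :* ((a :* d :- b :* c) :* (m :* r :- n :* q))) c⁻¹ (E'.e x 0F 0F) (E'.e x 0F 1F) (E'.e x 1F 0F) (E'.e x 1F 1F) (N 0F 0F) (N 0F 1F) (N 1F 0F) (N 1F 1F))
     N≉0 : ¬ D2 N F.≈ F.0#
     N≉0 z = p≉0 (F.trans p-eq (F.trans (F.*ˡ (F.trans Y-det (F.trans (F.*ˡ (F.trans (F.*ˡ z) (F.zeroʳ _))) (F.zeroʳ _)))) (F.zeroʳ _)))
     T-entry : ∀ j k -> Tv (E'.e x j) k F.≈ c x F.* Y j k
     T-entry j k = F.sym (F.trans (F.sym (F.*-assoc _ _ _)) (F.trans (F.*ʳ (Fₗ.inv-r (generator≉0 x))) (F.*-idˡ _)))
    local-adele : (v : Point -> F.Carrier) -> (∀ x -> O.B x 0ℤ (v x)) -> Adele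
    local-adele v v∈ = adele (λ x -> K.embed x (v x)) ([] , λ x -> inl (embed-ball x (v∈ x)))
    κ-entry : Fin 2 -> Fin 2 -> Adele
    κ-entry j k = local-adele (λ x -> At.κ-mat x j k) (λ x -> At.κ∈ x j k)
    embed-det : ∀ x a b c d -> K._≈_ x (K._-_ x (K._*_ x (K.embed x a) (K.embed x d)) (K._*_ x (K.embed x b) (K.embed x c))) (K.embed x (a F.* d F.- b F.* c))
    embed-det x a b c d = K.sym x (K.trans x (embed-+ x _ _) (K.+-cong x (embed-* x a d) (K.trans x (embed-neg x _) (K.-‿cong x (embed-* x b c)))))
    κ : GL₂
    κ = record
     { a = κ-entry 0F 0F ; b = κ-entry 1F 0F ; c = κ-entry 0F 1F ; d = κ-entry 1F 1F
     ; u = local-adele (λ x -> D2 (At.λ-mat x)) (λ x -> D₂-integral x (At.λ-mat x) (At.λ∈ x))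
     ; unit = λ x -> K.trans x (K.*ʳ x (K.trans x (embed-det x _ _ _ _) (K.embed-cong x (F.+ˡ (F.-‿cong (F.*-comm _ _)))))) (K.trans x (K.sym x (embed-* x _ _))
      (K.trans x (K.embed-cong x (At.inverse-det x)) (embed-1 x))) }
    κ∈ : AllEntries Integral κ
    κ∈ = entry 0F 0F , entry 1F 0F , entry 0F 1F , entry 1F 1F , λ x -> embed-ball x (D₂-integral x (At.λ-mat x) (At.λ∈ x))
     where
     entry : ∀ j k -> Integral (κ-entry j k)
     entry j k x = embed-ball x (At.κ∈ x j k)
    T : GL₂
    T = record
     { a = principal (N 0F 0F) ; b = principal (N 1F 0F) ; c = principal (N 0F 1F) ; d = principal (N 1F 1F) ; u = principal (Fₗ.inv (D2 N))
     ; unit = λ x -> K.trans x (K.*ʳ x (K.trans x (embed-det x _ _ _ _) (K.embed-cong x (F.+ˡ (F.-‿cong (F.*-comm _ _)))))) (principal-unit (At.N≉0 x0) x) }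
    T∈ : AllEntries Principal T
    T∈ = principal∈ (N 0F 0F) , principal∈ (N 1F 0F) , principal∈ (N 0F 1F) , principal∈ (N 1F 1F) , principal∈ (Fₗ.inv (D2 N))
    z z⁻¹ : Adele
    z = adele (λ x -> K.embed x (c x)) (almostAll-map (λ {x} e -> embed-ball x {0ℤ} {c x} (λ _ -> ≡⇒≤ (≡.sym e))) generator-almost)
    z⁻¹ = adele (λ x -> K.embed x (Fₗ.inv (c x))) (almostAll-map (λ {x} e -> embed-ball x {0ℤ} {Fₗ.inv (c x)} (λ _ -> ≡⇒≤ (≡.sym (≡.trans (O.v-inv x (generator≉0 x)) (ap (λ n -> Z.- n) e))))) generator-almost)
    same : (T · P'.point) ~ (P.point · κ)
    same = z , (z⁻¹ , λ x -> embed-unit x (generator≉0 x)) , entry 0F 0F , entry 1F 0F , entry 0F 1F , entry 1F 1F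
     where
     row : ∀ x a b c d -> K._≈_ x (K._+_ x (K._*_ x (K.embed x a) (K.embed x b)) (K._*_ x (K.embed x c) (K.embed x d))) (K.embed x (a F.* b F.+ c F.* d))
     row x a b c d = K.sym x (K.trans x (embed-+ x _ _) (K.+-cong x (embed-* x a b) (embed-* x c d)))
     left : ∀ x j k -> K.Carrier x
     left x j k = K._+_ x (K._*_ x (K.embed x (N 0F k)) (at (column P'.point j 0F) x)) (K._*_ x (K.embed x (N 1F k)) (at (column P'.point j 1F) x))
     right : ∀ x j k -> K.Carrier x
     right x j k = K._+_ x (K._*_ x (at (column P.point 0F k) x) (K.embed x (At.κ-mat x j 0F))) (K._*_ x (at (column P.point 1F k) x) (K.embed x (At.κ-mat x j 1F)))
     left≈ : ∀ x j k -> K._≈_ x (left x j k) (K.embed x (Tv (E'.e x j) k))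
     left≈ x j k = K.trans x (K.+-cong x (K.*ˡ x (P'.point-column x j 0F)) (K.*ˡ x (P'.point-column x j 1F))) (K.trans x (row x _ _ _ _)
      (K.embed-cong x (F.trans (F.+-cong (F.*-comm _ _) (F.*-comm _ _)) (F.sym (Tv-matrix (E'.e x j) k)))))
     right≈ : ∀ x j k -> K._≈_ x (right x j k) (K.embed x (At.Y x j k))
     right≈ x j k = K.trans x (K.+-cong x (K.*ʳ x (P.point-column x 0F k)) (K.*ʳ x (P.point-column x 1F k))) (K.trans x (row x _ _ _ _)
      (K.embed-cong x (F.sym (F.trans (P.expand-basis x (At.Y x j) k) (F.+-cong (F.*-comm _ _) (F.trans (F.+-idʳ _) (F.*-comm _ _)))))))
     entry : ∀ j k x -> K._≈_ x (left x j k) (K._*_ x (K.embed x (c x)) (right x j k))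
     entry j k x = K.trans x (left≈ x j k) (K.trans x (K.embed-cong x (At.T-entry x j k)) (K.trans x (embed-* x _ _) (K.*ˡ x (K.sym x (right≈ x j k)))))

 -- The finite list of bundles with small slopes

 module Representatives where
  open PlaneTensor public
  open Idele using (divisor)
  private module R = RingLaws 𝔸
  -- At each point t is replaced by a rational function of the same order, and b by a rational
  -- function that approximates it to that order, which exists by density. The double coset does not
  -- change by `triangular`.
  local-datum : ∀ t b -> Σ Datum λ 𝒹 -> τ t b ≈ᴰ Plane.point 𝒹
  local-datum t b = 𝒹 , ≈ᴰ-trans (triangular t b (Plane.idele 𝒹) (Plane.shear 𝒹) F.1# F.1≉0 F.0#
   (λ x -> ≡.trans (divisor≡ x) (≡.sym (≡.trans (ap (Z._+ fst (divisor t) x) (O.v1≡0 x)) (ℤₚ.+-identityˡ _)))) within) (≈ᴰ-sym (Plane.point-eq 𝒹))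
   where
   p f : Point -> F.Carrier
   p x = fst (O.with-value x (fst (divisor t) x))
   f x = fst (K.dense x (at b x) (fst (divisor t) x))
   ord-p : ∀ x -> ord x (p x) ≡ fst (divisor t) x
   ord-p x = snd (snd (O.with-value x (fst (divisor t) x)))
   close : ∀ x -> B x (fst (divisor t) x) (K._-_ x (at b x) (K.embed x (f x)))
   close x = snd (K.dense x (at b x) (fst (divisor t) x))
   recover : ∀ x a c -> K._≈_ x (K._-_ x a (K._-_ x a c)) c
   recover x = Kₛ.solve x 2 (λ a c -> a :- (a :- c) := c)
   𝒹 : Datum
   𝒹 = record
    { p = p ; f = f ; p≉0 = λ x -> fst (snd (O.with-value x (fst (divisor t) x)))
    ; p-almost = almostAll-map (λ {x} e -> ≡.trans (ord-p x) e) (snd (divisor t))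
    ; f-almost = almostAll-∩ (λ {x} e h -> ball-embed x (V.ball-resp x (recover x _ _) (V.ball-- x h (subst (λ n -> B x n (K._-_ x (at b x) (K.embed x (f x)))) e (close x)))))
     (snd (divisor t)) (Adele.integral b) }
   divisor≡ : ∀ x -> fst (divisor (Plane.idele 𝒹)) x ≡ fst (divisor t) x
   divisor≡ x = ≡.trans (Plane.idele-divisor 𝒹 x) (ord-p x)
   within : Within (divisor (Plane.idele 𝒹)) (Plane.shear 𝒹 R.- (principal F.1# R.* b R.+ principal F.0#))
   within x = subst (λ n -> B x n (at (Plane.shear 𝒹 R.- (principal F.1# R.* b R.+ principal F.0#)) x)) (≡.sym (divisor≡ x))
    (V.ball-resp x (K.trans x (rearrange x (at b x) (K.embed x (f x))) (K.+-cong x (K.sym x (Plane.shear-at 𝒹 x)) (K.-‿cong x (K.+-cong x (K.*ʳ x (K.sym x (embed-1 x))) (K.sym x (embed-0 x)))))) (V.ball-neg' x (close x)))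
    where
    rearrange : ∀ x b f -> K._≈_ x (K.-_ x (K._-_ x b f)) (K._-_ x f (K._+_ x (K._*_ x (K.1# x) b) (K.0# x)))
    rearrange x = Kₛ.solve x 2 (λ b f -> :- (b :- f) := f :- (con 1ℤ :* b :+ con 0ℤ))
  Good : GL₂ -> Set
  Good h = ∀ d -> Slope h d -> d ≤ m_X g
  small-slopes⇒good : ∀ h -> ¬ Slope h (Z.suc (m_X g)) -> Good h
  small-slopes⇒good h small d (t , b , e , le) = ≮⇒≥ λ lt -> small (t , b , e , ≤-trans (i<j⇒suc[i]≤j lt) le)
  GoodDatum : Set
  GoodDatum = Σ Datum λ 𝒹 -> Good (Plane.point 𝒹)
  -- The list of `finite-classes` may contain classes with larger slopes. They are discarded,
  -- because every bundle kept has to satisfy δ ≤ m_X itself.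
  good-data : ∃ λ (L : List GoodDatum) -> ∀ h -> Good h -> Any (λ a -> h ≈ᴰ Plane.point (fst a)) L
  good-data = List.concatMap pick (fst (finite-classes (m_X g))) , λ h good ->
   Anyₚ.concat⁺ (Anyₚ.map⁺ (Any.map (λ {(t , b)} e -> found h good t b e em) (snd (finite-classes (m_X g)) h good)))
   where
   keep : ∀ 𝒹 -> Dec (Good (Plane.point 𝒹)) -> List GoodDatum
   keep 𝒹 (yes good) = (𝒹 , good) ∷ []
   keep 𝒹 (no _) = []
   pick : Idele × Adele -> List GoodDatum
   pick (t , b) = keep (fst (local-datum t b)) em
   found : ∀ h -> Good h -> ∀ t b -> h ≈ᴰ τ t b -> (d : Dec (Good (Plane.point (fst (local-datum t b))))) ->
    Any (λ a -> h ≈ᴰ Plane.point (fst a)) (keep (fst (local-datum t b)) d)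
   found h good t b e (yes _) = here (≈ᴰ-trans {h} {τ t b} {Plane.point (fst (local-datum t b))} e (snd (local-datum t b)))
   found h good t b e (no bad) = ⊥-elim (bad λ d s -> good d (Slope-resp {h} {Plane.point (fst (local-datum t b))}
    (≈ᴰ-trans {h} {τ t b} {Plane.point (fst (local-datum t b))} e (snd (local-datum t b))) s))

 -- The dimension bound

 module Conclusion (ℝ : RealField) (dg : Adeles.Automorphic.HaarG X F̂ ℝ) (normalized : Adeles.Automorphic.Normalized X F̂ ℝ dg) (dn : Adeles.Automorphic.HaarN X F̂ ℝ) where
  open Bundles X
  open Adeles X F̂ using (GL₂; module Automorphic)
  open Automorphic ℝ using (𝒱₀; Dim𝒱₀)
  open Representatives using (_≈ᴰ_; GoodDatum; good-data; small-slopes⇒good; module Plane; module Frames; tensor-class; exists-δ)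
  open Vanishing ℝ dg normalized dn using (vanishes; 𝒱₀-+; 𝒱₀-scale; invariances; module Average)
  open DualBases em ℝ {GL₂} {GoodDatum} (λ a -> Plane.point (fst a)) (𝒱₀ dg dn) 𝒱₀-+ 𝒱₀-scale
  open ComplexNumbers em ℝ using (_≈_; 0#; ℂ-ring'; ℂ-field; ℂ)
  private module ℂ' = RingLaws ℂ-ring'
  determined : ∀ f -> 𝒱₀ dg dn f -> (∀ a -> a ∈ fst good-data -> f (Plane.point (fst a)) ≈ 0#) -> ∀ h -> f h ≈ 0#
  determined f f∈ zeros = vanishes f f∈ λ h small -> search (fst good-data) zeros (snd good-data h (small-slopes⇒good h small))
   where
   search : ∀ {h} L -> (∀ a -> a ∈ L -> f (Plane.point (fst a)) ≈ 0#) -> Any (λ a -> h ≈ᴰ Plane.point (fst a)) L -> f h ≈ 0#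
   search (a ∷ L) zeros (here e) = ℂ'.trans (Average.class-invariant f (invariances f∈) e) (zeros a (here ≡.refl))
   search (a ∷ L) zeros (there p) = search L (λ b b∈ -> zeros b (there b∈)) p
  conclude : (∃ λ n -> Σ (DualFamily n) λ B -> Determines [] (DualFamily.p B)) -> Σ ℕ λ dim -> Dim𝒱₀ dg dn dim ×
   Σ (Fin dim -> VectorBundle 2) λ M -> (∀ i -> Σ ℤ λ δ -> Isδ (M i) δ × δ ≤ m_X g) × (∀ i j -> M i ∼ M j -> i ≡ j)
  conclude (n , B , determines) = n , family-dim B determines , (λ i -> Frames.bundle (Plane.plane (fst (p i))))
   , (λ i -> exists-δ (fst (p i)) (m_X g) (snd (p i)))
   -- Equivalent bundles lie in one double coset, on which e i is constant; but e i is 1 at the i-th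
   -- point and 0 at every other.
   , λ i j equiv -> Classical.dne em λ ne -> Field.1≉0 ℂ-field (ℂ'.trans (ℂ'.sym (diagonal i))
    (ℂ'.trans (Average.class-invariant (e i) (invariances (e∈ i)) (tensor-class (fst (p i)) (fst (p j)) equiv)) (off i j ne)))
   where open DualFamily B
  representatives : Σ ℕ λ dim -> Dim𝒱₀ dg dn dim ×
   Σ (Fin dim -> VectorBundle 2) λ M -> (∀ i -> Σ ℤ λ δ -> Isδ (M i) δ × δ ≤ m_X g) × (∀ i j -> M i ∼ M j -> i ≡ j)
  representatives = conclude (dual-family (fst good-data) determined)

theorem10p6 : (∀ {ℓ} -> ExcludedMiddle ℓ) -> (ℝ : RealField) (X : Curve) (F̂ : Completions X) ->
 let
  open Bundles X
  open Adeles X F̂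
  open Automorphic ℝ
 in
 (g : ℕ) -> IsGenus g ->
 (dg : HaarG) -> Normalized dg ->
 (dn : HaarN) ->
 Σ ℕ λ dim -> Dim𝒱₀ dg dn dim × Σ (Fin dim -> VectorBundle 2) λ M -> (∀ i -> Σ ℤ λ δ -> Isδ (M i) δ × δ ≤ m_X g) × (∀ i j -> M i ∼ M j -> i ≡ j)
theorem10p6 em ℝ X F̂ g isGenus dg normalized dn = Theory.Conclusion.representatives em X F̂ isGenus ℝ dg normalized dn
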